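{- There is a comparison-based heap data structure implementing the DecreaseKey heap interface (operations Insert, FindMin, DecreaseKey, DeleteMin) such that, in the worst case for each individual operation, Insert, FindMin and DecreaseKey each run in $O(1)$ time and DeleteMin runs in $O(\log n)$ time, where $n$ denotes the number of elements in the heap at the time of the operation.
   Context: A heap is a data structure maintaining a set of elements with keys, where the keys belong to a linearly ordered universe and are accessed only through comparisons of two keys (each taking $O(1)$ time). The model of computation is the standard word RAM / pointer machine with arrays; the heap is initially empty. The DecreaseKey heap interface consists of the following operations. - Insert($k$): adds a new element with key $k$ to the heap and returns a pointer to this element, to be used for future references. - FindMin: returns an element with the smallest key in the heap, leaving it in the heap (if several elements have the minimal key, one of them is chosen; if the heap is empty, null is returned). - DeleteMin: removes from the heap the element with the smallest key (the one returned by FindMin). - DecreaseKey($x,k$): given a pointer $x$ to an element currently in the heap and a key $k$ not larger than the current key of $x$, changes the key of $x$ to $k$. The $O(\cdot)$ bounds are worst-case bounds on every single operation (not amortized), with constants independent of the operation sequence. As usual, $O(\log n)$ is read as $O(1)$ for $n\le 1$. -}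

module Defs where

open import Level using (Level; _⊔_)
open import Data.Bool.Base using (Bool; true; false; if_then_else_; _∧_; _∨_; _xor_)
open import Data.List.Base using (List; []; _∷_; map; length; filter)
open import Data.List.Membership.Propositional using (_∈_; _∉_)
open import Data.List.Relation.Unary.All using (All)
open import Data.Maybe.Base using (Maybe; just; nothing; zipWith)
open import Data.Nat.Base using (ℕ; zero; suc; _+_; _*_; _∸_; _^_; _≤_; _≡ᵇ_; _<ᵇ_; _/_; _%_)
open import Data.Nat.Properties using (m^n≢0; _≟_)
open import Data.Product.Base using (Σ-syntax; ∃-syntax; _×_; _,_; proj₁; proj₂)
open import Data.Sum.Base using (_⊎_)
open import Relation.Binary.Bundles using (DecTotalOrder)
open import Relation.Binary.PropositionalEquality using (_≡_; _≢_)
open import Relation.Nullary.Decidable.Core using (does; ¬?)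

------------------------------------------------------------------------
-- A word RAM with an opaque type of keys.
--
-- The machine has w-bit words, a word memory addressed by words, and a
-- separate bank of key cells, also addressed by words.  Program text is
-- finite and mentions neither w nor the type of keys; keys can be copied
-- and compared, and nothing else, so every program is comparison-based.

data WordOp : Set where
  add sub mul div mod : WordOp
  and or xor shl shr  : WordOp

data Expr : Set where
  lit : ℕ → Expr                       -- constant of the program text
  reg : ℕ → Expr                       -- word register
  mem : Expr → Expr                    -- word memory at a computed address
  op  : WordOp → Expr → Expr → Expr

data KeyExpr : Set where
  kreg : ℕ → KeyExpr                   -- key register
  kmem : Expr → KeyExpr                -- key memory at a computed address

data Test : Set where
  _==_ _<<_ : Expr → Expr → Test
  _≤ᵏ_      : KeyExpr → KeyExpr → Test

infixr 4 _⨾_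

data Cmd : Set where
  skip          : Cmd
  reg_≔_        : ℕ → Expr → Cmd
  mem[_]≔_      : Expr → Expr → Cmd
  kreg_≔_       : ℕ → KeyExpr → Cmd
  kmem[_]≔_     : Expr → KeyExpr → Cmd
  _⨾_           : Cmd → Cmd → Cmd
  if_then_else′_ : Test → Cmd → Cmd → Cmd
  while_do′_    : Test → Cmd → Cmd

-- Cost: one unit for every operator, operand, memory access, assignment
-- and test that is executed.

costᵉ : Expr → ℕ
costᵉ (lit _)      = 1
costᵉ (reg _)      = 1
costᵉ (mem e)      = 1 + costᵉ e
costᵉ (op _ e₁ e₂) = 1 + costᵉ e₁ + costᵉ e₂

costᵏ : KeyExpr → ℕ
costᵏ (kreg _) = 1
costᵏ (kmem e) = 1 + costᵉ e

costᵗ : Test → ℕ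
costᵗ (e₁ == e₂) = 1 + costᵉ e₁ + costᵉ e₂
costᵗ (e₁ << e₂) = 1 + costᵉ e₁ + costᵉ e₂
costᵗ (k₁ ≤ᵏ k₂) = 1 + costᵏ k₁ + costᵏ k₂

-- Words are naturals below 2 ^ w; results are reduced modulo 2 ^ w.

trunc : ℕ → ℕ → ℕ
trunc w x = _%_ x (2 ^ w) {{m^n≢0 2 w}}

-- Division and remainder by 0 are given the conventional value 0.
quot : ℕ → ℕ → ℕ
quot x zero      = 0
quot x y@(suc _) = x / y

rem : ℕ → ℕ → ℕ
rem x zero      = 0
rem x y@(suc _) = x % y

bitwise : (Bool → Bool → Bool) → (width : ℕ) → ℕ → ℕ → ℕ
bitwise f zero    x y = 0
bitwise f (suc w) x y =
  (if f (x % 2 ≡ᵇ 1) (y % 2 ≡ᵇ 1) then 1 else 0) + 2 * bitwise f w (x / 2) (y / 2)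

evalOp : (w : ℕ) → WordOp → ℕ → ℕ → ℕ
evalOp w add x y = trunc w (x + y)
evalOp w sub x y = trunc w (x + 2 ^ w ∸ y)
evalOp w mul x y = trunc w (x * y)
evalOp w div x y = quot x y
evalOp w mod x y = rem x y
evalOp w and x y = bitwise _∧_ w x y
evalOp w or  x y = bitwise _∨_ w x y
evalOp w xor x y = bitwise _xor_ w x y
evalOp w shl x y = trunc w (x * 2 ^ y)
evalOp w shr x y = quot x (2 ^ y)

update : ∀ {b} {B : Set b} → (ℕ → B) → ℕ → B → (ℕ → B)
update f i v j = if i ≡ᵇ j then v else f j

module Machine {a ℓ₁ ℓ₂ : Level} (K : DecTotalOrder a ℓ₁ ℓ₂) (w : ℕ) where

  open DecTotalOrder K using (_≤?_) renaming (Carrier to Key)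

  -- A key cell is empty (nothing) until a key has been copied into it.
  record State : Set a where
    constructor ⟨_,_,_,_⟩
    field
      regs     : ℕ → ℕ
      memory   : ℕ → ℕ
      keyRegs  : ℕ → Maybe Key
      keyCells : ℕ → Maybe Key

  open State public

  blank : State
  blank = ⟨ (λ _ → 0) , (λ _ → 0) , (λ _ → nothing) , (λ _ → nothing) ⟩

  setReg : ℕ → ℕ → State → State
  setReg i v s = record s { regs = update (regs s) i v }

  setMem : ℕ → ℕ → State → State
  setMem i v s = record s { memory = update (memory s) i v }

  setKeyReg : ℕ → Key → State → State
  setKeyReg i k s = record s { keyRegs = update (keyRegs s) i (just k) }

  setKeyCell : ℕ → Key → State → State
  setKeyCell i k s = record s { keyCells = update (keyCells s) i (just k) }

  eval : Expr → State → ℕ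
  eval (lit n)      s = trunc w n
  eval (reg i)      s = regs s i
  eval (mem e)      s = memory s (eval e s)
  eval (op o e₁ e₂) s = evalOp w o (eval e₁ s) (eval e₂ s)

  evalKey : KeyExpr → State → Maybe Key
  evalKey (kreg i) s = keyRegs s i
  evalKey (kmem e) s = keyCells s (eval e s)

  evalTest : Test → State → Maybe Bool
  evalTest (e₁ == e₂) s = just (eval e₁ s ≡ᵇ eval e₂ s)
  evalTest (e₁ << e₂) s = just (eval e₁ s <ᵇ eval e₂ s)
  evalTest (k₁ ≤ᵏ k₂) s = zipWith (λ x y → does (x ≤? y)) (evalKey k₁ s) (evalKey k₂ s)

  -- Run p s t s′: started in s, the program p halts in s′ after t units of
  -- time.  A program that reads an empty key cell is stuck and has no run.
  data Run : Cmd → State → ℕ → State → Set a where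
    skip       : ∀ {s} → Run skip s 0 s
    set-reg    : ∀ {s i e} →
                 Run (reg i ≔ e) s (1 + costᵉ e) (setReg i (eval e s) s)
    set-mem    : ∀ {s e₁ e₂} →
                 Run (mem[ e₁ ]≔ e₂) s (1 + costᵉ e₁ + costᵉ e₂)
                     (setMem (eval e₁ s) (eval e₂ s) s)
    set-kreg   : ∀ {s i κ k} → evalKey κ s ≡ just k →
                 Run (kreg i ≔ κ) s (1 + costᵏ κ) (setKeyReg i k s)
    set-kmem   : ∀ {s e κ k} → evalKey κ s ≡ just k →
                 Run (kmem[ e ]≔ κ) s (1 + costᵉ e + costᵏ κ)
                     (setKeyCell (eval e s) k s)
    seq        : ∀ {p q s s′ s″ t t′} → Run p s t s′ → Run q s′ t′ s″ →
                 Run (p ⨾ q) s (t + t′) s″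
    if-true    : ∀ {b p q s s′ t} → evalTest b s ≡ just true → Run p s t s′ →
                 Run (if b then p else′ q) s (costᵗ b + t) s′
    if-false   : ∀ {b p q s s′ t} → evalTest b s ≡ just false → Run q s t s′ →
                 Run (if b then p else′ q) s (costᵗ b + t) s′
    while-stop : ∀ {b p s} → evalTest b s ≡ just false →
                 Run (while b do′ p) s (costᵗ b) s
    while-step : ∀ {b p s s′ s″ t t′} → evalTest b s ≡ just true →
                 Run p s t s′ → Run (while b do′ p) s′ t′ s″ →
                 Run (while b do′ p) s (costᵗ b + t + t′) s″

------------------------------------------------------------------------
-- The DecreaseKey heap interface.
--
-- Calling convention: a pointer argument or result is in word register 0,
-- a key argument is in key register 0, and the null pointer is 0.

record HeapProgram : Set where
  field
    makeHeap    : Cmd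
    insert      : Cmd
    findMin     : Cmd
    decreaseKey : Cmd
    deleteMin   : Cmd

-- Time allowed for each operation as a function of the number of elements
-- in the heap when the operation is called.
record TimeBounds : Set where
  constructor makeHeap:_insert:_findMin:_decreaseKey:_deleteMin:_
  field
    makeHeap    : ℕ
    insert      : ℕ → ℕ
    findMin     : ℕ → ℕ
    decreaseKey : ℕ → ℕ
    deleteMin   : ℕ → ℕ

module HeapSpec {a ℓ₁ ℓ₂ : Level} (K : DecTotalOrder a ℓ₁ ℓ₂) (w : ℕ) (P : HeapProgram) where

  open DecTotalOrder K using () renaming (Carrier to Key; _≤_ to _≤ᴷ_)
  open Machine K w public
  open HeapProgram P

  -- The contents a client knows the heap to have: the pointers of the
  -- current elements, with their keys.
  Contents : Set a
  Contents = List (ℕ × Key)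

  pointers : Contents → List ℕ
  pointers = map proj₁

  remove : ℕ → Contents → Contents
  remove x = filter (λ e → ¬? (proj₁ e ≟ x))

  changeKey : ℕ → Key → Contents → Contents
  changeKey x k = map (λ e → if proj₁ e ≡ᵇ x then (x , k) else e)

  result : State → ℕ
  result s = regs s 0

  -- Words can address the memory needed for n elements, up to the constant
  -- factor d; that is, w ≥ log₂ (n + 1) + O(1).
  Fits : (d n : ℕ) → Set
  Fits d n = d * suc n ≤ 2 ^ w

  -- Reachable d s h: some sequence of legal operations, starting with an
  -- empty heap, leaves the machine in state s and the heap with contents h.
  -- DeleteMin removes the element that FindMin would return if it were
  -- called in the same state.
  data Reachable (d : ℕ) : State → Contents → Set (a ⊔ ℓ₂) where
    made      : ∀ {t s} → Fits d 0 → Run makeHeap blank t s → Reachable d s []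
    inserted  : ∀ {s h t s′} (k : Key) → Reachable d s h →
                Fits d (suc (length h)) →
                Run insert (setKeyReg 0 k s) t s′ →
                Reachable d s′ ((result s′ , k) ∷ h)
    found     : ∀ {s h t s′} → Reachable d s h →
                Run findMin s t s′ →
                Reachable d s′ h
    decreased : ∀ {s h t s′} (x : ℕ) (k₀ k : Key) → Reachable d s h →
                (x , k₀) ∈ h → k ≤ᴷ k₀ →
                Run decreaseKey (setReg 0 x (setKeyReg 0 k s)) t s′ →
                Reachable d s′ (changeKey x k h)
    deleted   : ∀ {s h t t′ s₁ s′} → Reachable d s h → h ≢ [] →
                Run findMin s t s₁ →
                Run deleteMin s t′ s′ →
                Reachable d s′ (remove (result s₁) h)

  -- x is an acceptable answer to FindMin.
  IsMin : Contents → ℕ → Set (a ⊔ ℓ₂)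
  IsMin h x = (h ≡ [] × x ≡ 0)
            ⊎ (∃[ k ] ((x , k) ∈ h × All (λ e → k ≤ᴷ proj₂ e) h))

  HaltsWithin : ∀ {ℓ} → ℕ → Cmd → State → (State → Set ℓ) → Set (a ⊔ ℓ)
  HaltsWithin T p s Post = ∃[ t ] ∃[ s′ ] (Run p s t s′ × t ≤ T × Post s′)

  Halts : ∀ {ℓ} → Cmd → State → (State → Set ℓ) → Set (a ⊔ ℓ)
  Halts p s Post = ∃[ t ] ∃[ s′ ] (Run p s t s′ × Post s′)

  record Implements (d : ℕ) (T : TimeBounds) : Set (a ⊔ ℓ₂) where
    private module T = TimeBounds T
    field
      makeHeap-halts :
        Fits d 0 → ∃[ t ] ∃[ s′ ] (Run makeHeap blank t s′ × t ≤ T.makeHeap)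

      insert-correct :
        ∀ {s h} → Reachable d s h → Fits d (suc (length h)) → (k : Key) →
        HaltsWithin (T.insert (length h)) insert (setKeyReg 0 k s)
          λ s′ → result s′ ≢ 0 × result s′ ∉ pointers h

      -- The second component says that ties between minimal elements are
      -- not broken anew by an immediately following FindMin; as DeleteMin
      -- removes the element FindMin would return, FindMin followed by
      -- DeleteMin thus removes the element that was found.
      findMin-correct :
        ∀ {s h} → Reachable d s h →
        HaltsWithin (T.findMin (length h)) findMin s
          λ s′ → IsMin h (result s′) ×
                 Halts findMin s′ λ s″ → result s″ ≡ result s′

      decreaseKey-halts :
        ∀ {s h} → Reachable d s h → ∀ {x k₀} k → (x , k₀) ∈ h → k ≤ᴷ k₀ →
        ∃[ t ] ∃[ s′ ] (Run decreaseKey (setReg 0 x (setKeyReg 0 k s)) t s′ ×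
                        t ≤ T.decreaseKey (length h))

      deleteMin-halts :
        ∀ {s h} → Reachable d s h → h ≢ [] →
        ∃[ t ] ∃[ s′ ] (Run deleteMin s t s′ × t ≤ T.deleteMin (length h))

{-# OPTIONS --safe #-}

-- The heap is a forest of perfect ternary tournament trees of which the elements are the leaves.  A node
-- below its parent is clean if it does not beat the parent's winner; DecreaseKey may make the topmost node
-- won by the element violate this, and such nodes are called dirty.  Roots and dirty nodes are kept in
-- buckets by height, so the minimum is found among them.
--
-- Three roots of the same height can be joined.  Two dirty nodes x and y of the same height can be replaced
-- by one of the next height: exchange x with a child of the parent P of y so that both are below P (whose
-- winner is not smaller than that of the parent of x); if P itself is the winning child of its parent,
-- exchange x and y with two children of a clean sibling of P, and call that sibling P; now P is the topmost
-- node won by its leaf, so its winner can be recomputed, which makes x and y clean and P dirty.  A clean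
-- sibling exists if at most one node of the height of P is dirty, hence if x and y are taken from the
-- highest bucket with two members.  By the pigeonhole principle one such step per operation keeps the
-- number of roots and of dirty nodes logarithmic.  The highest overfull bucket is found in constant time by
-- looking up the logarithm of the bit mask of the overfull buckets.
--
-- DeleteMin dissolves the path from the minimum to its root into trees, and then joins and repairs until
-- no bucket is overfull.
module Submission where

open import Data.Bool.Base using (Bool; true; false; if_then_else_; T)
open import Data.Empty using (⊥; ⊥-elim)
open import Data.List.Base using (List; []; _∷_; map; length; filter)
open import Data.List.Membership.Propositional using (_∈_; _∉_)
open import Data.List.Properties using (filter-accept; filter-reject)
open import Data.List.Relation.Unary.All using (All; []; _∷_)
import Data.List.Relation.Unary.All as All
open import Data.List.Relation.Unary.AllPairs using ([]; _∷_)
open import Data.List.Relation.Unary.Any using (here; there)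
open import Data.List.Relation.Unary.Unique.Propositional using (Unique)
open import Data.Maybe.Base using (Maybe; just; nothing)
open import Data.Maybe.Properties using (just-injective)
open import Data.Nat.Base hiding (_⊔_)
open import Data.Nat.DivMod using (m<n⇒m%n≡m; [m+n]%n≡m%n)
open import Data.Nat.Induction using (<-rec)
open import Data.Nat.Logarithm
open import Data.Nat.Properties hiding (_≤?_)
open import Data.Nat.Solver using (module +-*-Solver)
open +-*-Solver using (solve; con; _:+_; _:*_; _:=_)
open import Data.Product.Base hiding (map)
open import Data.Sum.Base using (_⊎_; inj₁; inj₂; [_,_]′)
open import Data.Unit.Base using (⊤; tt)
open import Function.Base using (_∘_; case_of_)
open import Level using (Level; _⊔_; Lift; lift) renaming (suc to lsuc; zero to lzero)
open import Relation.Binary.Bundles using (DecTotalOrder)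
open import Relation.Binary.Definitions using (tri<; tri≈; tri>)
open import Relation.Binary.PropositionalEquality
open import Relation.Nullary using (¬_; yes; no)
open import Relation.Nullary.Decidable.Core using (¬?)
open import Defs

-- Three children are what makes both repairs work. Two dirty nodes below one parent leave only its
-- winner as the third child, so one election settles both; and a winning `P` has two siblings, at
-- most one of them dirty. The election is confined to a node that loses at its parent, because
-- every ancestor won through it would store the same leaf. One step per operation suffices: a join
-- turns three roots into one and a repair two dirty nodes into at most one, so either no bucket is
-- overfull and the pigeonhole bound holds, or the count is back at or below its old value.
--
-- The other difficulty is the machine. Words wrap around, memory has to stay linear in the largest
-- size so far however many operations are run, and there is no instruction for logarithms. So node
-- identifiers are recycled, the table of logarithms gains two entries with each new identifier, and
-- programs are verified on an abstract machine with unbounded numbers, where each result must be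
-- shown to be small. The specification quantifies over arbitrary runs; determinism identifies them
-- with the run that is constructed.

decide : ∀ {p} {P : Set p} (x y : ℕ) → (x ≡ y → P) → (x ≢ y → P) → P
decide x y f g with x ≟ y
... | yes e = f e
... | no n  = g n

none : ∀ {v} → ¬ (v ≢ 0) → v ≡ 0
none {zero} _ = refl
none {suc v} n = ⊥-elim (n 1+n≢0)

-- Functions updated at one, two or three points.

module _ {b} {B : Set b} where

  update-≡ : ∀ (f : ℕ → B) i v {j} → j ≡ i → update f i v j ≡ v
  update-≡ f i v refl with i ≡ᵇ i in eq
  ... | true  = refl
  ... | false = ⊥-elim (subst T eq (≡⇒≡ᵇ i i refl))

  update-≢ : ∀ (f : ℕ → B) i v {j} → j ≢ i → update f i v j ≡ f j
  update-≢ f i v {j} j≢i with i ≡ᵇ j in eq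
  ... | false = refl
  ... | true  = ⊥-elim (j≢i (sym (≡ᵇ⇒≡ i j (subst T (sym eq) tt))))

  record Upd (f : ℕ → B) (i : ℕ) (v : B) (f′ : ℕ → B) : Set b where
    constructor mkUpd
    field
      at  : f′ i ≡ v
      off : ∀ {j} → j ≢ i → f′ j ≡ f j

  record Upd₂ (f : ℕ → B) (i : ℕ) (v : B) (j : ℕ) (u : B) (f′ : ℕ → B) : Set b where
    constructor mkUpd₂
    field
      at₁ : f′ i ≡ v
      at₂ : f′ j ≡ u
      off : ∀ {k} → k ≢ i → k ≢ j → f′ k ≡ f k

  record Upd₃ (f : ℕ → B) (i : ℕ) (v : B) (j : ℕ) (u : B) (k : ℕ) (t : B)
              (f′ : ℕ → B) : Set b where
    constructor mkUpd₃
    field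
      at₁ : f′ i ≡ v
      at₂ : f′ j ≡ u
      at₃ : f′ k ≡ t
      off : ∀ {l} → l ≢ i → l ≢ j → l ≢ k → f′ l ≡ f l

  upd : ∀ f i v → Upd f i v (update f i v)
  upd f i v = mkUpd (update-≡ f i v refl) (update-≢ f i v)

  upd₂ : ∀ f i v j u → i ≢ j → Upd₂ f i v j u (update (update f i v) j u)
  upd₂ f i v j u i≢j = mkUpd₂
    (trans (update-≢ f₁ j u i≢j) (update-≡ f i v refl))
    (update-≡ f₁ j u refl)
    (λ p q → trans (update-≢ f₁ j u q) (update-≢ f i v p))
    where f₁ = update f i v

  upd₃ : ∀ f i v j u k t → i ≢ j → i ≢ k → j ≢ k →
         Upd₃ f i v j u k t (update (update (update f i v) j u) k t)
  upd₃ f i v j u k t i≢j i≢k j≢k = mkUpd₃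
    (trans (update-≢ f₂ k t i≢k) (trans (update-≢ f₁ j u i≢j) (update-≡ f i v refl)))
    (trans (update-≢ f₂ k t j≢k) (update-≡ f₁ j u refl))
    (update-≡ f₂ k t refl)
    (λ p q r → trans (update-≢ f₂ k t r) (trans (update-≢ f₁ j u q) (update-≢ f i v p)))
    where
    f₁ = update f i v
    f₂ = update f₁ j u

-- Slots: the children of P sit in slots 4 P, 4 P + 1 and 4 P + 2.

slot-< : ∀ {p q i} j → i < 4 → p < q → 4 * p + i < 4 * q + j
slot-< {p} {q} {i} j i<4 p<q = begin-strict
  4 * p + i   <⟨ +-monoʳ-< (4 * p) i<4 ⟩
  4 * p + 4   ≡⟨ +-comm (4 * p) 4 ⟩
  4 + 4 * p   ≡⟨ *-suc 4 p ⟨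
  4 * suc p   ≤⟨ *-monoʳ-≤ 4 p<q ⟩
  4 * q       ≤⟨ m≤m+n (4 * q) j ⟩
  4 * q + j   ∎
  where open ≤-Reasoning

slot-injˡ : ∀ {p q i j} → i < 4 → j < 4 → 4 * p + i ≡ 4 * q + j → p ≡ q
slot-injˡ {p} {q} {i} {j} i<4 j<4 eq with <-cmp p q
... | tri≈ _ p≡q _ = p≡q
... | tri< p<q _ _ = ⊥-elim (<⇒≢ (slot-< j i<4 p<q) eq)
... | tri> _ _ q<p = ⊥-elim (<⇒≢ (slot-< i j<4 q<p) (sym eq))

slot-injʳ : ∀ {p q i j} → p ≡ q → 4 * p + i ≡ 4 * q + j → i ≡ j
slot-injʳ {p} refl eq = +-cancelˡ-≡ (4 * p) _ _ eq

-- Tournament forests given by arrays, and the changes that preserve them.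

module Forest {a ℓ₁ ℓ₂ : Level} (K : DecTotalOrder a ℓ₁ ℓ₂) where

  open DecTotalOrder K using () renaming
    (Carrier to Key; _≤_ to _≤ᴷ_; refl to reflᴷ; trans to transᴷ; total to totalᴷ) public

  -- Compares cells rather than keys: both must be filled, since the machine gets stuck on an empty
  -- one.
  KLe : (ℕ → Maybe Key) → ℕ → ℕ → Set (a ⊔ ℓ₂)
  KLe C x y = ∃₂ λ k k′ → C x ≡ just k × C y ≡ just k′ × k ≤ᴷ k′

  KLe-trans : ∀ C {x y z} → KLe C x y → KLe C y z → KLe C x z
  KLe-trans _ (k , l , p , q , r) (l′ , m , p′ , q′ , r′) with trans (sym q) p′
  ... | refl = k , m , p , q′ , transᴷ r r′

  KLe-refl : ∀ C {x k} → C x ≡ just k → KLe C x x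
  KLe-refl _ p = _ , _ , p , p , reflᴷ

  -- In a valid forest this marks the upper end of the winning path of a leaf: no ancestor is won by
  -- the same leaf.
  Top : (par win : ℕ → ℕ) → ℕ → Set
  Top par win x = par x ≡ 0 ⊎ win (par x) ≢ x

  -- A node x is live when W x ≢ 0; D is the set of dirty nodes.
  record Tree (par pos cont win W T ht : ℕ → ℕ) (C : ℕ → Maybe Key)
              (D : ℕ → Set) : Set (a ⊔ ℓ₂) where
    field
      chl : ∀ {p h} j → W p ≢ 0 → ht p ≡ suc h → j < 3 →
            let x = cont (4 * p + j) in
            W x ≢ 0 × par x ≡ p × pos x ≡ 4 * p + j × ht x ≡ h
      prn : ∀ {x} → W x ≢ 0 → par x ≢ 0 →
            W (par x) ≢ 0 × ht (par x) ≡ suc (ht x) ×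
            (∃[ j ] (j < 3 × pos x ≡ 4 * par x + j)) × cont (pos x) ≡ x
      win-ok : ∀ {p h} → W p ≢ 0 → ht p ≡ suc h →
               W (win p) ≢ 0 × par (win p) ≡ p × W p ≡ W (win p)
      lfW  : ∀ {x} → W x ≢ 0 → ht x ≡ 0 → W x ≡ x
      lf   : ∀ {x} → W x ≢ 0 → W (W x) ≢ 0 × ht (W x) ≡ 0
      key  : ∀ {x} → W x ≢ 0 → ht x ≡ 0 → ∃[ k ] (C x ≡ just k)
      -- `D` is a set of marks, which may be stale: a marked node is allowed to beat its parent's
      -- winner but need not do so, for instance after an exchange has moved it below a stronger
      -- parent. Winning children share their parent's leaf and never need a mark.
      dirty : ∀ {x} → D x → W x ≢ 0 × par x ≢ 0 × win (par x) ≢ x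
      ord  : ∀ {x} → W x ≢ 0 → par x ≢ 0 → D x ⊎ KLe C (W (par x)) (W x)
      -- Together with `top-ok` this makes `T` a bijection from the live leaves to the upper ends of
      -- winning paths, so one lookup finds the only node that a decreased key can put out of order.
      top  : ∀ {x} → W x ≢ 0 → Top par win x → T (W x) ≡ x
      top-ok : ∀ {b} → W b ≢ 0 → ht b ≡ 0 →
               W (T b) ≢ 0 × W (T b) ≡ b × Top par win (T b)
      null : W 0 ≡ 0

    live≢0 : ∀ {x} → W x ≢ 0 → x ≢ 0
    live≢0 lx refl = lx null

    wkey : ∀ {x} → W x ≢ 0 → ∃[ k ] (C (W x) ≡ just k)
    wkey lx with lf lx
    ... | l , h = key l h

    ht-win : ∀ {p h} → W p ≢ 0 → ht p ≡ suc h → ht (win p) ≡ h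
    ht-win {p} lp hp with win-ok lp hp
    ... | lw , pw , _ with prn lw (λ e → live≢0 lp (trans (sym pw) e))
    ... | _ , hw , _ = suc-injective (trans (sym hw) (trans (cong ht pw) hp))

    par-not-win : ∀ {p x h} → W p ≢ 0 → ht p ≡ suc h → par x ≢ p → win p ≢ x
    par-not-win lp hp ne refl = ne (proj₁ (proj₂ (win-ok lp hp)))

    par-ht : ∀ {x} → W x ≢ 0 → par x ≢ 0 → ht (par x) ≡ suc (ht x)
    par-ht lx px = proj₁ (proj₂ (prn lx px))

    par-live : ∀ {x} → W x ≢ 0 → par x ≢ 0 → W (par x) ≢ 0
    par-live lx px = proj₁ (prn lx px)

    pos-inj : ∀ {x y} → W x ≢ 0 → par x ≢ 0 → W y ≢ 0 → par y ≢ 0 → pos x ≡ pos y → x ≡ y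
    pos-inj lx px ly py e with prn lx px | prn ly py
    ... | _ , _ , _ , cx | _ , _ , _ , cy = trans (sym cx) (trans (cong cont e) cy)

    child : ∀ {x p} → W x ≢ 0 → p ≢ 0 → par x ≡ p →
            x ≡ cont (4 * p + 0) ⊎ x ≡ cont (4 * p + 1) ⊎ x ≡ cont (4 * p + 2)
    child lx p≢0 refl with prn lx p≢0
    ... | _ , _ , (0 , _ , e) , c = inj₁ (trans (sym c) (cong cont e))
    ... | _ , _ , (1 , _ , e) , c = inj₂ (inj₁ (trans (sym c) (cong cont e)))
    ... | _ , _ , (2 , _ , e) , c = inj₂ (inj₂ (trans (sym c) (cong cont e)))
    ... | _ , _ , (suc (suc (suc _)) , s≤s (s≤s (s≤s ())) , _) , _

    chl-≢ : ∀ {p h i j} → W p ≢ 0 → ht p ≡ suc h → i < 3 → j < 3 → i ≢ j →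
            cont (4 * p + i) ≢ cont (4 * p + j)
    chl-≢ {p} lp hp i<3 j<3 i≢j e with chl _ lp hp i<3 | chl _ lp hp j<3
    ... | _ , _ , pi , _ | _ , _ , pj , _ =
      i≢j (+-cancelˡ-≡ (4 * p) _ _ (trans (sym pi) (trans (cong pos e) pj)))

  module _ {par pos cont win W T ht C D} (t : Tree par pos cont win W T ht C D) where
    open Tree t

    live-back : ∀ {p v W′ z} → Upd W p v W′ → W p ≢ 0 → W′ z ≢ 0 → W z ≢ 0
    live-back {p} {z = z} (mkUpd _ off) lp l with z ≟ p
    ... | yes refl = lp
    ... | no n = λ e → l (trans (off n) e)

    live-fwd : ∀ {p v W′ z} → Upd W p v W′ → v ≢ 0 → W z ≢ 0 → W′ z ≢ 0
    live-fwd {p} {z = z} (mkUpd at off) v≢0 l with z ≟ p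
    ... | yes refl = λ e → v≢0 (trans (sym at) e)
    ... | no n = λ e → l (trans (sym (off n)) e)

    -- Following winning children from `z` leads to the leaf `W z`. If that leaf is a root, no step
    -- can have been taken, as the last one would give it a parent.
    only-self : ∀ {x} h {z} → ht z ≡ h → W x ≢ 0 → par x ≡ 0 → W z ≢ 0 → W z ≡ x → z ≡ x
    only-self zero hz lx px lz e = trans (sym (lfW lz hz)) e
    only-self (suc h) {z} hz lx px lz e with win-ok lz hz
    ... | l , p , w with only-self h (ht-win lz hz) lx px l (trans (sym w) e)
    ... | refl = ⊥-elim (live≢0 lz (trans (sym p) px))

    module _ {w : ℕ} (low : ∀ {z} → W z ≢ 0 → ht z < w) where

      -- Climb until a root or a marked node is met; each unmarked node passed does not beat its
      -- parent's winner. Heights grow with every step, so the distance of `ht x` to the height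
      -- bound is enough fuel. This is why the minimum can be sought among roots and dirty nodes
      -- alone.
      candidate : ∀ n {x} → w ≤ ht x + n → W x ≢ 0 →
                  ∃[ y ] (W y ≢ 0 × (par y ≡ 0 ⊎ D y) × KLe C (W y) (W x))
      candidate zero {x} w≤ lx = ⊥-elim (<⇒≱ (low lx) (subst (w ≤_) (+-identityʳ _) w≤))
      candidate (suc n) {x} w≤ lx with par x ≟ 0
      ... | yes e = x , lx , inj₁ e , KLe-refl C (proj₂ (wkey lx))
      ... | no px with ord lx px
      ... | inj₁ d = x , lx , inj₂ d , KLe-refl C (proj₂ (wkey lx))
      ... | inj₂ k with candidate n (subst (w ≤_) (trans (+-suc _ n) (cong (_+ n) (sym (par-ht lx px)))) w≤)
                                    (par-live lx px)
      ... | y , ly , c , k′ = y , ly , c , KLe-trans C k′ k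

      -- The same climb, not stopped by marks. It transfers bounds on the heights of roots to all
      -- nodes.
      root-above : ∀ n {x} → w ≤ ht x + n → W x ≢ 0 → ∃[ y ] (W y ≢ 0 × par y ≡ 0 × ht x ≤ ht y)
      root-above zero {x} w≤ lx = ⊥-elim (<⇒≱ (low lx) (subst (w ≤_) (+-identityʳ _) w≤))
      root-above (suc n) {x} w≤ lx with par x ≟ 0
      ... | yes e = x , lx , e , ≤-refl
      ... | no px with root-above n (subst (w ≤_) (trans (+-suc _ n) (cong (_+ n) (sym (par-ht lx px)))) w≤)
                                    (par-live lx px)
      ... | y , ly , e , k = y , ly , e , ≤-trans (n≤1+n _) (subst (_≤ ht y) (par-ht lx px) k)

  -- Here and below, a change of the forest is a record whose fields are the hypotheses and whose
  -- `tree′` is the resulting forest. Neither `x` nor `v` is a winning child, before or after, so no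
  -- winner and no end of a winning path changes. As `x` keeps its mark it may land below any
  -- parent; only `v` has to be compared with the new one, which is `ov`.
  record Exchange : Set (lsuc lzero ⊔ a ⊔ ℓ₂) where
    constructor exchange
    field
      {par pos cont win W Tp ht} : ℕ → ℕ
      {C}                       : ℕ → Maybe Key
      {D}                       : ℕ → Set
      t                         : Tree par pos cont win W Tp ht C D
      {x v}                     : ℕ
      {par′ pos′ cont′}         : ℕ → ℕ
      lx                        : W x ≢ 0
      lv                        : W v ≢ 0
      px                        : par x ≢ 0
      pv                        : par v ≢ 0
      p≢q                       : par x ≢ par v
      hxv                       : ht x ≡ ht v
      wx                        : win (par x) ≢ x
      wv                        : win (par v) ≢ v
      dx                        : D x
      ov                        : D v ⊎ KLe C (W (par x)) (W v)
      uP                        : Upd₂ par x (par v) v (par x) par′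
      uX                        : Upd₂ pos x (pos v) v (pos x) pos′
      uY                        : Upd₂ cont (pos x) v (pos v) x cont′

    open Tree t
    open Upd₂ uP renaming (at₁ to par-x; at₂ to par-v; off to par-o)
    open Upd₂ uX renaming (at₁ to pos-x; at₂ to pos-v; off to pos-o)
    open Upd₂ uY renaming (at₁ to cont-x; at₂ to cont-v; off to cont-o)

    nwx : win (par v) ≢ x
    nwx = par-not-win (par-live lv pv) (par-ht lv pv) p≢q
    nwv : win (par x) ≢ v
    nwv = par-not-win (par-live lx px) (par-ht lx px) (p≢q ∘ sym)
    chl′ : ∀ {p h} j → W p ≢ 0 → ht p ≡ suc h → j < 3 →
          let y = cont′ (4 * p + j) in
          W y ≢ 0 × par′ y ≡ p × pos′ y ≡ 4 * p + j × ht y ≡ h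
    chl′ {p} j lp hp j<3 with chl j lp hp j<3
    ... | ly , py , sy , hy with 4 * p + j ≟ pos x
    ... | yes e with prn lx px
    ... | _ , _ , _ , cx rewrite e | cx | cont-x = lv , trans par-v py , pos-v , trans (sym hxv) hy
    chl′ {p} j lp hp j<3 | ly , py , sy , hy | no n with 4 * p + j ≟ pos v
    ... | yes e with prn lv pv
    ... | _ , _ , _ , cv rewrite e | cv | cont-v = lx , trans par-x py , pos-x , trans hxv hy
    chl′ {p} j lp hp j<3 | ly , py , sy , hy | no n | no m rewrite cont-o n m =
      ly , trans (par-o y≢x y≢v) py , trans (pos-o y≢x y≢v) sy , hy
      where
      y≢x : cont (4 * p + j) ≢ x
      y≢x e = n (trans (sym sy) (cong pos e))
      y≢v : cont (4 * p + j) ≢ v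
      y≢v e = m (trans (sym sy) (cong pos e))
    prn′ : ∀ {z} → W z ≢ 0 → par′ z ≢ 0 →
          W (par′ z) ≢ 0 × ht (par′ z) ≡ suc (ht z) ×
          (∃[ j ] (j < 3 × pos′ z ≡ 4 * par′ z + j)) × cont′ (pos′ z) ≡ z
    prn′ {z} lz pz with z ≟ x
    ... | yes refl rewrite par-x | pos-x with prn lv pv
    ... | l , h , s , _ = l , trans h (cong suc (sym hxv)) , s , cont-v
    prn′ {z} lz pz | no n with z ≟ v
    ... | yes refl rewrite par-v | pos-v with prn lx px
    ... | l , h , s , _ = l , trans h (cong suc hxv) , s , cont-x
    prn′ {z} lz pz | no n | no m rewrite par-o n m | pos-o n m with prn lz pz
    ... | l , h , s , c = l , h , s ,
      trans (cont-o (n ∘ pos-inj lz pz lx px) (m ∘ pos-inj lz pz lv pv)) c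
    win′ : ∀ {p h} → W p ≢ 0 → ht p ≡ suc h →
             W (win p) ≢ 0 × par′ (win p) ≡ p × W p ≡ W (win p)
    win′ {p} lp hp with win-ok lp hp
    ... | l , e , w = l , trans (par-o (λ q → wx (trans (cong win (trans (cong par (sym q)) e)) q))
        (λ q → wv (trans (cong win (trans (cong par (sym q)) e)) q))) e , w
    dirty′ : ∀ {z} → D z → W z ≢ 0 × par′ z ≢ 0 × win (par′ z) ≢ z
    dirty′ {z} dz with z ≟ x
    ... | yes refl rewrite par-x = lx , pv , nwx
    ... | no n with z ≟ v
    ... | yes refl rewrite par-v = lv , px , nwv
    ... | no m rewrite par-o n m = dirty dz
    ord′ : ∀ {z} → W z ≢ 0 → par′ z ≢ 0 → D z ⊎ KLe C (W (par′ z)) (W z)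
    ord′ {z} lz pz with z ≟ x
    ... | yes refl = inj₁ dx
    ... | no n with z ≟ v
    ... | yes refl rewrite par-v = ov
    ... | no m rewrite par-o n m = ord lz pz
    top′ : ∀ {z} → W z ≢ 0 → Top par′ win z → Tp (W z) ≡ z
    top′ {z} lz tz with z ≟ x
    ... | yes refl = top lx (inj₂ wx)
    ... | no n with z ≟ v
    ... | yes refl = top lv (inj₂ wv)
    ... | no m rewrite par-o n m = top lz tz
    top-ok′ : ∀ {b} → W b ≢ 0 → ht b ≡ 0 → W (Tp b) ≢ 0 × W (Tp b) ≡ b × Top par′ win (Tp b)
    top-ok′ {b} lb hb with top-ok lb hb
    ... | l , e , tp with Tp b ≟ x
    ... | yes q rewrite q | par-x = l , e , inj₂ nwx
    ... | no n with Tp b ≟ v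
    ... | yes q rewrite q | par-v = l , e , inj₂ nwv
    ... | no m rewrite par-o n m = l , e , tp

    tree′ : Tree par′ pos′ cont′ win W Tp ht C D
    tree′ = record
      { chl = chl′ ; prn = prn′ ; win-ok = win′ ; lfW = lfW ; lf = lf ; key = key
      ; dirty = dirty′ ; ord = ord′ ; top = top′ ; top-ok = top-ok′ ; null = null }

  -- The path of the old leaf now ends at the old winning child and that of the new leaf at `p`; the
  -- write for the new leaf comes second and so prevails when the winner stays the same. With a
  -- minimal winner all children of `p` are in order and their marks can go, while `p` itself,
  -- unless a root, must be marked.
  record Elect : Set (lsuc lzero ⊔ a ⊔ ℓ₂) where
    constructor elect
    field
      {par pos cont win W Tp ht} : ℕ → ℕ
      {C}                       : ℕ → Maybe Key
      {D}                       : ℕ → Set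
      t                         : Tree par pos cont win W Tp ht C D
      {p h m}                   : ℕ
      {win′ W′ T₁ T′}           : ℕ → ℕ
      {D′}                      : ℕ → Set
      lp                        : W p ≢ 0
      hp                        : ht p ≡ suc h
      tp                        : Top par win p
      lm                        : W m ≢ 0
      pm                        : par m ≡ p
      min                       : ∀ {z} → W z ≢ 0 → par z ≡ p → KLe C (W m) (W z)
      uwin                      : Upd win p m win′
      uW                        : Upd W p (W m) W′
      uT                        : Upd Tp (W (win p)) (win p) T₁
      uT′                       : Upd T₁ (W m) p T′
      d₁                        : ∀ {z} → D′ z → par z ≢ p × (D z ⊎ (z ≡ p × par p ≢ 0))
      d₂                        : ∀ {z} → D z → par z ≢ p → D′ z
      d₃                        : par p ≢ 0 → D′ p

    open Tree t

    open Upd uwin renaming (at to win-at; off to win-off)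
    open Upd uW renaming (at to W-at; off to W-off)
    open Upd uT renaming (at to T₁-at; off to T₁-off)
    open Upd uT′ renaming (at to T-at; off to T-off)
    old : ℕ
    old = win p
    p≢0 : p ≢ 0
    p≢0 = live≢0 lp
    fw : ∀ {z} → W z ≢ 0 → W′ z ≢ 0
    fw = live-fwd t uW lm
    bk : ∀ {z} → W′ z ≢ 0 → W z ≢ 0
    bk = live-back t uW lp
    lold : W old ≢ 0
    lold = proj₁ (win-ok lp hp)
    pold : par old ≡ p
    pold = proj₁ (proj₂ (win-ok lp hp))
    Wold : W p ≡ W old
    Wold = proj₂ (proj₂ (win-ok lp hp))
    ≢p : ∀ {z} → W z ≢ 0 → par z ≡ p → z ≢ p
    ≢p lz pz refl = 1+n≢n (sym (trans (sym (cong ht pz)) (par-ht lz (λ e → p≢0 (trans (sym pz) e)))))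
    T-old : Tp (W old) ≡ p
    T-old = trans (cong Tp (sym Wold)) (top lp tp)
    m≢old⇒Tp : m ≢ old → Tp (W m) ≡ m
    m≢old⇒Tp n = top lm (inj₂ (λ e → n (trans (sym e) (cong win pm))))
    chl′ : ∀ {q i} j → W′ q ≢ 0 → ht q ≡ suc i → j < 3 →
          let x = cont (4 * q + j) in
          W′ x ≢ 0 × par x ≡ q × pos x ≡ 4 * q + j × ht x ≡ i
    chl′ j lq hq j<3 with chl j (bk lq) hq j<3
    ... | l , r = fw l , r
    prn′ : ∀ {x} → W′ x ≢ 0 → par x ≢ 0 →
          W′ (par x) ≢ 0 × ht (par x) ≡ suc (ht x) ×
          (∃[ j ] (j < 3 × pos x ≡ 4 * par x + j)) × cont (pos x) ≡ x
    prn′ lx px with prn (bk lx) px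
    ... | l , r = fw l , r
    win-ok′ : ∀ {q i} → W′ q ≢ 0 → ht q ≡ suc i →
             W′ (win′ q) ≢ 0 × par (win′ q) ≡ q × W′ q ≡ W′ (win′ q)
    win-ok′ {q} lq hq with q ≟ p
    ... | yes refl rewrite win-at | W-at | W-off (≢p lm pm) = lm , pm , refl
    ... | no n rewrite win-off n | W-off n with win-ok lq hq
    ... | l , e , w with win q ≟ p
    ... | no k = fw l , e , trans w (sym (W-off k))
    -- Here `tp` is indispensable: if `p` won its parent `q`, the leaf stored at `q` would now be
    -- outdated.
    ... | yes k = ⊥-elim (case tp of λ
                    { (inj₁ z) → live≢0 lq (trans (sym e) (trans (cong par k) z))
                    ; (inj₂ z) → z (trans (cong win (trans (cong par (sym k)) e)) k) })
    lfW′ : ∀ {x} → W′ x ≢ 0 → ht x ≡ 0 → W′ x ≡ x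
    lfW′ lx hx = trans (W-off (λ { refl → 1+n≢0 (trans (sym hp) hx) })) (lfW (bk lx) hx)
    lf′ : ∀ {x} → W′ x ≢ 0 → W′ (W′ x) ≢ 0 × ht (W′ x) ≡ 0
    lf′ {x} lx with x ≟ p
    ... | yes refl rewrite W-at = fw (proj₁ (lf lm)) , proj₂ (lf lm)
    ... | no n with lf (bk lx)
    ... | l , h rewrite W-off n = fw l , h
    dirty′ : ∀ {z} → D′ z → W′ z ≢ 0 × par z ≢ 0 × win′ (par z) ≢ z
    dirty′ {z} dz with d₁ dz
    ... | n , inj₁ d with dirty d
    ... | l , q , w = fw l , q , λ e → w (trans (sym (win-off n)) e)
    dirty′ {z} dz | n , inj₂ (refl , q) = fw lp , q , λ e → case tp of λ
        { (inj₁ k) → q k ; (inj₂ k) → k (trans (sym (win-off n)) e) }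
    ord′ : ∀ {x} → W′ x ≢ 0 → par x ≢ 0 → D′ x ⊎ KLe C (W′ (par x)) (W′ x)
    ord′ {x} lx px with x ≟ p
    ... | yes refl = inj₁ (d₃ px)
    ... | no n with par x ≟ p
    ... | yes k rewrite k | W-at | W-off n = inj₂ (min lx k)
    ... | no k rewrite W-off k | W-off n = case ord lx px of λ
            { (inj₁ d) → inj₁ (d₂ d k) ; (inj₂ c) → inj₂ c }
    T-other : ∀ {b} → b ≢ W old → b ≢ W m → T′ b ≡ Tp b
    T-other n k = trans (T-off k) (T₁-off n)
    top′ : ∀ {x} → W′ x ≢ 0 → Top par win′ x → T′ (W′ x) ≡ x
    top′ {x} lx tx with x ≟ p
    ... | yes refl rewrite W-at = T-at
    ... | no n rewrite W-off n with par x ≟ p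
    ... | no k = trans (T-other n₁ n₂) Tx
      where
      Tx : Tp (W x) ≡ x
      Tx = top (lx) (case tx of λ { (inj₁ e) → inj₁ e ; (inj₂ e) → inj₂ (λ f → e (trans (win-off k) f)) })
      n₁ : W x ≢ W old
      n₁ e = n (trans (sym Tx) (trans (cong Tp e) T-old))
      n₂ : W x ≢ W m
      n₂ e with m ≟ old
      ... | yes q = n₁ (trans e (cong W q))
      ... | no q = k (subst (λ y → par y ≡ p) (trans (sym (m≢old⇒Tp q)) (trans (cong Tp (sym e)) Tx)) pm)
    top′ {x} lx tx | no n | yes k with x ≟ m
    ... | yes refl = ⊥-elim (case tx of λ
            { (inj₁ e) → p≢0 (trans (sym k) e) ; (inj₂ e) → e (trans (cong win′ k) win-at) })
    ... | no x≢m with x ≟ old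
    ... | yes refl = trans (T-off n₂) T₁-at
      where
      n₂ : W x ≢ W m
      n₂ e = ≢p lm pm (trans (sym (m≢old⇒Tp (x≢m ∘ sym))) (trans (cong Tp (sym e)) T-old))
    ... | no x≢old = trans (T-other n₁ n₂) Tx
      where
      Tx : Tp (W x) ≡ x
      Tx = top (lx) (inj₂ (λ f → x≢old (trans (sym f) (cong win k))))
      n₁ : W x ≢ W old
      n₁ e = n (trans (sym Tx) (trans (cong Tp e) T-old))
      n₂ : W x ≢ W m
      n₂ e with m ≟ old
      ... | yes q = n₁ (trans e (cong W q))
      ... | no q = x≢m (trans (sym Tx) (trans (cong Tp e) (m≢old⇒Tp q)))
    top-ok′ : ∀ {b} → W′ b ≢ 0 → ht b ≡ 0 → W′ (T′ b) ≢ 0 × W′ (T′ b) ≡ b × Top par win′ (T′ b)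
    top-ok′ {b} lb hb with b ≟ W m
    ... | yes refl rewrite T-at = fw lp , W-at , (case tp of λ
            { (inj₁ e) → inj₁ e ; (inj₂ e) → inj₂ (λ f → e (trans (sym (win-off par≢)) f)) })
      where
      par≢ : par p ≢ p
      par≢ e = ≢p lp e refl
    ... | no b≢m with b ≟ W old
    ... | yes refl rewrite T-off b≢m | T₁-at =
            fw lold , W-off (≢p lold pold) ,
            inj₂ (λ e → b≢m (cong W (trans (sym e) (trans (cong win′ pold) win-at))))
    ... | no b≢old rewrite T-other b≢old b≢m with top-ok (bk lb) hb
    ... | l , e , tb = fw l , trans (W-off Tb≢p) e , tb′
      where
      Tb≢p : Tp b ≢ p
      Tb≢p q = b≢old (trans (sym e) (trans (cong W q) Wold))
      tb′ : Top par win′ (Tp b)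
      tb′ with par (Tp b) ≟ p
      ... | yes q = inj₂ (λ f → b≢m (trans (sym e) (cong W (trans (sym f) (trans (cong win′ q) win-at)))))
      ... | no q = case tb of λ { (inj₁ z) → inj₁ z ; (inj₂ z) → inj₂ (λ f → z (trans (sym (win-off q)) f)) }

    tree′ : Tree par pos cont win′ W′ T′ ht C D′
    tree′ = record
      { chl = chl′ ; prn = prn′ ; win-ok = win-ok′ ; lfW = lfW′ ; lf = lf′
      ; key = λ l → key (bk l)
      ; dirty = dirty′ ; ord = ord′ ; top = top′ ; top-ok = top-ok′
      ; null = trans (Upd.off uW (λ e → live≢0 lp (sym e))) null }

  -- Only the winning child's path reached up to `r`, so a single entry of `Tp` changes. The
  -- children become roots, which cannot be dirty; hence their marks are dropped.
  record Split : Set (lsuc lzero ⊔ a ⊔ ℓ₂) where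
    constructor split
    field
      {par pos cont win W Tp ht} : ℕ → ℕ
      {C}                       : ℕ → Maybe Key
      {D}                       : ℕ → Set
      t                         : Tree par pos cont win W Tp ht C D
      {r h}                     : ℕ
      {par′ W′ T′}              : ℕ → ℕ
      {D′}                      : ℕ → Set
      lr                        : W r ≢ 0
      hr                        : ht r ≡ suc h
      pr                        : par r ≡ 0
      upar                      : Upd₃ par (cont (4 * r + 0)) 0 (cont (4 * r + 1)) 0 (cont (4 * r + 2)) 0 par′
      uW                        : Upd W r 0 W′
      uT                        : Upd Tp (W (win r)) (win r) T′
      d₁                        : ∀ {z} → D′ z → D z × par z ≢ r
      d₂                        : ∀ {z} → D z → par z ≢ r → D′ z

    open Tree t

    open Upd uW renaming (at to W-at; off to W-off)
    open Upd uT renaming (at to T-at; off to T-off)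
    old : ℕ
    old = win r
    r≢0 : r ≢ 0
    r≢0 = live≢0 lr
    ≢r : ∀ {z} → W′ z ≢ 0 → z ≢ r
    ≢r l refl = l W-at
    bk : ∀ {z} → W′ z ≢ 0 → W z ≢ 0
    bk l e = l (trans (W-off (≢r l)) e)
    fw : ∀ {z} → W z ≢ 0 → z ≢ r → W′ z ≢ 0
    fw l n e = l (trans (sym (W-off n)) e)
    par≢0⇒≢r : ∀ {z} → par z ≢ 0 → z ≢ r
    par≢0⇒≢r n refl = n pr
    lold : W old ≢ 0
    lold = proj₁ (win-ok lr hr)
    pold : par old ≡ r
    pold = proj₁ (proj₂ (win-ok lr hr))
    Wold : W r ≡ W old
    Wold = proj₂ (proj₂ (win-ok lr hr))
    T-old : Tp (W old) ≡ r
    T-old = trans (cong Tp (sym Wold)) (top lr (inj₁ pr))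
    old≢r : old ≢ r
    old≢r = par≢0⇒≢r (λ e → r≢0 (trans (sym pold) e))
    par-r : ∀ {z} → W z ≢ 0 → par z ≡ r → par′ z ≡ 0
    par-r lz pz with child lz r≢0 pz
    ... | inj₁ refl = Upd₃.at₁ upar
    ... | inj₂ (inj₁ refl) = Upd₃.at₂ upar
    ... | inj₂ (inj₂ refl) = Upd₃.at₃ upar
    par-o : ∀ {z} → par z ≢ r → par′ z ≡ par z
    par-o {z} n = Upd₃.off upar (no′ 0 (s≤s z≤n)) (no′ 1 (s≤s (s≤s z≤n))) (no′ 2 (s≤s (s≤s (s≤s z≤n))))
      where
      no′ : ∀ j → j < 3 → z ≢ cont (4 * r + j)
      no′ j j<3 refl = n (proj₁ (proj₂ (chl j lr hr j<3)))
    par-z : ∀ {z} → W z ≢ 0 → par′ z ≢ 0 → par z ≢ r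
    par-z l n e = n (par-r l e)
    chl′ : ∀ {q i} j → W′ q ≢ 0 → ht q ≡ suc i → j < 3 →
          let x = cont (4 * q + j) in
          W′ x ≢ 0 × par′ x ≡ q × pos x ≡ 4 * q + j × ht x ≡ i
    chl′ j lq hq j<3 with chl j (bk lq) hq j<3
    ... | l , p , s = fw l (par≢0⇒≢r (λ e → live≢0 (bk lq) (trans (sym p) e))) ,
                      trans (par-o (λ e → ≢r lq (trans (sym p) e))) p , s
    prn′ : ∀ {x} → W′ x ≢ 0 → par′ x ≢ 0 →
          W′ (par′ x) ≢ 0 × ht (par′ x) ≡ suc (ht x) ×
          (∃[ j ] (j < 3 × pos x ≡ 4 * par′ x + j)) × cont (pos x) ≡ x
    prn′ lx px with par-z (bk lx) px
    ... | n rewrite par-o n with prn (bk lx) px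
    ... | l , s = fw l n , s
    win-ok′ : ∀ {q i} → W′ q ≢ 0 → ht q ≡ suc i →
             W′ (win q) ≢ 0 × par′ (win q) ≡ q × W′ q ≡ W′ (win q)
    win-ok′ {q} lq hq with win-ok (bk lq) hq
    ... | l , p , w = fw l n , trans (par-o (λ e → ≢r lq (trans (sym p) e))) p ,
                      trans (W-off (≢r lq)) (trans w (sym (W-off n)))
      where
      n : win q ≢ r
      n = par≢0⇒≢r (λ e → live≢0 (bk lq) (trans (sym p) e))
    lf′ : ∀ {x} → W′ x ≢ 0 → W′ (W′ x) ≢ 0 × ht (W′ x) ≡ 0
    lf′ {x} lx rewrite W-off (≢r lx) with lf (bk lx)
    ... | l , h = fw l (λ { e → 1+n≢0 (trans (sym hr) (trans (cong ht (sym e)) h)) }) , h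
    dirty′ : ∀ {z} → D′ z → W′ z ≢ 0 × par′ z ≢ 0 × win (par′ z) ≢ z
    dirty′ dz with d₁ dz
    ... | d , n rewrite par-o n with dirty d
    ... | l , p , w = fw l (par≢0⇒≢r p) , p , w
    ord′ : ∀ {x} → W′ x ≢ 0 → par′ x ≢ 0 → D′ x ⊎ KLe C (W′ (par′ x)) (W′ x)
    ord′ lx px with par-z (bk lx) px
    ... | n rewrite par-o n | W-off n | W-off (≢r lx) = case ord (bk lx) px of λ
            { (inj₁ d) → inj₁ (d₂ d n) ; (inj₂ c) → inj₂ c }
    off-old : ∀ {x} → x ≢ r → Tp (W x) ≡ x → T′ (W x) ≡ x
    off-old n Tx = trans (T-off (λ e → n (trans (sym Tx) (trans (cong Tp e) T-old)))) Tx
    top′ : ∀ {x} → W′ x ≢ 0 → Top par′ win x → T′ (W′ x) ≡ x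
    top′ {x} lx tx with ≢r lx
    ... | x≢r rewrite W-off x≢r with par x ≟ r
    ... | no n rewrite par-o n = off-old x≢r (top lx tx)
    ... | yes e with x ≟ old
    ... | yes refl = T-at
    ... | no k = off-old x≢r (top lx (inj₂ (λ f → k (trans (sym f) (cong win e)))))
    top-ok′ : ∀ {b} → W′ b ≢ 0 → ht b ≡ 0 → W′ (T′ b) ≢ 0 × W′ (T′ b) ≡ b × Top par′ win (T′ b)
    top-ok′ {b} lb hb with b ≟ W old
    ... | yes refl rewrite T-at = fw lold old≢r , W-off old≢r , inj₁ (par-r lold pold)
    ... | no n rewrite T-off n with top-ok (bk lb) hb
    ... | l , e , tb = fw l Tb≢r , trans (W-off Tb≢r) e , tb′
      where
      Tb≢r : Tp b ≢ r
      Tb≢r q = n (trans (sym e) (trans (cong W q) Wold))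
      tb′ : Top par′ win (Tp b)
      tb′ with par (Tp b) ≟ r
      ... | yes q = inj₁ (par-r l q)
      ... | no q rewrite par-o q = tb

    tree′ : Tree par′ pos cont win W′ T′ ht C D′
    tree′ = record
      { chl = chl′ ; prn = prn′ ; win-ok = win-ok′
      ; lfW = λ l e → trans (W-off (≢r l)) (lfW (bk l) e) ; lf = lf′
      ; key = λ l → key (bk l)
      ; dirty = dirty′ ; ord = ord′ ; top = top′ ; top-ok = top-ok′
      ; null = trans (W-off (λ e → live≢0 lr (sym e))) null }

  -- By `only-self` no other node is won by a leaf that is a root, so nothing else refers to `x`.
  record Kill : Set (lsuc lzero ⊔ a ⊔ ℓ₂) where
    constructor kill
    field
      {par pos cont win W Tp ht} : ℕ → ℕ
      {C}                       : ℕ → Maybe Key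
      {D}                       : ℕ → Set
      t                         : Tree par pos cont win W Tp ht C D
      {x}                       : ℕ
      {W′}                      : ℕ → ℕ
      lx                        : W x ≢ 0
      hx                        : ht x ≡ 0
      px                        : par x ≡ 0
      uW                        : Upd W x 0 W′

    open Tree t
    open Upd uW renaming (at to W-at; off to W-off)

    ≢x : ∀ {z} → W′ z ≢ 0 → z ≢ x
    ≢x l refl = l W-at
    bk : ∀ {z} → W′ z ≢ 0 → W z ≢ 0
    bk l e = l (trans (W-off (≢x l)) e)
    fw : ∀ {z} → W z ≢ 0 → z ≢ x → W′ z ≢ 0
    fw l n e = l (trans (sym (W-off n)) e)
    nr : ∀ {z} → par z ≢ 0 → z ≢ x
    nr n refl = n px
    np : ∀ {z} → W z ≢ 0 → par z ≢ 0 → par z ≢ x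
    np l p e = 1+n≢0 (trans (sym (par-ht l p)) (trans (cong ht e) hx))
    win-ok′ : ∀ {q i} → W′ q ≢ 0 → ht q ≡ suc i →
             W′ (win q) ≢ 0 × par (win q) ≡ q × W′ q ≡ W′ (win q)
    win-ok′ lq hq with win-ok (bk lq) hq
    ... | l , p , w with nr (λ e → live≢0 (bk lq) (trans (sym p) e))
    ... | n = fw l n , p , trans (W-off (≢x lq)) (trans w (sym (W-off n)))
    lf′ : ∀ {z} → W′ z ≢ 0 → W′ (W′ z) ≢ 0 × ht (W′ z) ≡ 0
    lf′ {z} lz with ≢x lz
    ... | n rewrite W-off n with lf lz
    ... | l , e = fw l (n ∘ only-self t _ refl lx px lz) , e
    ord′ : ∀ {z} → W′ z ≢ 0 → par z ≢ 0 → D z ⊎ KLe C (W′ (par z)) (W′ z)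
    ord′ lz pz rewrite W-off (np (bk lz) pz) | W-off (≢x lz) = ord (bk lz) pz

    tree′ : Tree par pos cont win W′ Tp ht C D
    tree′ = record
      { chl = λ j l e j<3 → let l₁ , p , s = chl j (bk l) e j<3 in
                fw l₁ (nr (λ q → live≢0 (bk l) (trans (sym p) q))) , p , s
      ; prn = λ l p → let l₁ , s = prn (bk l) p in
                fw l₁ (np (bk l) p) , s
      ; win-ok = win-ok′
      ; lfW = λ l e → trans (W-off (≢x l)) (lfW (bk l) e)
      ; lf = lf′
      ; key = λ l → key (bk l)
      ; dirty = λ d → let l , p , w = dirty d in fw l (nr p) , p , w
      ; ord = ord′
      ; top = λ l k → trans (cong Tp (W-off (≢x l))) (top (bk l) k)
      ; top-ok = λ l e → let l₁ , q , k = top-ok (bk l) e in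
          let n = λ s → ≢x l (trans (sym q) (trans (cong W s) (lfW lx hx))) in
          fw l₁ n , trans (W-off n) q , k
      ; null = trans (W-off (λ e → live≢0 lx (sym e))) null }

  record AddLeaf : Set (lsuc lzero ⊔ a ⊔ ℓ₂) where
    constructor newLeaf
    field
      {par pos cont win W Tp ht} : ℕ → ℕ
      {C}                       : ℕ → Maybe Key
      {D}                       : ℕ → Set
      t                         : Tree par pos cont win W Tp ht C D
      {x}                       : ℕ
      {k}                       : Key
      {par′ W′ T′ ht′}          : ℕ → ℕ
      {C′}                      : ℕ → Maybe Key
      wx                        : W x ≡ 0
      x≢0                       : x ≢ 0
      uP                        : Upd par x 0 par′
      uW                        : Upd W x x W′
      uT                        : Upd Tp x x T′
      uH                        : Upd ht x 0 ht′
      uC                        : Upd C x (just k) C′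

    open Tree t
    open Upd uP renaming (at to p-at; off to p-off)
    open Upd uW renaming (at to W-at; off to W-off)
    open Upd uT renaming (at to T-at; off to T-off)
    open Upd uH renaming (at to h-at; off to h-off)
    open Upd uC renaming (at to C-at; off to C-off)

    ≢x : ∀ {z} → W z ≢ 0 → z ≢ x
    ≢x l refl = l wx
    fw : ∀ {z} → W z ≢ 0 → W′ z ≢ 0
    fw l e = l (trans (sym (W-off (≢x l))) e)
    bk : ∀ {z} → z ≢ x → W′ z ≢ 0 → W z ≢ 0
    bk n l e = l (trans (W-off n) e)
    chl′ : ∀ {q i} j → W′ q ≢ 0 → ht′ q ≡ suc i → j < 3 →
          let y = cont (4 * q + j) in
          W′ y ≢ 0 × par′ y ≡ q × pos y ≡ 4 * q + j × ht′ y ≡ i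
    chl′ {q} j lq hq j<3 with q ≟ x
    ... | yes refl = ⊥-elim (1+n≢0 (trans (sym hq) h-at))
    ... | no n with chl j (bk n lq) (trans (sym (h-off n)) hq) j<3
    ... | l , p , s , h = fw l , trans (p-off (≢x l)) p , s , trans (h-off (≢x l)) h
    prn′ : ∀ {z} → W′ z ≢ 0 → par′ z ≢ 0 →
          W′ (par′ z) ≢ 0 × ht′ (par′ z) ≡ suc (ht′ z) ×
          (∃[ j ] (j < 3 × pos z ≡ 4 * par′ z + j)) × cont (pos z) ≡ z
    prn′ {z} lz pz with z ≟ x
    ... | yes refl = ⊥-elim (pz p-at)
    ... | no n rewrite p-off n | h-off n with prn (bk n lz) pz
    ... | l , h , s = fw l , trans (h-off (≢x l)) h , s
    win-ok′ : ∀ {q i} → W′ q ≢ 0 → ht′ q ≡ suc i →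
             W′ (win q) ≢ 0 × par′ (win q) ≡ q × W′ q ≡ W′ (win q)
    win-ok′ {q} lq hq with q ≟ x
    ... | yes refl = ⊥-elim (1+n≢0 (trans (sym hq) h-at))
    ... | no n with win-ok (bk n lq) (trans (sym (h-off n)) hq)
    ... | l , p , w = fw l , trans (p-off (≢x l)) p , trans (W-off n) (trans w (sym (W-off (≢x l))))
    lfW′ : ∀ {z} → W′ z ≢ 0 → ht′ z ≡ 0 → W′ z ≡ z
    lfW′ {z} lz hz with z ≟ x
    ... | yes refl = W-at
    ... | no n = trans (W-off n) (lfW (bk n lz) (trans (sym (h-off n)) hz))
    lf′ : ∀ {z} → W′ z ≢ 0 → W′ (W′ z) ≢ 0 × ht′ (W′ z) ≡ 0
    lf′ {z} lz with z ≟ x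
    ... | yes refl rewrite W-at = (λ e → x≢0 (trans (sym W-at) e)) , h-at
    ... | no n rewrite W-off n with lf lz
    ... | l , h = fw l , trans (h-off (≢x l)) h
    key′ : ∀ {z} → W′ z ≢ 0 → ht′ z ≡ 0 → ∃[ k ] (C′ z ≡ just k)
    key′ {z} lz hz with z ≟ x
    ... | yes refl = _ , C-at
    ... | no n with key (bk n lz) (trans (sym (h-off n)) hz)
    ... | k , e = k , trans (C-off n) e
    dirty′ : ∀ {z} → D z → W′ z ≢ 0 × par′ z ≢ 0 × win (par′ z) ≢ z
    dirty′ d with dirty d
    ... | l , p , w rewrite p-off (≢x l) = fw l , p , w
    ord′ : ∀ {z} → W′ z ≢ 0 → par′ z ≢ 0 → D z ⊎ KLe C′ (W′ (par′ z)) (W′ z)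
    ord′ {z} lz pz with z ≟ x
    ... | yes refl = ⊥-elim (pz p-at)
    ... | no n rewrite p-off n with bk n lz
    ... | l with par-live l pz
    ... | lp rewrite W-off n | W-off (≢x lp) = case ord l pz of λ
            { (inj₁ d) → inj₁ d
            ; (inj₂ (k , k′ , c , c′ , le)) →
               inj₂ (k , k′ , trans (C-off (≢x (proj₁ (lf lp)))) c , trans (C-off (≢x (proj₁ (lf l)))) c′ , le) }
    top′ : ∀ {z} → W′ z ≢ 0 → Top par′ win z → T′ (W′ z) ≡ z
    top′ {z} lz tz with z ≟ x
    ... | yes refl rewrite W-at = T-at
    ... | no n with bk n lz
    ... | l rewrite p-off n | W-off n = trans (T-off (≢x (proj₁ (lf l)))) (top l tz)
    top-ok′ : ∀ {b} → W′ b ≢ 0 → ht′ b ≡ 0 → W′ (T′ b) ≢ 0 × W′ (T′ b) ≡ b × Top par′ win (T′ b)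
    top-ok′ {b} lb hb with b ≟ x
    ... | yes refl rewrite T-at = lb , W-at , inj₁ p-at
    ... | no n rewrite T-off n with top-ok (bk n lb) (trans (sym (h-off n)) hb)
    ... | l , e , tb = fw l , trans (W-off (≢x l)) e ,
           subst (λ y → y ≡ 0 ⊎ win y ≢ Tp b) (sym (p-off (≢x l))) tb

    tree′ : Tree par′ pos cont win W′ T′ ht′ C′ D
    tree′ = record
      { chl = chl′ ; prn = prn′ ; win-ok = win-ok′ ; lfW = lfW′ ; lf = lf′ ; key = key′
      ; dirty = dirty′ ; ord = ord′ ; top = top′ ; top-ok = top-ok′
      ; null = trans (W-off (x≢0 ∘ sym)) null }

  -- Take a node `z` won by `x`. If it is the winning child of its parent, both have the same leaf
  -- and compare equal; otherwise it ends the winning path and is `Tp x`. For all other nodes the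
  -- parent's key can only have fallen. So a single mark is enough.
  record Decrease : Set (lsuc lzero ⊔ a ⊔ ℓ₂) where
    constructor decrease
    field
      {par pos cont win W Tp ht} : ℕ → ℕ
      {C}                       : ℕ → Maybe Key
      {D}                       : ℕ → Set
      t                         : Tree par pos cont win W Tp ht C D
      {x}                       : ℕ
      {k₀ k}                    : Key
      {C′}                      : ℕ → Maybe Key
      {D′}                      : ℕ → Set
      lx                        : W x ≢ 0
      hx                        : ht x ≡ 0
      cx                        : C x ≡ just k₀
      k≤                        : k ≤ᴷ k₀
      uC                        : Upd C x (just k) C′
      d₁                        : ∀ {z} → D z → D′ z
      d₂                        : ∀ {z} → D′ z → D z ⊎ (z ≡ Tp x × par (Tp x) ≢ 0)
      d₃                        : par (Tp x) ≢ 0 → D′ (Tp x)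

    open Tree t
    open Upd uC renaming (at to C-at; off to C-off)

    key′ : ∀ {z} → W z ≢ 0 → ht z ≡ 0 → ∃[ k ] (C′ z ≡ just k)
    key′ {z} lz hz with z ≟ x
    ... | yes refl = _ , C-at
    ... | no n = let k , e = key lz hz in k , trans (C-off n) e
    dirty′ : ∀ {z} → D′ z → W z ≢ 0 × par z ≢ 0 × win (par z) ≢ z
    dirty′ d with d₂ d
    ... | inj₁ d′ = dirty d′
    ... | inj₂ (refl , p) with top-ok lx hx
    ... | l , _ , inj₁ e = ⊥-elim (p e)
    ... | l , _ , inj₂ e = l , p , e
    ord′ : ∀ {z} → W z ≢ 0 → par z ≢ 0 → D′ z ⊎ KLe C′ (W (par z)) (W z)
    ord′ {z} lz pz with W z ≟ x
    ... | yes e with win (par z) ≟ z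
    ... | yes q rewrite trans (proj₂ (proj₂ (win-ok (par-live lz pz) (par-ht lz pz)))) (trans (cong W q) e) | e =
          inj₂ (k , k , C-at , C-at , reflᴷ)
    ... | no q with trans (sym (top lz (inj₂ q))) (cong Tp e)
    ... | refl = inj₁ (d₃ pz)
    ord′ {z} lz pz | no n with ord lz pz
    ... | inj₁ d = inj₁ (d₁ d)
    ... | inj₂ (k₁ , k₂ , c₁ , c₂ , le) with W (par z) ≟ x
    ... | no m = inj₂ (k₁ , k₂ , trans (C-off m) c₁ , trans (C-off n) c₂ , le)
    ... | yes e rewrite e with trans (sym cx) c₁
    ... | refl = inj₂ (k , k₂ , C-at , trans (C-off n) c₂ , transᴷ k≤ le)

    tree′ : Tree par pos cont win W Tp ht C′ D′
    tree′ = record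
      { chl = chl ; prn = prn ; win-ok = win-ok ; lfW = lfW ; lf = lf ; key = key′
      ; dirty = dirty′ ; ord = ord′ ; top = top ; top-ok = top-ok ; null = null }

  -- The identifier `p` may be recycled, so `par₁` first clears its old parent. Of all winning paths
  -- only that of `m` grows; the other two roots become losing children and remain the ends of
  -- theirs.
  record Attach : Set (lsuc lzero ⊔ a ⊔ ℓ₂) where
    constructor attach
    field
      {par pos cont win W Tp ht}  : ℕ → ℕ
      {C}                        : ℕ → Maybe Key
      {D}                        : ℕ → Set
      t                          : Tree par pos cont win W Tp ht C D
      {p h x y z m}              : ℕ
      {par₁ par′ pos′ cont′ win′ W′ T′ ht′} : ℕ → ℕ
      wp                         : W p ≡ 0
      p≢0                        : p ≢ 0
      lx                         : W x ≢ 0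
      ly                         : W y ≢ 0
      lz                         : W z ≢ 0
      px                         : par x ≡ 0
      py                         : par y ≡ 0
      pz                         : par z ≡ 0
      hx                         : ht x ≡ h
      hy                         : ht y ≡ h
      hz                         : ht z ≡ h
      x≢y                        : x ≢ y
      x≢z                        : x ≢ z
      y≢z                        : y ≢ z
      m∈                         : m ≡ x ⊎ m ≡ y ⊎ m ≡ z
      mx                         : KLe C (W m) (W x)
      my                         : KLe C (W m) (W y)
      mz                         : KLe C (W m) (W z)
      uP                         : Upd par p 0 par₁
      upar                       : Upd₃ par₁ x p y p z p par′
      upos                       : Upd₃ pos x (4 * p + 0) y (4 * p + 1) z (4 * p + 2) pos′
      ucont                      : Upd₃ cont (4 * p + 0) x (4 * p + 1) y (4 * p + 2) z cont′
      uN                         : Upd win p m win′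
      uW                         : Upd W p (W m) W′
      uT                         : Upd Tp (W m) p T′
      uH                         : Upd ht p (suc h) ht′

    open Tree t
    open Upd uP renaming (at to par₁-at; off to par₁-off)
    open Upd uN renaming (at to win-at; off to win-off)
    open Upd uW renaming (at to W-at; off to W-off)
    open Upd uT renaming (at to T-at; off to T-off)
    open Upd uH renaming (at to h-at; off to h-off)

    ≢p : ∀ {v} → W v ≢ 0 → v ≢ p
    ≢p l refl = l wp
    data Is (v : ℕ) : Set where
      isp : v ≡ p → Is v
      isx : v ≡ x ⊎ v ≡ y ⊎ v ≡ z → Is v
      iso : v ≢ p → v ≢ x → v ≢ y → v ≢ z → Is v
    is : ∀ v → Is v
    is v with v ≟ p | v ≟ x | v ≟ y | v ≟ z
    ... | yes e | _ | _ | _ = isp e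
    ... | no _ | yes e | _ | _ = isx (inj₁ e)
    ... | no _ | no _ | yes e | _ = isx (inj₂ (inj₁ e))
    ... | no _ | no _ | no _ | yes e = isx (inj₂ (inj₂ e))
    ... | no a | no b | no c | no d = iso a b c d
    lch : ∀ {v} → v ≡ x ⊎ v ≡ y ⊎ v ≡ z → W v ≢ 0 × par v ≡ 0 × ht v ≡ h × par′ v ≡ p × KLe C (W m) (W v)
    lch (inj₁ refl) = lx , px , hx , Upd₃.at₁ upar , mx
    lch (inj₂ (inj₁ refl)) = ly , py , hy , Upd₃.at₂ upar , my
    lch (inj₂ (inj₂ refl)) = lz , pz , hz , Upd₃.at₃ upar , mz
    lm : W m ≢ 0
    lm = proj₁ (lch m∈)
    slot : ∀ {v} → v ≡ x ⊎ v ≡ y ⊎ v ≡ z → (∃[ j ] (j < 3 × pos′ v ≡ 4 * p + j)) × cont′ (pos′ v) ≡ v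
    slot (inj₁ refl) = (0 , s≤s z≤n , Upd₃.at₁ upos) , trans (cong cont′ (Upd₃.at₁ upos)) (Upd₃.at₁ ucont)
    slot (inj₂ (inj₁ refl)) =
      (1 , s≤s (s≤s z≤n) , Upd₃.at₂ upos) , trans (cong cont′ (Upd₃.at₂ upos)) (Upd₃.at₂ ucont)
    slot (inj₂ (inj₂ refl)) =
      (2 , s≤s (s≤s (s≤s z≤n)) , Upd₃.at₃ upos) , trans (cong cont′ (Upd₃.at₃ upos)) (Upd₃.at₃ ucont)
    par-p : par′ p ≡ 0
    par-p = trans (Upd₃.off upar (≢p lx ∘ sym) (≢p ly ∘ sym) (≢p lz ∘ sym)) par₁-at
    par-o : ∀ {v} → v ≢ p → v ≢ x → v ≢ y → v ≢ z → par′ v ≡ par v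
    par-o a b c d = trans (Upd₃.off upar b c d) (par₁-off a)
    par-nz : ∀ {v} → v ≢ p → par v ≢ 0 → par′ v ≡ par v
    par-nz a n = par-o a (λ { refl → n px }) (λ { refl → n py }) (λ { refl → n pz })
    pos-nz : ∀ {v} → par v ≢ 0 → pos′ v ≡ pos v
    pos-nz n = Upd₃.off upos (λ { refl → n px }) (λ { refl → n py }) (λ { refl → n pz })
    par≢p : ∀ {v} → W v ≢ 0 → par v ≢ p
    par≢p {v} l e with par v ≟ 0
    ... | yes q = p≢0 (trans (sym e) q)
    ... | no n = ≢p (par-live l n) e
    cont-o : ∀ {q} j → j < 3 → q ≢ p → cont′ (4 * q + j) ≡ cont (4 * q + j)
    cont-o j j<3 q≢p = Upd₃.off ucont
      (q≢p ∘ slot-injˡ (m≤n⇒m≤1+n j<3) (s≤s z≤n))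
      (q≢p ∘ slot-injˡ (m≤n⇒m≤1+n j<3) (s≤s (s≤s z≤n)))
      (q≢p ∘ slot-injˡ (m≤n⇒m≤1+n j<3) (s≤s (s≤s (s≤s z≤n))))
    fw : ∀ {v} → W v ≢ 0 → W′ v ≢ 0
    fw l e = l (trans (sym (W-off (≢p l))) e)
    bk : ∀ {v} → v ≢ p → W′ v ≢ 0 → W v ≢ 0
    bk n l e = l (trans (W-off n) e)
    lp′ : W′ p ≢ 0
    lp′ e = live≢0 (proj₁ (lf lm)) (trans (sym W-at) e)
    chl′ : ∀ {q i} j → W′ q ≢ 0 → ht′ q ≡ suc i → j < 3 →
          let v = cont′ (4 * q + j) in
          W′ v ≢ 0 × par′ v ≡ q × pos′ v ≡ 4 * q + j × ht′ v ≡ i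
    chl′ {q} j lq hq j<3 with q ≟ p
    chl′ {q} {i} j lq hq j<3 | yes refl = go j j<3
      where
      h≡i : h ≡ i
      h≡i = suc-injective (trans (sym h-at) hq)
      go : ∀ j → j < 3 → let v = cont′ (4 * p + j) in
          W′ v ≢ 0 × par′ v ≡ p × pos′ v ≡ 4 * p + j × ht′ v ≡ i
      go 0 _ rewrite Upd₃.at₁ ucont =
        fw lx , Upd₃.at₁ upar , Upd₃.at₁ upos , trans (h-off (≢p lx)) (trans hx h≡i)
      go 1 _ rewrite Upd₃.at₂ ucont =
        fw ly , Upd₃.at₂ upar , Upd₃.at₂ upos , trans (h-off (≢p ly)) (trans hy h≡i)
      go 2 _ rewrite Upd₃.at₃ ucont =
        fw lz , Upd₃.at₃ upar , Upd₃.at₃ upos , trans (h-off (≢p lz)) (trans hz h≡i)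
      go (suc (suc (suc _))) (s≤s (s≤s (s≤s ())))
    chl′ {q} j lq hq j<3 | no n rewrite cont-o j j<3 n
      with chl j (bk n lq) (trans (sym (h-off n)) hq) j<3
    ... | l , e , s , i = fw l , trans (par-nz (≢p l) nz) e , trans (pos-nz nz) s , trans (h-off (≢p l)) i
      where
      nz : par (cont (4 * q + j)) ≢ 0
      nz k = live≢0 (bk n lq) (trans (sym e) k)
    prn′ : ∀ {v} → W′ v ≢ 0 → par′ v ≢ 0 →
          W′ (par′ v) ≢ 0 × ht′ (par′ v) ≡ suc (ht′ v) ×
          (∃[ j ] (j < 3 × pos′ v ≡ 4 * par′ v + j)) × cont′ (pos′ v) ≡ v
    prn′ {v} lv pv with is v
    ... | isp refl = ⊥-elim (pv par-p)
    ... | isx v∈ with lch v∈ | slot v∈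
    ... | l , _ , e , q , _ | sl rewrite q | h-off (≢p l) = lp′ , trans h-at (cong suc (sym e)) , sl
    prn′ {v} lv pv | iso a b c d rewrite par-o a b c d | pos-nz pv | h-off a with prn (bk a lv) pv
    ... | l , e , (j , j<3 , s) , k = fw l , trans (h-off (≢p l)) e , (j , j<3 , s) ,
          trans (trans (cong cont′ s) (trans (cont-o j j<3 (≢p l)) (cong cont (sym s)))) k
    win-ok′ : ∀ {q i} → W′ q ≢ 0 → ht′ q ≡ suc i →
             W′ (win′ q) ≢ 0 × par′ (win′ q) ≡ q × W′ q ≡ W′ (win′ q)
    win-ok′ {q} lq hq with q ≟ p
    ... | yes refl rewrite win-at | W-at | W-off (≢p lm) = lm , proj₁ (proj₂ (proj₂ (proj₂ (lch m∈)))) , refl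
    ... | no n rewrite win-off n with win-ok (bk n lq) (trans (sym (h-off n)) hq)
    ... | l , e , w = fw l , trans (par-nz (≢p l) (λ k → live≢0 (bk n lq) (trans (sym e) k))) e ,
                      trans (W-off n) (trans w (sym (W-off (≢p l))))
    lfW′ : ∀ {v} → W′ v ≢ 0 → ht′ v ≡ 0 → W′ v ≡ v
    lfW′ {v} lv hv with v ≟ p
    ... | yes refl = ⊥-elim (1+n≢0 (trans (sym h-at) hv))
    ... | no n = trans (W-off n) (lfW (bk n lv) (trans (sym (h-off n)) hv))
    lf′ : ∀ {v} → W′ v ≢ 0 → W′ (W′ v) ≢ 0 × ht′ (W′ v) ≡ 0
    lf′ {v} lv with v ≟ p
    ... | yes refl rewrite W-at with lf lm
    ... | l , e = fw l , trans (h-off (≢p l)) e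
    lf′ {v} lv | no n rewrite W-off n with lf lv
    ... | l , e = fw l , trans (h-off (≢p l)) e
    key′ : ∀ {v} → W′ v ≢ 0 → ht′ v ≡ 0 → ∃[ k ] (C v ≡ just k)
    key′ {v} lv hv with v ≟ p
    ... | yes refl = ⊥-elim (1+n≢0 (trans (sym h-at) hv))
    ... | no n = key (bk n lv) (trans (sym (h-off n)) hv)
    dirty′ : ∀ {v} → D v → W′ v ≢ 0 × par′ v ≢ 0 × win′ (par′ v) ≢ v
    dirty′ d with dirty d
    ... | l , n , w rewrite par-nz (≢p l) n = fw l , n , λ e → w (trans (sym (win-off (par≢p l))) e)
    ord′ : ∀ {v} → W′ v ≢ 0 → par′ v ≢ 0 → D v ⊎ KLe C (W′ (par′ v)) (W′ v)
    ord′ {v} lv pv with is v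
    ... | isp refl = ⊥-elim (pv par-p)
    ... | isx v∈ with lch v∈
    ... | l , _ , e , q , k rewrite q | W-at | W-off (≢p l) = inj₂ k
    ord′ {v} lv pv | iso a b c d with bk a lv
    ... | l rewrite par-o a b c d | W-off (par≢p l) | W-off a = ord l pv
    T-o : ∀ {v} → v ≢ m → Tp (W v) ≡ v → T′ (W v) ≡ v
    T-o n e = trans (T-off (λ q → n (trans (sym e) (trans (cong Tp q) (top lm (inj₁ (proj₁ (proj₂ (lch m∈))))))))) e
    top′ : ∀ {v} → W′ v ≢ 0 → Top par′ win′ v → T′ (W′ v) ≡ v
    top′ {v} lv tv with is v
    ... | isp refl rewrite W-at = T-at
    ... | isx v∈ with lch v∈
    ... | l , r , _ , q , _ rewrite W-off (≢p l) = T-o (λ { refl → case tv of λ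
            { (inj₁ k) → p≢0 (trans (sym q) k) ; (inj₂ k) → k (trans (cong win′ q) win-at) } }) (top l (inj₁ r))
    top′ {v} lv tv | iso a b c d with bk a lv
    ... | l rewrite par-o a b c d | W-off a = T-o (λ { refl → case m∈ of λ
            { (inj₁ k) → b k ; (inj₂ (inj₁ k)) → c k ; (inj₂ (inj₂ k)) → d k } })
            (top l (case tv of λ { (inj₁ k) → inj₁ k ; (inj₂ k) → inj₂ (k ∘ trans (win-off (par≢p l))) }))
    top-ok′ : ∀ {b} → W′ b ≢ 0 → ht′ b ≡ 0 → W′ (T′ b) ≢ 0 × W′ (T′ b) ≡ b × Top par′ win′ (T′ b)
    top-ok′ {b} lb hb with b ≟ W m
    ... | yes refl rewrite T-at = lp′ , W-at , inj₁ par-p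
    ... | no b≢m rewrite T-off b≢m with b ≟ p
    ... | yes refl = ⊥-elim (1+n≢0 (trans (sym h-at) hb))
    ... | no n with top-ok (bk n lb) (trans (sym (h-off n)) hb)
    ... | l , e , tb = fw l , trans (W-off (≢p l)) e , tb′
      where
      tb′ : Top par′ win′ (Tp b)
      tb′ with is (Tp b)
      ... | isp q = ⊥-elim (≢p l q)
      ... | isx v∈ = inj₂ (λ k → b≢m (trans (sym e) (cong W (trans (sym k)
              (trans (cong win′ (proj₁ (proj₂ (proj₂ (proj₂ (lch v∈)))))) win-at)))))
      ... | iso a′ b′ c′ d′ rewrite par-o a′ b′ c′ d′ = case tb of λ
              { (inj₁ k) → inj₁ k ; (inj₂ k) → inj₂ (k ∘ trans (sym (win-off (par≢p l)))) }

    tree′ : Tree par′ pos′ cont′ win′ W′ T′ ht′ C D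
    tree′ = record
      { chl = chl′ ; prn = prn′ ; win-ok = win-ok′ ; lfW = lfW′ ; lf = lf′ ; key = key′
      ; dirty = dirty′ ; ord = ord′ ; top = top′ ; top-ok = top-ok′
      ; null = trans (W-off (p≢0 ∘ sym)) null }

-- Arithmetic identities for the size and counting arguments.

swap-outer : ∀ a b c → a + b + c ≡ c + b + a
swap-outer = solve 3 (λ a b c →
  a :+ b :+ c := c :+ b :+ a) refl

swap-left : ∀ a b d → a + (b + d) ≡ b + a + d
swap-left = solve 3 (λ a b d →
  a :+ (b :+ d) := b :+ a :+ d) refl

square-suc : ∀ a → suc (a * a + (a + a)) ≡ suc a * suc a
square-suc = solve 1 (λ a →
  con 1 :+ (a :* a :+ (a :+ a)) := (con 1 :+ a) :* (con 1 :+ a)) refl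

square-step : ∀ k → suc (3 + k) * suc (3 + k) + (k * k + 4 * k + 2) ≡ 2 * (suc (2 + k) * suc (2 + k))
square-step = solve 1 (λ k →
  (con 1 :+ (con 3 :+ k)) :* (con 1 :+ (con 3 :+ k)) :+ (k :* k :+ con 4 :* k :+ con 2) := con 2 :* ((con 1 :+ (con 2 :+ k)) :* (con 1 :+ (con 2 :+ k)))) refl

double-double : ∀ x → 2 * (4 * x) ≡ 4 * (2 * x)
double-double = solve 1 (λ x →
  con 2 :* (con 4 :* x) := con 4 :* (con 2 :* x)) refl

cap-split : ∀ m → 16 * suc (220 * suc m) + (80 * m + 64) ≡ 3600 * suc m
cap-split = solve 1 (λ m →
  con 16 :* (con 1 :+ con 220 :* (con 1 :+ m)) :+ (con 80 :* m :+ con 64) := con 3600 :* (con 1 :+ m)) refl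

square-sum : ∀ s → (7 * s) * (7 * s) + 6 * (s * s) ≡ 55 * (s * s)
square-sum = solve 1 (λ s →
  con 7 :* s :* (con 7 :* s) :+ con 6 :* (s :* s) := con 55 :* (s :* s)) refl

six-suc : ∀ m → 2 * (3 * m) + 6 ≡ 6 * suc m
six-suc = solve 1 (λ m →
  con 2 :* (con 3 :* m) :+ con 6 := con 6 :* (con 1 :+ m)) refl

two-suc : ∀ β → 1 + 2 * suc β ≡ 2 + (2 * β + 1)
two-suc = solve 1 (λ β →
  con 1 :+ con 2 :* (con 1 :+ β) := con 2 :+ (con 2 :* β :+ con 1)) refl

three-suc : ∀ m → 3 * m + 1 + 2 ≡ 3 * suc m
three-suc = solve 1 (λ m →
  con 3 :* m :+ con 1 :+ con 2 := con 3 :* (con 1 :+ m)) refl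

six-fold : ∀ s → s + s + 4 * s ≡ 6 * s
six-fold = solve 1 (λ s →
  s :+ s :+ con 4 :* s := con 6 :* s) refl

six-fold′ : ∀ s → s + 2 * s + 3 * s ≡ 6 * s
six-fold′ = solve 1 (λ s →
  s :+ con 2 :* s :+ con 3 :* s := con 6 :* s) refl

shift-two : ∀ r k → suc (suc r) + 2 * k ≡ r + 2 * suc k
shift-two = solve 2 (λ r k →
  con 1 :+ (con 1 :+ r) :+ con 2 :* k := r :+ con 2 :* (con 1 :+ k)) refl

distrib-scale : ∀ j a b s → j * s * a + b * s ≡ (j * a + b) * s
distrib-scale = solve 4 (λ j a b s →
  j :* s :* a :+ b :* s := (j :* a :+ b) :* s) refl

thrice : ∀ a b → a + (a + (a + b)) ≡ 3 * a + b
thrice = solve 2 (λ a b →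
  a :+ (a :+ (a :+ b)) := con 3 :* a :+ b) refl

3+ : ∀ n r → 3 * n + suc (suc (suc r)) ≡ 3 * suc n + r
3+ = solve 2 (λ n r →
  con 3 :* n :+ (con 1 :+ (con 1 :+ (con 1 :+ r))) := con 3 :* (con 1 :+ n) :+ r) refl

3+0 : ∀ n → suc (2 + (3 * n + 0)) ≡ 3 * suc n
3+0 = solve 1 (λ n →
  con 1 :+ (con 2 :+ (con 3 :* n :+ con 0)) := con 3 :* (con 1 :+ n)) refl

2*+1* : ∀ n → 2 * n + n ≡ 3 * n
2*+1* = solve 1 (λ n →
  con 2 :* n :+ n := con 3 :* n) refl

2*suc′ : ∀ β → 2 * suc β ≡ suc (2 * β + 1)
2*suc′ = solve 1 (λ β →
  con 2 :* (con 1 :+ β) := con 1 :+ (con 2 :* β :+ con 1)) refl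

regroup₁ : ∀ b u f r → 2 * b + u + (2 * f + r) ≡ 2 * (b + f) + u + r
regroup₁ = solve 4 (λ b u f r →
  con 2 :* b :+ u :+ (con 2 :* f :+ r) := con 2 :* (b :+ f) :+ u :+ r) refl

regroup₂ : ∀ b f u r → 2 * suc (b + f) + u + r ≡ 2 * b + r + (2 + u + 2 * f)
regroup₂ = solve 4 (λ b f u r →
  con 2 :* (con 1 :+ (b :+ f)) :+ u :+ r := con 2 :* b :+ r :+ (con 2 :+ u :+ con 2 :* f)) refl

regroup₃ : ∀ n f u g → n + 2 * f + (2 + u + 2 * g) ≡ n + suc (suc u) + (2 * g + 2 * f)
regroup₃ = solve 4 (λ n f u g →
  n :+ con 2 :* f :+ (con 2 :+ u :+ con 2 :* g) := n :+ (con 1 :+ (con 1 :+ u)) :+ (con 2 :* g :+ con 2 :* f)) refl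

regroup₄ : ∀ n r g f → n + r + (2 * g + 2 * f) ≡ n + 2 * g + (2 * f + r)
regroup₄ = solve 4 (λ n r g f →
  n :+ r :+ (con 2 :* g :+ con 2 :* f) := n :+ con 2 :* g :+ (con 2 :* f :+ r)) refl

2*+2 : ∀ b u → 2 * b + (2 + u) ≡ 2 * b + u + 2
2*+2 = solve 2 (λ b u →
  con 2 :* b :+ (con 2 :+ u) := con 2 :* b :+ u :+ con 2) refl

2*suc : ∀ n f → n + 2 * f + 2 ≡ n + 2 * suc f
2*suc = solve 2 (λ n f →
  n :+ con 2 :* f :+ con 2 := n :+ con 2 :* (con 1 :+ f)) refl

3*suc : ∀ n f → 3 * suc n + 2 * f ≡ suc (3 * n + 2 * suc f)
3*suc = solve 2 (λ n f →
  con 3 :* (con 1 :+ n) :+ con 2 :* f := con 1 :+ (con 3 :* n :+ con 2 :* (con 1 :+ f))) refl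

-- Finite sums and the pigeonhole bound.

sumTo : ℕ → (ℕ → ℕ) → ℕ
sumTo zero    f = 0
sumTo (suc n) f = f n + sumTo n f

sumTo-cong : ∀ n {f g} → (∀ {r} → r < n → f r ≡ g r) → sumTo n f ≡ sumTo n g
sumTo-cong zero    e = refl
sumTo-cong (suc n) e = cong₂ _+_ (e ≤-refl) (sumTo-cong n (e ∘ m≤n⇒m≤1+n))

sumTo-mono : ∀ n {f g} → (∀ {r} → r < n → f r ≤ g r) → sumTo n f ≤ sumTo n g
sumTo-mono zero    e = z≤n
sumTo-mono (suc n) e = +-mono-≤ (e ≤-refl) (sumTo-mono n (e ∘ m≤n⇒m≤1+n))

sumTo-term : ∀ {n r} f → r < n → f r ≤ sumTo n f
sumTo-term {suc n} {r} f r<n with r ≟ n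
... | yes refl = m≤m+n _ _
... | no r≢n = ≤-trans (sumTo-term f (≤∧≢⇒< (s≤s⁻¹ r<n) r≢n)) (m≤n+m _ (f n))

-- The old and the new term are added on opposite sides, which avoids truncated subtraction.
sumTo-upd : ∀ n {r f g} → r < n → (∀ {j} → j ≢ r → g j ≡ f j) →
            sumTo n g + f r ≡ sumTo n f + g r
sumTo-upd (suc n) {r} {f} {g} r<n off with r ≟ n
... | yes refl = begin
  g r + sumTo r g + f r  ≡⟨ cong (λ s → g r + s + f r) (sumTo-cong r (off ∘ <⇒≢)) ⟩
  g r + sumTo r f + f r  ≡⟨ swap-outer (g r) (sumTo r f) (f r) ⟩
  f r + sumTo r f + g r  ∎
  where
  open ≡-Reasoning
... | no r≢n = begin
  g n + sumTo n g + f r    ≡⟨ +-assoc (g n) _ _ ⟩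
  g n + (sumTo n g + f r)  ≡⟨ cong₂ _+_ (off (r≢n ∘ sym)) (sumTo-upd n (≤∧≢⇒< (s≤s⁻¹ r<n) r≢n) off) ⟩
  f n + (sumTo n f + g r)  ≡⟨ +-assoc (f n) _ _ ⟨
  f n + sumTo n f + g r    ∎
  where open ≡-Reasoning

sumTo-cut : ∀ {k n} f → k ≤ n → (∀ {r} → k ≤ r → r < n → f r ≡ 0) → sumTo n f ≡ sumTo k f
sumTo-cut {k} {zero} f z≤n z = refl
sumTo-cut {k} {suc n} f k≤n z with k ≟ suc n
... | yes refl = refl
... | no k≢ with ≤∧≢⇒< k≤n k≢
... | s≤s k≤ = trans (cong (_+ sumTo n f) (z k≤ ≤-refl)) (sumTo-cut f k≤ (λ p q → z p (m≤n⇒m≤1+n q)))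

sumTo-bound : ∀ n f b → (∀ {r} → r < n → f r ≤ b) → sumTo n f ≤ n * b
sumTo-bound zero    f b h = z≤n
sumTo-bound (suc n) f b h = +-mono-≤ (h ≤-refl) (sumTo-bound n f b (h ∘ m≤n⇒m≤1+n))

-- Only the heights up to l can be occupied.
sumTo-pigeon : ∀ {n l} f b → (∀ {r} → r < n → f r ≤ b) → (∀ {r} → f r ≢ 0 → r ≤ l) →
               sumTo n f ≤ b * suc l
sumTo-pigeon {n} {l} f b h z with ≤-total n (suc l)
... | inj₁ n≤ = ≤-trans (sumTo-bound n f b h)
  (≤-trans (*-monoˡ-≤ b n≤) (≤-reflexive (*-comm (suc l) b)))
... | inj₂ l<n = begin
  sumTo n f        ≡⟨ sumTo-cut f l<n zero′ ⟩
  sumTo (suc l) f  ≤⟨ sumTo-bound (suc l) f b (λ p → h (<-≤-trans p l<n)) ⟩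
  suc l * b        ≡⟨ *-comm (suc l) b ⟩
  b * suc l        ∎
  where
  open ≤-Reasoning
  zero′ : ∀ {r} → suc l ≤ r → r < n → f r ≡ 0
  zero′ {r} l<r _ with f r ≟ 0
  ... | yes e = e
  ... | no ne = ⊥-elim (<⇒≱ l<r (z ne))

-- The mask of the buckets holding at least t nodes.

bit : ℕ → (ℕ → ℕ) → ℕ → ℕ
bit t c r = if t ≤ᵇ c r then 2 ^ r else 0

mask : ℕ → ℕ → (ℕ → ℕ) → ℕ
mask w t c = sumTo w (bit t c)

bit-1 : ∀ {t c r} → t ≤ c r → bit t c r ≡ 2 ^ r
bit-1 {t} {c} {r} le with t ≤ᵇ c r in eq
... | true  = refl
... | false = ⊥-elim (subst T eq (≤⇒≤ᵇ le))

bit-0 : ∀ {t c r} → c r < t → bit t c r ≡ 0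
bit-0 {t} {c} {r} lt with t ≤ᵇ c r in eq
... | false = refl
... | true  = ⊥-elim (<⇒≱ lt (≤ᵇ⇒≤ t (c r) (subst T (sym eq) tt)))

bit-≤ : ∀ t c r → bit t c r ≤ 2 ^ r
bit-≤ t c r with t ≤ᵇ c r
... | true  = ≤-refl
... | false = z≤n

0<2^ : ∀ n → 0 < 2 ^ n
0<2^ n = m^n>0 2 n

2^suc : ∀ n → 2 ^ suc n ≡ 2 ^ n + 2 ^ n
2^suc n = cong (2 ^ n +_) (+-identityʳ (2 ^ n))

mask-< : ∀ w t c → mask w t c < 2 ^ w
mask-< zero    t c = s≤s z≤n
mask-< (suc w) t c = begin-strict
  bit t c w + mask w t c  <⟨ +-mono-≤-< (bit-≤ t c w) (mask-< w t c) ⟩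
  2 ^ w + 2 ^ w           ≡⟨ 2^suc w ⟨
  2 ^ suc w               ∎
  where open ≤-Reasoning

mask-cut : ∀ {k w t c} → (∀ {r} → k ≤ r → r < w → c r < t) → mask w t c < 2 ^ k
mask-cut {k} {w} {t} {c} z with ≤-total w k
... | inj₁ w≤k = <-≤-trans (mask-< w t c) (^-monoʳ-≤ 2 w≤k)
... | inj₂ k≤w = subst (_< 2 ^ k) (sym (sumTo-cut (bit t c) k≤w (λ p q → bit-0 {t} {c} (z p q)))) (mask-< k t c)

-- A bit above `l` would by itself push the mask to `2 ^ suc l`; and without bit `l` the remaining
-- distinct powers sum to less than `2 ^ l`. So the logarithm of the mask is the highest overfull
-- bucket.
mask-top : ∀ {l w t c} → 2 ^ l ≤ mask w t c → mask w t c < 2 ^ suc l →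
           l < w × t ≤ c l × (∀ {r} → l < r → r < w → c r < t)
mask-top {l} {w} {t} {c} lo hi = l<w , t≤ , above
  where
  l<w : l < w
  l<w = ≰⇒> λ w≤l → <⇒≱ (<-≤-trans (mask-< w t c) (^-monoʳ-≤ 2 w≤l)) lo
  above : ∀ {r} → l < r → r < w → c r < t
  above {r} l<r r<w = ≰⇒> λ t≤ → <⇒≱ hi (≤-trans (^-monoʳ-≤ 2 l<r)
    (≤-trans (≤-reflexive (sym (bit-1 {t} {c} t≤))) (sumTo-term (bit t c) r<w)))
  t≤ : t ≤ c l
  t≤ = ≮⇒≥ λ lt → <⇒≱ (mask-cut {l} {w} {t} {c} λ { {r} l≤r r<w → case r ≟ l of λ
         { (yes refl) → lt ; (no n) → above (≤∧≢⇒< l≤r (n ∘ sym)) r<w } }) lo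

mask-0 : ∀ {w t c r} → mask w t c ≡ 0 → r < w → c r < t
mask-0 {w} {t} {c} {r} e r<w = ≰⇒> λ t≤ → <⇒≱ (0<2^ r)
  (≤-trans (≤-reflexive (sym (bit-1 {t} {c} t≤))) (≤-trans (sumTo-term (bit t c) r<w) (≤-reflexive e)))

module _ {w t : ℕ} {c c′ : ℕ → ℕ} {r : ℕ} (r<w : r < w) where

  private
    off : Upd c r (c′ r) c′ → ∀ {j} → j ≢ r → bit t c′ j ≡ bit t c j
    off (mkUpd _ o) {j} n = cong (λ x → if t ≤ᵇ x then 2 ^ j else 0) (o n)

    step : Upd c r (c′ r) c′ → mask w t c′ + bit t c r ≡ mask w t c + bit t c′ r
    step u = sumTo-upd w r<w (off u)

  mask-same : Upd c r (c′ r) c′ → bit t c r ≡ bit t c′ r → mask w t c′ ≡ mask w t c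
  mask-same u e = +-cancelʳ-≡ (bit t c r) _ _ (trans (step u) (cong (mask w t c +_) (sym e)))

  -- The bit of a bucket flips only when its size crosses the threshold, so the program needs no
  -- more than an equality test on the size and one addition.
  mask-insert-≡ : Upd c r (suc (c r)) c′ → suc (c r) ≡ t → mask w t c′ ≡ mask w t c + 2 ^ r
  mask-insert-≡ (mkUpd at o) e = begin
    mask w t c′               ≡⟨ +-identityʳ _ ⟨
    mask w t c′ + 0           ≡⟨ cong (mask w t c′ +_) (bit-0 {t} {c} (≤-reflexive e)) ⟨
    mask w t c′ + bit t c r   ≡⟨ step (mkUpd refl o) ⟩
    mask w t c + bit t c′ r   ≡⟨ cong (mask w t c +_) (bit-1 {t} {c′} (≤-reflexive (sym (trans at e)))) ⟩
    mask w t c + 2 ^ r        ∎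
    where open ≡-Reasoning

  mask-insert-≢ : Upd c r (suc (c r)) c′ → suc (c r) ≢ t → mask w t c′ ≡ mask w t c
  mask-insert-≢ (mkUpd at o) n = mask-same (mkUpd refl o) (case <-cmp (c r) t of λ
    { (tri< lt _ _) → trans (bit-0 {t} {c} lt) (sym (bit-0 {t} {c′} (subst (_< t) (sym at) (≤∧≢⇒< lt n))))
    ; (tri≈ _ refl _) → trans (bit-1 {t} {c} ≤-refl) (sym (bit-1 {t} {c′} (subst (t ≤_) (sym at) (n≤1+n t))))
    ; (tri> _ _ gt) → trans (bit-1 {t} {c} (<⇒≤ gt))
                            (sym (bit-1 {t} {c′} (subst (t ≤_) (sym at) (m≤n⇒m≤1+n (<⇒≤ gt))))) })

-- A removal is an insertion read backwards.
mask-remove-≡ : ∀ {w t c c′ r} → r < w → Upd c r (c r ∸ 1) c′ → c r ≢ 0 → c r ≡ t →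
                mask w t c′ ≡ mask w t c ∸ 2 ^ r
mask-remove-≡ {w} {t} {c} {c′} {r} r<w (mkUpd at o) n e =
  trans (sym (m+n∸n≡m _ (2 ^ r))) (cong (_∸ 2 ^ r)
    (sym (mask-insert-≡ {c = c′} {c} r<w (mkUpd (sym s) (λ k → sym (o k))) (trans s e))))
  where
  s : suc (c′ r) ≡ c r
  s = trans (cong suc at) (m+[n∸m]≡n (n≢0⇒n>0 n))

mask-remove-≢ : ∀ {w t c c′ r} → r < w → Upd c r (c r ∸ 1) c′ → c r ≢ 0 → c r ≢ t →
                mask w t c′ ≡ mask w t c
mask-remove-≢ {w} {t} {c} {c′} {r} r<w (mkUpd at o) n e =
  sym (mask-insert-≢ {c = c′} {c} r<w (mkUpd (sym s) (λ k → sym (o k))) (e ∘ trans (sym s)))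
  where
  s : suc (c′ r) ≡ c r
  s = trans (cong suc at) (m+[n∸m]≡n (n≢0⇒n>0 n))

module _ {w c c′ r} (g : ℕ → ℕ) (r<w : r < w) (u : Upd c r (suc (c r)) c′) where

  -- Used with powers of three for `g`, where the sum counts the leaves below all roots.
  weigh-insert : sumTo w (λ j → c′ j * g j) ≡ g r + sumTo w (λ j → c j * g j)
  weigh-insert = +-cancelʳ-≡ (c r * g r) _ _ (begin
    sumTo w f′ + c r * g r          ≡⟨ sumTo-upd w r<w (λ n → cong (_* g _) (Upd.off u n)) ⟩
    sumTo w f + c′ r * g r          ≡⟨ cong (λ x → sumTo w f + x * g r) (Upd.at u) ⟩
    sumTo w f + (g r + c r * g r)   ≡⟨ swap-left (sumTo w f) (g r) (c r * g r) ⟩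
    g r + sumTo w f + c r * g r     ∎)
    where
    open ≡-Reasoning
    f f′ : ℕ → ℕ
    f j = c j * g j
    f′ j = c′ j * g j

  count-insert : sumTo w c′ ≡ suc (sumTo w c)
  count-insert = +-cancelʳ-≡ (c r) _ _
    (trans (sumTo-upd w r<w (Upd.off u)) (trans (cong (sumTo w c +_) (Upd.at u)) (+-suc _ _)))

-- Buckets: the i-th member (counted from 1) of bucket r is stored at pair r i.

pair : ℕ → ℕ → ℕ
pair r i = (r + i) * (r + i) + i

pair-< : ∀ {a b i j} → i ≤ a → a < b → a * a + i < b * b + j
pair-< {a} {b} {i} {j} i≤a a<b = begin-strict
  a * a + i       ≤⟨ +-monoʳ-≤ (a * a) i≤a ⟩
  a * a + a       <⟨ n<1+n _ ⟩
  suc (a * a + a) ≤⟨ s≤s (+-monoʳ-≤ (a * a) (m≤n+m a a)) ⟩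
  suc (a * a + (a + a)) ≡⟨ square-suc a ⟩
  suc a * suc a   ≤⟨ *-mono-≤ a<b a<b ⟩
  b * b           ≤⟨ m≤m+n _ j ⟩
  b * b + j       ∎
  where
  open ≤-Reasoning

-- With `a = r + i` one has `i ≤ a`, so `a * a + i` lies between consecutive squares and determines
-- `a`, then `i`, then `r`. The pairing grows only quadratically: heights and bucket sizes are
-- logarithmic, and their pairs must fit into linearly many records.
pair-inj : ∀ {r i s j} → pair r i ≡ pair s j → r ≡ s × i ≡ j
pair-inj {r} {i} {s} {j} e with <-cmp (r + i) (s + j)
... | tri< lt _ _ = ⊥-elim (<⇒≢ (pair-< (m≤n+m i r) lt) e)
... | tri> _ _ gt = ⊥-elim (<⇒≢ (pair-< (m≤n+m j s) gt) (sym e))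
... | tri≈ _ eq _ with +-cancelˡ-≡ ((s + j) * (s + j)) i j (subst (λ a → a * a + i ≡ pair s j) eq e)
... | refl = +-cancelʳ-≡ i r s eq , refl

-- Index 0 means that a node is in no bucket, which is why members are counted from 1. Entries and
-- indices point at each other so that a member can be removed from anywhere in constant time.
record Bucket (ht idx B c : ℕ → ℕ) : Set where
  field
    member : ∀ {x} → idx x ≢ 0 → idx x ≤ c (ht x) × B (pair (ht x) (idx x)) ≡ x
    entry  : ∀ {r i} → 1 ≤ i → i ≤ c r → idx (B (pair r i)) ≡ i × ht (B (pair r i)) ≡ r

  entry-in : ∀ {r i} → 1 ≤ i → i ≤ c r → idx (B (pair r i)) ≢ 0
  entry-in p q e = <⇒≢ p (sym (trans (sym (proj₁ (entry p q))) e))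

  count≢0 : ∀ {x} → idx x ≢ 0 → c (ht x) ≢ 0
  count≢0 n e = n (n≤0⇒n≡0 (subst (_ ≤_) e (proj₁ (member n))))

  nonempty : ∀ {r} → c r ≢ 0 → ∃[ x ] (idx x ≢ 0 × ht x ≡ r)
  nonempty n = _ , entry-in ≤-refl (n≢0⇒n>0 n) , proj₂ (entry ≤-refl (n≢0⇒n>0 n))

  -- Two different nodes in the same bucket.
  two : ∀ {x y} → idx x ≢ 0 → idx y ≢ 0 → ht x ≡ ht y → x ≢ y → 2 ≤ c (ht x)
  two {x} {y} ix iy h x≢y = ≰⇒> λ le → x≢y (begin
      x                          ≡⟨ proj₂ (member ix) ⟨
      B (pair (ht x) (idx x))    ≡⟨ cong₂ (λ a b → B (pair a b)) h (trans (one ix le) (sym (one iy (subst (λ k → c k ≤ 1) h le)))) ⟩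
      B (pair (ht y) (idx y))    ≡⟨ proj₂ (member iy) ⟩
      y                          ∎)
    where
    open ≡-Reasoning
    one : ∀ {z} → idx z ≢ 0 → c (ht z) ≤ 1 → idx z ≡ 1
    one iz le = ≤-antisym (≤-trans (proj₁ (member iz)) le) (n≢0⇒n>0 iz)

module _ {ht idx B c} (b : Bucket ht idx B c) where
  open Bucket b

  bucket-insert : ∀ {x B′ c′ idx′} → idx x ≡ 0 →
    Upd c (ht x) (suc (c (ht x))) c′ → Upd B (pair (ht x) (suc (c (ht x)))) x B′ →
    Upd idx x (suc (c (ht x))) idx′ → Bucket ht idx′ B′ c′
  bucket-insert {x} {B′} {c′} {idx′} ix (mkUpd c-at c-off) (mkUpd B-at B-off) (mkUpd i-at i-off) =
    record { member = member′ ; entry = entry′ }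
    where
    c≤ : ∀ r → c r ≤ c′ r
    c≤ r with r ≟ ht x
    ... | yes refl = subst (c r ≤_) (sym c-at) (n≤1+n _)
    ... | no n = ≤-reflexive (sym (c-off n))
    member′ : ∀ {z} → idx′ z ≢ 0 → idx′ z ≤ c′ (ht z) × B′ (pair (ht z) (idx′ z)) ≡ z
    member′ {z} iz with z ≟ x
    ... | yes refl rewrite i-at | c-at = ≤-refl , B-at
    ... | no n rewrite i-off n with member iz
    ... | p , q = ≤-trans p (c≤ _) , trans (B-off λ e → let e₁ , e₂ = pair-inj {ht z} {idx z} {ht x} {suc (c (ht x))} e in
                      <⇒≱ (subst (λ k → k < idx z) (cong c (sym e₁)) (≤-reflexive (sym e₂))) p) q
    entry′ : ∀ {r i} → 1 ≤ i → i ≤ c′ r → idx′ (B′ (pair r i)) ≡ i × ht (B′ (pair r i)) ≡ r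
    entry′ {r} {i} 1≤i i≤ with pair r i ≟ pair (ht x) (suc (c (ht x)))
    ... | yes e with pair-inj {r} {i} {ht x} {suc (c (ht x))} e
    ... | refl , refl rewrite B-at = i-at , refl
    entry′ {r} {i} 1≤i i≤ | no n rewrite B-off n with entry 1≤i i≤c
      where
      i≤c : i ≤ c r
      i≤c with r ≟ ht x
      ... | yes refl = s≤s⁻¹ (≤∧≢⇒< (subst (i ≤_) c-at i≤) (n ∘ cong (pair r)))
      ... | no m = subst (i ≤_) (c-off m) i≤
    ... | p , q = trans (i-off (λ e → <⇒≢ 1≤i (trans (sym ix) (trans (cong idx (sym e)) p)))) p , q

  -- The last member `y` fills the gap. The order of the two index writes matters: if `y` is `x`
  -- itself, the final 0 has to win. Another member may be renumbered, so only membership is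
  -- reported.
  bucket-remove : ∀ {x B′ c′ idx₁ idx′} → idx x ≢ 0 → let r = ht x; y = B (pair r (c r)) in
    Upd B (pair r (idx x)) y B′ → Upd idx y (idx x) idx₁ → Upd idx₁ x 0 idx′ →
    Upd c r (c r ∸ 1) c′ →
    Bucket ht idx′ B′ c′ × (∀ {z} → z ≢ x → idx z ≢ 0 → idx′ z ≢ 0) × (∀ {z} → idx′ z ≢ 0 → idx z ≢ 0 × z ≢ x)
  bucket-remove {x} {B′} {c′} {idx₁} {idx′} ix (mkUpd B-at B-off) (mkUpd y-at y-off) (mkUpd i-at i-off) (mkUpd c-at c-off) =
    record { member = λ {z} → member′ {z} ; entry = entry′ } , keep , only
    where
    r₀ y i₀ : ℕ
    r₀ = ht x
    y = B (pair r₀ (c r₀))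
    i₀ = idx x
    1≤c : 1 ≤ c r₀
    1≤c = n≢0⇒n>0 (count≢0 ix)
    iy : idx y ≡ c r₀
    iy = proj₁ (entry 1≤c ≤-refl)
    hy : ht y ≡ r₀
    hy = proj₂ (entry 1≤c ≤-refl)
    c′-suc : suc (c′ r₀) ≡ c r₀
    c′-suc = trans (cong suc c-at) (m+[n∸m]≡n 1≤c)
    idx-o : ∀ {z} → z ≢ x → z ≢ y → idx′ z ≡ idx z
    idx-o n m = trans (i-off n) (y-off m)
    keep : ∀ {z} → z ≢ x → idx z ≢ 0 → idx′ z ≢ 0
    keep {z} n iz with z ≟ y
    ... | yes refl = λ e → ix (trans (sym y-at) (trans (sym (i-off n)) e))
    ... | no m = λ e → iz (trans (sym (idx-o n m)) e)
    only : ∀ {z} → idx′ z ≢ 0 → idx z ≢ 0 × z ≢ x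
    only {z} iz with z ≟ x
    ... | yes refl = ⊥-elim (iz i-at)
    ... | no n with z ≟ y
    ... | yes refl = (λ e → <⇒≢ 1≤c (sym (trans (sym iy) e))) , n
    ... | no m = (λ e → iz (trans (idx-o n m) e)) , n
    member′ : ∀ {z} → idx′ z ≢ 0 → idx′ z ≤ c′ (ht z) × B′ (pair (ht z) (idx′ z)) ≡ z
    member′ {z} iz with only {z} iz
    ... | iz′ , n with z ≟ y
    ... | yes refl rewrite i-off n | y-at | hy = s≤s⁻¹ (subst (i₀ <_) (sym c′-suc) (≤∧≢⇒< (proj₁ (member ix)) i≢c)) , B-at
      where
      i≢c : i₀ ≢ c r₀
      i≢c e = n (trans (cong (λ k → B (pair r₀ k)) (sym e)) (proj₂ (member ix)))
    ... | no m rewrite idx-o n m with member iz′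
    ... | p , q = le , trans (B-off λ e → n (trans (sym q) (trans (cong B e) (proj₂ (member ix))))) q
      where
      le : idx z ≤ c′ (ht z)
      le with ht z ≟ r₀
      ... | no k = subst (idx z ≤_) (sym (c-off k)) p
      ... | yes k rewrite k = s≤s⁻¹ (subst (idx z <_) (sym c′-suc)
              (≤∧≢⇒< p λ e → m (trans (sym q) (cong (λ j → B (pair r₀ j)) e))))
    entry′ : ∀ {r i} → 1 ≤ i → i ≤ c′ r → idx′ (B′ (pair r i)) ≡ i × ht (B′ (pair r i)) ≡ r
    entry′ {r} {i} 1≤i i≤ with r ≟ r₀
    ... | no k rewrite B-off (k ∘ proj₁ ∘ pair-inj {r} {i} {r₀} {i₀}) with entry 1≤i (subst (i ≤_) (c-off k) i≤)
    ... | p , q = trans (idx-o (λ e → k (trans (sym q) (cong ht e))) (λ e → k (trans (sym q) (trans (cong ht e) hy)))) p , q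
    entry′ {r} {i} 1≤i i≤ | yes refl with i ≟ i₀
    ... | yes refl rewrite B-at = trans (i-off y≢x) y-at , hy
      where
      y≢x : y ≢ x
      y≢x e = <⇒≱ (subst (i₀ <_) c′-suc (s≤s i≤)) (≤-reflexive (trans (sym iy) (cong idx e)))
    ... | no k rewrite B-off (k ∘ proj₂ ∘ pair-inj {r} {i} {r₀} {i₀}) with entry 1≤i (≤-trans i≤ (≤-trans (n≤1+n _) (≤-reflexive c′-suc)))
    ... | p , q = trans (idx-o (λ e → k (trans (sym p) (cong idx e)))
            (λ e → <⇒≢ (subst (i <_) c′-suc (s≤s i≤)) (trans (sym p) (trans (cong idx e) iy)))) p , q

-- Logarithms

2≤⇒log≢0 : ∀ {n} → 2 ≤ n → 1 ≤ ⌊log₂ n ⌋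
2≤⇒log≢0 2≤n = ⌊log₂⌋-mono-≤ 2≤n

<2^log : ∀ n → n < 2 ^ suc ⌊log₂ n ⌋
<2^log n = ≰⇒> λ le → 1+n≰n (≤-trans (≤-reflexive (sym (⌊log₂[2^n]⌋≡n (suc ⌊log₂ n ⌋)))) (⌊log₂⌋-mono-≤ le))

2*⌊n/2⌋≤n : ∀ n → 2 * ⌊ n /2⌋ ≤ n
2*⌊n/2⌋≤n zero = z≤n
2*⌊n/2⌋≤n (suc zero) = z≤n
2*⌊n/2⌋≤n (suc (suc n)) = ≤-trans (≤-reflexive (*-suc 2 ⌊ n /2⌋)) (s≤s (s≤s (2*⌊n/2⌋≤n n)))

2^log≤ : ∀ n → n ≢ 0 → 2 ^ ⌊log₂ n ⌋ ≤ n
2^log≤ = <-rec _ λ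
  { zero rec n≢0 → ⊥-elim (n≢0 refl)
  ; (suc zero) rec _ → s≤s z≤n
  ; n@(suc (suc m)) rec _ → begin
      2 ^ ⌊log₂ n ⌋                 ≡⟨ cong (2 ^_) (m+[n∸m]≡n (2≤⇒log≢0 {n} (s≤s (s≤s z≤n)))) ⟨
      2 * 2 ^ (⌊log₂ n ⌋ ∸ 1)       ≡⟨ cong (λ k → 2 * 2 ^ k) (⌊log₂⌊n/2⌋⌋≡⌊log₂n⌋∸1 n) ⟨
      2 * 2 ^ ⌊log₂ ⌊ n /2⌋ ⌋       ≤⟨ *-monoʳ-≤ 2 (rec (⌊n/2⌋<n (suc m)) 1+n≢0) ⟩
      2 * ⌊ n /2⌋                   ≤⟨ 2*⌊n/2⌋≤n n ⟩
      n                             ∎ }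
  where open ≤-Reasoning

-- This and the even case are the two table entries that a new identifier `b` contributes.
log-2*+1 : ∀ b → b ≢ 0 → ⌊log₂ (2 * b + 1) ⌋ ≡ suc ⌊log₂ b ⌋
log-2*+1 b b≢0 = begin
  ⌊log₂ n ⌋                  ≡⟨ m+[n∸m]≡n (2≤⇒log≢0 2≤n) ⟨
  suc (⌊log₂ n ⌋ ∸ 1)        ≡⟨ cong suc (⌊log₂⌊n/2⌋⌋≡⌊log₂n⌋∸1 n) ⟨
  suc ⌊log₂ ⌊ n /2⌋ ⌋        ≡⟨ cong (λ k → suc ⌊log₂ k ⌋) (half b) ⟩
  suc ⌊log₂ b ⌋              ∎
  where
  open ≡-Reasoning
  n = 2 * b + 1
  2≤n : 2 ≤ n
  2≤n = ≤-trans (*-monoʳ-≤ 2 (n≢0⇒n>0 b≢0)) (m≤m+n _ 1)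
  half : ∀ b → ⌊ 2 * b + 1 /2⌋ ≡ b
  half zero = refl
  half (suc b) = trans (cong (λ k → ⌊ k + 1 /2⌋) (*-suc 2 b)) (cong suc (half b))

log-2* : ∀ b → b ≢ 0 → ⌊log₂ (2 * b) ⌋ ≡ suc ⌊log₂ b ⌋
log-2* zero n = ⊥-elim (n refl)
log-2* (suc b) _ = ⌊log₂[2*b]⌋≡1+⌊log₂b⌋ (suc b)

2^≤⇒≤log : ∀ {r n} → 2 ^ r ≤ n → r ≤ ⌊log₂ n ⌋
2^≤⇒≤log {r} le = ≤-trans (≤-reflexive (sym (⌊log₂[2^n]⌋≡n r))) (⌊log₂⌋-mono-≤ le)

2^≤3^ : ∀ r → 2 ^ r ≤ 3 ^ r
2^≤3^ r = ^-monoˡ-≤ r (s≤s (s≤s z≤n))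

-- Bounds the space of the buckets, quadratic in the logarithm, by a linear amount. From `3` on the
-- square less than doubles: `2 * (k + 3)²` exceeds `(k + 4)²` by `k * k + 4 * k + 2`.
square-≤ : ∀ l → suc l * suc l ≤ 4 * 2 ^ l
square-≤ zero = s≤s z≤n
square-≤ (suc zero) = s≤s (s≤s (s≤s (s≤s z≤n)))
square-≤ (suc (suc zero)) = m≤m+n 9 7
square-≤ (suc (suc (suc k))) = begin
  suc (3 + k) * suc (3 + k)                       ≤⟨ m≤m+n _ (k * k + 4 * k + 2) ⟩
  suc (3 + k) * suc (3 + k) + (k * k + 4 * k + 2) ≡⟨ square-step k ⟩
  2 * (suc (2 + k) * suc (2 + k))                 ≤⟨ *-monoʳ-≤ 2 (square-≤ (suc (suc k))) ⟩
  2 * (4 * 2 ^ suc (suc k))                       ≡⟨ double-double (2 ^ suc (suc k)) ⟩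
  4 * 2 ^ suc (suc (suc k))                       ∎
  where
  open ≤-Reasoning

-- Fields of a node: its parent, its slot, its winning child, the leaf it is won by (0 if the node is not
-- live), its height, and its positions in the dirty and in the root bucket of that height (0 if it is in
-- none).  nodeᶠ is indexed by slots, and topᶠ by leaves: it holds the topmost node won by a leaf.
-- Ent and Cnt are the entries and the sizes of the buckets, freeᶠ is the stack of free nodes,
-- logᶠ a table of logarithms, and pathᶠ records the way down to the leaf being deleted.

pattern parᶠ   = 0
pattern slotᶠ  = 1
pattern nodeᶠ  = 2
pattern winᶠ   = 3
pattern leafᶠ  = 4
pattern topᶠ   = 5
pattern htᶠ    = 6
pattern dIdxᶠ  = 7
pattern dEntᶠ  = 8
pattern dCntᶠ  = 9
pattern rIdxᶠ  = 10
pattern rEntᶠ  = 11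
pattern rCntᶠ  = 12
pattern freeᶠ  = 13
pattern logᶠ   = 14
pattern pathᶠ  = 15

-- Registers: the argument or result, the minimum (0 if the heap is empty), the last node allocated so far,
-- the number of free nodes, the masks of the overfull dirty and root buckets, and the number of elements.
-- The registers from 7 on are temporaries.

pattern argʳ   = 0
pattern minʳ   = 1
pattern lastʳ  = 2
pattern freeʳ  = 3
pattern dMaskʳ = 4
pattern rMaskʳ = 5
pattern sizeʳ  = 6

-- Programs over an array of records: field f of record i is word 16 i + f.

infixl 7 _⊗_
infixl 6 _⊕_ _⊖_
infix  4 _≐_ _≺_
infixr 3 _▸_

-- The implicit bounds are settled by computation. They ensure that literals are small words for
-- every admissible word length and that register and field numbers are within the records below.
data IE : Set where
  num : (n : ℕ) {_ : T (n <ᵇ 32)} → IE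
  var : (i : ℕ) {_ : T (i <ᵇ 24)} → IE
  fld : (f : ℕ) {_ : T (f <ᵇ 16)} → IE → IE
  _⊕_ _⊖_ _⊗_ : IE → IE → IE
  pow : IE → IE

data IT : Set where
  _≐_ _≺_ _≼_ : IE → IE → IT

data IC : Set where
  nop   : IC
  set   : (i : ℕ) {_ : T (i <ᵇ 24)} → IE → IC
  sto   : (f : ℕ) {_ : T (f <ᵇ 16)} → IE → IE → IC
  key   : IE → IC
  _▸_   : IC → IC → IC
  cond  : IT → IC → IC → IC
  while : IT → IC → IC

addr : ℕ → Expr → Expr
addr f e = op add (op mul (lit 16) e) (lit f)

⟦_⟧ᵉ : IE → Expr
⟦ num n ⟧ᵉ   = lit n
⟦ var i ⟧ᵉ   = reg i
⟦ fld f e ⟧ᵉ = mem (addr f ⟦ e ⟧ᵉ)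
⟦ x ⊕ y ⟧ᵉ   = op add ⟦ x ⟧ᵉ ⟦ y ⟧ᵉ
⟦ x ⊖ y ⟧ᵉ   = op sub ⟦ x ⟧ᵉ ⟦ y ⟧ᵉ
⟦ x ⊗ y ⟧ᵉ   = op mul ⟦ x ⟧ᵉ ⟦ y ⟧ᵉ
⟦ pow e ⟧ᵉ   = op shl (lit 1) ⟦ e ⟧ᵉ

⟦_⟧ᵗ : IT → Test
⟦ x ≐ y ⟧ᵗ = ⟦ x ⟧ᵉ == ⟦ y ⟧ᵉ
⟦ x ≺ y ⟧ᵗ = ⟦ x ⟧ᵉ << ⟦ y ⟧ᵉ
⟦ x ≼ y ⟧ᵗ = kmem ⟦ x ⟧ᵉ ≤ᵏ kmem ⟦ y ⟧ᵉ

⟦_⟧ : IC → Cmd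
⟦ nop ⟧        = skip
⟦ set i e ⟧    = reg i ≔ ⟦ e ⟧ᵉ
⟦ sto f x e ⟧  = mem[ addr f ⟦ x ⟧ᵉ ]≔ ⟦ e ⟧ᵉ
⟦ key x ⟧      = kmem[ ⟦ x ⟧ᵉ ]≔ kreg 0
⟦ p ▸ q ⟧      = ⟦ p ⟧ ⨾ ⟦ q ⟧
⟦ cond t p q ⟧ = if ⟦ t ⟧ᵗ then ⟦ p ⟧ else′ ⟦ q ⟧
⟦ while t p ⟧  = while ⟦ t ⟧ᵗ do′ ⟦ p ⟧

-- An upper bound on the running time of a program without loops.
cost : IC → ℕ
cost nop          = 0
cost (set i e)    = 1 + costᵉ ⟦ e ⟧ᵉ
cost (sto f x e)  = 1 + costᵉ (addr f ⟦ x ⟧ᵉ) + costᵉ ⟦ e ⟧ᵉ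
cost (key x)      = 1 + costᵉ ⟦ x ⟧ᵉ + 1
cost (p ▸ q)      = cost p + cost q
cost (cond t p q) = costᵗ ⟦ t ⟧ᵗ + (cost p + cost q)
cost (while t p)  = 0

-- The cost as an opaque constant, to keep the type checker from computing with large numerals.
abstract
  time : IC → ℕ
  time = cost

  time-≡ : ∀ c → cost c ≡ time c
  time-≡ c = refl

-- Registers and fields are kept in records, for which η makes writing back a value that was read a
-- definitional identity.

Tup : Set → ℕ → Set
Tup X zero    = ⊤
Tup X (suc n) = X × Tup X n

get : ∀ {X n} → X → Tup X n → ℕ → X
get {n = zero}  d t i       = d
get {n = suc n} d t zero    = proj₁ t
get {n = suc n} d t (suc i) = get d (proj₂ t) i

put : ∀ {X n} → ℕ → X → Tup X n → Tup X n
put {n = zero}  i       x t = t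
put {n = suc n} zero    x t = x , proj₂ t
put {n = suc n} (suc i) x t = proj₁ t , put i x (proj₂ t)

get-put-≡ : ∀ {X n} d i x (t : Tup X n) → i < n → get d (put i x t) i ≡ x
get-put-≡ {n = suc n} d zero    x t _ = refl
get-put-≡ {n = suc n} d (suc i) x t p = get-put-≡ d i x (proj₂ t) (s≤s⁻¹ p)

get-put-≢ : ∀ {X n} d i x (t : Tup X n) {j} → j ≢ i → get d (put i x t) j ≡ get d t j
get-put-≢ {n = zero}  d i       x t         n = refl
get-put-≢ {n = suc _} d zero    x t {zero}  n = ⊥-elim (n refl)
get-put-≢ {n = suc _} d zero    x t {suc j} n = refl
get-put-≢ {n = suc _} d (suc i) x t {zero}  n = refl
get-put-≢ {n = suc _} d (suc i) x t {suc j} n = get-put-≢ d i x (proj₂ t) (n ∘ cong suc)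

record Registers : Set where
  constructor mkRegisters
  field r₀ r₁ r₂ r₃ r₄ r₅ r₆ r₇ r₈ r₉ r₁₀ r₁₁ r₁₂ r₁₃ r₁₄ r₁₅ r₁₆ r₁₇ r₁₈ r₁₉ r₂₀ r₂₁ r₂₂ r₂₃ : ℕ

module _ where
  open Registers

  readᴿ : Registers → ℕ → ℕ
  readᴿ t 0 = r₀ t
  readᴿ t 1 = r₁ t
  readᴿ t 2 = r₂ t
  readᴿ t 3 = r₃ t
  readᴿ t 4 = r₄ t
  readᴿ t 5 = r₅ t
  readᴿ t 6 = r₆ t
  readᴿ t 7 = r₇ t
  readᴿ t 8 = r₈ t
  readᴿ t 9 = r₉ t
  readᴿ t 10 = r₁₀ t
  readᴿ t 11 = r₁₁ t
  readᴿ t 12 = r₁₂ t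
  readᴿ t 13 = r₁₃ t
  readᴿ t 14 = r₁₄ t
  readᴿ t 15 = r₁₅ t
  readᴿ t 16 = r₁₆ t
  readᴿ t 17 = r₁₇ t
  readᴿ t 18 = r₁₈ t
  readᴿ t 19 = r₁₉ t
  readᴿ t 20 = r₂₀ t
  readᴿ t (suc 20) = r₂₁ t
  readᴿ t (suc (suc 20)) = r₂₂ t
  readᴿ t (suc (suc (suc 20))) = r₂₃ t
  readᴿ t _ = 0

  writeᴿ : ℕ → ℕ → Registers → Registers
  writeᴿ 0 x t = record t { r₀ = x }
  writeᴿ 1 x t = record t { r₁ = x }
  writeᴿ 2 x t = record t { r₂ = x }
  writeᴿ 3 x t = record t { r₃ = x }
  writeᴿ 4 x t = record t { r₄ = x }
  writeᴿ 5 x t = record t { r₅ = x }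
  writeᴿ 6 x t = record t { r₆ = x }
  writeᴿ 7 x t = record t { r₇ = x }
  writeᴿ 8 x t = record t { r₈ = x }
  writeᴿ 9 x t = record t { r₉ = x }
  writeᴿ 10 x t = record t { r₁₀ = x }
  writeᴿ 11 x t = record t { r₁₁ = x }
  writeᴿ 12 x t = record t { r₁₂ = x }
  writeᴿ 13 x t = record t { r₁₃ = x }
  writeᴿ 14 x t = record t { r₁₄ = x }
  writeᴿ 15 x t = record t { r₁₅ = x }
  writeᴿ 16 x t = record t { r₁₆ = x }
  writeᴿ 17 x t = record t { r₁₇ = x }
  writeᴿ 18 x t = record t { r₁₈ = x }
  writeᴿ 19 x t = record t { r₁₉ = x }
  writeᴿ 20 x t = record t { r₂₀ = x }
  writeᴿ (suc 20) x t = record t { r₂₁ = x }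
  writeᴿ (suc (suc 20)) x t = record t { r₂₂ = x }
  writeᴿ (suc (suc (suc 20))) x t = record t { r₂₃ = x }
  writeᴿ _ x t = t

  -- Passing to nested tuples proves the laws of reading after writing by induction, in place of one
  -- case for every pair of registers.
  tupᴿ : Registers → Tup ℕ 24
  tupᴿ t = r₀ t , r₁ t , r₂ t , r₃ t , r₄ t , r₅ t , r₆ t , r₇ t , r₈ t , r₉ t , r₁₀ t , r₁₁ t , r₁₂ t , r₁₃ t , r₁₄ t , r₁₅ t , r₁₆ t , r₁₇ t , r₁₈ t , r₁₉ t , r₂₀ t , r₂₁ t , r₂₂ t , r₂₃ t , tt

  readᴿ-get : ∀ t i → readᴿ t i ≡ get (0) (tupᴿ t) i
  readᴿ-get t 0 = refl
  readᴿ-get t 1 = refl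
  readᴿ-get t 2 = refl
  readᴿ-get t 3 = refl
  readᴿ-get t 4 = refl
  readᴿ-get t 5 = refl
  readᴿ-get t 6 = refl
  readᴿ-get t 7 = refl
  readᴿ-get t 8 = refl
  readᴿ-get t 9 = refl
  readᴿ-get t 10 = refl
  readᴿ-get t 11 = refl
  readᴿ-get t 12 = refl
  readᴿ-get t 13 = refl
  readᴿ-get t 14 = refl
  readᴿ-get t 15 = refl
  readᴿ-get t 16 = refl
  readᴿ-get t 17 = refl
  readᴿ-get t 18 = refl
  readᴿ-get t 19 = refl
  readᴿ-get t 20 = refl
  readᴿ-get t (suc 20) = refl
  readᴿ-get t (suc (suc 20)) = refl
  readᴿ-get t (suc (suc (suc 20))) = refl
  readᴿ-get t (suc (suc (suc (suc (suc (suc (suc (suc (suc (suc (suc (suc (suc (suc (suc (suc (suc (suc (suc (suc (suc (suc (suc (suc i)))))))))))))))))))))))) = refl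

  writeᴿ-put : ∀ i x t → tupᴿ (writeᴿ i x t) ≡ put i x (tupᴿ t)
  writeᴿ-put 0 x t = refl
  writeᴿ-put 1 x t = refl
  writeᴿ-put 2 x t = refl
  writeᴿ-put 3 x t = refl
  writeᴿ-put 4 x t = refl
  writeᴿ-put 5 x t = refl
  writeᴿ-put 6 x t = refl
  writeᴿ-put 7 x t = refl
  writeᴿ-put 8 x t = refl
  writeᴿ-put 9 x t = refl
  writeᴿ-put 10 x t = refl
  writeᴿ-put 11 x t = refl
  writeᴿ-put 12 x t = refl
  writeᴿ-put 13 x t = refl
  writeᴿ-put 14 x t = refl
  writeᴿ-put 15 x t = refl
  writeᴿ-put 16 x t = refl
  writeᴿ-put 17 x t = refl
  writeᴿ-put 18 x t = refl
  writeᴿ-put 19 x t = refl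
  writeᴿ-put 20 x t = refl
  writeᴿ-put (suc 20) x t = refl
  writeᴿ-put (suc (suc 20)) x t = refl
  writeᴿ-put (suc (suc (suc 20))) x t = refl
  writeᴿ-put (suc (suc (suc (suc (suc (suc (suc (suc (suc (suc (suc (suc (suc (suc (suc (suc (suc (suc (suc (suc (suc (suc (suc (suc i)))))))))))))))))))))))) x t = refl

  readᴿ-writeᴿ-≡ : ∀ i x t → i < 24 → readᴿ (writeᴿ i x t) i ≡ x
  readᴿ-writeᴿ-≡ i x t i< = trans (readᴿ-get (writeᴿ i x t) i)
    (trans (cong (λ u → get (0) u i) (writeᴿ-put i x t)) (get-put-≡ (0) i x (tupᴿ t) i<))

  readᴿ-writeᴿ-≢ : ∀ i x t {j} → j ≢ i → readᴿ (writeᴿ i x t) j ≡ readᴿ t j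
  readᴿ-writeᴿ-≢ i x t {j} j≢i = trans (readᴿ-get (writeᴿ i x t) j) (trans (cong (λ u → get (0) u j) (writeᴿ-put i x t))
    (trans (get-put-≢ (0) i x (tupᴿ t) j≢i) (sym (readᴿ-get t j))))

record Fields : Set where
  constructor mkFields
  field f₀ f₁ f₂ f₃ f₄ f₅ f₆ f₇ f₈ f₉ f₁₀ f₁₁ f₁₂ f₁₃ f₁₄ f₁₅ : ℕ → ℕ

module _ where
  open Fields

  readᶠ : Fields → ℕ → ℕ → ℕ
  readᶠ t 0 = f₀ t
  readᶠ t 1 = f₁ t
  readᶠ t 2 = f₂ t
  readᶠ t 3 = f₃ t
  readᶠ t 4 = f₄ t
  readᶠ t 5 = f₅ t
  readᶠ t 6 = f₆ t
  readᶠ t 7 = f₇ t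
  readᶠ t 8 = f₈ t
  readᶠ t 9 = f₉ t
  readᶠ t 10 = f₁₀ t
  readᶠ t 11 = f₁₁ t
  readᶠ t 12 = f₁₂ t
  readᶠ t 13 = f₁₃ t
  readᶠ t 14 = f₁₄ t
  readᶠ t 15 = f₁₅ t
  readᶠ t _ = λ _ → 0

  writeᶠ : ℕ → (ℕ → ℕ) → Fields → Fields
  writeᶠ 0 x t = record t { f₀ = x }
  writeᶠ 1 x t = record t { f₁ = x }
  writeᶠ 2 x t = record t { f₂ = x }
  writeᶠ 3 x t = record t { f₃ = x }
  writeᶠ 4 x t = record t { f₄ = x }
  writeᶠ 5 x t = record t { f₅ = x }
  writeᶠ 6 x t = record t { f₆ = x }
  writeᶠ 7 x t = record t { f₇ = x }
  writeᶠ 8 x t = record t { f₈ = x }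
  writeᶠ 9 x t = record t { f₉ = x }
  writeᶠ 10 x t = record t { f₁₀ = x }
  writeᶠ 11 x t = record t { f₁₁ = x }
  writeᶠ 12 x t = record t { f₁₂ = x }
  writeᶠ 13 x t = record t { f₁₃ = x }
  writeᶠ 14 x t = record t { f₁₄ = x }
  writeᶠ 15 x t = record t { f₁₅ = x }
  writeᶠ _ x t = t

  tupᶠ : Fields → Tup (ℕ → ℕ) 16
  tupᶠ t = f₀ t , f₁ t , f₂ t , f₃ t , f₄ t , f₅ t , f₆ t , f₇ t , f₈ t , f₉ t , f₁₀ t , f₁₁ t , f₁₂ t , f₁₃ t , f₁₄ t , f₁₅ t , tt

  readᶠ-get : ∀ t i → readᶠ t i ≡ get (λ _ → 0) (tupᶠ t) i
  readᶠ-get t 0 = refl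
  readᶠ-get t 1 = refl
  readᶠ-get t 2 = refl
  readᶠ-get t 3 = refl
  readᶠ-get t 4 = refl
  readᶠ-get t 5 = refl
  readᶠ-get t 6 = refl
  readᶠ-get t 7 = refl
  readᶠ-get t 8 = refl
  readᶠ-get t 9 = refl
  readᶠ-get t 10 = refl
  readᶠ-get t 11 = refl
  readᶠ-get t 12 = refl
  readᶠ-get t 13 = refl
  readᶠ-get t 14 = refl
  readᶠ-get t 15 = refl
  readᶠ-get t (suc (suc (suc (suc (suc (suc (suc (suc (suc (suc (suc (suc (suc (suc (suc (suc i)))))))))))))))) = refl

  writeᶠ-put : ∀ i x t → tupᶠ (writeᶠ i x t) ≡ put i x (tupᶠ t)
  writeᶠ-put 0 x t = refl
  writeᶠ-put 1 x t = refl
  writeᶠ-put 2 x t = refl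
  writeᶠ-put 3 x t = refl
  writeᶠ-put 4 x t = refl
  writeᶠ-put 5 x t = refl
  writeᶠ-put 6 x t = refl
  writeᶠ-put 7 x t = refl
  writeᶠ-put 8 x t = refl
  writeᶠ-put 9 x t = refl
  writeᶠ-put 10 x t = refl
  writeᶠ-put 11 x t = refl
  writeᶠ-put 12 x t = refl
  writeᶠ-put 13 x t = refl
  writeᶠ-put 14 x t = refl
  writeᶠ-put 15 x t = refl
  writeᶠ-put (suc (suc (suc (suc (suc (suc (suc (suc (suc (suc (suc (suc (suc (suc (suc (suc i)))))))))))))))) x t = refl

  readᶠ-writeᶠ-≡ : ∀ i x t → i < 16 → readᶠ (writeᶠ i x t) i ≡ x
  readᶠ-writeᶠ-≡ i x t i< = trans (readᶠ-get (writeᶠ i x t) i)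
    (trans (cong (λ u → get (λ _ → 0) u i) (writeᶠ-put i x t)) (get-put-≡ (λ _ → 0) i x (tupᶠ t) i<))

  readᶠ-writeᶠ-≢ : ∀ i x t {j} → j ≢ i → readᶠ (writeᶠ i x t) j ≡ readᶠ t j
  readᶠ-writeᶠ-≢ i x t {j} j≢i = trans (readᶠ-get (writeᶠ i x t) j) (trans (cong (λ u → get (λ _ → 0) u j) (writeᶠ-put i x t))
    (trans (get-put-≢ (λ _ → 0) i x (tupᶠ t) j≢i) (sym (readᶠ-get t j))))

field-< : ∀ {i j} f g → f < 16 → i < j → 16 * i + f < 16 * j + g
field-< {i} {j} f g f< i<j = begin-strict
  16 * i + f   <⟨ +-monoʳ-< (16 * i) f< ⟩
  16 * i + 16  ≡⟨ +-comm (16 * i) 16 ⟩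
  16 + 16 * i  ≡⟨ *-suc 16 i ⟨
  16 * suc i   ≤⟨ *-monoʳ-≤ 16 i<j ⟩
  16 * j       ≤⟨ m≤m+n _ g ⟩
  16 * j + g   ∎
  where open ≤-Reasoning

field-injˡ : ∀ {i j} f g → f < 16 → g < 16 → 16 * i + f ≡ 16 * j + g → i ≡ j
field-injˡ {i} {j} f g f< g< eq with <-cmp i j
... | tri≈ _ e _ = e
... | tri< lt _ _ = ⊥-elim (<⇒≢ (field-< f g f< lt) eq)
... | tri> _ _ gt = ⊥-elim (<⇒≢ (field-< g f g< gt) (sym eq))

-- An abstract machine with unbounded numbers, and its agreement with the word RAM.

module Semantics {a ℓ₁ ℓ₂ : Level} (K : DecTotalOrder a ℓ₁ ℓ₂) (w : ℕ) where

  open Forest K public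
  open DecTotalOrder K using (_≤?_)
  open Machine K w

  record AS : Set a where
    constructor mkAS
    field
      R  : Registers
      F  : Fields
      C  : ℕ → Maybe Key
      KR : Maybe Key
  open AS public

  -- All sixteen words of the record with index `v` are addressable. Every stored number is kept
  -- small, so each can serve as an index.
  Small : ℕ → Set
  Small v = 16 * suc v ≤ 2 ^ w

  rg : AS → ℕ → ℕ
  rg A = readᴿ (R A)

  fd : AS → ℕ → ℕ → ℕ
  fd A = readᶠ (F A)

  setR : ℕ → ℕ → AS → AS
  setR i v A = record A { R = writeᴿ i v (R A) }

  row : ℕ → (ℕ → ℕ) → AS → AS
  row f g A = record A { F = writeᶠ f g (F A) }

  setF : ℕ → ℕ → ℕ → AS → AS
  setF f i v A = row f (update (fd A f) i v) A

  setC : ℕ → AS → AS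
  setC i A = record A { C = update (C A) i (KR A) }

  val : IE → AS → ℕ
  val (num n)   A = n
  val (var i)   A = rg A i
  val (fld f e) A = fd A f (val e A)
  val (x ⊕ y)   A = val x A + val y A
  val (x ⊖ y)   A = val x A ∸ val y A
  val (x ⊗ y)   A = val x A * val y A
  val (pow e)   A = 2 ^ val e A

  -- Under these conditions no operation wraps around. A field access adds none: its index is a
  -- small value and field contents are small by the simulation.
  Safe : IE → AS → Set
  Safe (num n)   A = ⊤
  Safe (var i)   A = ⊤
  Safe (fld f e) A = Safe e A
  Safe (x ⊕ y)   A = Safe x A × Safe y A × Small (val x A + val y A)
  Safe (x ⊖ y)   A = Safe x A × Safe y A × val y A ≤ val x A
  Safe (x ⊗ y)   A = Safe x A × Safe y A × Small (val x A * val y A)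
  Safe (pow e)   A = Safe e A × Small (2 ^ val e A)

  q : Level
  q = a ⊔ ℓ₂

  wpᵗ : IT → AS → Set q → Set q → Set q
  wpᵗ (x ≐ y) A P N = (Safe x A × Safe y A) × (val x A ≡ val y A → P) × (val x A ≢ val y A → N)
  wpᵗ (x ≺ y) A P N = (Safe x A × Safe y A) × (val x A < val y A → P) × (val y A ≤ val x A → N)
  wpᵗ (x ≼ y) A P N = (Safe x A × Safe y A) ×
    (∃₂ λ k k′ → C A (val x A) ≡ just k × C A (val y A) ≡ just k′) ×
    (KLe (C A) (val x A) (val y A) → P) × (KLe (C A) (val y A) (val x A) → N)

  -- Loops get a false precondition, as they are treated by `do-while` with an explicit iteration
  -- count.
  wp : IC → (AS → Set q) → AS → Set q
  wp nop          Q A = Q A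
  wp (set i e)    Q A = Safe e A × Q (setR i (val e A) A)
  wp (sto f x e)  Q A = (Safe x A × Safe e A) × Q (setF f (val x A) (val e A) A)
  wp (key x)      Q A = Safe x A × (∃[ k ] (KR A ≡ just k)) × Q (setC (val x A) A)
  wp (c ▸ d)      Q A = wp c (wp d Q) A
  wp (cond t c d) Q A = wpᵗ t A (wp c Q A) (wp d Q A)
  wp (while t c)  Q A = Lift q ⊥

  wp-mono : ∀ c {Q Q′ A} → (∀ {B} → Q B → Q′ B) → wp c Q A → wp c Q′ A
  wp-mono nop h p = h p
  wp-mono (set i e) h (s , p) = s , h p
  wp-mono (sto f x e) h (s , p) = s , h p
  wp-mono (key x) h (s , k , p) = s , k , h p
  wp-mono (c ▸ d) h p = wp-mono c (wp-mono d h) p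
  wp-mono (cond (x ≐ y) c d) h (s , p , n) = s , wp-mono c h ∘ p , wp-mono d h ∘ n
  wp-mono (cond (x ≺ y) c d) h (s , p , n) = s , wp-mono c h ∘ p , wp-mono d h ∘ n
  wp-mono (cond (x ≼ y) c d) h (s , k , p , n) = s , k , wp-mono c h ∘ p , wp-mono d h ∘ n
  wp-mono (while t c) h (lift ())

  -- Unlike wp, the record WP is injective, so that c, Q and A can be inferred.
  record WP (c : IC) (Q : AS → Set q) (A : AS) : Set q where
    constructor ⟪_⟫
    field run : wp c Q A

  step : ∀ {c d Q A} → WP c (WP d Q) A → WP (c ▸ d) Q A
  step {c} ⟪ p ⟫ = ⟪ wp-mono c WP.run p ⟫

  -- The value is supplied with an equation, mostly `refl`, so that later goals mention the chosen
  -- name and not the expression evaluated.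
  setW : ∀ {i p e d Q A} v → val e A ≡ v → Safe e A → WP d Q (setR i v A) → WP (set i {p} e ▸ d) Q A
  setW _ refl s ⟪ p ⟫ = ⟪ s , p ⟫

  stoW : ∀ {f p x e d Q A} g → update (fd A f) (val x A) (val e A) ≡ g → Safe x A → Safe e A →
         WP d Q (row f g A) → WP (sto f {p} x e ▸ d) Q A
  stoW _ refl s s′ ⟪ p ⟫ = ⟪ (s , s′) , p ⟫

  keyW : ∀ {x k d Q A} v → val x A ≡ v → Safe x A → KR A ≡ just k → WP d Q (setC v A) → WP (key x ▸ d) Q A
  keyW _ refl s e ⟪ p ⟫ = ⟪ s , (_ , e) , p ⟫

  if≡ : ∀ {x y c d Q A} → Safe x A → Safe y A → (val x A ≡ val y A → WP c Q A) →
        (val x A ≢ val y A → WP d Q A) → WP (cond (x ≐ y) c d) Q A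
  if≡ s s′ p n = ⟪ (s , s′) , WP.run ∘ p , WP.run ∘ n ⟫

  if≤ᵏ : ∀ {x y c d Q A} → Safe x A → Safe y A →
         ∃[ k ] (C A (val x A) ≡ just k) → ∃[ k ] (C A (val y A) ≡ just k) →
         (KLe (C A) (val x A) (val y A) → WP c Q A) →
         (KLe (C A) (val y A) (val x A) → WP d Q A) → WP (cond (x ≼ y) c d) Q A
  if≤ᵏ s s′ (k , e) (k′ , e′) p n = ⟪ (s , s′) , (k , k′ , e , e′) , WP.run ∘ p , WP.run ∘ n ⟫

  skipW : ∀ {Q A} → Q A → WP nop Q A
  skipW p = ⟪ p ⟫

  lastW : ∀ {i p e Q A} v → val e A ≡ v → Safe e A → Q (setR i v A) → WP (set i {p} e) Q A
  lastW _ refl s p = ⟪ s , p ⟫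

  -- Fields are functions on all numbers, so memory agrees with them only at small indices; contents
  -- are required to be small everywhere.
  record Sim (s : State) (A : AS) : Set a where
    field
      reg-≡   : ∀ {i} → i < 24 → regs s i ≡ rg A i
      mem-≡   : ∀ {f i} → f < 16 → Small i → memory s (16 * i + f) ≡ fd A f i
      cell-≡  : ∀ i → keyCells s i ≡ C A i
      kreg-≡  : keyRegs s 0 ≡ KR A
      reg-sm  : ∀ {i} → i < 24 → Small (rg A i)
      mem-sm  : ∀ {f} i → f < 16 → Small (fd A f i)

  -- Reachability is about arbitrary runs, whereas verification constructs one; this identifies the
  -- two.
  Run-det : ∀ {p s t t′ s₁ s₂} → Run p s t s₁ → Run p s t′ s₂ → s₁ ≡ s₂
  Run-det skip skip = refl
  Run-det set-reg set-reg = refl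
  Run-det set-mem set-mem = refl
  Run-det (set-kreg e) (set-kreg e′) with trans (sym e) e′
  ... | refl = refl
  Run-det (set-kmem e) (set-kmem e′) with trans (sym e) e′
  ... | refl = refl
  Run-det (seq r₁ r₂) (seq r₁′ r₂′) with Run-det r₁ r₁′
  ... | refl = Run-det r₂ r₂′
  Run-det (if-true _ r) (if-true _ r′) = Run-det r r′
  Run-det (if-false _ r) (if-false _ r′) = Run-det r r′
  Run-det (if-true e _) (if-false e′ _) = case trans (sym e) e′ of λ ()
  Run-det (if-false e _) (if-true e′ _) = case trans (sym e) e′ of λ ()
  Run-det (while-stop _) (while-stop _) = refl
  Run-det (while-stop e) (while-step e′ _ _) = case trans (sym e) e′ of λ ()
  Run-det (while-step e _ _) (while-stop e′) = case trans (sym e) e′ of λ ()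
  Run-det (while-step _ r₁ r₂) (while-step _ r₁′ r₂′) with Run-det r₁ r₁′
  ... | refl = Run-det r₂ r₂′

  module _ (big : 16 * 32 ≤ 2 ^ w) where

    trunc-id : ∀ {v} → v < 2 ^ w → trunc w v ≡ v
    trunc-id lt = m<n⇒m%n≡m {{m^n≢0 2 w}} lt

    small-< : ∀ {v} → Small v → v < 2 ^ w
    small-< {v} sm = ≤-trans (m≤n*m (suc v) 16) sm

    small-lit : ∀ {n} → n < 32 → Small n
    small-lit n<32 = ≤-trans (*-monoʳ-≤ 16 n<32) big

    small-mono : ∀ {u v} → u ≤ v → Small v → Small u
    small-mono u≤v sm = ≤-trans (*-monoʳ-≤ 16 (s≤s u≤v)) sm

    addr-eval : ∀ {f} e {s v} → f < 16 → eval e s ≡ v → Small v → eval (addr f e) s ≡ 16 * v + f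
    addr-eval {f} e {s} {v} f< refl sm = begin
      trunc w (trunc w (trunc w 16 * v) + trunc w f)
        ≡⟨ cong₂ (λ x y → trunc w (trunc w (x * v) + y)) (trunc-id (<-≤-trans (m≤m+n 17 495) big))
             (trunc-id (<-≤-trans f< (≤-trans (m≤m+n 16 496) big))) ⟩
      trunc w (trunc w (16 * v) + f)
        ≡⟨ cong (λ x → trunc w (x + f)) (trunc-id (≤-<-trans (m≤m+n (16 * v) f) lt)) ⟩
      trunc w (16 * v + f)   ≡⟨ trunc-id lt ⟩
      16 * v + f             ∎
      where
      open ≡-Reasoning
      lt : 16 * v + f < 2 ^ w
      lt = <-≤-trans (+-monoʳ-< (16 * v) f<) (≤-trans (≤-reflexive (trans (+-comm (16 * v) 16) (sym (*-suc 16 v)))) sm)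

    eval-ok : ∀ e {s A} → Sim s A → Safe e A → eval ⟦ e ⟧ᵉ s ≡ val e A × Small (val e A)
    eval-ok (num n {p}) sim _ = trunc-id (small-< sm) , sm
      where sm = small-lit (<ᵇ⇒< n 32 p)
    eval-ok (var i {p}) sim _ = Sim.reg-≡ sim (<ᵇ⇒< i 24 p) , Sim.reg-sm sim (<ᵇ⇒< i 24 p)
    eval-ok (fld f {p} e) {s} sim sf with eval-ok e sim sf
    ... | ev , sm = trans (cong (memory s) (addr-eval ⟦ e ⟧ᵉ (<ᵇ⇒< f 16 p) ev sm))
                          (Sim.mem-≡ sim (<ᵇ⇒< f 16 p) sm) , Sim.mem-sm sim _ (<ᵇ⇒< f 16 p)
    eval-ok (x ⊕ y) sim (sx , sy , sm) with eval-ok x sim sx | eval-ok y sim sy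
    ... | ex , _ | ey , _ rewrite ex | ey = trunc-id (small-< sm) , sm
    eval-ok (x ⊗ y) sim (sx , sy , sm) with eval-ok x sim sx | eval-ok y sim sy
    ... | ex , _ | ey , _ rewrite ex | ey = trunc-id (small-< sm) , sm
    eval-ok (x ⊖ y) {A = A} sim (sx , sy , le) with eval-ok x sim sx | eval-ok y sim sy
    ... | ex , smx | ey , _ rewrite ex | ey = eq , small-mono (m∸n≤m _ (val y A)) smx
      where
      vx vy : ℕ
      vx = val x A
      vy = val y A
      eq : trunc w (vx + 2 ^ w ∸ vy) ≡ vx ∸ vy
      eq = trans (cong (trunc w) (trans (cong (_∸ vy) (+-comm vx (2 ^ w))) (trans (+-∸-assoc (2 ^ w) le) (+-comm (2 ^ w) _))))
        (trans ([m+n]%n≡m%n (vx ∸ vy) (2 ^ w) {{m^n≢0 2 w}}) (trunc-id (≤-<-trans (m∸n≤m vx vy) (small-< smx))))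
    eval-ok (pow e) {A = A} sim (se , sm) with eval-ok e sim se
    ... | ee , _ rewrite ee | trunc-id {1} (small-< (small-lit (s≤s (s≤s z≤n)))) =
      trans (cong (trunc w) (*-identityˡ (2 ^ val e A))) (trunc-id (small-< sm)) , sm

    test-ok : ∀ t {s A P N} → Sim s A → wpᵗ t A P N →
              (evalTest ⟦ t ⟧ᵗ s ≡ just true × P) ⊎ (evalTest ⟦ t ⟧ᵗ s ≡ just false × N)
    test-ok (x ≐ y) {A = A} sim ((sx , sy) , p , n)
      rewrite proj₁ (eval-ok x sim sx) | proj₁ (eval-ok y sim sy)
      with val x A ≡ᵇ val y A in eq
    ... | true  = inj₁ (refl , p (≡ᵇ⇒≡ (val x A) _ (subst T (sym eq) tt)))
    ... | false = inj₂ (refl , n (λ e → subst T eq (≡⇒≡ᵇ (val x A) _ e)))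
    test-ok (x ≺ y) {A = A} sim ((sx , sy) , p , n)
      rewrite proj₁ (eval-ok x sim sx) | proj₁ (eval-ok y sim sy)
      with val x A <ᵇ val y A in eq
    ... | true  = inj₁ (refl , p (<ᵇ⇒< (val x A) _ (subst T (sym eq) tt)))
    ... | false = inj₂ (refl , n (≮⇒≥ (λ lt → subst T eq (<⇒<ᵇ lt))))
    test-ok (x ≼ y) {A = A} sim ((sx , sy) , (k , k′ , ck , ck′) , p , n)
      rewrite proj₁ (eval-ok x sim sx) | proj₁ (eval-ok y sim sy)
            | Sim.cell-≡ sim (val x A) | Sim.cell-≡ sim (val y A) | ck | ck′
      with k ≤? k′
    ... | yes le = inj₁ (refl , p (k , k′ , refl , refl , le))
    ... | no nle = inj₂ (refl , n (k′ , k , refl , refl ,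
          (case totalᴷ k k′ of λ { (inj₁ le) → ⊥-elim (nle le) ; (inj₂ le) → le })))

    sim-setR : ∀ {s A v i} → Sim s A → i < 24 → Small v → Sim (setReg i v s) (setR i v A)
    sim-setR {s} {A} {v} {i} sim i< sm = record
      { reg-≡ = lem ; mem-≡ = mem-≡ ; cell-≡ = cell-≡ ; kreg-≡ = kreg-≡
      ; reg-sm = sm′ ; mem-sm = mem-sm }
      where
      open Sim sim
      lem : ∀ {j} → j < 24 → update (regs s) i v j ≡ rg (setR i v A) j
      lem {j} j< with j ≟ i
      ... | yes refl = trans (update-≡ (regs s) i v refl) (sym (readᴿ-writeᴿ-≡ i v (R A) i<))
      ... | no n = trans (update-≢ (regs s) i v n) (trans (reg-≡ j<) (sym (readᴿ-writeᴿ-≢ i v (R A) n)))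
      sm′ : ∀ {j} → j < 24 → Small (rg (setR i v A) j)
      sm′ {j} j< with j ≟ i
      ... | yes refl = subst Small (sym (readᴿ-writeᴿ-≡ i v (R A) i<)) sm
      ... | no n = subst Small (sym (readᴿ-writeᴿ-≢ i v (R A) n)) (reg-sm j<)

    sim-setF : ∀ {s A v f i} → Sim s A → f < 16 → Small i → Small v →
               Sim (setMem (16 * i + f) v s) (setF f i v A)
    sim-setF {s} {A} {v} {f} {i} sim f< smi sm = record
      { reg-≡ = reg-≡ ; mem-≡ = lem ; cell-≡ = cell-≡ ; kreg-≡ = kreg-≡
      ; reg-sm = reg-sm ; mem-sm = sm′ }
      where
      open Sim sim
      f′ : ℕ → ℕ
      f′ = update (fd A f) i v
      same : ∀ j → fd (setF f i v A) f j ≡ f′ j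
      same j = cong (λ h → h j) (readᶠ-writeᶠ-≡ f f′ (F A) f<)
      other : ∀ {g} j → g ≢ f → fd (setF f i v A) g j ≡ fd A g j
      other j n = cong (λ h → h j) (readᶠ-writeᶠ-≢ f f′ (F A) n)
      lem : ∀ {g j} → g < 16 → Small j →
            update (memory s) (16 * i + f) v (16 * j + g) ≡ fd (setF f i v A) g j
      lem {g} {j} g< smj with g ≟ f
      ... | no ne = trans (update-≢ (memory s) (16 * i + f) v ne′) (trans (mem-≡ g< smj) (sym (other j ne)))
        where
        ne′ : 16 * j + g ≢ 16 * i + f
        ne′ e with field-injˡ {j} {i} g f g< f< e
        ... | refl = ne (+-cancelˡ-≡ (16 * j) g f e)
      ... | yes refl with i ≟ j
      ... | yes refl = trans (update-≡ (memory s) (16 * i + f) v refl)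
                         (sym (trans (same i) (update-≡ (fd A f) i v refl)))
      ... | no ne = trans (update-≢ (memory s) (16 * i + f) v (ne ∘ sym ∘ field-injˡ {j} {i} f f f< f<))
                      (trans (mem-≡ g< smj) (sym (trans (same j) (update-≢ (fd A f) i v (ne ∘ sym)))))
      sm′ : ∀ {g} j → g < 16 → Small (fd (setF f i v A) g j)
      sm′ {g} j g< with g ≟ f
      ... | no ne = subst Small (sym (other j ne)) (mem-sm j g<)
      ... | yes refl with j ≟ i
      ... | yes e = subst Small (sym (trans (same j) (update-≡ (fd A f) i v e))) sm
      ... | no n = subst Small (sym (trans (same j) (update-≢ (fd A f) i v n))) (mem-sm j g<)

    -- Total correctness with a time bound, uniformly in all concrete states that represent `A`.
    Do : Cmd → AS → ℕ → (AS → Set q) → Set q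
    Do c A b Q = ∀ {s} → Sim s A →
      ∃₂ λ t s′ → Run c s t s′ × t ≤ b × ∃[ B ] (Sim s′ B × Q B)

    do-wp : ∀ c {Q A} → wp c Q A → Do ⟦ c ⟧ A (cost c) Q
    do-wp nop p sim = _ , _ , skip , z≤n , _ , sim , p
    do-wp (set i {i<} e) (se , p) {s} sim with eval-ok e sim se
    ... | ev , sm = _ , _ , set-reg , ≤-refl , _ ,
          subst (λ v → Sim (setReg i v s) _) (sym ev) (sim-setR sim (<ᵇ⇒< i 24 i<) sm) , p
    do-wp (sto f {f<} x e) (( sx , se) , p) {s} sim with eval-ok x sim sx | eval-ok e sim se
    ... | ex , smx | ev , sm = _ , _ , set-mem , ≤-refl , _ ,
          subst₂ (λ u v → Sim (setMem u v s) _) (sym (addr-eval ⟦ x ⟧ᵉ (<ᵇ⇒< f 16 f<) ex smx)) (sym ev)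
            (sim-setF sim (<ᵇ⇒< f 16 f<) smx sm) , p
    do-wp (key x) {A = A} (sx , (k , e) , p) {s} sim with eval-ok x sim sx
    ... | ex , sm = _ , _ , set-kmem (trans (Sim.kreg-≡ sim) e) , ≤-refl , _ ,
      record { reg-≡ = reg-≡ ; mem-≡ = mem-≡ ; cell-≡ = lem ; kreg-≡ = kreg-≡ ; reg-sm = reg-sm ; mem-sm = mem-sm } , p
      where
      open Sim sim
      lem : ∀ j → update (keyCells s) (eval ⟦ x ⟧ᵉ s) (just k) j ≡ update (C A) (val x A) (KR A) j
      lem j rewrite ex | e with val x A ≡ᵇ j
      ... | true = refl
      ... | false = cell-≡ j
    do-wp (c ▸ d) p sim with do-wp c p sim
    ... | _ , _ , r , le , _ , sim′ , p′ with do-wp d p′ sim′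
    ... | _ , _ , r′ , le′ , B , sim″ , p″ = _ , _ , seq r r′ , +-mono-≤ le le′ , B , sim″ , p″
    do-wp (cond t c d) p sim with test-ok t sim p
    ... | inj₁ (e , p′) with do-wp c p′ sim
    ... | _ , _ , r , le , B , sim′ , p″ = _ , _ , if-true e r ,
          +-monoʳ-≤ (costᵗ ⟦ t ⟧ᵗ) (≤-trans le (m≤m+n _ (cost d))) , B , sim′ , p″
    do-wp (cond t c d) p sim | inj₂ (e , p′) with do-wp d p′ sim
    ... | _ , _ , r , le , B , sim′ , p″ = _ , _ , if-false e r ,
          +-monoʳ-≤ (costᵗ ⟦ t ⟧ᵗ) (≤-trans le (m≤n+m _ (cost c))) , B , sim′ , p″
    do-wp (while t c) (lift ())

    do-seq : ∀ {c d A b b′ Q Q′} → Do c A b Q → (∀ {B} → Q B → Do d B b′ Q′) → Do (c ⨾ d) A (b + b′) Q′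
    do-seq p p′ sim with p sim
    ... | _ , _ , r , le , _ , sim′ , h with p′ h sim′
    ... | _ , _ , r′ , le′ , B , sim″ , h′ = _ , _ , seq r r′ , +-mono-≤ le le′ , B , sim″ , h′

    do-map : ∀ {c A b Q Q′} → (∀ {B} → Q B → Q′ B) → Do c A b Q → Do c A b Q′
    do-map f p sim with p sim
    ... | _ , _ , r , le , B , sim′ , h = _ , _ , r , le , B , sim′ , f h

    do-mono : ∀ {c A b b′ Q} → b ≤ b′ → Do c A b Q → Do c A b′ Q
    do-mono le p sim with p sim
    ... | _ , _ , r , le′ , B = _ , _ , r , ≤-trans le′ le , B

    -- The index of the invariant is at once the termination measure and a bound on the remaining
    -- iterations, from which the time is read off.
    do-while : ∀ t c {Q} b (I : ℕ → AS → Set q) →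
      (∀ m A → I m A → wpᵗ t A (∃[ m′ ] (m ≡ suc m′ × Do c A b (I m′))) (Q A)) →
      ∀ m A → I m A → Do (while ⟦ t ⟧ᵗ do′ c) A (m * (costᵗ ⟦ t ⟧ᵗ + b) + costᵗ ⟦ t ⟧ᵗ) Q
    do-while t c b I step m A i sim with test-ok t sim (step m A i)
    ... | inj₂ (e , h) = _ , _ , while-stop e , m≤n+m _ (m * (costᵗ ⟦ t ⟧ᵗ + b)) , _ , sim , h
    ... | inj₁ (e , m′ , refl , h) with h sim
    ... | _ , _ , r , le , _ , sim′ , i′ with do-while t c b I step m′ _ i′ sim′
    ... | _ , _ , r′ , le′ , B , sim″ , h′ = _ , _ , while-step e r r′ ,
      ≤-trans (+-mono-≤ (+-monoʳ-≤ (costᵗ ⟦ t ⟧ᵗ) le) le′)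
        (≤-reflexive (sym (+-assoc (costᵗ ⟦ t ⟧ᵗ + b) (m′ * (costᵗ ⟦ t ⟧ᵗ + b)) (costᵗ ⟦ t ⟧ᵗ)))) , B , sim″ , h′

-- The programs for buckets, nodes and the repair of the forest.

pairᵉ : IE → IE → IE
pairᵉ r i = (r ⊕ i) ⊗ (r ⊕ i) ⊕ i

-- The parameters are the index, entry and size fields of a family of buckets, its mask register and
-- its threshold: 2 for dirty nodes, 3 for roots.
insᶜ : (i b c m t : ℕ) {_ : T (i <ᵇ 16)} {_ : T (b <ᵇ 16)} {_ : T (c <ᵇ 16)} {_ : T (m <ᵇ 24)} {_ : T (t <ᵇ 32)} → IC
insᶜ i b c m t {i<} {b<} {c<} {m<} {t<} =
  set 7 (fld htᶠ (var 10)) ▸ set 8 (num 1 ⊕ fld c {c<} (var 7)) ▸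
  sto b {b<} (pairᵉ (var 7) (var 8)) (var 10) ▸ sto i {i<} (var 10) (var 8) ▸ sto c {c<} (var 7) (var 8) ▸
  cond (var 8 ≐ num t {t<}) (set m {m<} (var m {m<} ⊕ pow (var 7))) nop

remᶜ : (i b c m t : ℕ) {_ : T (i <ᵇ 16)} {_ : T (b <ᵇ 16)} {_ : T (c <ᵇ 16)} {_ : T (m <ᵇ 24)} {_ : T (t <ᵇ 32)} → IC
remᶜ i b c m t {i<} {b<} {c<} {m<} {t<} =
  set 7 (fld htᶠ (var 10)) ▸ set 8 (fld c {c<} (var 7)) ▸ set 9 (fld b {b<} (pairᵉ (var 7) (var 8))) ▸
  sto b {b<} (pairᵉ (var 7) (fld i {i<} (var 10))) (var 9) ▸
  sto i {i<} (var 9) (fld i {i<} (var 10)) ▸ sto i {i<} (var 10) (num 0) ▸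
  sto c {c<} (var 7) (var 8 ⊖ num 1) ▸
  cond (var 8 ≐ num t {t<}) (set m {m<} (var m {m<} ⊖ pow (var 7))) nop

-- Registers act as parameters: 10 the node that enters or leaves a bucket or is freed, 11 to 13 the
-- roots to be joined, or 11 and 12 the dirty pair, 14 the allocated node, 15 the least of three
-- nodes, 16 the node worked on, 18 to 20 its children or the roots compared.
allocᶜ freeᶜ minᶜ childrenᶜ pickᶜ swapᶜ moveᶜ : IC
allocᶜ = cond (var freeʳ ≐ num 0)
  -- The entry for the new identifier itself is already present, having been written when half of it
  -- was allocated, or being the initial 0 for identifier 1.
  (set lastʳ (num 1 ⊕ var lastʳ) ▸ set 7 (num 1 ⊕ fld logᶠ (var lastʳ)) ▸
   sto logᶠ (num 2 ⊗ var lastʳ) (var 7) ▸ sto logᶠ (num 2 ⊗ var lastʳ ⊕ num 1) (var 7) ▸ set 14 (var lastʳ))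
  (set freeʳ (var freeʳ ⊖ num 1) ▸ set 14 (fld freeᶠ (var freeʳ)))
freeᶜ = sto freeᶠ (var freeʳ) (var 10) ▸ set freeʳ (num 1 ⊕ var freeʳ)
minᶜ = cond (fld leafᶠ (var 18) ≼ fld leafᶠ (var 19))
  (cond (fld leafᶠ (var 18) ≼ fld leafᶠ (var 20)) (set 15 (var 18)) (set 15 (var 20)))
  (cond (fld leafᶠ (var 19) ≼ fld leafᶠ (var 20)) (set 15 (var 19)) (set 15 (var 20)))
childrenᶜ = set 18 (fld nodeᶠ (num 4 ⊗ var 16 ⊕ num 0)) ▸ set 19 (fld nodeᶠ (num 4 ⊗ var 16 ⊕ num 1)) ▸
  set 20 (fld nodeᶠ (num 4 ⊗ var 16 ⊕ num 2))
pickᶜ = cond (var 18 ≐ fld winᶠ (var 16))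
  (cond (var 19 ≐ var 17) (set 21 (var 20)) (set 21 (var 19)))
  (cond (var 18 ≐ var 17)
    (cond (var 19 ≐ fld winᶠ (var 16)) (set 21 (var 20)) (set 21 (var 19)))
    (set 21 (var 18)))
swapᶜ = set 22 (fld parᶠ (var 11)) ▸ set 23 (fld slotᶠ (var 11)) ▸
  sto nodeᶠ (var 23) (var 21) ▸ sto nodeᶠ (fld slotᶠ (var 21)) (var 11) ▸
  sto slotᶠ (var 11) (fld slotᶠ (var 21)) ▸ sto slotᶠ (var 21) (var 23) ▸
  sto parᶠ (var 11) (var 16) ▸ sto parᶠ (var 21) (var 22)
-- Moves the dirty node in register 11 below the node in register 16, in exchange for a child which is
-- neither the winning one nor the one in register 17.
moveᶜ = childrenᶜ ▸ pickᶜ ▸ swapᶜ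

insDirtyᶜ remDirtyᶜ insRootᶜ remRootᶜ newLeafᶜ attachᶜ joinᶜ : IC
insDirtyᶜ = insᶜ dIdxᶠ dEntᶠ dCntᶠ dMaskʳ 2
remDirtyᶜ = remᶜ dIdxᶠ dEntᶠ dCntᶠ dMaskʳ 2
insRootᶜ  = insᶜ rIdxᶠ rEntᶠ rCntᶠ rMaskʳ 3
remRootᶜ  = remᶜ rIdxᶠ rEntᶠ rCntᶠ rMaskʳ 3
newLeafᶜ = allocᶜ ▸ key (var 14) ▸ sto leafᶠ (var 14) (var 14) ▸ sto htᶠ (var 14) (num 0) ▸
  sto parᶠ (var 14) (num 0) ▸ sto topᶠ (var 14) (var 14) ▸ set 10 (var 14) ▸ insRootᶜ ▸
  set sizeʳ (num 1 ⊕ var sizeʳ)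
attachᶜ =
  sto parᶠ (var 14) (num 0) ▸ sto parᶠ (var 11) (var 14) ▸ sto parᶠ (var 12) (var 14) ▸ sto parᶠ (var 13) (var 14) ▸
  sto slotᶠ (var 11) (num 4 ⊗ var 14 ⊕ num 0) ▸ sto slotᶠ (var 12) (num 4 ⊗ var 14 ⊕ num 1) ▸
  sto slotᶠ (var 13) (num 4 ⊗ var 14 ⊕ num 2) ▸
  sto nodeᶠ (num 4 ⊗ var 14 ⊕ num 0) (var 11) ▸ sto nodeᶠ (num 4 ⊗ var 14 ⊕ num 1) (var 12) ▸
  sto nodeᶠ (num 4 ⊗ var 14 ⊕ num 2) (var 13) ▸
  sto winᶠ (var 14) (var 15) ▸ sto topᶠ (fld leafᶠ (var 15)) (var 14) ▸ sto htᶠ (var 14) (num 1 ⊕ fld htᶠ (var 11)) ▸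
  sto leafᶠ (var 14) (fld leafᶠ (var 15)) ▸ set 10 (var 14) ▸ insRootᶜ
joinᶜ = set 10 (fld logᶠ (var rMaskʳ)) ▸ set 11 (fld rEntᶠ (pairᵉ (var 10) (num 1))) ▸
  set 12 (fld rEntᶠ (pairᵉ (var 10) (num 2))) ▸ set 13 (fld rEntᶠ (pairᵉ (var 10) (num 3))) ▸
  set 10 (var 11) ▸ remRootᶜ ▸ set 10 (var 12) ▸ remRootᶜ ▸ set 10 (var 13) ▸ remRootᶜ ▸
  allocᶜ ▸ set 18 (var 11) ▸ set 19 (var 12) ▸ set 20 (var 13) ▸ minᶜ ▸ attachᶜ

detachᶜ splitᶜ killᶜ : IC
detachᶜ = cond (fld dIdxᶠ (var 10) ≐ num 0) nop remDirtyᶜ ▸ sto parᶠ (var 10) (num 0) ▸ insRootᶜ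
splitᶜ = set 10 (var 16) ▸ remRootᶜ ▸ sto topᶠ (fld leafᶠ (var 16)) (fld winᶠ (var 16)) ▸ childrenᶜ ▸
  set 10 (var 18) ▸ detachᶜ ▸ set 10 (var 19) ▸ detachᶜ ▸ set 10 (var 20) ▸ detachᶜ ▸
  set 10 (var 16) ▸ freeᶜ ▸ sto leafᶠ (var 16) (num 0)
killᶜ = set 10 (var 16) ▸ remRootᶜ ▸ freeᶜ ▸ sto leafᶠ (var 16) (num 0) ▸ set sizeʳ (var sizeʳ ⊖ num 1)

turnᶜ selectᶜ siblingsᶜ chooseᶜ liftᶜ electᶜ mergeᶜ reduceᶜ : IC
turnᶜ = set 17 (var 11) ▸ set 11 (var 12) ▸ set 12 (var 17)
selectᶜ = set 10 (fld logᶠ (var dMaskʳ)) ▸ set 11 (fld dEntᶠ (pairᵉ (var 10) (num 1))) ▸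
  set 12 (fld dEntᶠ (pairᵉ (var 10) (num 2))) ▸
  cond (fld leafᶠ (fld parᶠ (var 11)) ≼ fld leafᶠ (fld parᶠ (var 12))) nop turnᶜ
siblingsᶜ = set 16 (fld parᶠ (var 12)) ▸
  -- Register 17 protects the second dirty node from being the child given up.
  cond (fld parᶠ (var 11) ≐ var 16) nop (set 17 (var 12) ▸ moveᶜ)
-- One test suffices: of the two siblings of `P`, if the first is dirty, the other is clean.
chooseᶜ = set 21 (var 16) ▸ set 16 (var 13) ▸ childrenᶜ ▸
  cond (var 18 ≐ var 21)
    (cond (fld dIdxᶠ (var 19) ≐ num 0) (set 16 (var 19)) (set 16 (var 20)))
    (cond (fld dIdxᶠ (var 18) ≐ num 0) (set 16 (var 18))
      (cond (var 19 ≐ var 21) (set 16 (var 20)) (set 16 (var 19))))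
liftᶜ = set 13 (fld parᶠ (var 16)) ▸ cond (var 13 ≐ num 0) nop
  -- No live node is 0, so the first move spares only the winning child. `turnᶜ` leaves the node
  -- just moved in register 17, so the second move does not push it out again.
  (cond (fld winᶠ (var 13) ≐ var 16) (chooseᶜ ▸ set 17 (num 0) ▸ moveᶜ ▸ turnᶜ ▸ moveᶜ) nop)
electᶜ = sto topᶠ (fld leafᶠ (fld winᶠ (var 16))) (fld winᶠ (var 16)) ▸ sto topᶠ (fld leafᶠ (var 15)) (var 16) ▸
  sto winᶠ (var 16) (var 15) ▸ sto leafᶠ (var 16) (fld leafᶠ (var 15))
mergeᶜ = set 10 (var 11) ▸ remDirtyᶜ ▸ set 10 (var 12) ▸ remDirtyᶜ ▸ childrenᶜ ▸ minᶜ ▸ electᶜ ▸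
  -- The new winner may beat the one above it; the mark is set without a comparison.
  set 10 (var 16) ▸ cond (fld parᶠ (var 10) ≐ num 0) nop (cond (fld dIdxᶠ (var 10) ≐ num 0) insDirtyᶜ nop)
reduceᶜ = selectᶜ ▸ siblingsᶜ ▸ liftᶜ ▸ mergeᶜ

-- Three distinct members of a set of three exhaust it. Needed to see that a parent of two dirty
-- nodes has no children but these and its winner.
three : ∀ {a b c x y z : ℕ} → (x ≡ a ⊎ x ≡ b ⊎ x ≡ c) → (y ≡ a ⊎ y ≡ b ⊎ y ≡ c) → (z ≡ a ⊎ z ≡ b ⊎ z ≡ c) →
        x ≢ y → x ≢ z → y ≢ z → ∀ {u} → u ≡ a ⊎ u ≡ b ⊎ u ≡ c → u ≡ x ⊎ u ≡ y ⊎ u ≡ z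
three {a} {b} {c} {x} {y} {z} x∈ y∈ z∈ x≢y x≢z y≢z {u} u∈ with u ≟ x | u ≟ y | u ≟ z
... | yes e | _ | _ = inj₁ e
... | no _ | yes e | _ = inj₂ (inj₁ e)
... | no _ | no _ | yes e = inj₂ (inj₂ e)
... | no nx | no ny | no nz = ⊥-elim (case u∈ of λ
    { (inj₁ refl) → two (rest₁ nx x∈) (rest₁ ny y∈) (rest₁ nz z∈)
    ; (inj₂ (inj₁ refl)) → two (rest₂ nx x∈) (rest₂ ny y∈) (rest₂ nz z∈)
    ; (inj₂ (inj₂ refl)) → two (rest₃ nx x∈) (rest₃ ny y∈) (rest₃ nz z∈) })
  where
  two : ∀ {p q} → x ≡ p ⊎ x ≡ q → y ≡ p ⊎ y ≡ q → z ≡ p ⊎ z ≡ q → ⊥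
  two (inj₁ e) (inj₁ f) _ = x≢y (trans e (sym f))
  two (inj₂ e) (inj₂ f) _ = x≢y (trans e (sym f))
  two (inj₁ e) (inj₂ f) (inj₁ g) = x≢z (trans e (sym g))
  two (inj₁ e) (inj₂ f) (inj₂ g) = y≢z (trans f (sym g))
  two (inj₂ e) (inj₁ f) (inj₁ g) = y≢z (trans f (sym g))
  two (inj₂ e) (inj₁ f) (inj₂ g) = x≢z (trans e (sym g))
  rest₁ : ∀ {v} → a ≢ v → v ≡ a ⊎ v ≡ b ⊎ v ≡ c → v ≡ b ⊎ v ≡ c
  rest₁ n (inj₁ e) = ⊥-elim (n (sym e))
  rest₁ n (inj₂ o) = o
  rest₂ : ∀ {v} → b ≢ v → v ≡ a ⊎ v ≡ b ⊎ v ≡ c → v ≡ a ⊎ v ≡ c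
  rest₂ n (inj₁ e) = inj₁ e
  rest₂ n (inj₂ (inj₁ e)) = ⊥-elim (n (sym e))
  rest₂ n (inj₂ (inj₂ e)) = inj₂ e
  rest₃ : ∀ {v} → c ≢ v → v ≡ a ⊎ v ≡ b ⊎ v ≡ c → v ≡ a ⊎ v ≡ b
  rest₃ n (inj₁ e) = inj₁ e
  rest₃ n (inj₂ (inj₁ e)) = inj₂ e
  rest₃ n (inj₂ (inj₂ e)) = ⊥-elim (n (sym e))

markᶜ decreaseᶜ insertᶜ : IC
markᶜ = set 10 (fld topᶠ (var argʳ)) ▸
  cond (fld parᶠ (var 10) ≐ num 0) nop (cond (fld dIdxᶠ (var 10) ≐ num 0) insDirtyᶜ nop)
decreaseᶜ = key (var argʳ) ▸ cond (var argʳ ≼ var minʳ) (set minʳ (var argʳ)) nop ▸ markᶜ ▸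
  cond (var dMaskʳ ≐ num 0) nop reduceᶜ
insertᶜ = newLeafᶜ ▸
  cond (var minʳ ≐ num 0) (set minʳ (var 14)) (cond (var 14 ≼ var minʳ) (set minʳ (var 14)) nop) ▸
  set argʳ (var 14) ▸ cond (var rMaskʳ ≐ num 0) nop joinᶜ

-- Contents lists under a change of key and a removal.

module Contents {a} {Key : Set a} where

  ptrs : List (ℕ × Key) → List ℕ
  ptrs = map proj₁

  change : ℕ → Key → List (ℕ × Key) → List (ℕ × Key)
  change x k = map (λ e → if proj₁ e ≡ᵇ x then (x , k) else e)

  change-≡ : ∀ {x y} {k k′ : Key} → y ≡ x → (if y ≡ᵇ x then (x , k) else (y , k′)) ≡ (x , k)
  change-≡ {x} {y = y} e with y ≡ᵇ x in eq
  ... | true  = refl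
  ... | false = ⊥-elim (subst T eq (≡⇒≡ᵇ y x e))

  change-≢ : ∀ {x y} {k k′ : Key} → y ≢ x → (if y ≡ᵇ x then (x , k) else (y , k′)) ≡ (y , k′)
  change-≢ {x} {y = y} n with y ≡ᵇ x in eq
  ... | false = refl
  ... | true  = ⊥-elim (n (≡ᵇ⇒≡ y x (subst T (sym eq) tt)))

  change-in : ∀ {x k y k′} h → y ≢ x → (y , k′) ∈ h → (y , k′) ∈ change x k h
  change-in (_ ∷ h) n (here refl) = here (sym (change-≢ n))
  change-in (_ ∷ h) n (there i) = there (change-in h n i)

  change-new : ∀ {x k k₀} h → (x , k₀) ∈ h → (x , k) ∈ change x k h
  change-new (_ ∷ h) (here refl) = here (sym (change-≡ refl))
  change-new (_ ∷ h) (there i) = there (change-new h i)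

  in-change : ∀ {x k y k′} h → (y , k′) ∈ change x k h → (y ≡ x × k′ ≡ k) ⊎ (y ≢ x × (y , k′) ∈ h)
  in-change {x} ((z , _) ∷ h) (here e) with z ≟ x
  ... | yes refl with trans e (change-≡ refl)
  ... | refl = inj₁ (refl , refl)
  in-change ((z , _) ∷ h) (here e) | no n with trans e (change-≢ n)
  ... | refl = inj₂ (n , here refl)
  in-change (_ ∷ h) (there i) with in-change h i
  ... | inj₁ r = inj₁ r
  ... | inj₂ (n , j) = inj₂ (n , there j)

  change-ptrs : ∀ x k h → ptrs (change x k h) ≡ ptrs h
  change-ptrs x k [] = refl
  change-ptrs x k ((y , _) ∷ h) with y ≟ x
  ... | yes refl = cong₂ _∷_ (cong proj₁ (change-≡ refl)) (change-ptrs x k h)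
  ... | no n = cong₂ _∷_ (cong proj₁ (change-≢ n)) (change-ptrs x k h)

  change-length : ∀ x k h → length (change x k h) ≡ length h
  change-length x k [] = refl
  change-length x k (_ ∷ h) = cong suc (change-length x k h)

  drop : ℕ → List (ℕ × Key) → List (ℕ × Key)
  drop x = filter (λ e → ¬? (proj₁ e ≟ x))

  drop-no : ∀ {x z k} h → z ≢ x → drop x ((z , k) ∷ h) ≡ (z , k) ∷ drop x h
  drop-no {x} h n = filter-accept (λ e → ¬? (proj₁ e ≟ x)) n

  drop-yes : ∀ {x k} h → drop x ((x , k) ∷ h) ≡ drop x h
  drop-yes {x} h = filter-reject (λ e → ¬? (proj₁ e ≟ x)) (λ n → n refl)

  in-drop : ∀ {x y k} h → (y , k) ∈ drop x h → y ≢ x × (y , k) ∈ h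
  in-drop {x} ((z , k) ∷ h) i with z ≟ x
  ... | yes refl = let n , j = in-drop h (subst (_ ∈_) (drop-yes {x} {k} h) i) in n , there j
  ... | no n with subst (_ ∈_) (drop-no h n) i
  ... | here refl = n , here refl
  ... | there i′ = let n , j = in-drop h i′ in n , there j

  drop-in : ∀ {x y k} h → y ≢ x → (y , k) ∈ h → (y , k) ∈ drop x h
  drop-in {x} ((z , k) ∷ h) n i with z ≟ x
  drop-in (_ ∷ h) n (here refl) | yes refl = ⊥-elim (n refl)
  drop-in {x} ((_ , k) ∷ h) n (there i) | yes refl = subst (_ ∈_) (sym (drop-yes {x} {k} h)) (drop-in h n i)
  drop-in (_ ∷ h) n (here refl) | no ne = subst (_ ∈_) (sym (drop-no h ne)) (here refl)
  drop-in (_ ∷ h) n (there i) | no ne = subst (_ ∈_) (sym (drop-no h ne)) (there (drop-in h n i))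

  ptr-in : ∀ {y} h → y ∈ ptrs h → ∃[ k ] ((y , k) ∈ h)
  ptr-in ((_ , k) ∷ h) (here refl) = k , here refl
  ptr-in (_ ∷ h) (there i) = let k , j = ptr-in h i in k , there j

  in-ptr : ∀ {y k} h → (y , k) ∈ h → y ∈ ptrs h
  in-ptr (_ ∷ h) (here refl) = here refl
  in-ptr (_ ∷ h) (there i) = there (in-ptr h i)

  all-≢ : ∀ {x : ℕ} (xs : List ℕ) → (∀ {y} → y ∈ xs → x ≢ y) → All (x ≢_) xs
  all-≢ [] f = []
  all-≢ (_ ∷ xs) f = f (here refl) ∷ all-≢ xs (f ∘ there)

  drop-unique : ∀ {x} h → Unique (ptrs h) → Unique (ptrs (drop x h))
  drop-unique [] u = []
  drop-unique {x} ((z , k) ∷ h) (a ∷ u) with z ≟ x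
  ... | yes refl = subst (Unique ∘ ptrs) (sym (drop-yes {x} {k} h)) (drop-unique h u)
  ... | no n = subst (Unique ∘ ptrs) (sym (drop-no h n))
    (all-≢ (ptrs (drop x h)) (λ i → All.lookup a (in-ptr h (proj₂ (in-drop h (proj₂ (ptr-in (drop x h) i)))))) ∷ drop-unique h u)

  drop-none : ∀ {x} h → x ∉ ptrs h → drop x h ≡ h
  drop-none [] n = refl
  drop-none {x} ((z , _) ∷ h) n with z ≟ x
  ... | yes refl = ⊥-elim (n (here refl))
  ... | no ne = trans (drop-no h ne) (cong (_ ∷_) (drop-none h (n ∘ there)))

  drop-length : ∀ {x k} h → Unique (ptrs h) → (x , k) ∈ h → length h ≡ suc (length (drop x h))
  drop-length {x} ((z , k) ∷ h) (a ∷ u) i with z ≟ x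
  ... | yes refl = cong (suc ∘ length) (sym (trans (drop-yes {x} {k} h) (drop-none h (λ j → All.lookup a j refl))))
  drop-length ((z , _) ∷ h) (a ∷ u) (here refl) | no n = ⊥-elim (n refl)
  drop-length ((z , _) ∷ h) (a ∷ u) (there i) | no n =
    cong suc (trans (drop-length h u i) (cong length (sym (drop-no h n))))

-- DeleteMin: programs and time constants.

climbᶜ descendᶜ considerᶜ scanInitᶜ scanStepᶜ scanᶜ deleteᶜ : IC
climbᶜ = sto pathᶠ (fld parᶠ (var 16)) (var 16) ▸ set 16 (fld parᶠ (var 16))
descendᶜ = splitᶜ ▸ set 16 (fld pathᶠ (var 16))
considerᶜ = set 12 (fld leafᶠ (var 11)) ▸ cond (var minʳ ≐ num 0) (set minʳ (var 12))
  (cond (var 12 ≼ var minʳ) (set minʳ (var 12)) nop)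
scanStepᶜ =
  cond (fld rCntᶠ (var 16) ≐ num 0) nop
    (set 11 (fld rEntᶠ (pairᵉ (var 16) (num 1))) ▸ considerᶜ ▸
     cond (fld rCntᶠ (var 16) ≐ num 1) nop (set 11 (fld rEntᶠ (pairᵉ (var 16) (num 2))) ▸ considerᶜ)) ▸
  cond (fld dCntᶠ (var 16) ≐ num 0) nop (set 11 (fld dEntᶠ (pairᵉ (var 16) (num 1))) ▸ considerᶜ) ▸
  set 16 (num 1 ⊕ var 16)
scanInitᶜ = set minʳ (num 0) ▸ set 16 (num 0) ▸ set 17 (num 1 ⊕ fld logᶠ (var sizeʳ))
scanᶜ = scanInitᶜ ▸ while (var 16 ≺ var 17) scanStepᶜ
deleteᶜ = set 16 (var minʳ) ▸ while (num 0 ≺ fld parᶠ (var 16)) climbᶜ ▸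
  while (num 0 ≺ fld htᶠ (var 16)) descendᶜ ▸ killᶜ ▸
  while (num 0 ≺ var rMaskʳ) joinᶜ ▸ while (num 0 ≺ var dMaskʳ) reduceᶜ ▸ scanᶜ

loopTime : ℕ → IT → IC → ℕ
loopTime k t c = k * (costᵗ ⟦ t ⟧ᵗ + time c) + costᵗ ⟦ t ⟧ᵗ

-- deleteTime is the coefficient of 1 + log n in the running time of deleteᶜ; the other constants account
-- for its final parts.
scanTime reduceTime joinTime killTime descendTime deleteTime : ℕ
scanTime    = time scanInitᶜ + loopTime 1 (var 16 ≺ var 17) scanStepᶜ
reduceTime  = loopTime 1 (num 0 ≺ var dMaskʳ) reduceᶜ + scanTime
joinTime    = loopTime 4 (num 0 ≺ var rMaskʳ) joinᶜ + reduceTime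
killTime    = time killᶜ + joinTime
descendTime = loopTime 1 (num 0 ≺ fld htᶠ (var 16)) descendᶜ + killTime
deleteTime  = time (set 16 (var minʳ)) + (loopTime 1 (num 0 ≺ fld parᶠ (var 16)) climbᶜ + descendTime)

loop-linear : ∀ j t c {k s} → k ≤ j * suc s → k * (costᵗ ⟦ t ⟧ᵗ + time c) + costᵗ ⟦ t ⟧ᵗ ≤ loopTime j t c * suc s
loop-linear j t c {k} {s} k≤ = begin
  k * a + b                 ≤⟨ +-mono-≤ (*-monoˡ-≤ a k≤) (m≤m*n b (suc s)) ⟩
  j * suc s * a + b * suc s ≡⟨ distrib-scale j a b (suc s) ⟩
  (j * a + b) * suc s       ∎
  where
  open ≤-Reasoning
  a b : ℕ
  a = costᵗ ⟦ t ⟧ᵗ + time c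
  b = costᵗ ⟦ t ⟧ᵗ

-- Sizes, buckets and allocation for heaps of at most `m` elements.

module Bounded {a ℓ₁ ℓ₂ : Level} (K : DecTotalOrder a ℓ₁ ℓ₂) (w m : ℕ) (cap : 3600 * suc m ≤ 2 ^ w) where

  open Semantics K w public
  open Contents {a} {Key} public

  l : ℕ
  l = ⌊log₂ m ⌋

  -- The successor is there for `m ≡ 0`, whose logarithm is taken to be 0.
  2^l≤ : 2 ^ l ≤ suc m
  2^l≤ with m ≟ 0
  ... | yes refl = s≤s z≤n
  ... | no n = m≤n⇒m≤1+n (2^log≤ m n)

  l<w : l < w
  l<w = ≰⇒> λ w≤l → <⇒≱ (≤-<-trans 2^l≤ (<-≤-trans (m<m*n (suc m) 3600 (s≤s (s≤s z≤n)))
    (≤-trans (≤-reflexive (*-comm (suc m) 3600)) cap))) (^-monoʳ-≤ 2 w≤l)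

  -- Origin of 3600: sixteen words for each record with index up to `220 * suc m` come to slightly
  -- more than `3520 * suc m`, and the rest is slack. The factor 220 comes from `pair-safe`.
  small : ∀ {v} → v ≤ 220 * suc m → Small v
  small {v} le = begin
    16 * suc v                          ≤⟨ *-monoʳ-≤ 16 (s≤s le) ⟩
    16 * suc (220 * suc m)              ≤⟨ m≤m+n _ (80 * m + 64) ⟩
    16 * suc (220 * suc m) + (80 * m + 64)  ≡⟨ cap-split m ⟩
    3600 * suc m                        ≤⟨ cap ⟩
    2 ^ w                               ∎
    where
    open ≤-Reasoning

  small-k : ∀ {v} k → k ≤ 220 → v ≤ k * suc m → Small v
  small-k k k≤ le = small (≤-trans le (*-monoˡ-≤ (suc m) k≤))

  small-pow : ∀ {r} → r ≤ l → Small (2 ^ r)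
  small-pow r≤ = small-k 1 (s≤s z≤n) (≤-trans (^-monoʳ-≤ 2 r≤) (≤-trans 2^l≤ (≤-reflexive (sym (*-identityˡ _)))))

  sq≤ : suc l * suc l ≤ 4 * suc m
  sq≤ = ≤-trans (square-≤ l) (*-monoʳ-≤ 4 2^l≤)

  small-7l : ∀ {v} → v ≤ 7 * suc l → Small v
  small-7l le = small (≤-trans le (≤-trans (*-monoʳ-≤ 7 (≤-trans (m≤m*n (suc l) (suc l)) sq≤))
    (≤-trans (≤-reflexive (sym (*-assoc 7 4 (suc m)))) (*-monoˡ-≤ (suc m) (m≤m+n 28 192)))))

  -- With `s = suc l`, the pair is at most `(7 s)² + 6 s ≤ 55 s²`, and `s² ≤ 4 * suc m`, which gives
  -- 220.
  pair-safe : ∀ {r i} → r ≤ l → i ≤ 6 * suc l →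
              Small (r + i) × Small ((r + i) * (r + i)) × Small (pair r i)
  pair-safe {r} {i} r≤ i≤ = small-7l s≤ , small (≤-trans (m≤m+n _ i) le) , small le
    where
    s≤ : r + i ≤ 7 * suc l
    s≤ = +-mono-≤ (m≤n⇒m≤1+n r≤) i≤
    le : pair r i ≤ 220 * suc m
    le = begin
      (r + i) * (r + i) + i                     ≤⟨ +-mono-≤ (*-mono-≤ s≤ s≤) i≤ ⟩
      (7 * suc l) * (7 * suc l) + 6 * suc l     ≤⟨ +-monoʳ-≤ (7 * suc l * (7 * suc l)) (*-monoʳ-≤ 6 (m≤m*n (suc l) (suc l))) ⟩
      (7 * suc l) * (7 * suc l) + 6 * (suc l * suc l) ≡⟨ square-sum (suc l) ⟩
      55 * (suc l * suc l)                      ≤⟨ *-monoʳ-≤ 55 sq≤ ⟩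
      55 * (4 * suc m)                          ≡⟨ *-assoc 55 4 (suc m) ⟨
      220 * suc m                               ∎
      where
      open ≤-Reasoning

  -- The condition `Safe` of `pairᵉ`, unfolded for operands that have none of their own.
  PairSafe : ℕ → ℕ → Set
  PairSafe r i = ((⊤ × ⊤ × Small (r + i)) × (⊤ × ⊤ × Small (r + i)) × Small ((r + i) * (r + i))) × ⊤ × Small (pair r i)

  pairSafe : ∀ {r i} → r ≤ l → i ≤ 6 * suc l → PairSafe r i
  pairSafe r≤ i≤ = let s , s² , s³ = pair-safe r≤ i≤ in ((_ , _ , s) , (_ , _ , s) , s²) , _ , s³

  -- For root buckets this is the number of elements, since a perfect ternary tree of height `r` has
  -- `3 ^ r` leaves.
  weight : (ℕ → ℕ) → ℕ
  weight c = sumTo w (λ r → c r * 3 ^ r)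

  -- The bound on `cnt` is generous: between operations there are at most `2 * suc l` roots and
  -- `suc l` dirty nodes, and dissolving a path leaves at most `4 * suc l` roots.
  record BI (ht idx B c : ℕ → ℕ) (t M : ℕ) : Set where
    field
      bkt : Bucket ht idx B c
      msk : M ≡ mask w t c
      low : ∀ {z} → idx z ≢ 0 → ht z ≤ l
      cnt : sumTo w c ≤ 6 * suc l
    open Bucket bkt public

    occupied : ∀ {r} → c r ≢ 0 → r ≤ l
    occupied n with nonempty n
    ... | x , ix , refl = low ix

    count-≤ : ∀ r → c r ≤ sumTo w c
    count-≤ r with c r ≟ 0
    ... | yes e = subst (_≤ sumTo w c) (sym e) z≤n
    ... | no n = sumTo-term c (≤-<-trans (occupied n) l<w)

    mask-small : 1 ≤ t → Small M
    mask-small 1≤t = small-k 2 (s≤s (s≤s z≤n)) (begin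
      M              ≡⟨ msk ⟩
      mask w t c     ≤⟨ <⇒≤ (mask-cut {suc l} {w} {t} {c} λ {r} l<r _ → ≤-trans (s≤s (≤-reflexive (zero′ l<r))) 1≤t) ⟩
      2 ^ suc l      ≤⟨ *-monoʳ-≤ 2 2^l≤ ⟩
      2 * suc m      ∎)
      where
      open ≤-Reasoning
      zero′ : ∀ {r} → l < r → c r ≡ 0
      zero′ {r} l<r with c r ≟ 0
      ... | yes e = e
      ... | no n = ⊥-elim (<⇒≱ l<r (occupied n))

  bi-ht : ∀ {ht ht′ idx B c t M} → (∀ {z} → idx z ≢ 0 → ht′ z ≡ ht z) → BI ht idx B c t M →
          BI ht′ idx B c t M
  bi-ht {ht} {ht′} {idx} {B} {c} h b = record
    { bkt = record
        { member = λ {x} ix → subst (λ r → idx x ≤ c r × B (pair r (idx x)) ≡ x) (sym (h ix)) (BI.member b ix)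
        ; entry = λ p q → let e , f = BI.entry b p q in e , trans (h (BI.entry-in b p q)) f }
    ; msk = BI.msk b ; low = λ iz → subst (_≤ l) (sym (h iz)) (BI.low b iz) ; cnt = BI.cnt b }

  Added : (idx : ℕ → ℕ) (x : ℕ) (idx′ : ℕ → ℕ) → Set
  Added idx x idx′ = idx′ x ≢ 0 × (∀ {z} → z ≢ x → idx′ z ≡ idx z)

  -- Weaker than `Added`, which fixes all other indices: a removal renumbers the member that fills
  -- the gap, so only membership is tracked.
  Removed : (idx : ℕ → ℕ) (x : ℕ) (idx′ : ℕ → ℕ) → Set
  Removed idx x idx′ = (∀ {z} → z ≢ x → idx z ≢ 0 → idx′ z ≢ 0) × (∀ {z} → idx′ z ≢ 0 → idx z ≢ 0 × z ≢ x)

  bi-insert : ∀ {ht idx B c t M x idx′ B′ c′ M′} → BI ht idx B c t M → idx x ≡ 0 → ht x ≤ l →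
    sumTo w c < 6 * suc l →
    Upd c (ht x) (suc (c (ht x))) c′ → Upd B (pair (ht x) (suc (c (ht x)))) x B′ →
    Upd idx x (suc (c (ht x))) idx′ → M′ ≡ mask w t c′ → BI ht idx′ B′ c′ t M′
  bi-insert {ht} {idx} {x = x} {idx′} b ix hx lt uc uB ui e = record
    { bkt = bucket-insert (BI.bkt b) ix uc uB ui ; msk = e ; low = λ {z} → low′ {z}
    ; cnt = ≤-trans (≤-reflexive (count-insert (λ _ → 0) (≤-<-trans hx l<w) uc)) lt }
    where
    low′ : ∀ {z} → idx′ z ≢ 0 → ht z ≤ l
    low′ {z} iz with z ≟ x
    ... | yes refl = hx
    ... | no n = BI.low b (iz ∘ trans (Upd.off ui n))

  -- Proved once for each family of buckets, because reading and writing fields computes only when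
  -- the field number is a numeral.
  InsSpec : (i b c m t : ℕ) {_ : T (i <ᵇ 16)} {_ : T (b <ᵇ 16)} {_ : T (c <ᵇ 16)} {_ : T (m <ᵇ 24)} {_ : T (t <ᵇ 32)} → Set _
  InsSpec i b c m t {p₁} {p₂} {p₃} {p₄} {p₅} = ∀ {A Q} → let x = rg A 10; ht = fd A htᶠ in
    BI ht (fd A i) (fd A b) (fd A c) t (rg A m) → fd A i x ≡ 0 → ht x ≤ l →
    sumTo w (fd A c) < 6 * suc l →
    (∀ {i′ b′ c′ M′ r₇ r₈} → BI ht i′ b′ c′ t M′ → Added (fd A i) x i′ →
      sumTo w c′ ≡ suc (sumTo w (fd A c)) → weight c′ ≡ 3 ^ ht x + weight (fd A c) →
      Q (row c c′ (row b b′ (row i i′ (setR m M′ (setR 8 r₈ (setR 7 r₇ A))))))) →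
    WP (insᶜ i b c m t {p₁} {p₂} {p₃} {p₄} {p₅}) Q A

  ins-dirty : InsSpec dIdxᶠ dEntᶠ dCntᶠ dMaskʳ 2
  ins-dirty {A} {Q} bi ix hx lt k =
    setW r refl _ (setW n refl (_ , _ , small-7l (≤-trans n≤ (*-monoˡ-≤ (suc l) (n≤1+n 6))))
    (stoW b′ refl (pairSafe hx n≤) _ (stoW i′ refl _ _ (stoW c′ refl _ _
    (if≡ _ _
      (λ e → let out = bi′ (trans (cong (_+ 2 ^ r) msk) (sym (mask-insert-≡ r<w uc e))) in
        lastW (rg A dMaskʳ + 2 ^ r) refl (_ , (_ , small-pow hx) , BI.mask-small out (s≤s z≤n)) (k out added s₁ s₂))
      (λ ne → skipW (k (bi′ (trans msk (sym (mask-insert-≢ r<w uc ne)))) added s₁ s₂)))))))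
    where
    open BI bi using (msk; count-≤)
    x r n : ℕ
    x = rg A 10
    r = fd A htᶠ x
    n = suc (fd A dCntᶠ r)
    i′ b′ c′ : ℕ → ℕ
    i′ = update (fd A dIdxᶠ) x n
    b′ = update (fd A dEntᶠ) (pair r n) x
    c′ = update (fd A dCntᶠ) r n
    n≤ : n ≤ 6 * suc l
    n≤ = ≤-<-trans (count-≤ r) lt
    r<w : r < w
    r<w = ≤-<-trans hx l<w
    uc : Upd (fd A dCntᶠ) r n c′
    uc = upd (fd A dCntᶠ) r n
    ui : Upd (fd A dIdxᶠ) x n i′
    ui = upd (fd A dIdxᶠ) x n
    bi′ : ∀ {M′} → M′ ≡ mask w 2 c′ → BI (fd A htᶠ) i′ b′ c′ 2 M′
    bi′ = bi-insert bi ix hx lt uc (upd (fd A dEntᶠ) (pair r n) x) ui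
    added : Added (fd A dIdxᶠ) x i′
    added = (λ e → 1+n≢0 (trans (sym (Upd.at ui)) e)) , Upd.off ui
    s₁ : sumTo w c′ ≡ suc (sumTo w (fd A dCntᶠ))
    s₁ = count-insert (λ _ → 0) r<w uc
    s₂ : weight c′ ≡ 3 ^ r + weight (fd A dCntᶠ)
    s₂ = weigh-insert (3 ^_) r<w uc

  ins-root : InsSpec rIdxᶠ rEntᶠ rCntᶠ rMaskʳ 3
  ins-root {A} {Q} bi ix hx lt k =
    setW r refl _ (setW n refl (_ , _ , small-7l (≤-trans n≤ (*-monoˡ-≤ (suc l) (n≤1+n 6))))
    (stoW b′ refl (pairSafe hx n≤) _ (stoW i′ refl _ _ (stoW c′ refl _ _
    (if≡ _ _
      (λ e → let out = bi′ (trans (cong (_+ 2 ^ r) msk) (sym (mask-insert-≡ r<w uc e))) in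
        lastW (rg A rMaskʳ + 2 ^ r) refl (_ , (_ , small-pow hx) , BI.mask-small out (s≤s z≤n)) (k out added s₁ s₂))
      (λ ne → skipW (k (bi′ (trans msk (sym (mask-insert-≢ r<w uc ne)))) added s₁ s₂)))))))
    where
    open BI bi using (msk; count-≤)
    x r n : ℕ
    x = rg A 10
    r = fd A htᶠ x
    n = suc (fd A rCntᶠ r)
    i′ b′ c′ : ℕ → ℕ
    i′ = update (fd A rIdxᶠ) x n
    b′ = update (fd A rEntᶠ) (pair r n) x
    c′ = update (fd A rCntᶠ) r n
    n≤ : n ≤ 6 * suc l
    n≤ = ≤-<-trans (count-≤ r) lt
    r<w : r < w
    r<w = ≤-<-trans hx l<w
    uc : Upd (fd A rCntᶠ) r n c′
    uc = upd (fd A rCntᶠ) r n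
    ui : Upd (fd A rIdxᶠ) x n i′
    ui = upd (fd A rIdxᶠ) x n
    bi′ : ∀ {M′} → M′ ≡ mask w 3 c′ → BI (fd A htᶠ) i′ b′ c′ 3 M′
    bi′ = bi-insert bi ix hx lt uc (upd (fd A rEntᶠ) (pair r n) x) ui
    added : Added (fd A rIdxᶠ) x i′
    added = (λ e → 1+n≢0 (trans (sym (Upd.at ui)) e)) , Upd.off ui
    s₁ : sumTo w c′ ≡ suc (sumTo w (fd A rCntᶠ))
    s₁ = count-insert (λ _ → 0) r<w uc
    s₂ : weight c′ ≡ 3 ^ r + weight (fd A rCntᶠ)
    s₂ = weigh-insert (3 ^_) r<w uc

  bi-remove : ∀ {ht idx B c t M x B′ c′ idx₁ idx′ M′} → BI ht idx B c t M → idx x ≢ 0 →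
    let r = ht x; y = B (pair r (c r)) in
    Upd B (pair r (idx x)) y B′ → Upd idx y (idx x) idx₁ → Upd idx₁ x 0 idx′ →
    Upd c r (c r ∸ 1) c′ → M′ ≡ mask w t c′ →
    BI ht idx′ B′ c′ t M′ × Removed idx x idx′ × suc (sumTo w c′) ≡ sumTo w c ×
    3 ^ ht x + weight c′ ≡ weight c
  bi-remove {ht} {idx} {B} {c} {t} {x = x} {c′ = c′} b ix uB u₁ u₂ uc e
    with bucket-remove (BI.bkt b) ix uB u₁ u₂ uc
  ... | b′ , keep , only = record
    { bkt = b′ ; msk = e ; low = λ {z} n → BI.low b (proj₁ (only n))
    ; cnt = ≤-trans (n≤1+n _) (≤-trans (≤-reflexive s₁) (BI.cnt b)) } , ((λ {z} → keep {z}) , λ {z} → only {z}) , s₁ ,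
    sym (weigh-insert (3 ^_) r<w back)
    where
    r<w = ≤-<-trans (BI.low b ix) l<w
    -- Size and weight of the old bucket are those of an insertion into the new one.
    back : Upd c′ (ht x) (suc (c′ (ht x))) c
    back = mkUpd (sym (trans (cong suc (Upd.at uc)) (m+[n∸m]≡n (n≢0⇒n>0 (BI.count≢0 b ix))))) (λ n → sym (Upd.off uc n))
    s₁ = sym (count-insert (λ _ → 0) r<w back)

  RemSpec : (i b c m t : ℕ) {_ : T (i <ᵇ 16)} {_ : T (b <ᵇ 16)} {_ : T (c <ᵇ 16)} {_ : T (m <ᵇ 24)} {_ : T (t <ᵇ 32)} → Set _
  RemSpec i b c m t {p₁} {p₂} {p₃} {p₄} {p₅} = ∀ {A Q} → let x = rg A 10; ht = fd A htᶠ in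
    BI ht (fd A i) (fd A b) (fd A c) t (rg A m) → fd A i x ≢ 0 →
    (∀ {i′ b′ c′ M′ r₇ r₈ r₉} → BI ht i′ b′ c′ t M′ → Removed (fd A i) x i′ →
      suc (sumTo w c′) ≡ sumTo w (fd A c) → 3 ^ ht x + weight c′ ≡ weight (fd A c) →
      Q (row c c′ (row b b′ (row i i′ (setR m M′ (setR 9 r₉ (setR 8 r₈ (setR 7 r₇ A)))))))) →
    WP (remᶜ i b c m t {p₁} {p₂} {p₃} {p₄} {p₅}) Q A

  rem-dirty : RemSpec dIdxᶠ dEntᶠ dCntᶠ dMaskʳ 2
  rem-dirty {A} {Q} bi ix k =
    setW r refl _ (setW (fd A dCntᶠ r) refl _ (setW y refl (pairSafe hx c≤)
    (stoW b′ refl (pairSafe hx (≤-trans (proj₁ (BI.member bi ix)) c≤)) _ (stoW i₁ refl _ _ (stoW i′ refl _ _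
    (stoW c′ refl _ (_ , _ , n≢0⇒n>0 c≢0)
    (if≡ _ _
      (λ e → lastW (rg A dMaskʳ ∸ 2 ^ r) refl (_ , (_ , small-pow hx) ,
                ≤-trans (≤-reflexive (sym (bit-1 {2} {fd A dCntᶠ} {r} (≤-reflexive (sym e)))))
                  (≤-trans (sumTo-term (bit 2 (fd A dCntᶠ)) r<w) (≤-reflexive (sym msk))))
              (out (trans (cong (_∸ 2 ^ r) msk) (sym (mask-remove-≡ r<w uc c≢0 e)))))
      (λ n → skipW (out (trans msk (sym (mask-remove-≢ r<w uc c≢0 n))))))))))))
    where
    open BI bi using (msk; count-≤)
    x r y : ℕ
    x = rg A 10
    r = fd A htᶠ x
    y = fd A dEntᶠ (pair r (fd A dCntᶠ r))
    i₁ i′ b′ c′ : ℕ → ℕ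
    i₁ = update (fd A dIdxᶠ) y (fd A dIdxᶠ x)
    i′ = update i₁ x 0
    b′ = update (fd A dEntᶠ) (pair r (fd A dIdxᶠ x)) y
    c′ = update (fd A dCntᶠ) r (fd A dCntᶠ r ∸ 1)
    hx : r ≤ l
    hx = BI.low bi ix
    r<w : r < w
    r<w = ≤-<-trans hx l<w
    c≢0 : fd A dCntᶠ r ≢ 0
    c≢0 = BI.count≢0 bi ix
    c≤ : fd A dCntᶠ r ≤ 6 * suc l
    c≤ = ≤-trans (count-≤ r) (BI.cnt bi)
    uc : Upd (fd A dCntᶠ) r (fd A dCntᶠ r ∸ 1) c′
    uc = upd (fd A dCntᶠ) r (fd A dCntᶠ r ∸ 1)
    removed : ∀ {M′} → M′ ≡ mask w 2 c′ → BI (fd A htᶠ) i′ b′ c′ 2 M′ × Removed (fd A dIdxᶠ) x i′ ×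
      suc (sumTo w c′) ≡ sumTo w (fd A dCntᶠ) × 3 ^ r + weight c′ ≡ weight (fd A dCntᶠ)
    removed = bi-remove bi ix (upd (fd A dEntᶠ) (pair r (fd A dIdxᶠ x)) y) (upd (fd A dIdxᶠ) y (fd A dIdxᶠ x)) (upd i₁ x 0) uc
    out : ∀ {M′} → M′ ≡ mask w 2 c′ →
          Q (row dCntᶠ c′ (row dEntᶠ b′ (row dIdxᶠ i′ (setR dMaskʳ M′ (setR 9 y (setR 8 (fd A dCntᶠ r) (setR 7 r A)))))))
    out e = let b , rm , s₁ , s₂ = removed e in k b rm s₁ s₂

  rem-root : RemSpec rIdxᶠ rEntᶠ rCntᶠ rMaskʳ 3
  rem-root {A} {Q} bi ix k =
    setW r refl _ (setW (fd A rCntᶠ r) refl _ (setW y refl (pairSafe hx c≤)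
    (stoW b′ refl (pairSafe hx (≤-trans (proj₁ (BI.member bi ix)) c≤)) _ (stoW i₁ refl _ _ (stoW i′ refl _ _
    (stoW c′ refl _ (_ , _ , n≢0⇒n>0 c≢0)
    (if≡ _ _
      (λ e → lastW (rg A rMaskʳ ∸ 2 ^ r) refl (_ , (_ , small-pow hx) ,
                ≤-trans (≤-reflexive (sym (bit-1 {3} {fd A rCntᶠ} {r} (≤-reflexive (sym e)))))
                  (≤-trans (sumTo-term (bit 3 (fd A rCntᶠ)) r<w) (≤-reflexive (sym msk))))
              (out (trans (cong (_∸ 2 ^ r) msk) (sym (mask-remove-≡ r<w uc c≢0 e)))))
      (λ n → skipW (out (trans msk (sym (mask-remove-≢ r<w uc c≢0 n))))))))))))
    where
    open BI bi using (msk; count-≤)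
    x r y : ℕ
    x = rg A 10
    r = fd A htᶠ x
    y = fd A rEntᶠ (pair r (fd A rCntᶠ r))
    i₁ i′ b′ c′ : ℕ → ℕ
    i₁ = update (fd A rIdxᶠ) y (fd A rIdxᶠ x)
    i′ = update i₁ x 0
    b′ = update (fd A rEntᶠ) (pair r (fd A rIdxᶠ x)) y
    c′ = update (fd A rCntᶠ) r (fd A rCntᶠ r ∸ 1)
    hx : r ≤ l
    hx = BI.low bi ix
    r<w : r < w
    r<w = ≤-<-trans hx l<w
    c≢0 : fd A rCntᶠ r ≢ 0
    c≢0 = BI.count≢0 bi ix
    c≤ : fd A rCntᶠ r ≤ 6 * suc l
    c≤ = ≤-trans (count-≤ r) (BI.cnt bi)
    uc : Upd (fd A rCntᶠ) r (fd A rCntᶠ r ∸ 1) c′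
    uc = upd (fd A rCntᶠ) r (fd A rCntᶠ r ∸ 1)
    removed : ∀ {M′} → M′ ≡ mask w 3 c′ → BI (fd A htᶠ) i′ b′ c′ 3 M′ × Removed (fd A rIdxᶠ) x i′ ×
      suc (sumTo w c′) ≡ sumTo w (fd A rCntᶠ) × 3 ^ r + weight c′ ≡ weight (fd A rCntᶠ)
    removed = bi-remove bi ix (upd (fd A rEntᶠ) (pair r (fd A rIdxᶠ x)) y) (upd (fd A rIdxᶠ) y (fd A rIdxᶠ x)) (upd i₁ x 0) uc
    out : ∀ {M′} → M′ ≡ mask w 3 c′ →
          Q (row rCntᶠ c′ (row rEntᶠ b′ (row rIdxᶠ i′ (setR rMaskʳ M′ (setR 9 y (setR 8 (fd A rCntᶠ r) (setR 7 r A)))))))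
    out e = let b , rm , s₁ , s₂ = removed e in k b rm s₁ s₂

  -- Free nodes, node identifiers and the table of logarithms.

  record AI (W FS LG : ℕ → ℕ) (β φ : ℕ) : Set where
    field
      ids      : ∀ {x} → W x ≢ 0 → x ≤ β
      free     : ∀ {i} → i < φ → FS i ≢ 0 × FS i ≤ β × W (FS i) ≡ 0
      distinct : ∀ {i j} → i < φ → j < φ → FS i ≡ FS j → i ≡ j
      logs     : ∀ {i} → i ≤ 2 * β + 1 → LG i ≡ ⌊log₂ i ⌋
      nul      : W 0 ≡ 0
      space    : 2 * β ≤ 3 * m

  β≤ : ∀ {β} → 2 * β ≤ 3 * m → β ≤ 3 * m
  β≤ {β} le = ≤-trans (m≤m+n β (β + 0)) le

  small-id : ∀ {x} → 2 * x ≤ 3 * m → Small x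
  small-id le = small-k 3 (m≤m+n 3 217) (≤-trans (β≤ le) (*-monoʳ-≤ 3 (n≤1+n m)))

  small-slot : ∀ {x j} → 2 * x ≤ 3 * m → j ≤ 6 → Small (4 * x + j)
  small-slot {x} {j} le j≤ = small-k 6 (m≤m+n 6 214) (begin
    4 * x + j        ≤⟨ +-mono-≤ (≤-reflexive (*-assoc 2 2 x)) j≤ ⟩
    2 * (2 * x) + 6  ≤⟨ +-monoˡ-≤ 6 (*-monoʳ-≤ 2 le) ⟩
    2 * (3 * m) + 6  ≡⟨ six-suc m ⟩
    6 * suc m        ∎)
    where
    open ≤-Reasoning

  small-slot₀ : ∀ {x} → 2 * x ≤ 3 * m → Small (4 * x)
  small-slot₀ {x} le = subst Small (+-identityʳ (4 * x)) (small-slot {x} {0} le z≤n)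

  log≤ : ∀ n → ⌊log₂ n ⌋ ≤ n
  log≤ zero = z≤n
  log≤ n@(suc _) = ≤-trans (<⇒≤ (n<2^n ⌊log₂ n ⌋)) (2^log≤ n 1+n≢0)
    where
    n<2^n : ∀ n → n < 2 ^ n
    n<2^n zero = s≤s z≤n
    n<2^n (suc n) = ≤-trans (+-mono-≤ (0<2^ n) (n<2^n n)) (≤-reflexive (sym (2^suc n)))

  ai-live : ∀ {W FS LG β φ p v W′} → AI W FS LG β φ → p ≢ 0 → p ≤ β → (∀ {i} → i < φ → FS i ≢ p) →
            Upd W p v W′ → AI W′ FS LG β φ
  ai-live {W} {p = p} ai p≢0 p≤ np (mkUpd at off) = record
    { ids = λ {x} lx → case x ≟ p of λ
        { (yes refl) → p≤ ; (no n) → AI.ids ai (λ e → lx (trans (off n) e)) }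
    ; free = λ i< → let f≢ , f≤ , f = AI.free ai i< in f≢ , f≤ , trans (off (np i<)) f
    ; distinct = AI.distinct ai ; logs = AI.logs ai
    ; nul = trans (off (p≢0 ∘ sym)) (AI.nul ai) ; space = AI.space ai }

  module _ {W FS LG : ℕ → ℕ} {β : ℕ} where

    -- The entry for `suc β` is available since `suc β ≤ 2 * β + 1`; it yields the two that extend
    -- the table to `2 * suc β + 1`.
    ai-bump : ∀ {L₁ L′ v} → AI W FS LG β 0 → 2 * suc β ≤ 3 * m → v ≡ suc (LG (suc β)) →
              Upd LG (2 * suc β) v L₁ → Upd L₁ (2 * suc β + 1) v L′ → AI W FS L′ (suc β) 0
    ai-bump {L₁} {L′} {v} ai le e (mkUpd at₁ off₁) (mkUpd at₂ off₂) = record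
      { ids = m≤n⇒m≤1+n ∘ AI.ids ai ; free = λ () ; distinct = λ ()
      ; logs = logs′ ; nul = AI.nul ai ; space = le }
      where
      v≡ : v ≡ suc ⌊log₂ suc β ⌋
      v≡ = trans e (cong suc (AI.logs ai (≤-trans (s≤s (m≤m+n β (β + 0))) (≤-reflexive (+-comm 1 (2 * β))))))
      logs′ : ∀ {i} → i ≤ 2 * suc β + 1 → L′ i ≡ ⌊log₂ i ⌋
      logs′ {i} i≤ =
        decide i (2 * suc β + 1) (λ { refl → trans at₂ (trans v≡ (sym (log-2*+1 (suc β) 1+n≢0))) }) λ n →
        decide i (2 * suc β) (λ { refl → trans (off₂ n) (trans at₁ (trans v≡ (sym (log-2* (suc β) 1+n≢0)))) }) λ n′ →
        trans (off₂ n) (trans (off₁ n′) (AI.logs ai (s≤s⁻¹ (s≤s⁻¹ (begin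
          2 + i             ≤⟨ s≤s (≤∧≢⇒< (s≤s⁻¹ (≤-trans (≤∧≢⇒< i≤ n) (≤-reflexive (+-comm (2 * suc β) 1)))) n′) ⟩
          1 + 2 * suc β     ≡⟨ two-suc β ⟩
          2 + (2 * β + 1)   ∎)))))
        where
        open ≤-Reasoning

    ai-pop : ∀ {φ} → AI W FS LG β (suc φ) → AI W FS LG β φ × (∀ {i} → i < φ → FS i ≢ FS φ)
    ai-pop {φ} ai = record
      { ids = AI.ids ai ; free = AI.free ai ∘ m≤n⇒m≤1+n
      ; distinct = λ p q → AI.distinct ai (m≤n⇒m≤1+n p) (m≤n⇒m≤1+n q)
      ; logs = AI.logs ai ; nul = AI.nul ai ; space = AI.space ai } ,
      λ i< e → <⇒≢ i< (AI.distinct ai (m≤n⇒m≤1+n i<) ≤-refl e)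

    -- Entries of the stack are dead while `x` is live up to this point, so `x` is not yet on it and
    -- entries stay distinct.
    ai-push : ∀ {φ x FS′ W′} → AI W FS LG β φ → W x ≢ 0 → Upd FS φ x FS′ → Upd W x 0 W′ →
              AI W′ FS′ LG β (suc φ)
    ai-push {φ} {x} {FS′} {W′} ai lx (mkUpd at off) (mkUpd W-at W-off) = record
      { ids = λ {z} lz → AI.ids ai (live lz)
      ; free = free′ ; distinct = distinct′ ; logs = AI.logs ai
      ; nul = trans (W-off (λ { refl → lx (AI.nul ai) })) (AI.nul ai) ; space = AI.space ai }
      where
      live : ∀ {z} → W′ z ≢ 0 → W z ≢ 0
      live {z} lz = decide z x (λ { refl → lx }) (λ n e → lz (trans (W-off n) e))
      ≢x : ∀ {i} → i < φ → FS i ≢ x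
      ≢x i< refl = lx (proj₂ (proj₂ (AI.free ai i<)))
      free′ : ∀ {i} → i < suc φ → FS′ i ≢ 0 × FS′ i ≤ β × W′ (FS′ i) ≡ 0
      free′ {i} i≤ = decide i φ
        (λ e → subst Ok (sym (trans (cong FS′ e) at)) ((λ e → lx (trans (cong W e) (AI.nul ai))) , AI.ids ai lx , W-at))
        (λ n → let i< = ≤∧≢⇒< (s≤s⁻¹ i≤) n; p , q , e = AI.free ai i< in
          subst Ok (sym (off n)) (p , q , trans (W-off (≢x i<)) e))
        where
        Ok : ℕ → Set
        Ok y = y ≢ 0 × y ≤ β × W′ y ≡ 0
      distinct′ : ∀ {i j} → i < suc φ → j < suc φ → FS′ i ≡ FS′ j → i ≡ j
      distinct′ {i} {j} i≤ j≤ e = decide i φ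
        (λ p → decide j φ (λ q → trans p (sym q)) (λ n →
          ⊥-elim (≢x (≤∧≢⇒< (s≤s⁻¹ j≤) n) (trans (sym (off n)) (trans (sym e) (trans (cong FS′ p) at))))))
        (λ n → decide j φ
          (λ q → ⊥-elim (≢x (≤∧≢⇒< (s≤s⁻¹ i≤) n) (trans (sym (off n)) (trans e (trans (cong FS′ q) at)))))
          (λ n′ → AI.distinct ai (≤∧≢⇒< (s≤s⁻¹ i≤) n) (≤∧≢⇒< (s≤s⁻¹ j≤) n′) (trans (sym (off n)) (trans e (off n′)))))

  -- The last equation says that the number of identifiers in use, `β` minus `φ`, grows by one,
  -- without subtraction. Space has to be shown only when the stack is empty.
  alloc-wp : ∀ {A Q} → AI (fd A leafᶠ) (fd A freeᶠ) (fd A logᶠ) (rg A lastʳ) (rg A freeʳ) →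
    (rg A freeʳ ≡ 0 → 2 * suc (rg A lastʳ) ≤ 3 * m) →
    (∀ {L β φ p r₇} → AI (fd A leafᶠ) (fd A freeᶠ) L β φ → p ≢ 0 → fd A leafᶠ p ≡ 0 → p ≤ β →
       (∀ {i} → i < φ → fd A freeᶠ i ≢ p) → β + rg A freeʳ ≡ suc (rg A lastʳ + φ) →
       Q (row logᶠ L (setR 14 p (setR 7 r₇ (setR freeʳ φ (setR lastʳ β A)))))) →
    WP allocᶜ Q A
  alloc-wp {A} {Q} ai room k = ⟪ _ , fresh , reuse ⟫
    where
    β = rg A lastʳ
    fresh : rg A freeʳ ≡ 0 → _
    fresh e = (_ , _ , sβ) , (_ , _ , small-k 4 (m≤m+n 4 216) (begin
        suc (fd A logᶠ (suc β))  ≡⟨ cong suc (AI.logs ai (≤-trans (s≤s (m≤m+n β (β + 0))) (≤-reflexive (+-comm 1 (2 * β))))) ⟩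
        suc ⌊log₂ suc β ⌋      ≤⟨ s≤s (log≤ (suc β)) ⟩
        suc (suc β)            ≤⟨ s≤s (β≤ (room e)) ⟩
        suc (3 * m)            ≤⟨ +-mono-≤ (s≤s (z≤n {m})) (*-monoʳ-≤ 3 (n≤1+n m)) ⟩
        suc m + 3 * suc m      ∎)) ,
      ((_ , _ , s2β) , _) , (((_ , _ , s2β) , _ , s2β+1) , _) , _ ,
      k {φ = rg A freeʳ} (subst (AI _ _ _ _) (sym e) (ai-bump (subst (AI _ _ _ _) e ai) (room e) refl (upd _ _ _) (upd _ _ _)))
        1+n≢0 (dead refl) ≤-refl (λ {i} i< → ⊥-elim (n≮0 (subst (i <_) e i<))) refl
      where
      open ≤-Reasoning
      sβ : Small (suc β)
      sβ = small-id {suc β} (room e)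
      s2β : Small (2 * suc β)
      s2β = small-k 3 (m≤m+n 3 217) (≤-trans (room e) (*-monoʳ-≤ 3 (n≤1+n m)))
      s2β+1 : Small (2 * suc β + 1)
      s2β+1 = small-k 3 (m≤m+n 3 217) (≤-trans (+-mono-≤ (room e) (s≤s z≤n)) (≤-trans (m≤m+n (3 * m + 1) 2)
        (≤-reflexive (three-suc m))))
      dead : ∀ {p} → p ≡ suc β → fd A leafᶠ p ≡ 0
      dead refl = none (λ n → 1+n≰n (AI.ids ai n))
    reuse : rg A freeʳ ≢ 0 → _
    reuse n = (_ , _ , n≢0⇒n>0 n) , _ ,
      k (proj₁ popped) (proj₁ f) (proj₂ (proj₂ f)) (proj₁ (proj₂ f)) (proj₂ popped)
        (trans (cong (β +_) (sym s)) (+-suc β _))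
      where
      s : suc (rg A freeʳ ∸ 1) ≡ rg A freeʳ
      s = m+[n∸m]≡n (n≢0⇒n>0 n)
      popped = ai-pop (subst (AI _ _ _ _) (sym s) ai)
      f = AI.free ai (≤-reflexive s)

  free-wp : ∀ {A Q} → AI (fd A leafᶠ) (fd A freeᶠ) (fd A logᶠ) (rg A lastʳ) (rg A freeʳ) → fd A leafᶠ (rg A 10) ≢ 0 →
    suc (rg A freeʳ) ≤ 3 * suc m →
    (∀ {FS} → (∀ {W′} → Upd (fd A leafᶠ) (rg A 10) 0 W′ → AI W′ FS (fd A logᶠ) (rg A lastʳ) (suc (rg A freeʳ))) →
       Q (row freeᶠ FS (setR freeʳ (suc (rg A freeʳ)) A))) →
    WP freeᶜ Q A
  free-wp ai lx le k = ⟪ _ , (_ , _ , small-k 3 (m≤m+n 3 217) le) , k (ai-push ai lx (upd _ _ _)) ⟫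

  min-wp : ∀ {A Q} → let W = fd A leafᶠ; x = rg A 18; y = rg A 19; z = rg A 20 in
    ∃[ k ] (C A (W x) ≡ just k) → ∃[ k ] (C A (W y) ≡ just k) → ∃[ k ] (C A (W z) ≡ just k) →
    (∀ {v} → v ≡ x ⊎ v ≡ y ⊎ v ≡ z → KLe (C A) (W v) (W x) → KLe (C A) (W v) (W y) → KLe (C A) (W v) (W z) →
      Q (setR 15 v A)) →
    WP minᶜ Q A
  min-wp {A} (kx , ex) (ky , ey) (kz , ez) k =
    ⟪ _ , (_ , _ , ex , ey) ,
    (λ xy → _ , (_ , _ , ex , ez) ,
      (λ xz → _ , k (inj₁ refl) (KLe-refl c ex) xy xz) ,
      (λ zx → _ , k (inj₂ (inj₂ refl)) zx (KLe-trans c zx xy) (KLe-refl c ez))) ,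
    (λ yx → _ , (_ , _ , ey , ez) ,
      (λ yz → _ , k (inj₂ (inj₁ refl)) yx (KLe-refl c ey) yz) ,
      (λ zy → _ , k (inj₂ (inj₂ refl)) (KLe-trans c zy yx) zy (KLe-refl c ez))) ⟫
    where c = C A

  TreeA : AS → (ℕ → Set) → Set q
  TreeA A D = Tree (fd A parᶠ) (fd A slotᶠ) (fd A nodeᶠ) (fd A winᶠ) (fd A leafᶠ) (fd A topᶠ) (fd A htᶠ) (C A) D

  pick-wp : ∀ {A Q} → let x = rg A 18; y = rg A 19; z = rg A 20; e₁ = fd A winᶠ (rg A 16); e₂ = rg A 17 in
    x ≢ y → x ≢ z → y ≢ z →
    (∀ {v} → v ≡ x ⊎ v ≡ y ⊎ v ≡ z → v ≢ e₁ → v ≢ e₂ → Q (setR 21 v A)) → WP pickᶜ Q A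
  pick-wp x≢y x≢z y≢z k = ⟪
    _ , (λ x≡ → _ , (λ y≡ → _ , k (inj₂ (inj₂ refl)) (λ e → x≢z (trans x≡ (sym e))) (λ e → y≢z (trans y≡ (sym e)))) ,
                    (λ y≢ → _ , k (inj₂ (inj₁ refl)) (λ e → x≢y (trans x≡ (sym e))) y≢)) ,
        (λ x≢ → _ , (λ x≡ → _ , (λ y≡ → _ , k (inj₂ (inj₂ refl)) (λ e → y≢z (trans y≡ (sym e))) (λ e → x≢z (trans x≡ (sym e)))) ,
                                (λ y≢ → _ , k (inj₂ (inj₁ refl)) y≢ (λ e → x≢y (trans x≡ (sym e))))) ,
                    (λ x≢′ → _ , k (inj₁ refl) x≢ x≢′)) ⟫

  children-wp : ∀ {A Q} → let p = rg A 16 in 2 * p ≤ 3 * m →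
    Q (setR 20 (fd A nodeᶠ (4 * p + 2)) (setR 19 (fd A nodeᶠ (4 * p + 1)) (setR 18 (fd A nodeᶠ (4 * p + 0)) A))) →
    WP childrenᶜ Q A
  children-wp {A} le k = ⟪ ((_ , _ , small-slot₀ {rg A 16} le) , _ , small-slot {rg A 16} le z≤n) ,
    ((_ , _ , small-slot₀ {rg A 16} le) , _ , small-slot {rg A 16} le (s≤s z≤n)) ,
    ((_ , _ , small-slot₀ {rg A 16} le) , _ , small-slot {rg A 16} le (s≤s (s≤s z≤n))) , k ⟫

  -- The child given up goes below the old parent of `x`. Unless marked, it does not beat the winner
  -- of `z`, which by hypothesis does not beat that of the old parent, so no new mark arises.
  move-wp : ∀ {A Q D} → TreeA A D → let x = rg A 11; z = rg A 16; par = fd A parᶠ; W = fd A leafᶠ; ht = fd A htᶠ in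
    D x → W z ≢ 0 → ht z ≡ suc (ht x) → par x ≢ z → KLe (C A) (W (par x)) (W z) → 2 * z ≤ 3 * m →
    (∀ {par′ pos′ cont′ v r₁₈ r₁₉ r₂₀ r₂₂ r₂₃} →
      Tree par′ pos′ cont′ (fd A winᶠ) W (fd A topᶠ) ht (C A) D →
      par′ x ≡ z → (∀ {y} → y ≢ x → y ≢ v → par′ y ≡ par y) → W v ≢ 0 → v ≢ rg A 17 → par v ≡ z → par′ v ≡ par x →
      ht v ≡ ht x →
      Q (row nodeᶠ cont′ (row slotᶠ pos′ (row parᶠ par′ (setR 23 r₂₃ (setR 22 r₂₂ (setR 21 v
          (setR 20 r₂₀ (setR 19 r₁₉ (setR 18 r₁₈ A)))))))))) →
    WP moveᶜ Q A
  move-wp {A} {Q} {D} t dx lz hz px≢z le 2z≤ k =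
    step (children-wp 2z≤ (step (pick-wp (Tree.chl-≢ t lz hz (s≤s z≤n) (s≤s (s≤s z≤n)) (λ ()))
      (Tree.chl-≢ t lz hz (s≤s z≤n) (s≤s (s≤s (s≤s z≤n))) (λ ()))
      (Tree.chl-≢ t lz hz (s≤s (s≤s z≤n)) (s≤s (s≤s (s≤s z≤n))) (λ ()))
      λ {v} v∈ v≢win v≢e → let lv , pv , hv = chv v∈ in
        run v≢win v≢e lv pv hv)))
    where
    x z : ℕ
    x = rg A 11
    z = rg A 16
    open Tree t
    lx = proj₁ (dirty dx)
    px = proj₁ (proj₂ (dirty dx))
    wx = proj₂ (proj₂ (dirty dx))
    z≢0 = live≢0 lz
    chv : ∀ {v} → v ≡ fd A nodeᶠ (4 * z + 0) ⊎ v ≡ fd A nodeᶠ (4 * z + 1) ⊎ v ≡ fd A nodeᶠ (4 * z + 2) →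
          fd A leafᶠ v ≢ 0 × fd A parᶠ v ≡ z × fd A htᶠ v ≡ fd A htᶠ x
    chv (inj₁ refl) = let l , p , _ , h = chl 0 lz hz (s≤s z≤n) in l , p , h
    chv (inj₂ (inj₁ refl)) = let l , p , _ , h = chl 1 lz hz (s≤s (s≤s z≤n)) in l , p , h
    chv (inj₂ (inj₂ refl)) = let l , p , _ , h = chl 2 lz hz (s≤s (s≤s (s≤s z≤n))) in l , p , h
    go : ∀ {v r₁₈ r₁₉ r₂₀ r₂₂ r₂₃} → v ≢ fd A winᶠ z → v ≢ rg A 17 → fd A leafᶠ v ≢ 0 → fd A parᶠ v ≡ z → fd A htᶠ v ≡ fd A htᶠ x →
      Q (row nodeᶠ (update (update (fd A nodeᶠ) (fd A slotᶠ x) v) (fd A slotᶠ v) x)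
        (row slotᶠ (update (update (fd A slotᶠ) x (fd A slotᶠ v)) v (fd A slotᶠ x))
        (row parᶠ (update (update (fd A parᶠ) x z) v (fd A parᶠ x))
        (setR 23 r₂₃ (setR 22 r₂₂ (setR 21 v (setR 20 r₂₀ (setR 19 r₁₉ (setR 18 r₁₈ A)))))))))
    go {v} v≢win v≢e lv pv hv =
      k (Exchange.tree′ (exchange t lx lv px pv≢0 (λ e → px≢z (trans e pv)) (sym hv) wx (λ e → v≢win (trans (sym e) (cong (fd A winᶠ) pv)))
          dx (dv (ord lv pv≢0)) u₀ (upd₂ _ _ _ _ _ x≢v) (upd₂ _ _ _ _ _ (x≢v ∘ pos-inj lx px lv pv≢0))))
        (trans (Upd₂.at₁ u₀) pv) (Upd₂.off u₀) lv v≢e pv (Upd₂.at₂ u₀) hv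
      where
      pv≢0 : fd A parᶠ v ≢ 0
      pv≢0 e = z≢0 (trans (sym pv) e)
      x≢v : x ≢ v
      x≢v refl = px≢z pv
      u₀ : Upd₂ (fd A parᶠ) x (fd A parᶠ v) v (fd A parᶠ x) (update (update (fd A parᶠ) x z) v (fd A parᶠ x))
      u₀ = subst (λ y → Upd₂ (fd A parᶠ) x y v (fd A parᶠ x) (update (update (fd A parᶠ) x z) v (fd A parᶠ x))) (sym pv)
             (upd₂ (fd A parᶠ) x z v (fd A parᶠ x) x≢v)
      dv : D v ⊎ KLe (C A) (fd A leafᶠ (fd A parᶠ v)) (fd A leafᶠ v) → D v ⊎ KLe (C A) (fd A leafᶠ (fd A parᶠ x)) (fd A leafᶠ v)
      dv (inj₁ d) = inj₁ d
      dv (inj₂ c) = inj₂ (KLe-trans (C A) le (subst (λ y → KLe (C A) (fd A leafᶠ y) (fd A leafᶠ v)) pv c))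
    run : ∀ {v r₁₈ r₁₉ r₂₀} → v ≢ fd A winᶠ z → v ≢ rg A 17 → fd A leafᶠ v ≢ 0 → fd A parᶠ v ≡ z → fd A htᶠ v ≡ fd A htᶠ x →
      WP swapᶜ Q (setR 21 v (setR 20 r₂₀ (setR 19 r₁₉ (setR 18 r₁₈ A))))
    run {v} {r₁₈} {r₁₉} {r₂₀} v≢win v≢e lv pv hv =
      setW (fd A parᶠ x) refl _ (setW (fd A slotᶠ x) refl _
      (stoW (update (fd A nodeᶠ) (fd A slotᶠ x) v) refl _ _ (stoW (update (update (fd A nodeᶠ) (fd A slotᶠ x) v) (fd A slotᶠ v) x) refl _ _
      (stoW (update (fd A slotᶠ) x (fd A slotᶠ v)) refl _ _ (stoW (update (update (fd A slotᶠ) x (fd A slotᶠ v)) v (fd A slotᶠ x)) refl _ _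
      (stoW (update (fd A parᶠ) x z) refl _ _ ⟪ _ , go {r₁₈ = r₁₈} {r₁₉} {r₂₀} v≢win v≢e lv pv hv ⟫))))))

  -- The invariant of the data structure, apart from the minimum and the contents.

  record Core (A : AS) (n : ℕ) : Set q where
    field
      tree  : TreeA A (λ x → fd A dIdxᶠ x ≢ 0)
      dir   : BI (fd A htᶠ) (fd A dIdxᶠ) (fd A dEntᶠ) (fd A dCntᶠ) 2 (rg A dMaskʳ)
      rts   : BI (fd A htᶠ) (fd A rIdxᶠ) (fd A rEntᶠ) (fd A rCntᶠ) 3 (rg A rMaskʳ)
      root→ : ∀ {x} → fd A leafᶠ x ≢ 0 → fd A parᶠ x ≡ 0 → fd A rIdxᶠ x ≢ 0
      →root : ∀ {x} → fd A rIdxᶠ x ≢ 0 → fd A leafᶠ x ≢ 0 × fd A parᶠ x ≡ 0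
      low   : ∀ {x} → fd A leafᶠ x ≢ 0 → fd A htᶠ x ≤ l
      ai    : AI (fd A leafᶠ) (fd A freeᶠ) (fd A logᶠ) (rg A lastʳ) (rg A freeʳ)
      total : weight (fd A rCntᶠ) ≡ n
      -- A ternary forest with `n` leaves and `r` roots has `(n - r) / 2` inner nodes, hence twice
      -- its node count is `3 n - r`; and the nodes in use number `lastʳ` minus `freeʳ`.
      nodes : 2 * rg A lastʳ + sumTo w (fd A rCntᶠ) ≡ 3 * n + 2 * rg A freeʳ
      n≤m   : n ≤ m
      size  : rg A sizeʳ ≡ n

    -- The root above `x` is at least as high and contributes `3 ^ ht` leaves to the total.
    height : ∀ {x} → fd A leafᶠ x ≢ 0 → 3 ^ fd A htᶠ x ≤ n
    height lx with root-above tree {suc l} (λ lz → s≤s (low lz)) (suc l) (m≤n+m (suc l) _) lx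
    ... | y , ly , py , le = ≤-trans (^-monoʳ-≤ 3 le) (≤-trans
      (≤-trans (≤-reflexive (sym (*-identityˡ _))) (*-monoˡ-≤ (3 ^ fd A htᶠ y) (n≢0⇒n>0 (BI.count≢0 rts iy))))
      (≤-trans (sumTo-term (λ r → fd A rCntᶠ r * 3 ^ r) (≤-<-trans (low ly) l<w)) (≤-reflexive total)))
      where iy = root→ ly py

    occ-root : ∀ {r} → fd A rCntᶠ r ≢ 0 → r ≤ ⌊log₂ n ⌋
    occ-root n with BI.nonempty rts n
    ... | x , ix , refl = 2^≤⇒≤log (≤-trans (2^≤3^ (fd A htᶠ x)) (height (proj₁ (→root ix))))

    occ-dirty : ∀ {r} → fd A dCntᶠ r ≢ 0 → r ≤ ⌊log₂ n ⌋
    occ-dirty n with BI.nonempty dir n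
    ... | x , ix , refl = 2^≤⇒≤log (≤-trans (2^≤3^ (fd A htᶠ x)) (height (proj₁ (Tree.dirty tree ix))))

    roots≤n : sumTo w (fd A rCntᶠ) ≤ n
    roots≤n = ≤-trans (sumTo-mono w (λ {r} _ → m≤m*n (fd A rCntᶠ r) (3 ^ r) {{m^n≢0 3 r}})) (≤-reflexive total)

    φ≤β : rg A freeʳ ≤ rg A lastʳ
    φ≤β = *-cancelˡ-≤ 2 (+-cancelˡ-≤ (3 * n) _ _ (begin
      3 * n + 2 * rg A freeʳ                ≡⟨ nodes ⟨
      2 * rg A lastʳ + sumTo w (fd A rCntᶠ)    ≤⟨ +-monoʳ-≤ (2 * rg A lastʳ) (≤-trans roots≤n (m≤m+n n (2 * n))) ⟩
      2 * rg A lastʳ + 3 * n                ≡⟨ +-comm _ (3 * n) ⟩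
      3 * n + 2 * rg A lastʳ                ∎))
      where open ≤-Reasoning

    n≤β : n ≤ rg A lastʳ
    n≤β = *-cancelˡ-≤ 2 (+-cancelʳ-≤ n _ _ (begin
      2 * n + n                       ≡⟨ 2*+1* n ⟩
      3 * n                           ≤⟨ m≤m+n (3 * n) _ ⟩
      3 * n + 2 * rg A freeʳ              ≡⟨ nodes ⟨
      2 * rg A lastʳ + sumTo w (fd A rCntᶠ)  ≤⟨ +-monoʳ-≤ (2 * rg A lastʳ) roots≤n ⟩
      2 * rg A lastʳ + n                  ∎))
      where open ≤-Reasoning

    -- Occupied heights are at most `⌊log₂ n ⌋`, so the mask is below `2 * suc n`; as `n` is at most
    -- `lastʳ`, the table of logarithms reaches that far.
    top-bucket : ∀ {c t M} → M ≡ mask w t c → 1 ≤ t → (∀ {r} → c r ≢ 0 → r ≤ ⌊log₂ n ⌋) → M ≢ 0 →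
      t ≤ c (fd A logᶠ M) × (∀ {r} → fd A logᶠ M < r → r < w → c r < t)
    top-bucket {c} {t} {M} e 1≤t occ M≢0 =
      let _ , t≤ , above = mask-top {⌊log₂ M ⌋} {w} {t} {c} (≤-trans (2^log≤ M M≢0) (≤-reflexive e))
                             (≤-trans (s≤s (≤-reflexive (sym e))) (<2^log M))
      in subst (λ h → t ≤ c h × (∀ {r} → h < r → r < w → c r < t)) (sym (AI.logs ai M≤)) (t≤ , above)
      where
      M≤ : M ≤ 2 * rg A lastʳ + 1
      M≤ = s≤s⁻¹ (begin
        suc M              ≡⟨ cong suc e ⟩
        suc (mask w t c)   ≤⟨ mask-cut {suc ⌊log₂ n ⌋} {w} {t} {c} (λ {r} lr _ → ≤-trans (s≤s (≤-reflexive (z lr))) 1≤t) ⟩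
        2 * 2 ^ ⌊log₂ n ⌋  ≤⟨ *-monoʳ-≤ 2 (2^log≤suc n) ⟩
        2 * suc n          ≤⟨ *-monoʳ-≤ 2 (s≤s n≤β) ⟩
        2 * suc (rg A lastʳ)   ≡⟨ 2*suc′ (rg A lastʳ) ⟩
        suc (2 * rg A lastʳ + 1) ∎)
        where
        open ≤-Reasoning
        2^log≤suc : ∀ n → 2 ^ ⌊log₂ n ⌋ ≤ suc n
        2^log≤suc zero = s≤s z≤n
        2^log≤suc n@(suc _) = m≤n⇒m≤1+n (2^log≤ n 1+n≢0)
        z : ∀ {r} → ⌊log₂ n ⌋ < r → c r ≡ 0
        z lr = none λ ne → <⇒≱ lr (occ ne)

  Leaf : AS → ℕ → Set
  Leaf A x = fd A leafᶠ x ≢ 0 × fd A htᶠ x ≡ 0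

  roots dirties : AS → ℕ
  roots A = sumTo w (fd A rCntᶠ)
  dirties A = sumTo w (fd A dCntᶠ)

  record Same (A B : AS) : Set a where
    field
      leaf→ : ∀ {x} → Leaf A x → Leaf B x
      →leaf : ∀ {x} → Leaf B x → Leaf A x
      keys  : C B ≡ C A
      min-≡ : rg B minʳ ≡ rg A minʳ
      res-≡ : rg B argʳ ≡ rg A argʳ

  same-trans : ∀ {A B D} → Same A B → Same B D → Same A D
  same-trans s t = record
    { leaf→ = Same.leaf→ t ∘ Same.leaf→ s ; →leaf = Same.→leaf s ∘ Same.→leaf t
    ; keys = trans (Same.keys t) (Same.keys s) ; min-≡ = trans (Same.min-≡ t) (Same.min-≡ s)
    ; res-≡ = trans (Same.res-≡ t) (Same.res-≡ s) }

  -- Adding a leaf and joining three roots.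

  record NewLeaf (A B : AS) (k : Key) : Set a where
    field
      fresh : ¬ Leaf A (rg B 14)
      nz    : rg B 14 ≢ 0
      new   : Leaf B (rg B 14)
      leaf→ : ∀ {x} → Leaf A x → Leaf B x
      →leaf : ∀ {x} → Leaf B x → x ≢ rg B 14 → Leaf A x
      key-at  : C B (rg B 14) ≡ just k
      key-off : ∀ {x} → x ≢ rg B 14 → C B x ≡ C A x
      min-≡ : rg B minʳ ≡ rg A minʳ

  -- The numbers of nodes in use, of roots and of elements are tied together by the invariant `nodes`,
  -- which allocation preserves when it is followed by the stated changes.
  alloc-nodes : ∀ {A n} → Core A n → ∀ β φ u n′ → β + rg A freeʳ ≡ suc (rg A lastʳ + φ) →
    3 * n + suc (suc u) ≡ 3 * n′ + roots A → 2 * β + u ≡ 3 * n′ + 2 * φ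
  alloc-nodes {A} {n} core β φ u n′ eq e = +-cancelʳ-≡ (2 * rg A freeʳ + roots A) _ _ (begin
    2 * β + u + (2 * rg A freeʳ + roots A)              ≡⟨ regroup₁ β u (rg A freeʳ) (roots A) ⟩
    2 * (β + rg A freeʳ) + u + roots A                  ≡⟨ cong (λ x → 2 * x + u + roots A) eq ⟩
    2 * suc (rg A lastʳ + φ) + u + roots A              ≡⟨ regroup₂ (rg A lastʳ) φ u (roots A) ⟩
    2 * rg A lastʳ + roots A + (2 + u + 2 * φ)          ≡⟨ cong (_+ (2 + u + 2 * φ)) (Core.nodes core) ⟩
    3 * n + 2 * rg A freeʳ + (2 + u + 2 * φ)            ≡⟨ regroup₃ (3 * n) (rg A freeʳ) u φ ⟩
    3 * n + suc (suc u) + (2 * φ + 2 * rg A freeʳ)      ≡⟨ cong (_+ (2 * φ + 2 * rg A freeʳ)) e ⟩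
    3 * n′ + roots A + (2 * φ + 2 * rg A freeʳ)         ≡⟨ regroup₄ (3 * n′) (roots A) φ (rg A freeʳ) ⟩
    3 * n′ + 2 * φ + (2 * rg A freeʳ + roots A)         ∎)
    where open ≡-Reasoning

  -- Collects what is known after the allocation, so that the new invariant is proved apart from the
  -- run of the program. The other step records serve the same purpose.
  record NewLeafStep : Set q where
    constructor adding
    field
      {A}     : AS
      {n}     : ℕ
      {k}     : Key
      core    : Core A n
      n<m     : suc n ≤ m
      kr      : KR A ≡ just k
      {L}     : ℕ → ℕ
      {β φ p} : ℕ
      ai′     : AI (fd A leafᶠ) (fd A freeᶠ) L β φ
      p≢0     : p ≢ 0
      dead    : fd A leafᶠ p ≡ 0
      p≤      : p ≤ β
      np      : ∀ {i} → i < φ → fd A freeᶠ i ≢ p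
      eq      : β + rg A freeʳ ≡ suc (rg A lastʳ + φ)

    open Core core

    W′ H′ P′ T′ : ℕ → ℕ
    W′ = update (fd A leafᶠ) p p
    H′ = update (fd A htᶠ) p 0
    P′ = update (fd A parᶠ) p 0
    T′ = update (fd A topᶠ) p p

    uW : Upd (fd A leafᶠ) p p W′
    uW = upd (fd A leafᶠ) p p
    uH : Upd (fd A htᶠ) p 0 H′
    uH = upd (fd A htᶠ) p 0
    uP : Upd (fd A parᶠ) p 0 P′
    uP = upd (fd A parᶠ) p 0
    uC : Upd (C A) p (just k) (update (C A) p (KR A))
    uC = subst (λ v → Upd (C A) p v (update (C A) p (KR A))) kr (upd (C A) p (KR A))

    live≢p : ∀ {z} → fd A leafᶠ z ≢ 0 → z ≢ p
    live≢p lz refl = lz dead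
    fw : ∀ {z} → fd A leafᶠ z ≢ 0 → W′ z ≢ 0
    fw lz e = lz (trans (sym (Upd.off uW (live≢p lz))) e)
    bk : ∀ {z} → z ≢ p → W′ z ≢ 0 → fd A leafᶠ z ≢ 0
    bk ne lz e = lz (trans (Upd.off uW ne) e)
    p-live : W′ p ≢ 0
    p-live e = p≢0 (trans (sym (Upd.at uW)) e)
    ip : fd A rIdxᶠ p ≡ 0
    ip = none λ i → proj₁ (→root i) dead
    h≤ : H′ p ≤ l
    h≤ = ≤-trans (≤-reflexive (Upd.at uH)) z≤n
    rts′ : BI H′ (fd A rIdxᶠ) (fd A rEntᶠ) (fd A rCntᶠ) 3 (rg A rMaskʳ)
    rts′ = bi-ht (λ i → Upd.off uH (live≢p (proj₁ (→root i)))) rts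
    dir′ : BI H′ (fd A dIdxᶠ) (fd A dEntᶠ) (fd A dCntᶠ) 2 (rg A dMaskʳ)
    dir′ = bi-ht (λ d → Upd.off uH (live≢p (proj₁ (Tree.dirty tree d)))) dir

    record NewRoot : Set where
      constructor rooting
      field
        {i b c}     : ℕ → ℕ
        {M}         : ℕ
        bi          : BI H′ i b c 3 M
        added         : Added (fd A rIdxᶠ) p i
        s₁          : sumTo w c ≡ suc (roots A)
        s₂          : weight c ≡ 3 ^ H′ p + weight (fd A rCntᶠ)
        r₇ r₇′ r₈   : ℕ

      B : AS
      B = setR sizeʳ (suc (rg A sizeʳ)) (row rCntᶠ c (row rEntᶠ b (row rIdxᶠ i (setR rMaskʳ M (setR 8 r₈ (setR 7 r₇′
            (setR 10 p (row topᶠ T′ (row parᶠ P′ (row htᶠ H′ (row leafᶠ W′ (setC p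
            (row logᶠ L (setR 14 p (setR 7 r₇ (setR freeʳ φ (setR lastʳ β A)))))))))))))))))

      coreB : Core B (suc n)
      coreB = record
        { tree = AddLeaf.tree′ (newLeaf tree dead p≢0 uP uW (upd (fd A topᶠ) p p) uH uC) ; dir = dir′ ; rts = bi
        ; root→ = root→′ ; →root = →root′ ; low = low′ ; ai = ai-live ai′ p≢0 p≤ np uW
        ; total = trans s₂ (cong₂ _+_ (cong (3 ^_) (Upd.at uH)) total)
        ; nodes = alloc-nodes core β φ (sumTo w c) (suc n) eq
            (trans (cong (λ u → 3 * n + suc (suc u)) s₁) (3+ n (roots A)))
        ; n≤m = n<m ; size = cong suc size }
        where
        root→′ : ∀ {x} → W′ x ≢ 0 → P′ x ≡ 0 → i x ≢ 0
        root→′ {x} lx px = decide x p (λ { refl → proj₁ added }) λ ne e →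
          root→ (bk ne lx) (trans (sym (Upd.off uP ne)) px) (trans (sym (proj₂ added ne)) e)
        →root′ : ∀ {x} → i x ≢ 0 → W′ x ≢ 0 × P′ x ≡ 0
        →root′ {x} ix = decide x p (λ { refl → p-live , Upd.at uP }) λ ne →
          let lx , px = →root (λ e → ix (trans (proj₂ added ne) e)) in fw lx , trans (Upd.off uP ne) px
        low′ : ∀ {x} → W′ x ≢ 0 → H′ x ≤ l
        low′ {x} lx = decide x p (λ { refl → h≤ }) λ ne → ≤-trans (≤-reflexive (Upd.off uH ne)) (low (bk ne lx))

      isNew : NewLeaf A B k
      isNew = record
        { fresh = λ lf → proj₁ lf dead
        ; nz = p≢0 ; new = p-live , Upd.at uH
        ; leaf→ = λ { (lx , hx) → fw lx , trans (Upd.off uH (live≢p lx)) hx }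
        ; →leaf = λ { (lx , hx) ne → bk ne lx , trans (sym (Upd.off uH ne)) hx }
        ; key-at = Upd.at uC ; key-off = Upd.off uC ; min-≡ = refl }

  newLeaf-wp : ∀ {A Q n k} → Core A n → suc n ≤ m → KR A ≡ just k → roots A < 6 * suc l →
    (∀ {B} → Core B (suc n) → NewLeaf A B k → roots B ≡ suc (roots A) → dirties B ≡ dirties A → Q B) →
    WP newLeafᶜ Q A
  newLeaf-wp {A} {Q} {n} {k} core n<m kr lt K′ = step (alloc-wp ai room go)
    where
    open Core core
    go : ∀ {L β φ p r₇} → AI (fd A leafᶠ) (fd A freeᶠ) L β φ → p ≢ 0 → fd A leafᶠ p ≡ 0 → p ≤ β →
       (∀ {i} → i < φ → fd A freeᶠ i ≢ p) → β + rg A freeʳ ≡ suc (rg A lastʳ + φ) →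
       WP (key (var 14) ▸ sto leafᶠ (var 14) (var 14) ▸ sto htᶠ (var 14) (num 0) ▸
         sto parᶠ (var 14) (num 0) ▸ sto topᶠ (var 14) (var 14) ▸ set 10 (var 14) ▸ insRootᶜ ▸
         set sizeʳ (num 1 ⊕ var sizeʳ)) Q (row logᶠ L (setR 14 p (setR 7 r₇ (setR freeʳ φ (setR lastʳ β A)))))
    go {L} {β} {φ} {p} {r₇} ai′ p≢0 dead p≤ np eq =
      keyW p refl _ kr (stoW W′ refl _ _ (stoW H′ refl _ _ (stoW P′ refl _ _ (stoW T′ refl _ _
      (setW p refl _ (step (ins-root rts′ ip h≤ lt λ {_} {_} {_} {_} {r₇′} {r₈} bi added s₁ s₂ →
      lastW (suc (rg A sizeʳ)) refl (_ , _ , small-k 1 (s≤s z≤n) (begin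
          suc (rg A sizeʳ)  ≡⟨ cong suc size ⟩
          suc n         ≤⟨ n<m ⟩
          m             ≤⟨ n≤1+n m ⟩
          suc m         ≡⟨ *-identityˡ (suc m) ⟨
          1 * suc m     ∎))
        (done (rooting bi added s₁ s₂ r₇ r₇′ r₈)))))))))
      where
      open NewLeafStep (adding core n<m kr ai′ p≢0 dead p≤ np eq)
        using (W′; H′; P′; T′; rts′; ip; h≤; NewRoot; module NewRoot; rooting)
      open ≤-Reasoning
      done : (D : NewRoot) → Q (NewRoot.B D)
      done D = K′ (NewRoot.coreB D) (NewRoot.isNew D) (NewRoot.s₁ D) refl
    -- With no free node, `nodes` gives `2 * lastʳ ≤ 3 * n`; a new identifier costs 2 while the new
    -- element brings 3.
    room : rg A freeʳ ≡ 0 → 2 * suc (rg A lastʳ) ≤ 3 * m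
    room e = begin
      2 * suc (rg A lastʳ)              ≡⟨ *-suc 2 (rg A lastʳ) ⟩
      2 + 2 * rg A lastʳ                ≤⟨ +-monoʳ-≤ 2 (m≤m+n (2 * rg A lastʳ) (roots A)) ⟩
      2 + (2 * rg A lastʳ + roots A)    ≡⟨ cong (2 +_) nodes ⟩
      2 + (3 * n + 2 * rg A freeʳ)      ≡⟨ cong (λ φ → 2 + (3 * n + 2 * φ)) e ⟩
      2 + (3 * n + 0)               ≤⟨ ≤-trans (n≤1+n _) (≤-reflexive (3+0 n)) ⟩
      3 * suc n                     ≤⟨ *-monoʳ-≤ 3 n<m ⟩
      3 * m                         ∎
      where open ≤-Reasoning

  record JoinStep : Set q where
    constructor joining
    field
      {A}           : AS
      {n r x y z}   : ℕ
      core          : Core A n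
      ix            : fd A rIdxᶠ x ≢ 0
      iy            : fd A rIdxᶠ y ≢ 0
      iz            : fd A rIdxᶠ z ≢ 0
      hx            : fd A htᶠ x ≡ r
      hy            : fd A htᶠ y ≡ r
      hz            : fd A htᶠ z ≡ r
      x≢y           : x ≢ y
      x≢z           : x ≢ z
      y≢z           : y ≢ z
      {L}           : ℕ → ℕ
      {β φ p}       : ℕ
      ai′           : AI (fd A leafᶠ) (fd A freeᶠ) L β φ
      p≢0           : p ≢ 0
      dead          : fd A leafᶠ p ≡ 0
      p≤            : p ≤ β
      np            : ∀ {i} → i < φ → fd A freeᶠ i ≢ p
      eq            : β + rg A freeʳ ≡ suc (rg A lastʳ + φ)
      {v}           : ℕ
      v∈            : v ≡ x ⊎ v ≡ y ⊎ v ≡ z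
      vx            : KLe (C A) (fd A leafᶠ v) (fd A leafᶠ x)
      vy            : KLe (C A) (fd A leafᶠ v) (fd A leafᶠ y)
      vz            : KLe (C A) (fd A leafᶠ v) (fd A leafᶠ z)
      {i₁ b₁ c₁}    : ℕ → ℕ
      {M₁}          : ℕ
      bi₁           : BI (fd A htᶠ) i₁ b₁ c₁ 3 M₁
      rm₁           : Removed (fd A rIdxᶠ) x i₁
      {i₂ b₂ c₂}    : ℕ → ℕ
      {M₂}          : ℕ
      bi₂           : BI (fd A htᶠ) i₂ b₂ c₂ 3 M₂
      rm₂           : Removed i₁ y i₂
      {i₃ b₃ c₃}    : ℕ → ℕ
      {M₃}          : ℕ
      bi₃           : BI (fd A htᶠ) i₃ b₃ c₃ 3 M₃
      rm₃           : Removed i₂ z i₃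
      s₃            : suc (suc (suc (sumTo w c₃))) ≡ roots A
      t₃            : 3 ^ suc r + weight c₃ ≡ n

    open Core core

    P₁ P′ X′ Y′ N′ T′ H′ W′ : ℕ → ℕ
    P₁ = update (fd A parᶠ) p 0
    P′ = update (update (update P₁ x p) y p) z p
    X′ = update (update (update (fd A slotᶠ) x (4 * p + 0)) y (4 * p + 1)) z (4 * p + 2)
    Y′ = update (update (update (fd A nodeᶠ) (4 * p + 0) x) (4 * p + 1) y) (4 * p + 2) z
    N′ = update (fd A winᶠ) p v
    T′ = update (fd A topᶠ) (fd A leafᶠ v) p
    H′ = update (fd A htᶠ) p (suc (fd A htᶠ x))
    W′ = update (fd A leafᶠ) p (fd A leafᶠ v)

    lx = proj₁ (→root ix)
    ly = proj₁ (→root iy)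
    lz = proj₁ (→root iz)
    lv : fd A leafᶠ v ≢ 0
    lv e = [ go lx , [ go ly , go lz ]′ ]′ v∈
      where
      go : ∀ {u} → fd A leafᶠ u ≢ 0 → v ≢ u
      go lu e′ = lu (trans (cong (fd A leafᶠ) (sym e′)) e)
    live≢p : ∀ {q} → fd A leafᶠ q ≢ 0 → q ≢ p
    live≢p lq refl = lq dead
    uW : Upd (fd A leafᶠ) p (fd A leafᶠ v) W′
    uW = upd (fd A leafᶠ) p (fd A leafᶠ v)
    uH : Upd (fd A htᶠ) p (suc (fd A htᶠ x)) H′
    uH = upd (fd A htᶠ) p (suc (fd A htᶠ x))
    uP : Upd₃ P₁ x p y p z p P′
    uP = upd₃ P₁ x p y p z p x≢y x≢z y≢z
    par-o : ∀ {q} → q ≢ p → q ≢ x → q ≢ y → q ≢ z → P′ q ≡ fd A parᶠ q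
    par-o a b c d = trans (Upd₃.off uP b c d) (Upd.off (upd (fd A parᶠ) p 0) a)
    fw : ∀ {q} → fd A leafᶠ q ≢ 0 → W′ q ≢ 0
    fw lq e = lq (trans (sym (Upd.off uW (live≢p lq))) e)
    bk : ∀ {q} → q ≢ p → W′ q ≢ 0 → fd A leafᶠ q ≢ 0
    bk ne lq e = lq (trans (Upd.off uW ne) e)
    p-live : W′ p ≢ 0
    p-live e = lv (trans (sym (Upd.at uW)) e)
    only : ∀ {q} → i₃ q ≢ 0 → fd A rIdxᶠ q ≢ 0 × q ≢ x × q ≢ y × q ≢ z
    only iq = let i2 , ne3 = proj₂ rm₃ iq; i1 , ne2 = proj₂ rm₂ i2; i0 , ne1 = proj₂ rm₁ i1 in i0 , ne1 , ne2 , ne3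
    keep : ∀ {q} → q ≢ x → q ≢ y → q ≢ z → fd A rIdxᶠ q ≢ 0 → i₃ q ≢ 0
    keep a b c iq = proj₁ rm₃ c (proj₁ rm₂ b (proj₁ rm₁ a iq))
    ip : i₃ p ≡ 0
    ip = none λ i → proj₁ (→root (proj₁ (only i))) dead
    -- The three trees alone hold this many elements, so the joined tree is still of height at most
    -- `⌊log₂ n ⌋`.
    r≤ : 3 ^ suc r ≤ n
    r≤ = ≤-trans (m≤m+n (3 ^ suc r) (weight c₃)) (≤-reflexive t₃)
    hp : H′ p ≡ suc r
    hp = trans (Upd.at uH) (cong suc hx)
    h≤ : H′ p ≤ l
    h≤ = ≤-trans (≤-reflexive hp) (≤-trans (2^≤⇒≤log (≤-trans (2^≤3^ (suc r)) r≤)) (⌊log₂⌋-mono-≤ n≤m))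
    lt : sumTo w c₃ < 6 * suc l
    lt = ≤-trans (m≤n+m (suc (sumTo w c₃)) 2) (≤-trans (≤-reflexive s₃) (BI.cnt rts))
    rts′ : BI H′ i₃ b₃ c₃ 3 M₃
    rts′ = bi-ht (λ i → Upd.off uH (live≢p (proj₁ (→root (proj₁ (only i)))))) bi₃
    dir′ : BI H′ (fd A dIdxᶠ) (fd A dEntᶠ) (fd A dCntᶠ) 2 (rg A dMaskʳ)
    dir′ = bi-ht (λ d → Upd.off uH (live≢p (proj₁ (Tree.dirty tree d)))) dir
    tree′ : Tree P′ X′ Y′ N′ W′ T′ H′ (C A) (λ q → fd A dIdxᶠ q ≢ 0)
    tree′ = Attach.tree′ (attach tree dead p≢0 lx ly lz (proj₂ (→root ix)) (proj₂ (→root iy)) (proj₂ (→root iz))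
      refl (trans hy (sym hx)) (trans hz (sym hx)) x≢y x≢z y≢z v∈ vx vy vz
      (upd (fd A parᶠ) p 0) uP (upd₃ (fd A slotᶠ) x _ y _ z _ x≢y x≢z y≢z)
      (upd₃ (fd A nodeᶠ) (4 * p + 0) x (4 * p + 1) y (4 * p + 2) z (λ e → 0≢1+n (+-cancelˡ-≡ (4 * p) 0 1 e))
        (λ e → 0≢1+n (+-cancelˡ-≡ (4 * p) 0 2 e)) (λ e → 1+n≢n (sym (+-cancelˡ-≡ (4 * p) 1 2 e))))
      (upd (fd A winᶠ) p v) uW (upd (fd A topᶠ) (fd A leafᶠ v) p) uH)

    record Attached : Set where
      constructor attaching
      field
        {i b c}  : ℕ → ℕ
        {M}      : ℕ
        bi       : BI H′ i b c 3 M
        added      : Added i₃ p i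
        s₄       : sumTo w c ≡ suc (sumTo w c₃)
        t₄       : weight c ≡ 3 ^ H′ p + weight c₃
        t₇ t₈ t₉ : ℕ

      B : AS
      B = row rCntᶠ c (row rEntᶠ b (row rIdxᶠ i (row leafᶠ W′ (row htᶠ H′ (row topᶠ T′ (row winᶠ N′ (row nodeᶠ Y′ (row slotᶠ X′ (row parᶠ P′ (row logᶠ L
            (setR 20 z (setR 19 y (setR 18 x (setR 15 v (setR 14 p (setR 13 z (setR 12 y (setR 11 x (setR 10 p
            (setR 9 t₉ (setR 8 t₈ (setR 7 t₇ (setR rMaskʳ M (setR freeʳ φ (setR lastʳ β A)))))))))))))))))))))))))

      roots′ : suc (suc (sumTo w c)) ≡ roots A
      roots′ = trans (cong (2 +_) s₄) s₃

      coreB : Core B n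
      coreB = record
        { tree = tree′ ; dir = dir′ ; rts = bi
        ; root→ = root→′ ; →root = →root′ ; low = low′ ; ai = ai-live ai′ p≢0 p≤ np uW
        ; total = trans t₄ (trans (cong (λ h → 3 ^ h + weight c₃) hp) t₃)
        ; nodes = alloc-nodes core β φ (sumTo w c) n eq (cong (3 * n +_) roots′)
        ; n≤m = n≤m ; size = size }
        where
        root→′ : ∀ {q} → W′ q ≢ 0 → P′ q ≡ 0 → i q ≢ 0
        root→′ {q} lq pq =
          decide q p (λ { refl → proj₁ added }) λ ne →
          decide q x (λ { refl → ⊥-elim (p≢0 (trans (sym (Upd₃.at₁ uP)) pq)) }) λ nx →
          decide q y (λ { refl → ⊥-elim (p≢0 (trans (sym (Upd₃.at₂ uP)) pq)) }) λ ny →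
          decide q z (λ { refl → ⊥-elim (p≢0 (trans (sym (Upd₃.at₃ uP)) pq)) }) λ nz e →
          keep nx ny nz (root→ (bk ne lq) (trans (sym (par-o ne nx ny nz)) pq)) (trans (sym (proj₂ added ne)) e)
        →root′ : ∀ {q} → i q ≢ 0 → W′ q ≢ 0 × P′ q ≡ 0
        →root′ {q} iq =
          decide q p (λ { refl → p-live , trans (Upd₃.off uP (live≢p lx ∘ sym) (live≢p ly ∘ sym) (live≢p lz ∘ sym))
                                    (Upd.at (upd (fd A parᶠ) p 0)) }) λ ne →
          let i0 , nx , ny , nz = only (λ e → iq (trans (proj₂ added ne) e)); lq , pq = →root i0 in
          fw lq , trans (par-o ne nx ny nz) pq
        low′ : ∀ {q} → W′ q ≢ 0 → H′ q ≤ l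
        low′ {q} lq = decide q p (λ { refl → h≤ }) λ ne → ≤-trans (≤-reflexive (Upd.off uH ne)) (low (bk ne lq))

      same : Same A B
      same = record
        { leaf→ = λ { (lq , hq) → fw lq , trans (Upd.off uH (live≢p lq)) hq }
        ; →leaf = λ {q} → →leaf′ {q}
        ; keys = refl ; min-≡ = refl ; res-≡ = refl }
        where
        →leaf′ : ∀ {q} → W′ q ≢ 0 × H′ q ≡ 0 → fd A leafᶠ q ≢ 0 × fd A htᶠ q ≡ 0
        →leaf′ {q} (lq , hq) = decide q p (λ { refl → ⊥-elim (1+n≢0 (trans (sym hp) hq)) }) λ ne →
          bk ne lq , trans (sym (Upd.off uH ne)) hq

    id-≤ : 2 * p ≤ 3 * m
    id-≤ = ≤-trans (*-monoʳ-≤ 2 p≤) (AI.space ai′)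

    attach-wp : ∀ {Q t₇ t₈ t₉ q₁₀} →
      (∀ {B} → Core B n → Same A B → suc (suc (roots B)) ≡ roots A → dirties B ≡ dirties A → Q B) →
      WP attachᶜ Q (setR 15 v (setR 20 z (setR 19 y (setR 18 x (row logᶠ L (setR 14 p (setR 7 t₇ (setR freeʳ φ (setR lastʳ β
        (row rCntᶠ c₃ (row rEntᶠ b₃ (row rIdxᶠ i₃ (setR rMaskʳ M₃ (setR 9 t₉ (setR 8 t₈ (setR 13 z (setR 12 y (setR 11 x
        (setR 10 q₁₀ A)))))))))))))))))))
    attach-wp {Q} K′ =
      stoW P₁ refl _ _ (stoW (update P₁ x p) refl _ _ (stoW (update (update P₁ x p) y p) refl _ _ (stoW P′ refl _ _
      (stoW (update (fd A slotᶠ) x (4 * p + 0)) refl _ ((_ , _ , s4) , _ , sl z≤n)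
      (stoW (update (update (fd A slotᶠ) x (4 * p + 0)) y (4 * p + 1)) refl _ ((_ , _ , s4) , _ , sl (s≤s z≤n))
      (stoW X′ refl _ ((_ , _ , s4) , _ , sl (s≤s (s≤s z≤n)))
      (stoW (update (fd A nodeᶠ) (4 * p + 0) x) refl ((_ , _ , s4) , _ , sl z≤n) _
      (stoW (update (update (fd A nodeᶠ) (4 * p + 0) x) (4 * p + 1) y) refl ((_ , _ , s4) , _ , sl (s≤s z≤n)) _
      (stoW Y′ refl ((_ , _ , s4) , _ , sl (s≤s (s≤s z≤n))) _
      (stoW N′ refl _ _ (stoW T′ refl _ _
      (stoW H′ refl _ (_ , _ , small-7l (≤-trans (≤-trans (≤-reflexive (sym (Upd.at uH))) h≤) (≤-trans (n≤1+n l) (m≤n*m (suc l) 7))))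
      (stoW W′ refl _ _ (setW p refl _ (ins-root rts′ ip h≤ lt λ {_} {_} {_} {_} {t₇} {t₈} bi added s t →
        done (attaching bi added s t t₇ t₈ _))))))))))))))))
      where
      done : (D : Attached) → Q (Attached.B D)
      done D = K′ (Attached.coreB D) (Attached.same D) (Attached.roots′ D) refl
      s4 : Small (4 * p)
      s4 = small-slot₀ {p} id-≤
      sl : ∀ {j} → j ≤ 2 → Small (4 * p + j)
      sl j≤ = small-slot {p} id-≤ (≤-trans j≤ (m≤m+n 2 4))

  join-wp : ∀ {A Q n} → Core A n → rg A rMaskʳ ≢ 0 →
    (∀ {B} → Core B n → Same A B → suc (suc (roots B)) ≡ roots A → dirties B ≡ dirties A → Q B) →
    WP joinᶜ Q A
  join-wp {A} {Q} {n} core M≢0 K′ =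
    setW r refl _ (setW x refl (ps (s≤s z≤n)) (setW y refl (ps (s≤s (s≤s z≤n))) (setW z refl (ps ≤-refl)
    (setW x refl _ (step (rem-root rts ix λ bi₁ rm₁ s₁ t₁ →
    setW y refl _ (step (rem-root bi₁ (proj₁ rm₁ (x≢y ∘ sym) iy) λ bi₂ rm₂ s₂ t₂ →
    setW z refl _ (step (rem-root bi₂ (proj₁ rm₂ (y≢z ∘ sym) (proj₁ rm₁ (x≢z ∘ sym) iz)) λ bi₃ rm₃ s₃ t₃ →
    step (alloc-wp ai room λ ai′ p≢0 dead p≤ np eq →
    setW x refl _ (setW y refl _ (setW z refl _ (step (min-wp (Tree.wkey tree lx) (Tree.wkey tree ly) (Tree.wkey tree lz)
      λ v∈ vx vy vz →
    JoinStep.attach-wp (joining core ix iy iz hx hy hz x≢y x≢z y≢z ai′ p≢0 dead p≤ np eq v∈ vx vy vz bi₁ rm₁ bi₂ rm₂ bi₃ rm₃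
      (trans (cong (2 +_) s₃) (trans (cong suc s₂) s₁)) (weight₃ t₁ t₂ t₃)) K′)))))))))))))))
    where
    open Core core
    r x y z : ℕ
    r = fd A logᶠ (rg A rMaskʳ)
    x = fd A rEntᶠ (pair r 1)
    y = fd A rEntᶠ (pair r 2)
    z = fd A rEntᶠ (pair r 3)
    3≤ : 3 ≤ fd A rCntᶠ r
    3≤ = proj₁ (top-bucket {fd A rCntᶠ} {3} (BI.msk rts) (s≤s z≤n) occ-root M≢0)
    r≤l : r ≤ l
    r≤l = BI.occupied rts (λ e → n≮0 (subst (3 ≤_) e 3≤))
    ps : ∀ {j} → j ≤ 3 → PairSafe r j
    ps j≤ = pairSafe r≤l (≤-trans j≤ (≤-trans (m≤m+n 3 3) (m≤m*n 6 (suc l))))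
    ent : ∀ {j} → 1 ≤ j → j ≤ 3 → fd A rIdxᶠ (fd A rEntᶠ (pair r j)) ≡ j × fd A htᶠ (fd A rEntᶠ (pair r j)) ≡ r
    ent p q = BI.entry rts p (≤-trans q 3≤)
    e₁ = ent {1} (s≤s z≤n) (s≤s z≤n)
    e₂ = ent {2} (s≤s z≤n) (s≤s (s≤s z≤n))
    e₃ = ent {3} (s≤s z≤n) ≤-refl
    hx = proj₂ e₁
    hy = proj₂ e₂
    hz = proj₂ e₃
    ix : fd A rIdxᶠ x ≢ 0
    ix e = 0≢1+n (trans (sym e) (proj₁ e₁))
    iy : fd A rIdxᶠ y ≢ 0
    iy e = 0≢1+n (trans (sym e) (proj₁ e₂))
    iz : fd A rIdxᶠ z ≢ 0
    iz e = 0≢1+n (trans (sym e) (proj₁ e₃))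
    x≢y : x ≢ y
    x≢y e = case trans (sym (proj₁ e₁)) (trans (cong (fd A rIdxᶠ) e) (proj₁ e₂)) of λ ()
    x≢z : x ≢ z
    x≢z e = case trans (sym (proj₁ e₁)) (trans (cong (fd A rIdxᶠ) e) (proj₁ e₃)) of λ ()
    y≢z : y ≢ z
    y≢z e = case trans (sym (proj₁ e₂)) (trans (cong (fd A rIdxᶠ) e) (proj₁ e₃)) of λ ()
    lx = proj₁ (→root ix)
    ly = proj₁ (→root iy)
    lz = proj₁ (→root iz)
    weight₃ : ∀ {w₁ w₂ w₃} → 3 ^ fd A htᶠ x + w₁ ≡ weight (fd A rCntᶠ) → 3 ^ fd A htᶠ y + w₂ ≡ w₁ →
              3 ^ fd A htᶠ z + w₃ ≡ w₂ → 3 ^ suc r + w₃ ≡ n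
    weight₃ {w₃ = w₃} refl′ refl refl = trans (sym (thrice (3 ^ r) w₃))
      (trans (cong₂ (λ a b → a + b) (cong (3 ^_) (sym hx)) (cong₂ _+_ (cong (3 ^_) (sym hy)) (cong (λ h → 3 ^ h + w₃) (sym hz))))
        (trans refl′ total))
    -- With no free node, `nodes` says that `2 * lastʳ` plus the number of roots is `3 * n`; there
    -- are three roots or more, and a new identifier costs 2.
    room : rg A freeʳ ≡ 0 → 2 * suc (rg A lastʳ) ≤ 3 * m
    room e = begin
      2 * suc (rg A lastʳ)              ≡⟨ *-suc 2 (rg A lastʳ) ⟩
      2 + 2 * rg A lastʳ                ≤⟨ +-monoˡ-≤ (2 * rg A lastʳ) (≤-trans (n≤1+n 2) (≤-trans 3≤ (BI.count-≤ rts r))) ⟩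
      roots A + 2 * rg A lastʳ          ≡⟨ +-comm (roots A) _ ⟩
      2 * rg A lastʳ + roots A          ≡⟨ nodes ⟩
      3 * n + 2 * rg A freeʳ            ≡⟨ cong (λ φ → 3 * n + 2 * φ) e ⟩
      3 * n + 0                     ≡⟨ +-identityʳ (3 * n) ⟩
      3 * n                         ≤⟨ *-monoʳ-≤ 3 n≤m ⟩
      3 * m                         ∎
      where open ≤-Reasoning

  -- Splitting a root and deleting a leaf that is a root.

  lastSto : ∀ {f p x e Q A} g → update (fd A f) (val x A) (val e A) ≡ g → Safe x A → Safe e A →
            Q (row f g A) → WP (sto f {p} x e) Q A
  lastSto _ refl s s′ p = ⟪ (s , s′) , p ⟫

  detach-wp : ∀ {A Q} → let c = rg A 10 in
    BI (fd A htᶠ) (fd A dIdxᶠ) (fd A dEntᶠ) (fd A dCntᶠ) 2 (rg A dMaskʳ) → BI (fd A htᶠ) (fd A rIdxᶠ) (fd A rEntᶠ) (fd A rCntᶠ) 3 (rg A rMaskʳ) →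
    fd A rIdxᶠ c ≡ 0 → fd A htᶠ c ≤ l → roots A < 6 * suc l →
    (∀ {i₇ b₈ c₉ M₄ i b c′ M₅ t₇ t₈ t₉} →
      BI (fd A htᶠ) i₇ b₈ c₉ 2 M₄ → Removed (fd A dIdxᶠ) c i₇ → sumTo w c₉ ≤ dirties A →
      BI (fd A htᶠ) i b c′ 3 M₅ → Added (fd A rIdxᶠ) c i → sumTo w c′ ≡ suc (roots A) →
      weight c′ ≡ 3 ^ fd A htᶠ c + weight (fd A rCntᶠ) →
      Q (row rCntᶠ c′ (row rEntᶠ b (row rIdxᶠ i (setR rMaskʳ M₅ (row parᶠ (update (fd A parᶠ) c 0)
          (row dCntᶠ c₉ (row dEntᶠ b₈ (row dIdxᶠ i₇ (setR dMaskʳ M₄ (setR 9 t₉ (setR 8 t₈ (setR 7 t₇ A))))))))))))) →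
    WP detachᶜ Q A
  detach-wp {A} {Q} dir rts ic hc lt k = step (if≡ _ _
      (λ e → skipW (rest dir ((λ _ iz → iz) , λ iz → iz , λ { refl → iz e }) ≤-refl))
      (λ n → rem-dirty dir n λ bi rm s _ → rest bi rm (≤-trans (n≤1+n _) (≤-reflexive s))))
    where
    rest : ∀ {i₇ b₈ c₉ M₄ t₇ t₈ t₉} → BI (fd A htᶠ) i₇ b₈ c₉ 2 M₄ → Removed (fd A dIdxᶠ) (rg A 10) i₇ → sumTo w c₉ ≤ dirties A →
      WP (sto parᶠ (var 10) (num 0) ▸ insRootᶜ) Q (row dCntᶠ c₉ (row dEntᶠ b₈ (row dIdxᶠ i₇ (setR dMaskʳ M₄ (setR 9 t₉ (setR 8 t₈ (setR 7 t₇ A)))))))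
    rest {t₉ = t₉} bi rm le = stoW (update (fd A parᶠ) (rg A 10) 0) refl _ _
      (ins-root rts ic hc lt λ bi′ add s t → k {t₉ = t₉} bi rm le bi′ add s t)

  free-room : ∀ {A n} → Core A n → suc (rg A freeʳ) ≤ 3 * suc m
  free-room core = ≤-trans (s≤s (≤-trans (Core.φ≤β core) (β≤ (AI.space (Core.ai core)))))
    (≤-trans (m≤n+m (suc (3 * m)) 2) (≤-reflexive (sym (*-suc 3 m))))

  -- What is needed to carry a recorded path past a split: the next node on it becomes a root, and
  -- parents further down stay.
  record Splits (A B : AS) (r : ℕ) : Set where
    field
      child-root : ∀ {x} → fd A leafᶠ x ≢ 0 → fd A parᶠ x ≡ r → fd B leafᶠ x ≢ 0 × fd B parᶠ x ≡ 0
      other      : ∀ {x} → fd A leafᶠ x ≢ 0 → fd A parᶠ x ≢ 0 → fd A parᶠ x ≢ r → fd B leafᶠ x ≢ 0 × fd B parᶠ x ≡ fd A parᶠ x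
      heights    : fd B htᶠ ≡ fd A htᶠ
      descent    : fd B pathᶠ ≡ fd A pathᶠ
      node       : rg B 16 ≡ rg A 16

  record SplitStep : Set q where
    constructor splitting
    field
      {A}           : AS
      {n h}         : ℕ
      core          : Core A n
      lr            : fd A leafᶠ (rg A 16) ≢ 0
      pr            : fd A parᶠ (rg A 16) ≡ 0
      hr            : fd A htᶠ (rg A 16) ≡ suc h
      lt            : roots A + 2 ≤ 6 * suc l
      {i₁ b₁ c₁}    : ℕ → ℕ
      {M₁}          : ℕ
      bi₁           : BI (fd A htᶠ) i₁ b₁ c₁ 3 M₁
      rm₁           : Removed (fd A rIdxᶠ) (rg A 16) i₁
      s₁            : suc (sumTo w c₁) ≡ roots A
      t₁            : 3 ^ fd A htᶠ (rg A 16) + weight c₁ ≡ weight (fd A rCntᶠ)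

    open Core core

    r x y z : ℕ
    r = rg A 16
    x = fd A nodeᶠ (4 * r + 0)
    y = fd A nodeᶠ (4 * r + 1)
    z = fd A nodeᶠ (4 * r + 2)

    cx = Tree.chl tree {r} 0 lr hr (s≤s z≤n)
    cy = Tree.chl tree {r} 1 lr hr (s≤s (s≤s z≤n))
    cz = Tree.chl tree {r} 2 lr hr (s≤s (s≤s (s≤s z≤n)))
    x≢y : x ≢ y
    x≢y = Tree.chl-≢ tree lr hr (s≤s z≤n) (s≤s (s≤s z≤n)) (λ ())
    x≢z : x ≢ z
    x≢z = Tree.chl-≢ tree lr hr (s≤s z≤n) (s≤s (s≤s (s≤s z≤n))) (λ ())
    y≢z : y ≢ z
    y≢z = Tree.chl-≢ tree lr hr (s≤s (s≤s z≤n)) (s≤s (s≤s (s≤s z≤n))) (λ ())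
    r≢0 : r ≢ 0
    r≢0 = Tree.live≢0 tree lr

    not-root : ∀ {q} → fd A parᶠ q ≡ r → i₁ q ≡ 0
    not-root pq = none λ iq → r≢0 (trans (sym pq) (proj₂ (→root (proj₁ (proj₂ rm₁ iq)))))
    child-h : ∀ {q} → fd A htᶠ q ≡ h → fd A htᶠ q ≤ l
    child-h e = ≤-trans (≤-reflexive e) (≤-trans (n≤1+n h) (≤-trans (≤-reflexive (sym hr)) (low lr)))
    -- The split root leaves its bucket first, so the three children exceed the old count by only
    -- two.
    room : ∀ {u} k → k ≤ 2 → u ≡ k + sumTo w c₁ → u < 6 * suc l
    room k k≤ refl = ≤-trans (s≤s (+-monoˡ-≤ (sumTo w c₁) k≤)) (≤-trans (≤-reflexive
      (trans (cong (2 +_) s₁) (+-comm 2 (roots A)))) lt)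

    P′ T′ W′ : ℕ → ℕ
    P′ = update (update (update (fd A parᶠ) x 0) y 0) z 0
    T′ = update (fd A topᶠ) (fd A leafᶠ r) (fd A winᶠ r)
    W′ = update (fd A leafᶠ) r 0

    uP : Upd₃ (fd A parᶠ) x 0 y 0 z 0 P′
    uP = upd₃ (fd A parᶠ) x 0 y 0 z 0 x≢y x≢z y≢z
    uW : Upd (fd A leafᶠ) r 0 W′
    uW = upd (fd A leafᶠ) r 0
    ≢r : ∀ {q} → W′ q ≢ 0 → q ≢ r
    ≢r lq e = lq (trans (cong W′ e) (Upd.at uW))
    fw : ∀ {q} → fd A leafᶠ q ≢ 0 → q ≢ r → W′ q ≢ 0
    fw lq ne e = lq (trans (sym (Upd.off uW ne)) e)
    bk : ∀ {q} → W′ q ≢ 0 → fd A leafᶠ q ≢ 0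
    bk lq e = lq (trans (Upd.off uW (≢r lq)) e)
    par-o : ∀ {q} → fd A parᶠ q ≢ r → P′ q ≡ fd A parᶠ q
    par-o ne = Upd₃.off uP (λ { refl → ne (proj₁ (proj₂ cx)) }) (λ { refl → ne (proj₁ (proj₂ cy)) })
                 (λ { refl → ne (proj₁ (proj₂ cz)) })

    record Detached : Set where
      constructor detaching
      field
        {FS}             : ℕ → ℕ
        ai′              : AI W′ FS (fd A logᶠ) (rg A lastʳ) (suc (rg A freeʳ))
        {d₁ d₂ d₃ e₃ f₃} : ℕ → ℕ
        {M₃}             : ℕ
        ra               : Removed (fd A dIdxᶠ) x d₁
        rb               : Removed d₁ y d₂
        rc               : Removed d₂ z d₃
        dir′             : BI (fd A htᶠ) d₃ e₃ f₃ 2 M₃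
        {i₂ i₃ i₄ b₄ c₄} : ℕ → ℕ
        {M₄}             : ℕ
        aa               : Added i₁ x i₂
        ab               : Added i₂ y i₃
        ac               : Added i₃ z i₄
        rts′             : BI (fd A htᶠ) i₄ b₄ c₄ 3 M₄
        s₄               : sumTo w c₄ ≡ suc (suc (suc (sumTo w c₁)))
        t₄               : weight c₄ ≡ 3 ^ fd A htᶠ z + (3 ^ fd A htᶠ y + (3 ^ fd A htᶠ x + weight c₁))
        t₇ t₈ t₉         : ℕ

      B : AS
      B = row leafᶠ W′ (row freeᶠ FS (row rCntᶠ c₄ (row rEntᶠ b₄ (row rIdxᶠ i₄ (row parᶠ P′ (row dCntᶠ f₃ (row dEntᶠ e₃ (row dIdxᶠ d₃ (row topᶠ T′
            (setR freeʳ (suc (rg A freeʳ)) (setR lastʳ (rg A lastʳ) (setR rMaskʳ M₄ (setR dMaskʳ M₃ (setR 9 t₉ (setR 8 t₈ (setR 7 t₇ (setR 10 r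
            (setR 20 z (setR 19 y (setR 18 x A))))))))))))))))))))

      idx-≢ : ∀ {q} → q ≢ x → q ≢ y → q ≢ z → i₄ q ≡ i₁ q
      idx-≢ nx ny nz = trans (proj₂ ac nz) (trans (proj₂ ab ny) (proj₂ aa nx))

      root-idx : ∀ {q} → fd A leafᶠ q ≢ 0 → fd A parᶠ q ≡ r → i₄ q ≢ 0
      root-idx lq pq with Tree.child tree lq r≢0 pq
      ... | inj₁ refl = λ e → proj₁ aa (trans (sym (trans (proj₂ ac x≢z) (proj₂ ab x≢y))) e)
      ... | inj₂ (inj₁ refl) = λ e → proj₁ ab (trans (sym (proj₂ ac y≢z)) e)
      ... | inj₂ (inj₂ refl) = proj₁ ac

      par-r : ∀ {q} → fd A leafᶠ q ≢ 0 → fd A parᶠ q ≡ r → P′ q ≡ 0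
      par-r lq pq with Tree.child tree lq r≢0 pq
      ... | inj₁ refl = Upd₃.at₁ uP
      ... | inj₂ (inj₁ refl) = Upd₃.at₂ uP
      ... | inj₂ (inj₂ refl) = Upd₃.at₃ uP

      coreB : Core B n
      coreB = record
        { tree = Split.tree′ (split tree lr hr pr uP uW uT
            (λ dq → let q₂ , nz = proj₂ rc dq; q₁ , ny = proj₂ rb q₂; q₀ , nx = proj₂ ra q₁ in q₀ , λ pq →
               [ nx , [ ny , nz ]′ ]′ (Tree.child tree (proj₁ (Tree.dirty tree q₀)) r≢0 pq))
            (λ dq ne → proj₁ rc (λ { refl → ne (proj₁ (proj₂ cz)) }) (proj₁ rb (λ { refl → ne (proj₁ (proj₂ cy)) })
               (proj₁ ra (λ { refl → ne (proj₁ (proj₂ cx)) }) dq))))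
        ; dir = dir′ ; rts = rts′ ; root→ = root→′ ; →root = →root′
        ; low = low ∘ bk ; ai = ai′
        ; total = trans t₄ (trans (cong₂ _+_ (cong (3 ^_) (hz)) (cong₂ _+_ (cong (3 ^_) hy) (cong (λ k → 3 ^ k + weight c₁) hx)))
            (trans (thrice (3 ^ h) (weight c₁)) (trans (cong (λ k → 3 ^ k + weight c₁) (sym hr)) (trans t₁ total))))
        ; nodes = nodes′
        ; n≤m = n≤m ; size = size }
        where
        hx = proj₂ (proj₂ (proj₂ cx))
        hy = proj₂ (proj₂ (proj₂ cy))
        hz = proj₂ (proj₂ (proj₂ cz))
        Wr : fd A leafᶠ r ≡ fd A leafᶠ (fd A winᶠ r)
        Wr = proj₂ (proj₂ (Tree.win-ok tree lr hr))
        uT : Upd (fd A topᶠ) (fd A leafᶠ (fd A winᶠ r)) (fd A winᶠ r) T′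
        uT = subst (λ b → Upd (fd A topᶠ) b (fd A winᶠ r) T′) Wr (upd (fd A topᶠ) (fd A leafᶠ r) (fd A winᶠ r))
        nodes′ : 2 * rg A lastʳ + sumTo w c₄ ≡ 3 * n + 2 * suc (rg A freeʳ)
        nodes′ = trans (cong (2 * rg A lastʳ +_) (trans s₄ (cong (2 +_) s₁)))
          (trans (2*+2 (rg A lastʳ) (roots A)) (trans (cong (_+ 2) nodes) (2*suc (3 * n) (rg A freeʳ))))
        root→′ : ∀ {q} → W′ q ≢ 0 → P′ q ≡ 0 → i₄ q ≢ 0
        root→′ {q} lq pq = decide (fd A parᶠ q) r (root-idx (bk lq)) λ ne e → proj₁ rm₁ (≢r lq) (root→ (bk lq) (trans (sym (par-o ne)) pq))
            (trans (sym (idx-≢ (λ { refl → ne (proj₁ (proj₂ cx)) }) (λ { refl → ne (proj₁ (proj₂ cy)) })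
               (λ { refl → ne (proj₁ (proj₂ cz)) }))) e)
        →root′ : ∀ {q} → i₄ q ≢ 0 → W′ q ≢ 0 × P′ q ≡ 0
        →root′ {q} iq =
          decide q x (λ e → ch (proj₁ cx) (proj₁ (proj₂ cx)) e) λ nx →
          decide q y (λ e → ch (proj₁ cy) (proj₁ (proj₂ cy)) e) λ ny →
          decide q z (λ e → ch (proj₁ cz) (proj₁ (proj₂ cz)) e) λ nz →
          let i0 , ne = proj₂ rm₁ (λ e → iq (trans (idx-≢ nx ny nz) e)); lq , pq = →root i0 in
          fw lq ne , trans (par-o (λ e → r≢0 (trans (sym e) pq))) pq
          where
          ch : ∀ {q q′} → fd A leafᶠ q ≢ 0 → fd A parᶠ q ≡ r → q′ ≡ q → W′ q′ ≢ 0 × P′ q′ ≡ 0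
          ch lq pq refl = fw lq (λ e → r≢0 (trans (sym pq) (trans (cong (fd A parᶠ) e) pr))) , par-r lq pq

      same : Same A B
      same = record
        { leaf→ = λ { (lq , hq) → fw lq (λ { e → 1+n≢0 (trans (sym hr) (trans (cong (fd A htᶠ) (sym e)) hq)) }) , hq }
        ; →leaf = λ { (lq , hq) → bk lq , hq }
        ; keys = refl ; min-≡ = refl ; res-≡ = refl }

      splits : Splits A B r
      splits = record
        { child-root = λ lq pq → fw lq (λ e → r≢0 (trans (sym pq) (trans (cong (fd A parᶠ) e) pr))) , par-r lq pq
        ; other = λ lq pq ne → fw lq (λ e → pq (trans (cong (fd A parᶠ) e) pr)) , par-o ne
        ; heights = refl ; descent = refl ; node = refl }

    finish-wp : ∀ {Q t₇ t₈ t₉} →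
      (∀ {B} → Core B n → Same A B → Splits A B r → roots B ≡ suc (suc (roots A)) → dirties B ≤ dirties A → Q B) →
      WP (sto topᶠ (fld leafᶠ (var 16)) (fld winᶠ (var 16)) ▸ childrenᶜ ▸
        set 10 (var 18) ▸ detachᶜ ▸ set 10 (var 19) ▸ detachᶜ ▸ set 10 (var 20) ▸ detachᶜ ▸
        set 10 (var 16) ▸ freeᶜ ▸ sto leafᶠ (var 16) (num 0)) Q
        (row rCntᶠ c₁ (row rEntᶠ b₁ (row rIdxᶠ i₁ (setR rMaskʳ M₁ (setR 9 t₉ (setR 8 t₈ (setR 7 t₇ (setR 10 r A))))))))
    finish-wp {Q} K′ =
      stoW T′ refl _ _ (step (children-wp (≤-trans (*-monoʳ-≤ 2 (AI.ids ai lr)) (AI.space ai))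
      (setW x refl _ (step (detach-wp dir bi₁ (not-root (proj₁ (proj₂ cx))) (child-h (proj₂ (proj₂ (proj₂ cx)))) (room 0 z≤n refl)
        λ bd₁ ra u₁ bi₂ aa s₂ t₂ →
      setW y refl _ (step (detach-wp bd₁ bi₂ (trans (proj₂ aa (x≢y ∘ sym)) (not-root (proj₁ (proj₂ cy))))
        (child-h (proj₂ (proj₂ (proj₂ cy)))) (room 1 (s≤s z≤n) s₂)
        λ bd₂ rb u₂ bi₃ ab s₃ t₃ →
      setW z refl _ (step (detach-wp bd₂ bi₃ (trans (proj₂ ab (y≢z ∘ sym)) (trans (proj₂ aa (x≢z ∘ sym)) (not-root (proj₁ (proj₂ cz)))))
        (child-h (proj₂ (proj₂ (proj₂ cz)))) (room 2 ≤-refl (trans s₃ (cong suc s₂)))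
        λ {_} {_} {_} {_} {_} {_} {_} {_} {t₇} {t₈} {t₉} bd₃ rc u₃ bi₄ ac s₄ t₄ →
      setW r refl _ (step (free-wp ai lr (free-room core) λ ai′ → lastSto W′ refl _ _
        (done (detaching (ai′ uW) ra rb rc bd₃ aa ab ac bi₄ (trans s₄ (cong suc (trans s₃ (cong suc s₂))))
          (trans t₄ (cong (3 ^ fd A htᶠ z +_) (trans t₃ (cong (3 ^ fd A htᶠ y +_) t₂)))) t₇ t₈ t₉) (≤-trans u₃ (≤-trans u₂ u₁))))))))))))))
      where
      done : (D : Detached) → sumTo w (Detached.f₃ D) ≤ dirties A → Q (Detached.B D)
      done D u = K′ coreB same splits (trans s₄ (cong (2 +_) s₁)) u
        where open Detached D

  split-wp : ∀ {A Q n h} → Core A n → let r = rg A 16 in fd A leafᶠ r ≢ 0 → fd A parᶠ r ≡ 0 → fd A htᶠ r ≡ suc h →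
    roots A + 2 ≤ 6 * suc l →
    (∀ {B} → Core B n → Same A B → Splits A B r → roots B ≡ suc (suc (roots A)) → dirties B ≤ dirties A → Q B) →
    WP splitᶜ Q A
  split-wp {A} core lr pr hr lt K′ =
    setW (rg A 16) refl _ (step (rem-root (Core.rts core) (Core.root→ core lr pr)
      λ bi₁ rm₁ s₁ t₁ → SplitStep.finish-wp (splitting core lr pr hr lt bi₁ rm₁ s₁ t₁) K′))

  record Killed (A B : AS) (x : ℕ) : Set a where
    field
      leaf→ : ∀ {y} → Leaf A y → y ≢ x → Leaf B y
      →leaf : ∀ {y} → Leaf B y → Leaf A y × y ≢ x
      keys  : C B ≡ C A

  kill-wp : ∀ {A Q n} → Core A (suc n) → Leaf A (rg A 16) → fd A parᶠ (rg A 16) ≡ 0 →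
    (∀ {B} → Core B n → Killed A B (rg A 16) → suc (roots B) ≡ roots A → dirties B ≡ dirties A → Q B) →
    WP killᶜ Q A
  kill-wp {A} {Q} {n} core (lx , hx) px K′ =
    setW x refl _ (step (rem-root rts (root→ lx px) λ {_} {_} {_} {_} {t₇} {t₈} {t₉} bi rm s t →
    step (free-wp ai lx (free-room core) λ ai′ → stoW W′ refl _ _
    (lastW (rg A sizeʳ ∸ 1) refl (_ , _ , ≤-trans (s≤s z≤n) (≤-reflexive (sym size)))
      (done (freeing (ai′ uW) bi rm s t t₇ t₈ t₉))))))
    where
    open Core core
    x : ℕ
    x = rg A 16
    W′ : ℕ → ℕ
    W′ = update (fd A leafᶠ) x 0
    uW : Upd (fd A leafᶠ) x 0 W′
    uW = upd (fd A leafᶠ) x 0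
    ≢x : ∀ {q} → W′ q ≢ 0 → q ≢ x
    ≢x lq e = lq (trans (cong W′ e) (Upd.at uW))
    fw : ∀ {q} → fd A leafᶠ q ≢ 0 → q ≢ x → W′ q ≢ 0
    fw lq ne e = lq (trans (sym (Upd.off uW ne)) e)
    bk : ∀ {q} → W′ q ≢ 0 → fd A leafᶠ q ≢ 0
    bk lq e = lq (trans (Upd.off uW (≢x lq)) e)
    record Freed : Set where
      constructor freeing
      field
        {FS i b c} : ℕ → ℕ
        {M}        : ℕ
        ai′        : AI W′ FS (fd A logᶠ) (rg A lastʳ) (suc (rg A freeʳ))
        bi         : BI (fd A htᶠ) i b c 3 M
        rm         : Removed (fd A rIdxᶠ) x i
        s          : suc (sumTo w c) ≡ roots A
        t          : 3 ^ fd A htᶠ x + weight c ≡ weight (fd A rCntᶠ)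
        t₇ t₈ t₉   : ℕ
      B : AS
      B = setR sizeʳ (rg A sizeʳ ∸ 1) (row leafᶠ W′ (row freeᶠ FS (setR freeʳ (suc (rg A freeʳ)) (row rCntᶠ c (row rEntᶠ b (row rIdxᶠ i (setR rMaskʳ M
            (setR 9 t₉ (setR 8 t₈ (setR 7 t₇ (setR 10 x A)))))))))))
      coreB : Core B n
      coreB = record
        { tree = Kill.tree′ (kill tree lx hx px uW) ; dir = dir ; rts = bi
        ; root→ = λ lq pq → proj₁ rm (≢x lq) (root→ (bk lq) pq)
        ; →root = λ iq → let i0 , ne = proj₂ rm iq; lq , pq = →root i0 in fw lq ne , pq
        ; low = low ∘ bk ; ai = ai′
        ; total = suc-injective (trans (cong (λ h → 3 ^ h + weight c) (sym hx)) (trans t total))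
        ; nodes = suc-injective (trans (trans (sym (+-suc (2 * rg A lastʳ) (sumTo w c))) (cong (2 * rg A lastʳ +_) s))
                    (trans nodes (3*suc n (rg A freeʳ))))
        ; n≤m = ≤-trans (n≤1+n n) n≤m ; size = cong (_∸ 1) size }
      killed : Killed A B x
      killed = record
        { leaf→ = λ { (lq , hq) ne → fw lq ne , hq }
        ; →leaf = λ { (lq , hq) → (bk lq , hq) , ≢x lq } ; keys = refl }
    done : (D : Freed) → Q (Freed.B D)
    done D = K′ (Freed.coreB D) (Freed.killed D) (Freed.s D) refl

  -- Replacing two dirty nodes by one of the next height.

  record Pairing (A₀ A : AS) (n x y : ℕ) : Set q where
    field
      core : Core A n
      same : Same A₀ A
      rts≡ : roots A ≡ roots A₀ × rg A rMaskʳ ≡ rg A₀ rMaskʳ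
      drt≡ : dirties A ≡ dirties A₀
      dx   : fd A dIdxᶠ x ≢ 0
      dy   : fd A dIdxᶠ y ≢ 0
      x≢y  : x ≢ y
      hxy  : fd A htᶠ x ≡ fd A htᶠ y
      -- Available because the pair comes from the highest overfull bucket; it provides the clean
      -- sibling in the lifting step.
      above : ∀ {r} → fd A htᶠ x < r → r < w → fd A dCntᶠ r < 2

    lx = proj₁ (Tree.dirty (Core.tree core) dx)
    px = proj₁ (proj₂ (Tree.dirty (Core.tree core) dx))
    wx = proj₂ (proj₂ (Tree.dirty (Core.tree core) dx))
    ly = proj₁ (Tree.dirty (Core.tree core) dy)
    py = proj₁ (proj₂ (Tree.dirty (Core.tree core) dy))
    wy = proj₂ (proj₂ (Tree.dirty (Core.tree core) dy))

  turn : ∀ {A₀ A n x y} → Pairing A₀ A n x y → Pairing A₀ A n y x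
  turn {A = A} p = record
    { core = core ; same = same ; rts≡ = rts≡ ; drt≡ = drt≡ ; dx = dy ; dy = dx ; x≢y = x≢y ∘ sym
    ; hxy = sym hxy ; above = λ lt → above (subst (_< _) (sym hxy) lt) }
    where open Pairing p

  -- The invariant does not read these registers, so each component has the same type in the new
  -- state. A change of only some of them is an instance, by writing back the present values of the
  -- others.
  core-temps : ∀ {A n} → Core A n → ∀ {t₀ t₁ t₇ t₈ t₉ t₁₀ t₁₁ t₁₂ t₁₃ t₁₄ t₁₅ t₁₆ t₁₇ t₁₈ t₁₉ t₂₀ t₂₁ t₂₂ t₂₃} →
    Core (setR argʳ t₀ (setR minʳ t₁ (setR 7 t₇ (setR 8 t₈ (setR 9 t₉ (setR 10 t₁₀ (setR 11 t₁₁ (setR 12 t₁₂ (setR 13 t₁₃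
      (setR 14 t₁₄ (setR 15 t₁₅ (setR 16 t₁₆ (setR 17 t₁₇ (setR 18 t₁₈ (setR 19 t₁₉ (setR 20 t₂₀ (setR 21 t₂₁
      (setR 22 t₂₂ (setR 23 t₂₃ A))))))))))))))))))) n
  core-temps c = record
    { tree = tree ; dir = dir ; rts = rts ; root→ = root→ ; →root = →root ; low = low ; ai = ai
    ; total = total ; nodes = nodes ; n≤m = n≤m ; size = size }
    where open Core c

  temps : ∀ {A₀ A n x y} → Pairing A₀ A n x y → ∀ {t₇ t₈ t₉ t₁₀ t₁₁ t₁₂ t₁₃ t₁₄ t₁₅ t₁₆ t₁₇ t₁₈ t₁₉ t₂₀ t₂₁ t₂₂ t₂₃} →
    Pairing A₀ (setR 7 t₇ (setR 8 t₈ (setR 9 t₉ (setR 10 t₁₀ (setR 11 t₁₁ (setR 12 t₁₂ (setR 13 t₁₃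
      (setR 14 t₁₄ (setR 15 t₁₅ (setR 16 t₁₆ (setR 17 t₁₇ (setR 18 t₁₈ (setR 19 t₁₉ (setR 20 t₂₀ (setR 21 t₂₁
      (setR 22 t₂₂ (setR 23 t₂₃ A))))))))))))))))) n x y
  temps p = record
    { core = core-temps core
    ; same = record { leaf→ = Same.leaf→ same ; →leaf = Same.→leaf same ; keys = Same.keys same
                    ; min-≡ = Same.min-≡ same ; res-≡ = Same.res-≡ same }
    ; rts≡ = rts≡ ; drt≡ = drt≡ ; dx = dx ; dy = dy ; x≢y = x≢y ; hxy = hxy ; above = above }
    where open Pairing p

  moved : ∀ {A₀ A n x y z v par′ pos′ cont′} → Pairing A₀ A n x y →
    Tree par′ pos′ cont′ (fd A winᶠ) (fd A leafᶠ) (fd A topᶠ) (fd A htᶠ) (C A) (λ q → fd A dIdxᶠ q ≢ 0) →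
    par′ x ≡ z → (∀ {q} → q ≢ x → q ≢ v → par′ q ≡ fd A parᶠ q) → fd A parᶠ v ≡ z → par′ v ≡ fd A parᶠ x → z ≢ 0 →
    Pairing A₀ (row nodeᶠ cont′ (row slotᶠ pos′ (row parᶠ par′ A))) n x y
  moved {A₀} {A} {n} {x} {y} {z} {v} {par′} p t px′ off pv pv′ z≢0 = record
    { core = record
        { tree = t ; dir = dir ; rts = rts ; root→ = root→′ ; →root = →root′ ; low = low ; ai = ai
        ; total = total ; nodes = nodes ; n≤m = n≤m ; size = size }
    ; same = record { leaf→ = Same.leaf→ same ; →leaf = Same.→leaf same ; keys = Same.keys same
                    ; min-≡ = Same.min-≡ same ; res-≡ = Same.res-≡ same }
    ; rts≡ = rts≡ ; drt≡ = drt≡ ; dx = dx ; dy = dy ; x≢y = x≢y ; hxy = hxy ; above = above }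
    where
    open Pairing p
    open Core core
    root→′ : ∀ {q} → fd A leafᶠ q ≢ 0 → par′ q ≡ 0 → fd A rIdxᶠ q ≢ 0
    root→′ {q} lq pq =
      decide q x (λ { refl → ⊥-elim (z≢0 (trans (sym px′) pq)) }) λ ne →
      decide q v (λ { refl → ⊥-elim (px (trans (sym pv′) pq)) }) λ nv →
      root→ lq (trans (sym (off ne nv)) pq)
    →root′ : ∀ {q} → fd A rIdxᶠ q ≢ 0 → fd A leafᶠ q ≢ 0 × par′ q ≡ 0
    →root′ {q} iq = let lq , pq = →root iq in lq , trans (off (λ { refl → px pq }) (λ { refl → z≢0 (trans (sym pv) pq) })) pq

  id-ok : ∀ {A n x} → Core A n → fd A leafᶠ x ≢ 0 → 2 * x ≤ 3 * m
  id-ok core lx = ≤-trans (*-monoʳ-≤ 2 (AI.ids (Core.ai core) lx)) (AI.space (Core.ai core))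

  -- The pair is turned so that the parent of `x` has the smaller winner; then a child given up by
  -- the parent of `y` can be placed there without a new mark.
  select-wp : ∀ {A Q n} → Core A n → rg A dMaskʳ ≢ 0 →
    (∀ {B} → let x = rg B 11; y = rg B 12 in
      Pairing A B n x y → KLe (C B) (fd B leafᶠ (fd B parᶠ x)) (fd B leafᶠ (fd B parᶠ y)) → Q B) →
    WP selectᶜ Q A
  select-wp {A} {Q} {n} core M≢0 k =
    setW r refl _ (setW x refl (pairSafe r≤l (6≤ (s≤s z≤n))) (setW y refl (pairSafe r≤l (6≤ (s≤s (s≤s z≤n))))
    (if≤ᵏ _ _ (Tree.wkey tree (Tree.par-live tree lx px)) (Tree.wkey tree (Tree.par-live tree ly py))
      (λ le → skipW (k (temps pr) le))
      (λ le → setW x refl _ (setW y refl _ (lastW x refl _ (k (temps (turn pr)) le)))))))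
    where
    open Core core
    r x y : ℕ
    r = fd A logᶠ (rg A dMaskʳ)
    x = fd A dEntᶠ (pair r 1)
    y = fd A dEntᶠ (pair r 2)
    tb = top-bucket {fd A dCntᶠ} {2} (BI.msk dir) (s≤s z≤n) occ-dirty M≢0
    2≤ : 2 ≤ fd A dCntᶠ r
    2≤ = proj₁ tb
    r≤l : r ≤ l
    r≤l = BI.occupied dir (λ e → n≮0 (subst (2 ≤_) e 2≤))
    6≤ : ∀ {j} → j ≤ 2 → j ≤ 6 * suc l
    6≤ j≤ = ≤-trans j≤ (≤-trans (m≤m+n 2 4) (m≤m*n 6 (suc l)))
    e₁ : fd A dIdxᶠ x ≡ 1 × fd A htᶠ x ≡ r
    e₁ = BI.entry dir (s≤s z≤n) (≤-trans (s≤s z≤n) 2≤)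
    e₂ : fd A dIdxᶠ y ≡ 2 × fd A htᶠ y ≡ r
    e₂ = BI.entry dir (s≤s z≤n) 2≤
    pr : Pairing A A n x y
    pr = record
      { core = core
      ; same = record { leaf→ = λ lf → lf ; →leaf = λ lf → lf ; keys = refl ; min-≡ = refl ; res-≡ = refl }
      ; rts≡ = refl , refl ; drt≡ = refl
      ; dx = λ e → 0≢1+n (trans (sym e) (proj₁ e₁))
      ; dy = λ e → 0≢1+n (trans (sym e) (proj₁ e₂))
      ; x≢y = λ e → case trans (sym (proj₁ e₁)) (trans (cong (fd A dIdxᶠ) e) (proj₁ e₂)) of λ ()
      ; hxy = trans (proj₂ e₁) (sym (proj₂ e₂))
      ; above = λ lt → proj₂ tb (subst (_< _) (proj₂ e₁) lt) }
    open Pairing pr using (lx; px; ly; py)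

  siblings-wp : ∀ {A₀ A Q n} → let x = rg A 11; y = rg A 12 in
    Pairing A₀ A n x y → KLe (C A) (fd A leafᶠ (fd A parᶠ x)) (fd A leafᶠ (fd A parᶠ y)) →
    (∀ {B} → let x = rg B 11; y = rg B 12 in
      Pairing A₀ B n x y → fd B parᶠ x ≡ rg B 16 → fd B parᶠ y ≡ rg B 16 → Q B) →
    WP siblingsᶜ Q A
  siblings-wp {A₀} {A} pr le k = setW (fd A parᶠ y) refl _ (if≡ _ _
      (λ e → skipW (k (temps pr) e refl))
      (λ ne → setW y refl _ (move-wp tree dx lp hp ne le (id-ok core lp)
        λ t px′ off lv v≢y pv pv′ hv →
          k (temps (moved pr t px′ off pv pv′ py)) px′ (off (x≢y ∘ sym) (v≢y ∘ sym)))))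
    where
    open Pairing pr
    open Core core
    x y : ℕ
    x = rg A 11
    y = rg A 12
    lp : fd A leafᶠ (fd A parᶠ y) ≢ 0
    lp = Tree.par-live tree ly py
    hp : fd A htᶠ (fd A parᶠ y) ≡ suc (fd A htᶠ x)
    hp = trans (Tree.par-ht tree ly py) (cong suc (sym hxy))

  record LiftStep : Set q where
    constructor lifting
    field
      {A₀ A} : AS
      {n}    : ℕ
      pr     : Pairing A₀ A n (rg A 11) (rg A 12)
      pxe    : fd A parᶠ (rg A 11) ≡ rg A 16
      pye    : fd A parᶠ (rg A 12) ≡ rg A 16
      Q≢0    : fd A parᶠ (rg A 16) ≢ 0
      chain  : fd A winᶠ (fd A parᶠ (rg A 16)) ≡ rg A 16

    open Pairing pr
    open Core core

    x y p s : ℕ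
    x = rg A 11
    y = rg A 12
    p = rg A 16
    s = fd A parᶠ p

    p≢0 : p ≢ 0
    p≢0 e = px (trans pxe e)
    lp : fd A leafᶠ p ≢ 0
    lp = subst (λ p → fd A leafᶠ p ≢ 0) pxe (Tree.par-live tree lx px)
    hp : fd A htᶠ p ≡ suc (fd A htᶠ x)
    hp = trans (cong (fd A htᶠ) (sym pxe)) (Tree.par-ht tree lx px)
    ls : fd A leafᶠ s ≢ 0
    ls = Tree.par-live tree lp Q≢0
    hs : fd A htᶠ s ≡ suc (fd A htᶠ p)
    hs = Tree.par-ht tree lp Q≢0
    Ws : fd A leafᶠ s ≡ fd A leafᶠ p
    Ws = trans (proj₂ (proj₂ (Tree.win-ok tree ls hs))) (cong (fd A leafᶠ) chain)

    c₀ c₁ c₂ : ℕ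
    c₀ = fd A nodeᶠ (4 * s + 0)
    c₁ = fd A nodeᶠ (4 * s + 1)
    c₂ = fd A nodeᶠ (4 * s + 2)

    Good : ℕ → Set
    Good z = fd A leafᶠ z ≢ 0 × fd A parᶠ z ≡ s × fd A htᶠ z ≡ fd A htᶠ p

    g₀ : Good c₀
    g₀ = let l , e , _ , h = Tree.chl tree {s} 0 ls hs (s≤s z≤n) in l , e , h
    g₁ : Good c₁
    g₁ = let l , e , _ , h = Tree.chl tree {s} 1 ls hs (s≤s (s≤s z≤n)) in l , e , h
    g₂ : Good c₂
    g₂ = let l , e , _ , h = Tree.chl tree {s} 2 ls hs (s≤s (s≤s (s≤s z≤n))) in l , e , h
    c₀≢c₁ : c₀ ≢ c₁
    c₀≢c₁ = Tree.chl-≢ tree ls hs (s≤s z≤n) (s≤s (s≤s z≤n)) (λ ())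
    c₀≢c₂ : c₀ ≢ c₂
    c₀≢c₂ = Tree.chl-≢ tree ls hs (s≤s z≤n) (s≤s (s≤s (s≤s z≤n))) (λ ())
    c₁≢c₂ : c₁ ≢ c₂
    c₁≢c₂ = Tree.chl-≢ tree ls hs (s≤s (s≤s z≤n)) (s≤s (s≤s (s≤s z≤n))) (λ ())

    -- The bucket of x is the highest overfull one, so that at most one node of the height of p is dirty.
    clean : ∀ {u v} → u ≢ v → Good u → Good v → fd A dIdxᶠ u ≢ 0 → fd A dIdxᶠ v ≡ 0
    clean {u} {v} u≢v (lu , _ , hu) (lv , _ , hv) du = none λ dv →
      <⇒≱ (above {fd A htᶠ u} (≤-reflexive (trans (sym hp) (sym hu))) (≤-<-trans (low lu) l<w))
          (BI.two dir du dv (trans hu (sym hv)) u≢v)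

    choose-wp : ∀ {Q} →
      (∀ {z t₁₈ t₁₉ t₂₀ t₂₁} → Good z → z ≢ p → fd A dIdxᶠ z ≡ 0 →
        Q (setR 16 z (setR 20 t₂₀ (setR 19 t₁₉ (setR 18 t₁₈ (setR 21 t₂₁ (setR 13 s A))))))) →
      WP chooseᶜ Q (setR 13 s A)
    choose-wp k = setW p refl _ (setW s refl _ (step (children-wp (id-ok core ls) (if≡ _ _
      (λ c₀≡p → if≡ _ _
        (λ e → lastW c₁ refl _ (k g₁ (λ f → c₀≢c₁ (trans c₀≡p (sym f))) e))
        (λ d → lastW c₂ refl _ (k g₂ (λ f → c₀≢c₂ (trans c₀≡p (sym f))) (clean c₁≢c₂ g₁ g₂ d))))
      (λ c₀≢p → if≡ _ _
        (λ e → lastW c₀ refl _ (k g₀ c₀≢p e))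
        (λ d → if≡ _ _
          (λ c₁≡p → lastW c₂ refl _ (k g₂ (λ f → c₁≢c₂ (trans c₁≡p (sym f))) (clean c₀≢c₂ g₀ g₂ d)))
          (λ c₁≢p → lastW c₁ refl _ (k g₁ c₁≢p (clean c₀≢c₁ g₀ g₁ d)))))))))

    -- The leaf of `s` is that of its winning child `p`, and a clean `z` does not beat it. Hence
    -- children of `z` may be moved below `p`.
    below : ∀ {z} → Good z → z ≢ p → fd A dIdxᶠ z ≡ 0 → KLe (C A) (fd A leafᶠ p) (fd A leafᶠ z)
    below {z} (lz , pz , hz) z≢p nd =
      [ (λ d → ⊥-elim (d nd)) , subst (λ b → KLe (C A) b (fd A leafᶠ z)) (trans (cong (fd A leafᶠ) pz) Ws) ]′
        (Tree.ord tree lz (λ e → Q≢0 (trans (sym pz) e)))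

    -- After both exchanges `z` takes over the role of `p`. It loses at `s`, because `p` wins there,
    -- and so may hold an election.
    lift-rest : ∀ {Q z t₁₈ t₁₉ t₂₀ t₂₁} → Good z → z ≢ p → fd A dIdxᶠ z ≡ 0 →
      (∀ {B} → let x = rg B 11; y = rg B 12; p = rg B 16 in
        Pairing A₀ B n x y → fd B parᶠ x ≡ p → fd B parᶠ y ≡ p → Top (fd B parᶠ) (fd B winᶠ) p → Q B) →
      WP (set 17 (num 0) ▸ moveᶜ ▸ turnᶜ ▸ moveᶜ) Q
        (setR 16 z (setR 20 t₂₀ (setR 19 t₁₉ (setR 18 t₁₈ (setR 21 t₂₁ (setR 13 s A))))))
    lift-rest {Q} {z} g z≢p nd k = setW 0 refl _ (step (move-wp tree dx lz hz (λ e → z≢p (trans (sym e) pxe)) le (id-ok core lz)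
        λ {par′} {pos′} {cont′} {v} t px′ off lv _ pv pv′ hv →
        let pr₁ = moved pr t px′ off pv pv′ z≢0
            py′ : par′ y ≡ p
            py′ = trans (off (x≢y ∘ sym) (λ e → z≢p (trans (sym pv) (trans (cong (fd A parᶠ) (sym e)) pye)))) pye
        in step (setW x refl _ (setW y refl _ (lastW x refl _ (move-wp t dy lz (trans hz (cong suc hxy))
             (λ e → z≢p (trans (sym e) py′)) (subst (λ b → KLe (C A) (fd A leafᶠ b) (fd A leafᶠ z)) (sym py′) (below g z≢p nd)) (id-ok core lz)
             λ {par″} {_} {_} {v′} t′ py″ off′ lv′ v′≢x pv″ pv‴ hv′ →
             k (temps (moved (turn pr₁) t′ py″ off′ pv″ pv‴ z≢0)) py″ (trans (off′ x≢y (v′≢x ∘ sym)) px′)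
               (inj₂ (λ e → z≢p (trans (sym e) (trans (cong (fd A winᶠ)
                 -- All nodes exchanged lie one level below `z`, so the parent of `z` is still `s`.
                 (trans (off′ (z≢ (trans hz (cong suc hxy)) refl) (z≢ (trans hz (cong suc (sym (trans hv′ (sym hxy))))) refl))
                   (trans (off (z≢ hz refl) (z≢ (trans hz (cong suc (sym hv))) refl)) pz))) chain))))))))))
      where
      lz = proj₁ g
      pz = proj₁ (proj₂ g)
      hz : fd A htᶠ z ≡ suc (fd A htᶠ x)
      hz = trans (proj₂ (proj₂ g)) hp
      z≢0 : z ≢ 0
      z≢0 = Tree.live≢0 tree lz
      z≢ : ∀ {u h} → fd A htᶠ z ≡ suc h → h ≡ fd A htᶠ u → z ≢ u
      z≢ e refl refl = 1+n≢n (sym e)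
      le : KLe (C A) (fd A leafᶠ (fd A parᶠ x)) (fd A leafᶠ z)
      le = subst (λ b → KLe (C A) (fd A leafᶠ b) (fd A leafᶠ z)) (sym pxe) (below g z≢p nd)

  lift-wp : ∀ {A₀ A Q n} → Pairing A₀ A n (rg A 11) (rg A 12) → fd A parᶠ (rg A 11) ≡ rg A 16 → fd A parᶠ (rg A 12) ≡ rg A 16 →
    (∀ {B} → let x = rg B 11; y = rg B 12; p = rg B 16 in
      Pairing A₀ B n x y → fd B parᶠ x ≡ p → fd B parᶠ y ≡ p → Top (fd B parᶠ) (fd B winᶠ) p → Q B) →
    WP liftᶜ Q A
  lift-wp {A₀} {A} {Q} {n} pr ex ey k = setW (fd A parᶠ (rg A 16)) refl _ (if≡ _ _
    (λ e → skipW (k (temps pr) ex ey (inj₁ e)))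
    (λ ne → if≡ _ _
      (λ ch → step (LiftStep.choose-wp (lifting pr ex ey ne ch) λ {_} {t₁₈} {t₁₉} {t₂₀} {t₂₁} g z≢p nd →
                LiftStep.lift-rest (lifting pr ex ey ne ch) {t₁₈ = t₁₈} {t₁₉} {t₂₀} {t₂₁} g z≢p nd k))
      (λ nch → skipW (k (temps pr) ex ey (inj₂ nch)))))

  record MergeStep : Set q where
    constructor merging
    field
      {A₀ A} : AS
      {n}    : ℕ
      {x y}  : ℕ
      pr     : Pairing A₀ A n x y
      pxe    : fd A parᶠ x ≡ rg A 16
      pye    : fd A parᶠ y ≡ rg A 16
      tp     : Top (fd A parᶠ) (fd A winᶠ) (rg A 16)

    open Pairing pr
    open Core core

    p c₀ c₁ c₂ : ℕ
    p = rg A 16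
    c₀ = fd A nodeᶠ (4 * p + 0)
    c₁ = fd A nodeᶠ (4 * p + 1)
    c₂ = fd A nodeᶠ (4 * p + 2)

    p≢0 : p ≢ 0
    p≢0 e = px (trans pxe e)
    lp : fd A leafᶠ p ≢ 0
    lp = subst (λ p → fd A leafᶠ p ≢ 0) pxe (Tree.par-live tree lx px)
    hp : fd A htᶠ p ≡ suc (fd A htᶠ x)
    hp = trans (cong (fd A htᶠ) (sym pxe)) (Tree.par-ht tree lx px)
    par≢p : fd A parᶠ p ≢ p
    par≢p e = 1+n≢n (sym (trans (cong (fd A htᶠ) (sym e)) (Tree.par-ht tree lp (λ z → p≢0 (trans (sym e) z)))))
    wk : ∀ j → j < 3 → ∃[ k ] (C A (fd A leafᶠ (fd A nodeᶠ (4 * p + j))) ≡ just k)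
    wk j j<3 = Tree.wkey tree (proj₁ (Tree.chl tree {p} j lp hp j<3))

    -- Marked nodes are never winning children, so `x`, `y` and the winner are three distinct
    -- children. It follows that no child of `p` keeps a mark.
    children : ∀ {u} → fd A leafᶠ u ≢ 0 → fd A parᶠ u ≡ p → u ≢ fd A winᶠ p → u ≡ x ⊎ u ≡ y
    children lu pu nw = [ inj₁ , [ inj₂ , (λ e → ⊥-elim (nw e)) ]′ ]′ (three (Tree.child tree lx p≢0 pxe) (Tree.child tree ly p≢0 pye)
        (Tree.child tree (proj₁ (Tree.win-ok tree lp hp)) p≢0 (proj₁ (proj₂ (Tree.win-ok tree lp hp)))) x≢y
        (λ e → wx (trans (cong (fd A winᶠ) pxe) (sym e))) (λ e → wy (trans (cong (fd A winᶠ) pye) (sym e)))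
        (Tree.child tree lu p≢0 pu))

    record Elected : Set q where
      constructor electing
      field
        {v} : ℕ
        v∈  : v ≡ c₀ ⊎ v ≡ c₁ ⊎ v ≡ c₂
        v₀  : KLe (C A) (fd A leafᶠ v) (fd A leafᶠ c₀)
        v₁  : KLe (C A) (fd A leafᶠ v) (fd A leafᶠ c₁)
        v₂  : KLe (C A) (fd A leafᶠ v) (fd A leafᶠ c₂)

      W′ N′ T₁ T′ : ℕ → ℕ
      W′ = update (fd A leafᶠ) p (fd A leafᶠ v)
      N′ = update (fd A winᶠ) p v
      T₁ = update (fd A topᶠ) (fd A leafᶠ (fd A winᶠ p)) (fd A winᶠ p)
      T′ = update T₁ (fd A leafᶠ v) p

      chv : fd A leafᶠ v ≢ 0 × fd A parᶠ v ≡ p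
      chv = [ ch 0 (s≤s z≤n) , [ ch 1 (s≤s (s≤s z≤n)) , ch 2 (s≤s (s≤s (s≤s z≤n))) ]′ ]′ v∈
        where
        ch : ∀ j → j < 3 → v ≡ fd A nodeᶠ (4 * p + j) → fd A leafᶠ v ≢ 0 × fd A parᶠ v ≡ p
        ch j j<3 e = let l , e′ , _ = Tree.chl tree {p} j lp hp j<3 in
          subst (λ u → fd A leafᶠ u ≢ 0 × fd A parᶠ u ≡ p) (sym e) (l , e′)
      uW : Upd (fd A leafᶠ) p (fd A leafᶠ v) W′
      uW = upd (fd A leafᶠ) p (fd A leafᶠ v)
      fw : ∀ {q} → fd A leafᶠ q ≢ 0 → W′ q ≢ 0
      fw = live-fwd tree uW (proj₁ chv)
      bk : ∀ {q} → W′ q ≢ 0 → fd A leafᶠ q ≢ 0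
      bk = live-back tree uW lp

      least : ∀ {u} → fd A leafᶠ u ≢ 0 → fd A parᶠ u ≡ p → KLe (C A) (fd A leafᶠ v) (fd A leafᶠ u)
      least lu pu with Tree.child tree lu p≢0 pu
      ... | inj₁ refl = v₀
      ... | inj₂ (inj₁ refl) = v₁
      ... | inj₂ (inj₂ refl) = v₂

      -- The common form of three endings: `p` is a root, carries a mark already, or receives one.
      record Emptied : Set q where
        constructor emptying
        field
          {i b c} : ℕ → ℕ
          {M}     : ℕ
          bi      : BI (fd A htᶠ) i b c 2 M
          d₁      : ∀ {z} → i z ≢ 0 → fd A parᶠ z ≢ p × (fd A dIdxᶠ z ≢ 0 ⊎ (z ≡ p × fd A parᶠ p ≢ 0))
          d₂      : ∀ {z} → fd A dIdxᶠ z ≢ 0 → fd A parᶠ z ≢ p → i z ≢ 0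
          d₃      : fd A parᶠ p ≢ 0 → i p ≢ 0

        B : AS
        B = row dCntᶠ c (row dEntᶠ b (row dIdxᶠ i (setR dMaskʳ M (row leafᶠ W′ (row winᶠ N′ (row topᶠ T′ A))))))

        coreB : Core B n
        coreB = record
          { tree = Elect.tree′ (elect tree lp hp tp (proj₁ chv) (proj₂ chv) least (upd (fd A winᶠ) p v) uW
              (upd (fd A topᶠ) (fd A leafᶠ (fd A winᶠ p)) (fd A winᶠ p)) (upd T₁ (fd A leafᶠ v) p) d₁ d₂ d₃)
          ; dir = bi ; rts = rts ; root→ = λ lq → root→ (bk lq)
          ; →root = λ iq → let lq , pq = →root iq in fw lq , pq
          ; low = λ lq → low (bk lq) ; ai = ai-live ai p≢0 (AI.ids ai lp)
              (λ i< e → lp (trans (cong (fd A leafᶠ) (sym e)) (proj₂ (proj₂ (AI.free ai i<))))) uW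
          ; total = total ; nodes = nodes ; n≤m = n≤m ; size = size }

        sameB : Same A₀ B
        sameB = record
          { leaf→ = λ lf → let lq , hq = Same.leaf→ same lf in fw lq , hq
          ; →leaf = λ { (lq , hq) → Same.→leaf same (bk lq , hq) }
          ; keys = Same.keys same ; min-≡ = Same.min-≡ same ; res-≡ = Same.res-≡ same }

    module _ {i₁ i₂} (rm₁ : Removed (fd A dIdxᶠ) x i₁) (rm₂ : Removed i₁ y i₂) where

      clean : ∀ {z} → i₂ z ≢ 0 → fd A parᶠ z ≢ p × fd A dIdxᶠ z ≢ 0
      clean iz = let j , ny = proj₂ rm₂ iz; d , nx = proj₂ rm₁ j; lz , _ , wz = Tree.dirty tree d in
        (λ pz → [ nx , ny ]′ (children lz pz (λ e → wz (trans (cong (fd A winᶠ) pz) (sym e))))) , d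
      clean′ : ∀ {z} → i₂ z ≢ 0 → fd A parᶠ z ≢ p × (fd A dIdxᶠ z ≢ 0 ⊎ (z ≡ p × fd A parᶠ p ≢ 0))
      clean′ iz = map₂ inj₁ (clean iz)
      still : ∀ {z} → fd A dIdxᶠ z ≢ 0 → fd A parᶠ z ≢ p → i₂ z ≢ 0
      still dz ne = proj₁ rm₂ (λ { refl → ne pye }) (proj₁ rm₁ (λ { refl → ne pxe }) dz)

      module _ {i₃} (ad : Added i₂ p i₃) where

        clean-p : fd A parᶠ p ≢ 0 → ∀ {z} → i₃ z ≢ 0 → fd A parᶠ z ≢ p × (fd A dIdxᶠ z ≢ 0 ⊎ (z ≡ p × fd A parᶠ p ≢ 0))
        clean-p ne {z} iz = decide z p (λ { refl → par≢p , inj₂ (refl , ne) })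
          (λ n → clean′ (λ e → iz (trans (proj₂ ad n) e)))
        still-p : ∀ {z} → fd A dIdxᶠ z ≢ 0 → fd A parᶠ z ≢ p → i₃ z ≢ 0
        still-p {z} dz ne = decide z p (λ { refl → proj₁ ad }) (λ n e → still dz ne (trans (sym (proj₂ ad n)) e))

  same-temps : ∀ {A₀ A} → Same A₀ A → ∀ {t₇ t₈ t₉ t₁₀ t₁₁ t₁₂ t₁₃ t₁₄ t₁₅ t₁₆ t₁₇ t₁₈ t₁₉ t₂₀ t₂₁ t₂₂ t₂₃} →
    Same A₀ (setR 7 t₇ (setR 8 t₈ (setR 9 t₉ (setR 10 t₁₀ (setR 11 t₁₁ (setR 12 t₁₂ (setR 13 t₁₃
      (setR 14 t₁₄ (setR 15 t₁₅ (setR 16 t₁₆ (setR 17 t₁₇ (setR 18 t₁₈ (setR 19 t₁₉ (setR 20 t₂₀ (setR 21 t₂₁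
      (setR 22 t₂₂ (setR 23 t₂₃ A)))))))))))))))))
  same-temps s = record
    { leaf→ = Same.leaf→ s ; →leaf = Same.→leaf s ; keys = Same.keys s ; min-≡ = Same.min-≡ s ; res-≡ = Same.res-≡ s }

  merge-wp : ∀ {A₀ A Q n} → let x = rg A 11; y = rg A 12; p = rg A 16 in
    Pairing A₀ A n x y → fd A parᶠ x ≡ p → fd A parᶠ y ≡ p → Top (fd A parᶠ) (fd A winᶠ) p →
    (∀ {B} → Core B n → Same A₀ B → roots B ≡ roots A₀ × rg B rMaskʳ ≡ rg A₀ rMaskʳ → suc (dirties B) ≤ dirties A₀ → Q B) → WP mergeᶜ Q A
  merge-wp {A₀} {A} {Q} {n} pr ex ey tp k =
    setW (rg A 11) refl _ (step (rem-dirty dir dx λ bi₁ rm₁ s₁ _ →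
    setW (rg A 12) refl _ (step (rem-dirty bi₁ (proj₁ rm₁ (x≢y ∘ sym) dy)
      λ {i} {b} {c} {M} {t₇} {t₈} {t₉} bi₂ rm₂ s₂ _ → after {t₇ = t₇} {t₈} {t₉} bi₂ rm₁ rm₂ (trans (cong suc s₂) s₁)))))
    where
    open Pairing pr
    open Core core
    open MergeStep (merging pr ex ey tp)
      using (p; c₀; c₁; c₂; lp; wk; Elected; module Elected; electing; clean′; still; clean-p; still-p)
    after : ∀ {i₁ i b c M t₇ t₈ t₉} → BI (fd A htᶠ) i b c 2 M → Removed (fd A dIdxᶠ) (rg A 11) i₁ → Removed i₁ (rg A 12) i →
      suc (suc (sumTo w c)) ≡ dirties A →
      WP (childrenᶜ ▸ minᶜ ▸ electᶜ ▸
          set 10 (var 16) ▸ cond (fld parᶠ (var 10) ≐ num 0) nop (cond (fld dIdxᶠ (var 10) ≐ num 0) insDirtyᶜ nop)) Q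
         (row dCntᶠ c (row dEntᶠ b (row dIdxᶠ i (setR dMaskʳ M (setR 9 t₉ (setR 8 t₈ (setR 7 t₇ (setR 10 (rg A 12) A))))))))
    after {i₁} {i} {b} {c} {M} {t₇} {t₈} {t₉} bi rm₁ rm₂ s = step (children-wp (id-ok core lp)
      (step (min-wp (wk 0 (s≤s z≤n)) (wk 1 (s≤s (s≤s z≤n))) (wk 2 (s≤s (s≤s (s≤s z≤n)))) λ v∈ v₀ v₁ v₂ →
      step (elected (electing v∈ v₀ v₁ v₂)))))
      where
      le₁ : suc (sumTo w c) ≤ dirties A₀
      le₁ = ≤-trans (n≤1+n _) (≤-reflexive (trans s drt≡))
      elected : (E : Elected) → WP electᶜ (WP (set 10 (var 16) ▸ cond (fld parᶠ (var 10) ≐ num 0) nop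
          (cond (fld dIdxᶠ (var 10) ≐ num 0) insDirtyᶜ nop)) Q)
        (setR 15 (Elected.v E) (setR 20 c₂ (setR 19 c₁ (setR 18 c₀
          (row dCntᶠ c (row dEntᶠ b (row dIdxᶠ i (setR dMaskʳ M (setR 9 t₉ (setR 8 t₈ (setR 7 t₇ (setR 10 (rg A 12) A))))))))))))
      elected E = stoW T₁ refl _ _ (stoW T′ refl _ _ (stoW N′ refl _ _
        (lastSto W′ refl _ _ (setW p refl _ (if≡ _ _
          (λ e → skipW (done (emptying bi (clean′ rm₁ rm₂) (still rm₁ rm₂) (λ ne → ⊥-elim (ne e))) le₁))
          (λ ne → if≡ _ _
            (λ e → ins-dirty bi e (low lp) (≤-trans (n≤1+n _) (≤-trans (≤-reflexive s) (BI.cnt dir))) λ bi′ ad s′ _ →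
              done (emptying bi′ (clean-p rm₁ rm₂ ad ne) (still-p rm₁ rm₂ ad) (λ _ → proj₁ ad))
                (≤-reflexive (trans (cong suc s′) (trans s drt≡))))
            (λ ip → skipW (done (emptying bi (clean′ rm₁ rm₂) (still rm₁ rm₂) (λ _ → ip)) le₁))))))))
        where
        open Elected E
        done : (D : Emptied) → suc (sumTo w (Emptied.c D)) ≤ dirties A₀ →
          ∀ {t₇ t₈ t₉ t₁₀ t₁₅ t₁₈ t₁₉ t₂₀} →
          Q (row dCntᶠ (Emptied.c D) (row dEntᶠ (Emptied.b D) (row dIdxᶠ (Emptied.i D) (row leafᶠ W′ (row winᶠ N′ (row topᶠ T′ (setR dMaskʳ (Emptied.M D)
            (setR 7 t₇ (setR 8 t₈ (setR 9 t₉ (setR 10 t₁₀ (setR 15 t₁₅ (setR 18 t₁₈ (setR 19 t₁₉ (setR 20 t₂₀ A)))))))))))))))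
        done D le = k (core-temps (Emptied.coreB D)) (same-temps (Emptied.sameB D)) rts≡ le

  reduce-wp : ∀ {A Q n} → Core A n → rg A dMaskʳ ≢ 0 →
    (∀ {B} → Core B n → Same A B → roots B ≡ roots A × rg B rMaskʳ ≡ rg A rMaskʳ → suc (dirties B) ≤ dirties A → Q B) → WP reduceᶜ Q A
  reduce-wp core ne k = step (select-wp core ne λ pr le → step (siblings-wp pr le λ pr′ ex ey →
    step (lift-wp pr′ ex ey λ pr″ ex′ ey′ tp → merge-wp pr″ ex′ ey′ tp k)))

  -- The full heap invariant; DecreaseKey and Insert.

  Least : AS → Set q
  Least A = Leaf A (rg A minʳ) × (∀ {y} → Leaf A y → KLe (C A) (rg A minʳ) y)

  -- Only the total numbers of roots and dirty nodes are bounded: single buckets may stay overfull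
  -- between operations.
  record Heap (A : AS) (h : List (ℕ × Key)) : Set q where
    field
      core    : Core A (length h)
      few-r   : roots A ≤ 2 * suc ⌊log₂ length h ⌋
      few-d   : dirties A ≤ suc ⌊log₂ length h ⌋
      leaf-in : ∀ {x k} → Leaf A x → C A x ≡ just k → (x , k) ∈ h
      in-leaf : ∀ {x k} → (x , k) ∈ h → Leaf A x × C A x ≡ just k
      uniq    : Unique (ptrs h)
      least   : (h ≡ [] × rg A minʳ ≡ 0) ⊎ Least A

    log≤l : ⌊log₂ length h ⌋ ≤ l
    log≤l = ⌊log₂⌋-mono-≤ (Core.n≤m core)

  few-roots : ∀ {A n} → Core A n → rg A rMaskʳ ≡ 0 → roots A ≤ 2 * suc ⌊log₂ n ⌋
  few-roots {A} core e = sumTo-pigeon (fd A rCntᶠ) 2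
    (λ r<w → s≤s⁻¹ (mask-0 {w} {3} {fd A rCntᶠ} (trans (sym (BI.msk (Core.rts core))) e) r<w)) (Core.occ-root core)

  few-dirties : ∀ {A n} → Core A n → rg A dMaskʳ ≡ 0 → dirties A ≤ suc ⌊log₂ n ⌋
  few-dirties {A} {n} core e = ≤-trans (sumTo-pigeon (fd A dCntᶠ) 1
    (λ r<w → s≤s⁻¹ (mask-0 {w} {2} {fd A dCntᶠ} (trans (sym (BI.msk (Core.dir core))) e) r<w)) (Core.occ-dirty core))
    (≤-reflexive (*-identityˡ (suc ⌊log₂ n ⌋)))

  member≢[] : ∀ {A h x} → Heap A h → Leaf A x → h ≢ []
  member≢[] H lx refl = case Heap.leaf-in H lx (proj₂ (Tree.key (Core.tree (Heap.core H)) (proj₁ lx) (proj₂ lx))) of λ ()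

  decrease-wp : ∀ {A Q h k k₀} → Heap A h → (rg A argʳ , k₀) ∈ h → KR A ≡ just k → k ≤ᴷ k₀ →
    (∀ {B} → Heap B (change (rg A argʳ) k h) → Q B) → WP decreaseᶜ Q A
  decrease-wp {A} {Q} {h} {k} {k₀} H i kr k≤ out =
    keyW x refl _ kr (step (if≤ᵏ _ _ (k , Cx) (key-of leastA)
      (λ le → lastW x refl _ (rest lx (λ {y} ly → case y ≟ x of λ
          { (yes refl) → KLe-refl C′ Cx ; (no n) → KLe-trans C′ le (lower n (proj₂ leastA ly)) })))
      (λ le → skipW (rest (proj₁ leastA) (λ {y} ly → case y ≟ x of λ
          { (yes refl) → le ; (no n) → lower n (proj₂ leastA ly) })))))
    where
    open Heap H
    open Core core using (tree; dir; rts; root→; →root; low; ai; total; nodes; n≤m; size)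
    x n : ℕ
    x = rg A argʳ
    n = length h
    C′ : ℕ → Maybe Key
    C′ = update (C A) x (KR A)
    uC : Upd (C A) x (just k) C′
    uC = subst (λ v → Upd (C A) x v C′) kr (upd (C A) x (KR A))
    Cx : C′ x ≡ just k
    Cx = Upd.at uC
    lx : Leaf A x
    lx = proj₁ (in-leaf i)
    cx : C A x ≡ just k₀
    cx = proj₂ (in-leaf i)
    leastA : Least A
    leastA = [ (λ { (refl , _) → case i of λ () }) , (λ p → p) ]′ least
    key-of : Least A → ∃[ k ] (C′ (rg A minʳ) ≡ just k)
    key-of (lf , _) with rg A minʳ ≟ x
    ... | yes e = k , trans (cong C′ e) Cx
    ... | no ne = let k′ , e = Tree.key tree (proj₁ lf) (proj₂ lf) in k′ , trans (Upd.off uC ne) e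
    -- Lowering the key of `x` preserves a comparison when `x` stands on the left; the right side
    -- must be another leaf.
    lower : ∀ {y z} → z ≢ x → KLe (C A) y z → KLe C′ y z
    lower {y} n (k₁ , k₂ , e₁ , e₂ , le) with y ≟ x
    ... | no ne = k₁ , k₂ , trans (Upd.off uC ne) e₁ , trans (Upd.off uC n) e₂ , le
    ... | yes refl with trans (sym cx) e₁
    ... | refl = k , k₂ , Cx , trans (Upd.off uC n) e₂ , transᴷ k≤ le
    t : ℕ
    t = fd A topᶠ x

    -- The state after the marking step, up to registers.
    module _ {μ : ℕ} {i c b : ℕ → ℕ} {M : ℕ} (bi : BI (fd A htᶠ) i b c 2 M) (d₁ : ∀ {z} → fd A dIdxᶠ z ≢ 0 → i z ≢ 0)
      (d₂ : ∀ {z} → i z ≢ 0 → fd A dIdxᶠ z ≢ 0 ⊎ (z ≡ t × fd A parᶠ t ≢ 0)) (d₃ : fd A parᶠ t ≢ 0 → i t ≢ 0) where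
      B : AS
      B = row dCntᶠ c (row dEntᶠ b (row dIdxᶠ i (setR dMaskʳ M (setR minʳ μ (setC x A)))))
      coreB : Core B n
      coreB = record
        { tree = Decrease.tree′ (decrease tree (proj₁ lx) (proj₂ lx) cx k≤ uC d₁ d₂ d₃) ; dir = bi ; rts = rts
        ; root→ = root→ ; →root = →root ; low = low ; ai = ai ; total = total ; nodes = nodes ; n≤m = n≤m ; size = size }

    heap : ∀ {B} → Core B n → roots B ≤ 2 * suc ⌊log₂ n ⌋ → dirties B ≤ suc ⌊log₂ n ⌋ →
      (∀ {y} → Leaf A y → Leaf B y) → (∀ {y} → Leaf B y → Leaf A y) → C B ≡ C′ →
      Leaf A (rg B minʳ) → (∀ {y} → Leaf A y → KLe C′ (rg B minʳ) y) → Heap B (change x k h)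
    heap {B} cB r d lf→ →lf refl lm le = record
      { core = subst (Core B) (sym len) cB
      ; few-r = subst (λ n → roots B ≤ 2 * suc ⌊log₂ n ⌋) (sym len) r
      ; few-d = subst (λ n → dirties B ≤ suc ⌊log₂ n ⌋) (sym len) d
      ; leaf-in = λ {y} ly cy → decide y x
          (λ e → subst₂ (λ y v → (y , v) ∈ change x k h) (sym e)
            (just-injective (trans (sym Cx) (trans (sym (cong C′ e)) cy))) (change-new h i))
          (λ ne → change-in h ne (leaf-in (→lf ly) (trans (sym (Upd.off uC ne)) cy)))
      ; in-leaf = λ j →
          [ (λ (e , e′) → lf→ (subst (Leaf A) (sym e) lx) , trans (cong C′ e) (trans Cx (cong just (sym e′))))
          , (λ (ne , j′) → let ly , cy = in-leaf j′ in lf→ ly , trans (Upd.off uC ne) cy) ]′ (in-change h j)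
      ; uniq = subst Unique (sym (change-ptrs x k h)) uniq
      ; least = inj₂ (lf→ lm , λ ly → le (→lf ly)) }
      where len = change-length x k h

    finish : ∀ {B} → Core B n → roots B ≡ roots A → dirties B ≤ suc (dirties A) →
      (∀ {y} → Leaf A y → Leaf B y) → (∀ {y} → Leaf B y → Leaf A y) → C B ≡ C′ →
      Leaf A (rg B minʳ) → (∀ {y} → Leaf A y → KLe C′ (rg B minʳ) y) → WP (cond (var dMaskʳ ≐ num 0) nop reduceᶜ) Q B
    finish {B} cB r d lf→ →lf eC lm le = if≡ _ _
      (λ e → skipW (out (heap cB (≤-trans (≤-reflexive r) few-r) (few-dirties cB e) lf→ →lf eC lm le)))
      (λ ne → reduce-wp cB ne λ {D} cD same rts≡ drt≤ → out (heap cD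
        (≤-trans (≤-reflexive (trans (proj₁ rts≡) r)) few-r) (≤-trans (s≤s⁻¹ (≤-trans drt≤ d)) few-d)
        (Same.leaf→ same ∘ lf→) (→lf ∘ Same.→leaf same) (trans (Same.keys same) eC)
        (subst (Leaf A) (sym (Same.min-≡ same)) lm) (λ ly → subst (λ v → KLe C′ v _) (sym (Same.min-≡ same)) (le ly))))

    rest : ∀ {μ} → Leaf A μ → (∀ {y} → Leaf A y → KLe C′ μ y) →
      WP (markᶜ ▸ cond (var dMaskʳ ≐ num 0) nop reduceᶜ) Q (setR minʳ μ (setC x A))
    rest {μ} lm le = step (setW t refl _ (if≡ _ _
      (λ e → skipW (finish (core-temps (coreB {μ} dir (λ d → d) inj₁ (λ ne → ⊥-elim (ne e)))) refl (n≤1+n _) (λ y → y) (λ y → y) refl lm le))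
      (λ ne → if≡ _ _
        (λ e → ins-dirty dir e (low (proj₁ (Tree.top-ok tree (proj₁ lx) (proj₂ lx)))) lt λ bi add s _ →
          finish (core-temps (coreB {μ} bi (λ {z} d → keep add e d) (λ {z} → new add ne {z}) (λ _ → proj₁ add))) refl (≤-reflexive s)
            (λ y → y) (λ y → y) refl lm le)
        (λ d → skipW (finish (core-temps (coreB {μ} dir (λ d → d) inj₁ (λ _ → d))) refl (n≤1+n _) (λ y → y) (λ y → y) refl lm le)))))
      where
      lt : dirties A < 6 * suc l
      lt = ≤-trans (s≤s (≤-trans few-d (s≤s log≤l))) (≤-trans (+-monoˡ-≤ (suc l) (s≤s (z≤n {l})))
             (≤-trans (m≤m+n (suc l + suc l) (4 * suc l)) (≤-reflexive (six-fold (suc l)))))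
      keep : ∀ {i z} → Added (fd A dIdxᶠ) t i → fd A dIdxᶠ t ≡ 0 → fd A dIdxᶠ z ≢ 0 → i z ≢ 0
      keep {z = z} ad e d with z ≟ t
      ... | yes refl = ⊥-elim (d e)
      ... | no n = λ f → d (trans (sym (proj₂ ad n)) f)
      new : ∀ {i} → Added (fd A dIdxᶠ) t i → fd A parᶠ t ≢ 0 → ∀ {z} → i z ≢ 0 → fd A dIdxᶠ z ≢ 0 ⊎ (z ≡ t × fd A parᶠ t ≢ 0)
      new ad ne {z} iz with z ≟ t
      ... | yes refl = inj₂ (refl , ne)
      ... | no n = inj₁ (λ f → iz (trans (proj₂ ad n) f))

  insert-wp : ∀ {A Q h k} → Heap A h → suc (length h) ≤ m → KR A ≡ just k →
    (∀ {B} → Heap B ((rg B argʳ , k) ∷ h) → rg B argʳ ≢ 0 → rg B argʳ ∉ ptrs h → Q B) → WP insertᶜ Q A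
  insert-wp {A} {Q} {h} {k} H lt kr out = step (newLeaf-wp core lt kr room λ {B} → after {B})
    where
    open Heap H
    n : ℕ
    n = length h
    room : roots A < 6 * suc l
    room = ≤-trans (s≤s (≤-trans few-r (*-monoʳ-≤ 2 (s≤s log≤l)))) (≤-trans (+-monoˡ-≤ (2 * suc l) (s≤s (z≤n {l})))
      (≤-trans (m≤m+n (suc l + 2 * suc l) (3 * suc l)) (≤-reflexive (six-fold′ (suc l)))))
    after : ∀ {B} → Core B (suc n) → NewLeaf A B k → roots B ≡ suc (roots A) → dirties B ≡ dirties A →
      WP (cond (var minʳ ≐ num 0) (set minʳ (var 14)) (cond (var 14 ≼ var minʳ) (set minʳ (var 14)) nop) ▸
          set argʳ (var 14) ▸ cond (var rMaskʳ ≐ num 0) nop joinᶜ) Q B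
    after {B} cB new rB dB = step (if≡ _ _
        (λ e → lastW p refl _ (rest N.new λ {y} ly → case y ≟ p of λ
          { (yes refl) → KLe-refl (C B) N.key-at ; (no ne) → ⊥-elim (nomin e (N.→leaf ly ne)) }))
        (λ ne → if≤ᵏ _ _ (k , N.key-at) (oldkey ne)
          (λ le → lastW p refl _ (rest N.new λ {y} ly → case y ≟ p of λ
             { (yes refl) → KLe-refl (C B) N.key-at
             ; (no ney) → KLe-trans (C B) le (old (proj₂ (leastA ne) (N.→leaf ly ney)) ney ne) }))
          (λ le → skipW (rest (subst (Leaf B) (sym N.min-≡) (N.leaf→ (proj₁ (leastA ne)))) λ {y} ly → case y ≟ p of λ
             { (yes refl) → le ; (no ney) → old (proj₂ (leastA ne) (N.→leaf ly ney)) ney ne }))))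
      where
      module N = NewLeaf new
      p : ℕ
      p = rg B 14
      nomin : rg B minʳ ≡ 0 → ∀ {y} → Leaf A y → ⊥
      nomin e ly = [ (λ { (f , _) → member≢[] H ly f })
                   , (λ { (lm , _) → Tree.live≢0 (Core.tree core) (proj₁ lm) (trans (sym N.min-≡) e) }) ]′ least
      leastA : rg B minʳ ≢ 0 → Least A
      leastA ne = [ (λ { (_ , f) → ⊥-elim (ne (trans N.min-≡ f)) }) , (λ x → x) ]′ least
      p≢ : ∀ {y} → Leaf A y → y ≢ p
      p≢ ly e = N.fresh (subst (Leaf A) e ly)
      oldkey : rg B minʳ ≢ 0 → ∃[ k ] (C B (rg B minʳ) ≡ just k)
      oldkey ne = let lm , _ = leastA ne; k′ , e = Tree.key (Core.tree core) (proj₁ lm) (proj₂ lm) in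
        k′ , trans (cong (C B) N.min-≡) (trans (N.key-off (p≢ lm)) e)
      old : ∀ {y} → KLe (C A) (rg A minʳ) y → y ≢ p → rg B minʳ ≢ 0 → KLe (C B) (rg B minʳ) y
      old (k₁ , k₂ , e₁ , e₂ , le) ney ne =
        k₁ , k₂ , trans (cong (C B) N.min-≡) (trans (N.key-off (p≢ (proj₁ (leastA ne)))) e₁) , trans (N.key-off ney) e₂ , le
      p∉ : p ∉ ptrs h
      p∉ i = N.fresh (proj₁ (in-leaf (proj₂ (ptr-in h i))))
      heap : ∀ {D} → Core D (suc n) → roots D ≤ 2 * suc ⌊log₂ suc n ⌋ → dirties D ≤ suc ⌊log₂ suc n ⌋ →
        (∀ {y} → Leaf B y → Leaf D y) → (∀ {y} → Leaf D y → Leaf B y) → C D ≡ C B → rg D argʳ ≡ p →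
        Leaf B (rg D minʳ) → (∀ {y} → Leaf B y → KLe (C B) (rg D minʳ) y) → Q D
      heap {D} cD r d lf→ →lf eC e₀ lm le = out (subst (λ z → Heap D ((z , k) ∷ h)) (sym e₀) record
          { core = cD ; few-r = r ; few-d = d
          ; leaf-in = λ {y} ly cy → decide y p
              (λ e → here (cong₂ _,_ e (just-injective (trans (sym (trans (sym (cong (λ c → c y) eC)) cy)) (trans (cong (C B) e) N.key-at)))))
              (λ ne → there (leaf-in (N.→leaf (→lf ly) ne) (trans (sym (N.key-off ne)) (trans (sym (cong (λ c → c y) eC)) cy))))
          ; in-leaf = λ { (here refl) → lf→ N.new , trans (cong (λ c → c p) eC) N.key-at
                        ; (there {xs = _} i) → let ly , cy = in-leaf i in
                            lf→ (N.leaf→ ly) , trans (cong (λ c → c _) eC) (trans (N.key-off (p≢ ly)) cy) }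
          ; uniq = all-≢ (ptrs h) (λ i e → p∉ (subst (_∈ ptrs h) (sym e) i)) ∷ uniq
          ; least = inj₂ (lf→ lm , λ ly → subst (λ c → KLe c (rg D minʳ) _) (sym eC) (le (→lf ly))) })
          (λ e → N.nz (trans (sym e₀) e)) (λ i → p∉ (subst (_∈ ptrs h) e₀ i))
      few-d′ : dirties B ≤ suc ⌊log₂ suc n ⌋
      few-d′ = ≤-trans (≤-reflexive dB) (≤-trans few-d (s≤s (⌊log₂⌋-mono-≤ (n≤1+n n))))
      rest : ∀ {μ} → Leaf B μ → (∀ {y} → Leaf B y → KLe (C B) μ y) →
        WP (set argʳ (var 14) ▸ cond (var rMaskʳ ≐ num 0) nop joinᶜ) Q (setR minʳ μ B)
      rest {μ} lm le = setW p refl _ (if≡ _ _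
        (λ e → skipW (heap (core-temps cB) (few-roots cB e) few-d′ (λ y → y) (λ y → y) refl refl lm le))
        -- The insertion adds one root and the join takes two away, so the old bound persists.
        (λ ne → join-wp (core-temps cB {t₀ = p} {t₁ = μ}) ne λ {D} cD same r d → heap cD
          (≤-trans (n≤1+n _) (≤-trans (s≤s⁻¹ (≤-reflexive (trans r rB))) (≤-trans few-r (*-monoʳ-≤ 2 (s≤s (⌊log₂⌋-mono-≤ (n≤1+n n)))))))
          (≤-trans (≤-reflexive d) few-d′) (λ y → Same.leaf→ same y) (λ y → Same.→leaf same y) (Same.keys same) (Same.res-≡ same)
          (subst (Leaf B) (sym (Same.min-≡ same)) lm) (λ ly → subst (λ v → KLe (C B) v _) (sym (Same.min-≡ same)) (le ly))))

  -- The way up from the minimum and down again in DeleteMin.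

  big : 16 * 32 ≤ 2 ^ w
  big = ≤-trans (m≤m+n 512 3088) (≤-trans (≤-trans (≤-reflexive (sym (*-identityʳ 3600))) (*-monoʳ-≤ 3600 (s≤s z≤n))) cap)

  do-WP : ∀ {c Q A} → WP c Q A → Do big ⟦ c ⟧ A (time c) Q
  do-WP {c} {Q} {A} ⟪ p ⟫ = subst (λ t → Do big ⟦ c ⟧ A t Q) (time-≡ c) (do-wp big c p)

  -- From y, following the descent row dn leads down to the leaf x.
  Path : (W par ht dn : ℕ → ℕ) (x : ℕ) → ℕ → ℕ → Set
  Path W par ht dn x zero    y = y ≡ x
  Path W par ht dn x (suc j) y =
    W (dn y) ≢ 0 × par (dn y) ≡ y × ht (dn y) ≡ j × Path W par ht dn x j (dn y)

  module Climb {A n} (core : Core A n) (lf : Leaf A (rg A minʳ)) where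

    open Core core
    x : ℕ
    x = rg A minʳ
    L : ℕ
    L = ⌊log₂ n ⌋

    ht≤L : ∀ {y} → fd A leafᶠ y ≢ 0 → fd A htᶠ y ≤ L
    ht≤L {y} ly = 2^≤⇒≤log (≤-trans (2^≤3^ (fd A htᶠ y)) (height ly))

    -- The recorded path consults `dn` only at nodes of height at most `j`, and `p` is higher.
    path-upd : ∀ j {dn y p v} → fd A htᶠ y ≡ j → j < fd A htᶠ p → Path (fd A leafᶠ) (fd A parᶠ) (fd A htᶠ) dn x j y →
               Path (fd A leafᶠ) (fd A parᶠ) (fd A htᶠ) (update dn p v) x j y
    path-upd zero hy lt e = e
    path-upd (suc j) {dn} {y} {p} {v} hy lt (l , e , h , r) rewrite update-≢ dn p v {y} (λ { refl → <⇒≢ lt (sym hy) }) =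
      l , e , h , path-upd j h (≤-trans (n≤1+n (suc j)) lt) r

    I : ℕ → AS → Set q
    I k B = ∃₂ λ dn y → B ≡ row pathᶠ dn (setR 16 y A) × fd A leafᶠ y ≢ 0 × fd A htᶠ y + k ≡ L ×
      Path (fd A leafᶠ) (fd A parᶠ) (fd A htᶠ) dn x (fd A htᶠ y) y × Lift q ⊤

    Q₁ : AS → Set q
    Q₁ B = ∃₂ λ dn y → B ≡ row pathᶠ dn (setR 16 y A) × fd A leafᶠ y ≢ 0 × fd A parᶠ y ≡ 0 ×
      Path (fd A leafᶠ) (fd A parᶠ) (fd A htᶠ) dn x (fd A htᶠ y) y × Lift q ⊤

    climb-step : ∀ k B → I k B →
      wpᵗ (num 0 ≺ fld parᶠ (var 16)) B (∃[ k′ ] (k ≡ suc k′ × Do big ⟦ climbᶜ ⟧ B (time climbᶜ) (I k′))) (Q₁ B)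
    climb-step k _ (dn , y , refl , ly , e , path , _) = _ , up k e ,
      λ le → dn , y , refl , ly , n≤0⇒n≡0 le , path , _
      where
      up : ∀ k → fd A htᶠ y + k ≡ L → 0 < fd A parᶠ y → ∃[ k′ ] (k ≡ suc k′ × Do big ⟦ climbᶜ ⟧ (row pathᶠ dn (setR 16 y A)) (time climbᶜ) (I k′))
      -- At height `L` a parent would be higher than the number of elements permits.
      up zero e 0<p = ⊥-elim (<⇒≱ (≤-trans (≤-reflexive (cong suc (trans (sym e) (+-identityʳ _)))) (≤-reflexive (sym hp))) (ht≤L lp))
        where
        p≢0 : fd A parᶠ y ≢ 0
        p≢0 f = <⇒≢ 0<p (sym f)
        lp = Tree.par-live tree ly p≢0
        hp = Tree.par-ht tree ly p≢0
      up (suc k) e 0<p = k , refl , do-WP (stoW dn′ refl _ _ (lastW p refl _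
          (dn′ , p , refl , lp , trans (cong (_+ k) hp) (trans (sym (+-suc (fd A htᶠ y) k)) e) ,
           subst (λ j → Path (fd A leafᶠ) (fd A parᶠ) (fd A htᶠ) dn′ x j p) (sym hp)
             (step-in (update-≡ dn p y refl)) , _)))
        where
        p : ℕ
        p = fd A parᶠ y
        dn′ : ℕ → ℕ
        dn′ = update dn p y
        p≢0 : p ≢ 0
        p≢0 f = <⇒≢ 0<p (sym f)
        lp = Tree.par-live tree ly p≢0
        hp = Tree.par-ht tree ly p≢0
        step-in : dn′ p ≡ y → Path (fd A leafᶠ) (fd A parᶠ) (fd A htᶠ) dn′ x (suc (fd A htᶠ y)) p
        step-in d = subst (λ c → fd A leafᶠ c ≢ 0) (sym d) ly , trans (cong (fd A parᶠ) d) refl , cong (fd A htᶠ) d ,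
          subst (Path (fd A leafᶠ) (fd A parᶠ) (fd A htᶠ) dn′ x (fd A htᶠ y)) (sym d)
            (path-upd (fd A htᶠ y) refl (≤-reflexive (sym hp)) path)

    climb-do : Do big (while ⟦ num 0 ≺ fld parᶠ (var 16) ⟧ᵗ do′ ⟦ climbᶜ ⟧) (setR 16 x A)
      (L * (costᵗ ⟦ num 0 ≺ fld parᶠ (var 16) ⟧ᵗ + time climbᶜ) + costᵗ ⟦ num 0 ≺ fld parᶠ (var 16) ⟧ᵗ) Q₁
    climb-do = do-while big (num 0 ≺ fld parᶠ (var 16)) ⟦ climbᶜ ⟧ (time climbᶜ) I climb-step L (setR 16 x A)
      (fd A pathᶠ , x , refl , proj₁ lf , cong (_+ L) (proj₂ lf) ,
       subst (λ j → Path (fd A leafᶠ) (fd A parᶠ) (fd A htᶠ) (fd A pathᶠ) x j x) (sym (proj₂ lf)) refl , _)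

    PathIn : AS → ℕ → ℕ → Set
    PathIn B = Path (fd B leafᶠ) (fd B parᶠ) (fd B htᶠ) (fd B pathᶠ) x

    -- Nodes further down the path have parents of height at most `j`, which are not `r`, so their
    -- parents survive the split.
    path-split : ∀ {B D r} j {c} → fd B leafᶠ 0 ≡ 0 → Splits B D r → fd B htᶠ c ≡ j → j < fd B htᶠ r → c ≢ 0 →
                 PathIn B j c → PathIn D j c
    path-split zero nul s hc lt c≢0 e = e
    path-split {B} {D} {r} (suc j) {c} nul s hc lt c≢0 (l , e , h , rest) rewrite Splits.descent s | Splits.heights s =
      let l′ , e′ = Splits.other s l (λ f → c≢0 (trans (sym e) f)) (λ f → <⇒≢ lt (trans (sym hc) (cong (fd B htᶠ) (trans (sym e) f)))) in
      l′ , trans e′ e , h ,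
      subst₂ (λ ht dn → Path (fd D leafᶠ) (fd D parᶠ) ht dn x j (fd B pathᶠ c)) (Splits.heights s) (Splits.descent s)
        (path-split j nul s h (≤-trans (n≤1+n (suc j)) lt) (λ f → l (trans (cong (fd B leafᶠ) f) nul)) rest)

    -- Each split adds two roots and lowers `k` by one, so the number of roots plus `2 * k` stays
    -- constant.
    I₂ : ℕ → AS → Set q
    I₂ k B = Core B n × Same A B × fd B leafᶠ (rg B 16) ≢ 0 × fd B parᶠ (rg B 16) ≡ 0 × fd B htᶠ (rg B 16) ≡ k ×
      PathIn B k (rg B 16) × roots B + 2 * k ≤ 4 * suc L × dirties B ≤ dirties A

    Q₂ : AS → Set q
    Q₂ B = Core B n × Same A B × rg B 16 ≡ x × fd B parᶠ x ≡ 0 × roots B ≤ 4 * suc L × dirties B ≤ dirties A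

    L≤l : L ≤ l
    L≤l = ⌊log₂⌋-mono-≤ n≤m

    descend-step : ∀ k B → I₂ k B →
      wpᵗ (num 0 ≺ fld htᶠ (var 16)) B (∃[ k′ ] (k ≡ suc k′ × Do big ⟦ descendᶜ ⟧ B (time descendᶜ) (I₂ k′))) (Q₂ B)
    descend-step k B (cB , sB , ly , py , hy , path , rB , dB) = _ , down k hy path rB , stop k hy path rB
      where
      y : ℕ
      y = rg B 16
      stop : ∀ k → fd B htᶠ y ≡ k → PathIn B k y → roots B + 2 * k ≤ 4 * suc L → fd B htᶠ y ≤ 0 → Q₂ B
      stop zero hy refl rB le = cB , sB , refl , py , ≤-trans (≤-reflexive (sym (+-identityʳ _))) rB , dB
      stop (suc k) hy path rB le = ⊥-elim (n≮0 (subst (_≤ 0) hy le))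
      down : ∀ k → fd B htᶠ y ≡ k → PathIn B k y → roots B + 2 * k ≤ 4 * suc L → 0 < fd B htᶠ y →
        ∃[ k′ ] (k ≡ suc k′ × Do big ⟦ descendᶜ ⟧ B (time descendᶜ) (I₂ k′))
      down zero hy path rB lt = ⊥-elim (<⇒≢ lt (sym hy))
      down (suc k) hy (lc , ec , hc , path) rB lt = k , refl , do-WP (step (split-wp cB ly py hy room
        λ {D} cD same sp rD dD → lastW (fd D pathᶠ (rg D 16)) refl _ (next cD same sp rD dD (c≡ sp))))
        where
        c : ℕ
        c = fd B pathᶠ y
        c≡ : ∀ {D} → Splits B D y → fd D pathᶠ (rg D 16) ≡ c
        c≡ sp = cong₂ (λ f z → f z) (Splits.descent sp) (Splits.node sp)
        room : roots B + 2 ≤ 6 * suc l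
        room = ≤-trans (+-monoʳ-≤ (roots B) (≤-trans (m≤m+n 2 (2 * k)) (≤-reflexive (sym (*-suc 2 k)))))
          (≤-trans rB (*-mono-≤ (m≤m+n 4 2) (s≤s L≤l)))
        next : ∀ {D z} → Core D n → Same B D → Splits B D y → roots D ≡ suc (suc (roots B)) → dirties D ≤ dirties B →
          z ≡ c → I₂ k (setR 16 z D)
        next {D} cD same sp rD dD refl =
          core-temps cD , same-temps (same-trans sB same) , proj₁ root , proj₂ root ,
          trans (cong (λ h → h c) (Splits.heights sp)) hc ,
          path-split k (Tree.null (Core.tree cB)) sp hc (≤-reflexive (sym hy)) (Tree.live≢0 (Core.tree cB) lc) path ,
          ≤-trans (≤-reflexive (trans (cong (_+ 2 * k) rD) (shift-two (roots B) k))) rB , ≤-trans dD dB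
          where
          root = Splits.child-root sp lc ec

    descend-do : roots A ≤ 2 * suc L → ∀ {B} → Q₁ B → Do big (while ⟦ num 0 ≺ fld htᶠ (var 16) ⟧ᵗ do′ ⟦ descendᶜ ⟧) B
      (L * (costᵗ ⟦ num 0 ≺ fld htᶠ (var 16) ⟧ᵗ + time descendᶜ) + costᵗ ⟦ num 0 ≺ fld htᶠ (var 16) ⟧ᵗ) Q₂
    descend-do few (dn , y , refl , ly , py , path , _) = do-mono big
      (+-monoˡ-≤ (costᵗ ⟦ num 0 ≺ fld htᶠ (var 16) ⟧ᵗ) (*-monoˡ-≤ (costᵗ ⟦ num 0 ≺ fld htᶠ (var 16) ⟧ᵗ + time descendᶜ) (ht≤L ly)))
      (do-while big (num 0 ≺ fld htᶠ (var 16)) ⟦ descendᶜ ⟧ (time descendᶜ) I₂ descend-step (fd A htᶠ y) _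
        (record { tree = tree ; dir = dir ; rts = rts ; root→ = root→ ; →root = →root ; low = low ; ai = ai
                ; total = total ; nodes = nodes ; n≤m = n≤m ; size = size }
        , record { leaf→ = λ z → z ; →leaf = λ z → z ; keys = refl ; min-≡ = refl ; res-≡ = refl }
        , ly , py , refl , path
        -- At most `2 * suc L` roots at the start and two more for each of at most `L` levels.
        , ≤-trans (+-mono-≤ few (*-monoʳ-≤ 2 (≤-trans (ht≤L ly) (n≤1+n L)))) (≤-reflexive (sym (*-distribʳ-+ (suc L) 2 2))) , ≤-refl))

  -- Scanning the buckets for the new minimum.

  module Scan {A n} (core : Core A n) (e₄ : rg A dMaskʳ ≡ 0) (e₅ : rg A rMaskʳ ≡ 0) where

    open Core core
    L : ℕ
    L = ⌊log₂ n ⌋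

    L≤l : L ≤ l
    L≤l = ⌊log₂⌋-mono-≤ n≤m

    -- `S` holds the nodes already inspected, and `μ` is a leaf not beaten by any of their winners;
    -- 0 means that none has been seen.
    Best : (ℕ → Set) → ℕ → Set q
    Best S μ = Lift q (μ ≡ 0 × (∀ {c} → ¬ S c)) ⊎ (Leaf A μ × (∀ {c} → S c → KLe (C A) μ (fd A leafᶠ c)))

    weaken : ∀ {S S′ : ℕ → Set} {μ} → (∀ {c} → S′ c → S c) → Best S μ → Best S′ μ
    weaken f (inj₁ (lift (e , none′))) = inj₁ (lift (e , none′ ∘ f))
    weaken f (inj₂ (lf , le)) = inj₂ (lf , le ∘ f)

    st : ℕ → ℕ → ℕ → ℕ → AS
    st μ r t u = setR 16 r (setR 17 (suc L) (setR 12 u (setR 11 t (setR minʳ μ A))))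

    consider-wp : ∀ {S : ℕ → Set} {Q μ r c u} → fd A leafᶠ c ≢ 0 → Best S μ →
      (∀ {ν} → Best (λ z → S z ⊎ z ≡ c) ν → Q (st ν r c (fd A leafᶠ c))) → WP considerᶜ Q (st μ r c u)
    consider-wp {S} {Q} {μ} {r} {c} lc b k = setW v refl _ (if≡ _ _
      (λ e → lastW v refl _ (k (first b e)))
      (λ ne → if≤ᵏ _ _ (Tree.wkey tree lc) (μ-key b ne)
        (λ le → lastW v refl _ (k (better b ne le)))
        (λ le → skipW (k (worse b ne le)))))
      where
      v : ℕ
      v = fd A leafᶠ c
      vv : KLe (C A) v v
      vv = KLe-refl (C A) (proj₂ (Tree.wkey tree lc))
      first : Best S μ → μ ≡ 0 → Best (λ z → S z ⊎ z ≡ c) v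
      first (inj₁ (lift (_ , none′))) e = inj₂ (Tree.lf tree lc , λ { (inj₁ s) → ⊥-elim (none′ s) ; (inj₂ refl) → vv })
      first (inj₂ ((lm , _) , _)) e = ⊥-elim (Tree.live≢0 tree lm e)
      μ-key : Best S μ → μ ≢ 0 → ∃[ k ] (C A μ ≡ just k)
      μ-key (inj₁ (lift (e , _))) ne = ⊥-elim (ne e)
      μ-key (inj₂ ((lm , hm) , _)) ne = Tree.key tree lm hm
      better : Best S μ → μ ≢ 0 → KLe (C A) v μ → Best (λ z → S z ⊎ z ≡ c) v
      better (inj₁ (lift (e , _))) ne le = ⊥-elim (ne e)
      better (inj₂ (_ , m≤)) ne le = inj₂ (Tree.lf tree lc , λ
        { (inj₁ s) → KLe-trans (C A) le (m≤ s) ; (inj₂ refl) → vv })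
      worse : Best S μ → μ ≢ 0 → KLe (C A) μ v → Best (λ z → S z ⊎ z ≡ c) μ
      worse (inj₁ (lift (e , _))) ne le = ⊥-elim (ne e)
      worse (inj₂ (lm , m≤)) ne le = inj₂ (lm , λ { (inj₁ s) → m≤ s ; (inj₂ refl) → le })

    Below : ℕ → ℕ → Set
    Below r c = (fd A rIdxᶠ c ≢ 0 ⊎ fd A dIdxᶠ c ≢ 0) × fd A htᶠ c < r

    -- No bucket is overfull at this point. With `≤1` this justifies that the scan looks at two
    -- roots and one dirty node of each height.
    ≤2 : ∀ r → fd A rCntᶠ r ≤ 2
    ≤2 r with fd A rCntᶠ r ≟ 0
    ... | yes e = ≤-trans (≤-reflexive e) z≤n
    ... | no ne = s≤s⁻¹ (mask-0 {w} {3} {fd A rCntᶠ} (trans (sym (BI.msk rts)) e₅) (≤-<-trans (BI.occupied rts ne) l<w))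

    ≤1 : ∀ r → fd A dCntᶠ r ≤ 1
    ≤1 r with fd A dCntᶠ r ≟ 0
    ... | yes e = ≤-trans (≤-reflexive e) z≤n
    ... | no ne = s≤s⁻¹ (mask-0 {w} {2} {fd A dCntᶠ} (trans (sym (BI.msk dir)) e₄) (≤-<-trans (BI.occupied dir ne) l<w))

    -- An entry of a bucket of height r is determined by its position.
    entry-of : ∀ {i b c : ℕ → ℕ} {t M z r} → BI (fd A htᶠ) i b c t M → i z ≢ 0 → fd A htᶠ z ≡ r → ∀ j → i z ≡ j → z ≡ b (pair r j)
    entry-of B iz refl _ refl = sym (proj₂ (BI.member B iz))

    module _ {r : ℕ} where

      S₁ S₂ : ℕ → Set
      S₁ z = Below r z ⊎ (fd A rIdxᶠ z ≢ 0 × fd A htᶠ z ≡ r)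
      S₂ z = S₁ z ⊎ (fd A dIdxᶠ z ≢ 0 × fd A htᶠ z ≡ r)

      ps : ∀ {c : ℕ → ℕ} j → j ≤ 2 → r ≤ l → PairSafe r j
      ps j j≤ r≤ = pairSafe r≤ (≤-trans j≤ (≤-trans (m≤m+n 2 4) (m≤m*n 6 (suc l))))

      suc-ok : Small (suc l)
      suc-ok = small-7l (m≤n*m (suc l) 7)

      next-wp : ∀ {Q μ t u} → suc r ≤ suc L → Best (Below r) μ →
        (∀ {ν t u} → Best (Below (suc r)) ν → Q (st ν (suc r) t u)) → WP scanStepᶜ Q (st μ r t u)
      next-wp {Q} {μ} {t} {u} r<L b k = step (if≡ _ _
          (λ e → skipW (dirty-part {t = t} {u} (weaken (λ { (inj₁ z) → z ; (inj₂ (iz , hz)) →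
              ⊥-elim (BI.count≢0 rts iz (trans (cong (fd A rCntᶠ) hz) e)) }) b)))
          (λ ne → setW x refl (ps {fd A rCntᶠ} 1 (s≤s z≤n) (BI.occupied rts ne)) (step (consider-wp (live-root ne 1 (s≤s z≤n) (n≢0⇒n>0 ne)) b λ {μ₁} b₁ →
            if≡ _ _
              (λ e → skipW (dirty-part {t = x} {fd A leafᶠ x} (weaken (λ { (inj₁ z) → inj₁ z ; (inj₂ (iz , hz)) →
                  inj₂ (entry-of rts iz hz 1 (≤-antisym (≤-trans (proj₁ (BI.member rts iz)) (≤-reflexive (trans (cong (fd A rCntᶠ) hz) e))) (n≢0⇒n>0 iz))) }) b₁)))
              (λ ne′ → setW y refl (ps {fd A rCntᶠ} 2 ≤-refl (BI.occupied rts ne)) (consider-wp (live-root ne 2 (s≤s z≤n) (≤∧≢⇒< (n≢0⇒n>0 ne) (ne′ ∘ sym))) b₁ λ b₂ →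
                dirty-part {t = y} {fd A leafᶠ y} (weaken (λ { (inj₁ z) → inj₁ (inj₁ z) ; (inj₂ (iz , hz)) → two iz hz (fd A rIdxᶠ _) refl }) b₂)))))))
        where
        x y z : ℕ
        x = fd A rEntᶠ (pair r 1)
        y = fd A rEntᶠ (pair r 2)
        z = fd A dEntᶠ (pair r 1)
        live-root : fd A rCntᶠ r ≢ 0 → ∀ j → 1 ≤ j → j ≤ fd A rCntᶠ r → fd A leafᶠ (fd A rEntᶠ (pair r j)) ≢ 0
        live-root ne j 1≤ j≤ = proj₁ (→root (BI.entry-in rts 1≤ j≤))
        two : ∀ {v} → fd A rIdxᶠ v ≢ 0 → fd A htᶠ v ≡ r → ∀ j → fd A rIdxᶠ v ≡ j → (Below r v ⊎ v ≡ x) ⊎ v ≡ y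
        two iz hz 0 e = ⊥-elim (iz e)
        two iz hz 1 e = inj₁ (inj₂ (entry-of rts iz hz 1 e))
        two iz hz 2 e = inj₂ (entry-of rts iz hz 2 e)
        two iz hz (suc (suc (suc j))) e = ⊥-elim (<⇒≱ (≤-trans (s≤s (s≤s (s≤s z≤n))) (≤-reflexive (sym e)))
          (≤-trans (proj₁ (BI.member rts iz)) (≤2 _)))
        end : ∀ {ν t u} → Best S₂ ν → WP (set 16 (num 1 ⊕ var 16)) Q (st ν r t u)
        end b₂ = lastW (suc r) refl (_ , _ , small-mono big (≤-trans r<L (s≤s L≤l)) suc-ok) (k (weaken (λ { (cd , lt) →
            case fd A htᶠ _ ≟ r of λ
              { (no n) → inj₁ (inj₁ (cd , ≤∧≢⇒< (s≤s⁻¹ lt) n))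
              ; (yes e) → [ (λ i → inj₁ (inj₂ (i , e))) , (λ d → inj₂ (d , e)) ]′ cd } }) b₂))
        dirty-part : ∀ {ν t u} → Best S₁ ν →
          WP (cond (fld dCntᶠ (var 16) ≐ num 0) nop (set 11 (fld dEntᶠ (pairᵉ (var 16) (num 1))) ▸ considerᶜ) ▸ set 16 (num 1 ⊕ var 16)) Q
             (st ν r t u)
        dirty-part {t = t} {u} b₁ = step (if≡ _ _
          (λ e → skipW (end {t = t} {u} (weaken (λ { (inj₁ s) → s ; (inj₂ (d , h)) →
              ⊥-elim (BI.count≢0 dir d (trans (cong (fd A dCntᶠ) h) e)) }) b₁)))
          (λ ne → setW z refl (ps {fd A dCntᶠ} 1 (s≤s z≤n) (BI.occupied dir ne)) (consider-wp
            (proj₁ (Tree.dirty tree (BI.entry-in dir (s≤s z≤n) (n≢0⇒n>0 ne)))) b₁ λ b₂ →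
            end {t = z} {fd A leafᶠ z} (weaken (λ { (inj₁ s) → inj₁ s ; (inj₂ (d , h)) → inj₂ (entry-of dir d h 1
              (≤-antisym (≤-trans (proj₁ (BI.member dir d)) (≤1 _)) (n≢0⇒n>0 d))) }) b₂))))

    I : ℕ → AS → Set q
    I k B = ∃₂ λ μ r → ∃₂ λ t u → B ≡ st μ r t u × Best (Below r) μ × r + k ≡ suc L

    Qₛ : AS → Set q
    Qₛ B = ∃₂ λ μ r → ∃₂ λ t u → B ≡ st μ r t u × Best (Below (suc L)) μ

    scan-step : ∀ k B → I k B →
      wpᵗ (var 16 ≺ var 17) B (∃[ k′ ] (k ≡ suc k′ × Do big ⟦ scanStepᶜ ⟧ B (time scanStepᶜ) (I k′))) (Qₛ B)
    scan-step k _ (μ , r , t , u , refl , b , e) = _ , more k e ,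
      λ le → μ , r , t , u , refl , weaken (λ { (c , lt) → c , ≤-trans lt le }) b
      where
      more : ∀ k → r + k ≡ suc L → r < suc L → ∃[ k′ ] (k ≡ suc k′ × Do big ⟦ scanStepᶜ ⟧ (st μ r t u) (time scanStepᶜ) (I k′))
      more zero e lt = ⊥-elim (<⇒≢ lt (trans (sym (+-identityʳ r)) e))
      more (suc k) e lt = k , refl , do-WP (next-wp {t = t} {u} lt b λ {ν} {t} {u} b′ → ν , suc r , t , u , refl , b′ , trans (sym (+-suc r k)) e)

    scan-do : Do big ⟦ scanᶜ ⟧ A (time scanInitᶜ +
      (suc L * (costᵗ ⟦ var 16 ≺ var 17 ⟧ᵗ + time scanStepᶜ) + costᵗ ⟦ var 16 ≺ var 17 ⟧ᵗ)) Qₛ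
    scan-do = do-seq big {c = ⟦ scanInitᶜ ⟧} {b = time scanInitᶜ} {b′ = suc L * (costᵗ ⟦ var 16 ≺ var 17 ⟧ᵗ + time scanStepᶜ) + costᵗ ⟦ var 16 ≺ var 17 ⟧ᵗ} {Q = λ B → B ≡ st 0 0 (rg A 11) (rg A 12) × Lift q ⊤}
      (do-WP {scanInitᶜ} (setW 0 refl _ (setW 0 refl _ (lastW (suc L) (cong suc logN) (_ , _ , subst (Small ∘ suc) (sym logN) (small-mono big (s≤s L≤l) (small-7l (m≤n*m (suc l) 7)))) (refl , _)))))
      λ { (refl , _) → do-while big (var 16 ≺ var 17) ⟦ scanStepᶜ ⟧ (time scanStepᶜ) I scan-step (suc L) _
          (0 , 0 , rg A 11 , rg A 12 , refl , inj₁ (lift (refl , λ ())) , refl) }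
      where
      logN : fd A logᶠ (rg A sizeʳ) ≡ L
      logN = trans (AI.logs ai (≤-trans (≤-reflexive size) (≤-trans n≤β (≤-trans (m≤m+n (rg A lastʳ) _) (m≤m+n (2 * rg A lastʳ) 1)))))
                   (cong ⌊log₂_⌋ size)

  -- DeleteMin put together from its loops.

  do-seq-linear : ∀ {c d A p p′ s Q Q′} → Do big c A (p * s) Q → (∀ {B} → Q B → Do big d B (p′ * s) Q′) →
                  Do big (c ⨾ d) A ((p + p′) * s) Q′
  do-seq-linear {p = p} {p′} {s} d e = do-mono big (≤-reflexive (sym (*-distribʳ-+ s p p′))) (do-seq big d e)

  do-const : ∀ {c A p s Q} → Do big c A p Q → Do big c A (p * suc s) Q
  do-const {p = p} {s} = do-mono big (m≤m*n p (suc s))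

  -- A nonzero mask exhibits a bucket of at least three, so the count cannot run out before the mask
  -- does: the termination argument of the joining loop.
  roots≢0 : ∀ {A n} → Core A n → rg A rMaskʳ ≢ 0 → roots A ≢ 0
  roots≢0 {A} core ne e = n≮0 (subst (3 ≤_) e (≤-trans
    (proj₁ (Core.top-bucket core {fd A rCntᶠ} {3} (BI.msk (Core.rts core)) (s≤s z≤n) (Core.occ-root core) ne))
    (BI.count-≤ (Core.rts core) _)))

  dirties≢0 : ∀ {A n} → Core A n → rg A dMaskʳ ≢ 0 → dirties A ≢ 0
  dirties≢0 {A} core ne e = n≮0 (subst (2 ≤_) e (≤-trans
    (proj₁ (Core.top-bucket core {fd A dCntᶠ} {2} (BI.msk (Core.dir core)) (s≤s z≤n) (Core.occ-dirty core) ne))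
    (BI.count-≤ (Core.dir core) _)))

  module _ {A h} (H : Heap A h) (h≢[] : h ≢ []) where

    open Heap H

    x n L : ℕ
    x = rg A minʳ
    n = length (drop x h)
    L = ⌊log₂ length h ⌋

    leastA : Least A
    leastA = [ (λ { (e , _) → ⊥-elim (h≢[] e) }) , (λ p → p) ]′ least

    lx : Leaf A x
    lx = proj₁ leastA

    length-≡ : length h ≡ suc n
    length-≡ = drop-length h uniq (leaf-in lx (proj₂ (Tree.key (Core.tree core) (proj₁ lx) (proj₂ lx))))

    record Rest (B : AS) : Set q where
      constructor rest
      field
        leaf→ : ∀ {y} → Leaf A y → y ≢ x → Leaf B y
        →leaf : ∀ {y} → Leaf B y → Leaf A y × y ≢ x
        keys  : C B ≡ C A

    rest-same : ∀ {B D} → Same B D → Rest B → Rest D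
    rest-same s (rest f g e) = rest (λ ly ne → Same.leaf→ s (f ly ne)) (λ ly → g (Same.→leaf s ly)) (trans (Same.keys s) e)

    -- A join takes two roots away and a reduction at least one dirty node, so these counts bound
    -- the iterations. Reductions leave the root buckets alone, so the empty root mask carries
    -- through the second loop.
    I₃ I₄ : ℕ → AS → Set q
    I₃ k B = Core B n × Rest B × dirties B ≤ suc L × roots B ≤ k
    I₄ k B = Core B n × Rest B × rg B rMaskʳ ≡ 0 × dirties B ≤ k

    Q₃ Q₄ Q₅ : AS → Set q
    Q₃ B = Core B n × Rest B × dirties B ≤ suc L × rg B rMaskʳ ≡ 0
    Q₄ B = Core B n × Rest B × rg B rMaskʳ ≡ 0 × rg B dMaskʳ ≡ 0
    Q₅ B = Heap B (drop x h)

    join-step : ∀ k B → I₃ k B →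
      wpᵗ (num 0 ≺ var rMaskʳ) B (∃[ k′ ] (k ≡ suc k′ × Do big ⟦ joinᶜ ⟧ B (time joinᶜ) (I₃ k′))) (Q₃ B)
    join-step k B (cB , r , d , le) = _ , go k le , λ e → cB , r , d , n≤0⇒n≡0 e
      where
      go : ∀ k → roots B ≤ k → 0 < rg B rMaskʳ → ∃[ k′ ] (k ≡ suc k′ × Do big ⟦ joinᶜ ⟧ B (time joinᶜ) (I₃ k′))
      go zero le lt = ⊥-elim (roots≢0 cB (λ e → <⇒≢ lt (sym e)) (n≤0⇒n≡0 le))
      go (suc k) le lt = k , refl , do-WP {joinᶜ} (join-wp cB (λ e → <⇒≢ lt (sym e)) λ cD same rD dD →
        cD , rest-same same r , ≤-trans (≤-reflexive dD) d , ≤-trans (n≤1+n _) (s≤s⁻¹ (≤-trans (≤-reflexive rD) le)))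

    reduce-step : ∀ k B → I₄ k B →
      wpᵗ (num 0 ≺ var dMaskʳ) B (∃[ k′ ] (k ≡ suc k′ × Do big ⟦ reduceᶜ ⟧ B (time reduceᶜ) (I₄ k′))) (Q₄ B)
    reduce-step k B (cB , r , e₅ , le) = _ , go k le , λ e → cB , r , e₅ , n≤0⇒n≡0 e
      where
      go : ∀ k → dirties B ≤ k → 0 < rg B dMaskʳ → ∃[ k′ ] (k ≡ suc k′ × Do big ⟦ reduceᶜ ⟧ B (time reduceᶜ) (I₄ k′))
      go zero le lt = ⊥-elim (dirties≢0 cB (λ e → <⇒≢ lt (sym e)) (n≤0⇒n≡0 le))
      go (suc k) le lt = k , refl , do-WP {reduceᶜ} (reduce-wp cB (λ e → <⇒≢ lt (sym e)) λ cD same rD dD →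
        cD , rest-same same r , trans (proj₂ rD) e₅ , s≤s⁻¹ (≤-trans dD le))

    -- By `candidate` some root or dirty node has a winner no larger than a given leaf, and by
    -- `height` its bucket lies within the scanned range. So the best node scanned is least among
    -- all leaves.
    finish : ∀ {B} → Q₄ B → Do big ⟦ scanᶜ ⟧ B (scanTime * suc L) Q₅
    finish {B} (cB , rest f g eC , e₅ , e₄) = do-mono big bound
      (do-map big (λ { (μ , r , t₁ , t₂ , refl , best) → heap {μ} {r} {t₁} {t₂} best }) (Scan.scan-do cB e₄ e₅))
      where
      bound : time scanInitᶜ + (suc ⌊log₂ n ⌋ * (costᵗ ⟦ var 16 ≺ var 17 ⟧ᵗ + time scanStepᶜ) + costᵗ ⟦ var 16 ≺ var 17 ⟧ᵗ)
        ≤ scanTime * suc L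
      bound = ≤-trans
        (+-mono-≤ (m≤m*n (time scanInitᶜ) (suc L)) (loop-linear 1 (var 16 ≺ var 17) scanStepᶜ {suc ⌊log₂ n ⌋} {L}
            (≤-trans (s≤s (⌊log₂⌋-mono-≤ (≤-trans (n≤1+n n) (≤-reflexive (sym length-≡))))) (≤-reflexive (sym (*-identityˡ (suc L)))))))
        (≤-reflexive (sym (*-distribʳ-+ (suc L) (time scanInitᶜ) (loopTime 1 (var 16 ≺ var 17) scanStepᶜ))))
      open Scan cB e₄ e₅ using (Best; Below)
      open Core cB using (tree; low; root→; height)
      cand : ∀ {y} → Leaf B y → ∃[ c ] (fd B leafᶠ c ≢ 0 × (fd B parᶠ c ≡ 0 ⊎ fd B dIdxᶠ c ≢ 0) × KLe (C B) (fd B leafᶠ c) y)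
      cand {y} (ly , hy) = let c , lc , k , le = candidate tree {suc l} (λ lz → s≤s (low lz)) (suc l) (m≤n+m (suc l) _) ly in
        c , lc , k , subst (KLe (C B) (fd B leafᶠ c)) (Tree.lfW tree ly hy) le
      below : ∀ {c} → fd B leafᶠ c ≢ 0 → fd B parᶠ c ≡ 0 ⊎ fd B dIdxᶠ c ≢ 0 → Below (suc ⌊log₂ n ⌋) c
      below {c} lc k = [ (λ e → inj₁ (root→ lc e)) , inj₂ ]′ k , s≤s (2^≤⇒≤log (≤-trans (2^≤3^ (fd B htᶠ c)) (height lc)))
      least′ : ∀ {μ} → Best (Below (suc ⌊log₂ n ⌋)) μ → (drop x h ≡ [] × μ ≡ 0) ⊎ (Leaf B μ × (∀ {y} → Leaf B y → KLe (C B) μ y))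
      least′ (inj₁ (lift (e , none′))) = inj₁ (empty (drop x h) (λ {y} {k} i →
        let ne , j = in-drop h i; ly , _ = in-leaf j; c , lc , kc , _ = cand (f ly ne) in none′ (below lc kc)) , e)
        where
        empty : ∀ xs → (∀ {y k} → (y , k) ∈ xs → ⊥) → xs ≡ []
        empty [] no′ = refl
        empty (_ ∷ _) no′ = ⊥-elim (no′ (here refl))
      least′ (inj₂ (lμ , le)) = inj₂ (lμ , λ ly → let c , lc , kc , le′ = cand ly in KLe-trans (C B) (le (below lc kc)) le′)
      heap : ∀ {μ r t₁ t₂} → Best (Below (suc ⌊log₂ n ⌋)) μ → Heap (Scan.st cB e₄ e₅ μ r t₁ t₂) (drop x h)
      heap best = record
        { core = core-temps cB ; few-r = few-roots cB e₅ ; few-d = few-dirties cB e₄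
        ; leaf-in = λ {y} ly cy → let ly′ , ne = g ly in drop-in h ne (leaf-in ly′ (trans (sym (cong (λ c → c y) eC)) cy))
        ; in-leaf = λ {y} i → let ne , j = in-drop h i; ly , cy = in-leaf j in f ly ne , trans (cong (λ c → c y) eC) cy
        ; uniq = drop-unique h uniq
        ; least = least′ best }

    module Cl = Climb (subst (Core A) length-≡ core) lx

    private
      L≤ : Cl.L ≤ 1 * suc L
      L≤ = ≤-trans (≤-reflexive (cong ⌊log₂_⌋ (sym length-≡))) (≤-trans (n≤1+n L) (≤-reflexive (sym (*-identityˡ (suc L)))))

      few : roots A ≤ 2 * suc Cl.L
      few = ≤-trans few-r (≤-reflexive (cong (λ n → 2 * suc ⌊log₂ n ⌋) length-≡))

      reduces : ∀ {B} → Q₃ B → Do big (⟦ while (num 0 ≺ var dMaskʳ) reduceᶜ ▸ scanᶜ ⟧) B (reduceTime * suc L) Q₅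
      reduces {B} (cB , rB , dB , eB) =
        do-seq-linear {p = loopTime 1 (num 0 ≺ var dMaskʳ) reduceᶜ} {p′ = scanTime} {s = suc L} {Q = Q₄}
          (do-mono big (loop-linear 1 (num 0 ≺ var dMaskʳ) reduceᶜ {suc L} {L} (≤-reflexive (sym (*-identityˡ (suc L)))))
            (do-while big (num 0 ≺ var dMaskʳ) ⟦ reduceᶜ ⟧ (time reduceᶜ) I₄ reduce-step (suc L) B (cB , rB , eB , dB))) finish

      joins : ∀ {B} → I₃ (4 * suc L) B →
        Do big (⟦ while (num 0 ≺ var rMaskʳ) joinᶜ ▸ while (num 0 ≺ var dMaskʳ) reduceᶜ ▸ scanᶜ ⟧) B (joinTime * suc L) Q₅
      joins {B} i = do-seq-linear {p = loopTime 4 (num 0 ≺ var rMaskʳ) joinᶜ} {p′ = reduceTime} {s = suc L} {Q = Q₃}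
        (do-mono big (loop-linear 4 (num 0 ≺ var rMaskʳ) joinᶜ {4 * suc L} {L} ≤-refl)
          (do-while big (num 0 ≺ var rMaskʳ) ⟦ joinᶜ ⟧ (time joinᶜ) I₃ join-step (4 * suc L) B i)) reduces

      kills : ∀ {B} → Cl.Q₂ B →
        Do big (⟦ killᶜ ▸ while (num 0 ≺ var rMaskʳ) joinᶜ ▸ while (num 0 ≺ var dMaskʳ) reduceᶜ ▸ scanᶜ ⟧) B (killTime * suc L) Q₅
      kills {B} (c₂ , s₂ , e₂ , p₂ , r₂ , d₂) =
        do-seq-linear {p = time killᶜ} {p′ = joinTime} {s = suc L} {Q = I₃ (4 * suc L)}
          (do-const (do-WP {killᶜ} (kill-wp c₂ (subst (Leaf B) (sym e₂) (Same.leaf→ s₂ lx)) (trans (cong (fd B parᶠ) e₂) p₂)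
            λ {D} cD kd rD dD → cD ,
              rest (λ ly ne → Killed.leaf→ kd (Same.leaf→ s₂ ly) (λ e → ne (trans e e₂)))
                (λ ly → let ly₂ , ne = Killed.→leaf kd ly in Same.→leaf s₂ ly₂ , λ e → ne (trans e (sym e₂)))
                (trans (Killed.keys kd) (Same.keys s₂)) ,
              ≤-trans (≤-reflexive dD) (≤-trans d₂ few-d) ,
              ≤-trans (n≤1+n _) (≤-trans (≤-reflexive rD) (≤-trans r₂ (≤-reflexive (cong (λ n → 4 * suc ⌊log₂ n ⌋) (sym length-≡)))))))) joins

    delete-do : Do big ⟦ deleteᶜ ⟧ A (deleteTime * suc L) Q₅
    delete-do =
      do-seq-linear {p = time (set 16 (var minʳ))} {p′ = loopTime 1 (num 0 ≺ fld parᶠ (var 16)) climbᶜ + descendTime} {s = suc L}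
        {Q = λ B → B ≡ setR 16 x A × Lift q ⊤} (do-const (do-WP {set 16 (var minʳ)} (lastW x refl _ (refl , _)))) λ { (refl , _) →
      do-seq-linear {p = loopTime 1 (num 0 ≺ fld parᶠ (var 16)) climbᶜ} {p′ = descendTime} {s = suc L} {Q = Cl.Q₁}
        (do-mono big (loop-linear 1 (num 0 ≺ fld parᶠ (var 16)) climbᶜ {Cl.L} {L} L≤) Cl.climb-do) λ q₁ →
      do-seq-linear {p = loopTime 1 (num 0 ≺ fld htᶠ (var 16)) descendᶜ} {p′ = killTime} {s = suc L} {Q = Cl.Q₂}
        (do-mono big (loop-linear 1 (num 0 ≺ fld htᶠ (var 16)) descendᶜ {Cl.L} {L} L≤) (Cl.descend-do few q₁)) kills }

-- The heap program and its initial state.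

zeros : ∀ {X : Set} n → X → Tup X n
zeros zero    d = tt
zeros (suc n) d = d , zeros n d

get-zeros : ∀ {X : Set} n (d : X) i → get d (zeros n d) i ≡ d
get-zeros zero    d i       = refl
get-zeros (suc n) d zero    = refl
get-zeros (suc n) d (suc i) = get-zeros n d i

sumTo-0 : ∀ n {f} → (∀ r → f r ≡ 0) → sumTo n f ≡ 0
sumTo-0 zero    e = refl
sumTo-0 (suc n) e = cong₂ _+_ (e n) (sumTo-0 n e)

findᶜ : IC
findᶜ = set argʳ (var minʳ)

program : HeapProgram
program = record
  { makeHeap = skip ; insert = ⟦ insertᶜ ⟧ ; findMin = ⟦ findᶜ ⟧
  ; decreaseKey = ⟦ decreaseᶜ ⟧ ; deleteMin = ⟦ deleteᶜ ⟧ }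

constant : ℕ
constant = time insertᶜ + (time findᶜ + (time decreaseᶜ + deleteTime))

-- From the abstract invariant to the specification.

module Correct {a ℓ₁ ℓ₂ : Level} (K : DecTotalOrder a ℓ₁ ℓ₂) (w : ℕ) where

  open HeapSpec K w program
  open Semantics K w
  open Contents {a} {Key} hiding (drop)

  Cap : ℕ → Set
  Cap m = 3600 * suc m ≤ 2 ^ w

  HeapOf : ∀ m → Cap m → AS → Contents → Set q
  HeapOf m cap = Bounded.Heap K w m cap

  -- The capacity `m` is hidden and is kept when elements are deleted, since only the creation of
  -- the heap and insertions come with a promise about the word length.
  Good : State → Contents → Set q
  Good s h = ∃[ m ] Σ[ cap ∈ Cap m ] ∃[ A ] (Sim s A × HeapOf m cap A h)

  module _ (m m′ : ℕ) (cap : Cap m) (cap′ : Cap m′) (m≤ : m ≤ m′) where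
    -- The layout of memory does not depend on `m`, which occurs only in upper bounds.
    enlarge : ∀ {A h} → HeapOf m cap A h → HeapOf m′ cap′ A h
    enlarge {A} H = record
      { core = record
        { tree = tree ; dir = bi dir ; rts = bi rts ; root→ = root→ ; →root = →root
        ; low = λ lx → ≤-trans (low lx) l≤
        ; ai = record { ids = ids ; free = free ; distinct = distinct ; logs = logs ; nul = nul
                      ; space = ≤-trans space (*-monoʳ-≤ 3 m≤) }
        ; total = total ; nodes = nodes ; n≤m = ≤-trans n≤m m≤ ; size = size }
      ; few-r = few-r ; few-d = few-d ; leaf-in = leaf-in ; in-leaf = in-leaf ; uniq = uniq ; least = least }
      where
      open Bounded.Heap H
      open Bounded.Core core
      open Bounded.AI ai
      l≤ : ⌊log₂ m ⌋ ≤ ⌊log₂ m′ ⌋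
      l≤ = ⌊log₂⌋-mono-≤ m≤
      bi : ∀ {ht idx b c t M} → Bounded.BI K w m cap ht idx b c t M → Bounded.BI K w m′ cap′ ht idx b c t M
      bi b = record { bkt = Bounded.BI.bkt b ; msk = Bounded.BI.msk b ; low = λ i → ≤-trans (Bounded.BI.low b i) l≤
                    ; cnt = ≤-trans (Bounded.BI.cnt b) (*-monoʳ-≤ 6 (s≤s l≤)) }

  withKey : Key → AS → AS
  withKey k A = record A { KR = just k }

  module _ m (cap : Cap m) where
    heap-args : ∀ {A h x k} → HeapOf m cap A h → HeapOf m cap (setR argʳ x (withKey k A)) h
    heap-args H = record
      { core = record { tree = tree ; dir = dir ; rts = rts ; root→ = root→ ; →root = →root ; low = low
                      ; ai = ai ; total = total ; nodes = nodes ; n≤m = n≤m ; size = size }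
      ; few-r = few-r ; few-d = few-d ; leaf-in = leaf-in ; in-leaf = in-leaf ; uniq = uniq ; least = least }
      where
      open Bounded.Heap H
      open Bounded.Core core

    heap-result : ∀ {A h x} → HeapOf m cap A h → HeapOf m cap (setR argʳ x A) h
    heap-result H = record
      { core = record { tree = tree ; dir = dir ; rts = rts ; root→ = root→ ; →root = →root ; low = low
                      ; ai = ai ; total = total ; nodes = nodes ; n≤m = n≤m ; size = size }
      ; few-r = few-r ; few-d = few-d ; leaf-in = leaf-in ; in-leaf = in-leaf ; uniq = uniq ; least = least }
      where
      open Bounded.Heap H
      open Bounded.Core core

  sim-key : ∀ {s A k} → Sim s A → Sim (setKeyReg 0 k s) (withKey k A)
  sim-key sim = record { reg-≡ = reg-≡ ; mem-≡ = mem-≡ ; cell-≡ = cell-≡ ; kreg-≡ = refl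
                       ; reg-sm = reg-sm ; mem-sm = mem-sm }
    where open Sim sim

  -- The outcome of an operation, to be combined with determinism of runs.
  Outcome : ∀ {p} → Cmd → State → ℕ → (State → Set p) → Set (a ⊔ p)
  Outcome c s b Q = ∃₂ λ t s′ → Run c s t s′ × t ≤ b × Q s′

  same-outcome : ∀ {p c s b t s′} {Q : State → Set p} → Outcome c s b Q → Run c s t s′ → Q s′
  same-outcome {Q = Q} (_ , _ , r , _ , h) r′ = subst Q (Run-det r r′) h

  -- Blank memory already represents the empty heap, including the table of logarithms at 0 and 1;
  -- hence `makeHeap` does nothing.
  made-good : Fits 3600 0 → Good blank []
  made-good cap = 0 , cap , A₀ , sim₀ , heap₀
    where
    R₀ : Registers
    R₀ = mkRegisters 0 0 0 0 0 0 0 0 0 0 0 0 0 0 0 0 0 0 0 0 0 0 0 0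
    F₀ : Fields
    F₀ = mkFields z z z z z z z z z z z z z z z z where z = λ _ → 0
    A₀ : AS
    A₀ = mkAS R₀ F₀ (λ _ → nothing) nothing
    reg₀ : ∀ i → readᴿ R₀ i ≡ 0
    reg₀ i = trans (readᴿ-get R₀ i) (get-zeros 24 0 i)
    fld₀ : ∀ f i → readᶠ F₀ f i ≡ 0
    fld₀ f i = cong (λ g → g i) (trans (readᶠ-get F₀ f) (get-zeros 16 (λ _ → 0) f))
    small₀ : Small 0
    small₀ = Bounded.small K w 0 cap z≤n
    sim₀ : Sim blank A₀
    sim₀ = record
      { reg-≡ = λ {i} _ → sym (reg₀ i)
      ; mem-≡ = λ {f} {i} _ _ → sym (fld₀ f i)
      ; cell-≡ = λ _ → refl ; kreg-≡ = refl
      ; reg-sm = λ {i} _ → subst Small (sym (reg₀ i)) small₀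
      ; mem-sm = λ {f} i _ → subst Small (sym (fld₀ f i)) small₀ }
    absurd : ∀ {ℓ} {P : Set ℓ} → 0 ≢ 0 → P
    absurd n = ⊥-elim (n refl)
    bi₀ : ∀ t → Bounded.BI K w 0 cap (λ _ → 0) (λ _ → 0) (λ _ → 0) (λ _ → 0) (suc t) 0
    bi₀ t = record
      { bkt = record { member = absurd ; entry = λ p z → ⊥-elim (n≮0 (≤-trans p z)) }
      ; msk = sym (sumTo-0 w (λ r → bit-0 {suc t} {λ _ → 0} {r} (s≤s z≤n))) ; low = absurd
      ; cnt = ≤-trans (≤-reflexive (sumTo-0 w (λ _ → refl))) z≤n }
    heap₀ : HeapOf 0 cap A₀ []
    heap₀ = record
      { core = record
        { tree = record { chl = λ _ → absurd ; prn = absurd ; win-ok = absurd ; lfW = absurd ; lf = absurd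
                        ; key = absurd ; dirty = absurd ; ord = absurd ; top = absurd ; top-ok = absurd ; null = refl }
        ; dir = bi₀ 1 ; rts = bi₀ 2 ; root→ = absurd ; →root = absurd ; low = absurd
        ; ai = record { ids = absurd ; free = λ () ; distinct = λ () ; logs = logs₀ ; nul = refl ; space = z≤n }
        ; total = sumTo-0 w (λ _ → refl) ; nodes = sumTo-0 w (λ _ → refl) ; n≤m = z≤n ; size = refl }
      ; few-r = ≤-trans (≤-reflexive (sumTo-0 w (λ _ → refl))) z≤n
      ; few-d = ≤-trans (≤-reflexive (sumTo-0 w (λ _ → refl))) z≤n
      ; leaf-in = λ lx → absurd (proj₁ lx) ; in-leaf = λ () ; uniq = [] ; least = inj₁ (refl , refl) }
      where
      logs₀ : ∀ {i} → i ≤ 1 → 0 ≡ ⌊log₂ i ⌋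
      logs₀ z≤n = refl
      logs₀ (s≤s z≤n) = refl

  insert-do : ∀ {s h A} m (cap : Cap m) → Sim s A → HeapOf m cap A h → suc (length h) ≤ m → (k : Key) →
    Outcome ⟦ insertᶜ ⟧ (setKeyReg 0 k s) (time insertᶜ)
      (λ s′ → ∃[ B ] (Sim s′ B × HeapOf m cap B ((rg B argʳ , k) ∷ h) × rg B argʳ ≢ 0 × rg B argʳ ∉ pointers h))
  insert-do {s} {h} {A} m cap sim H le k =
    Bounded.do-WP K w m cap {insertᶜ} {Q = λ B → HeapOf m cap B ((rg B argʳ , k) ∷ h) × rg B argʳ ≢ 0 × rg B argʳ ∉ pointers h}
      (Bounded.insert-wp K w m cap (heap-args m cap {x = rg A argʳ} {k} H) le refl (λ HB nz ∉h → HB , nz , ∉h)) (sim-key sim)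

  Inserted : Contents → Key → State → Set q
  Inserted h k s′ = Good s′ ((result s′ , k) ∷ h) × result s′ ≢ 0 × result s′ ∉ pointers h

  inserted-result : ∀ {h k s′} m (cap : Cap m) →
    ∃[ B ] (Sim s′ B × HeapOf m cap B ((rg B argʳ , k) ∷ h) × rg B argʳ ≢ 0 × rg B argʳ ∉ pointers h) → Inserted h k s′
  inserted-result {h} {k} m cap (B , sim′ , HB , nz , ∉h) =
    (m , cap , B , sim′ , subst (λ x → HeapOf m cap B ((x , k) ∷ h)) (sym e) HB) ,
    (λ z → nz (trans (sym e) z)) , (λ i → ∉h (subst (_∈ pointers h) e i))
    where e = Sim.reg-≡ sim′ (s≤s z≤n)

  outcome-map : ∀ {p p′ c s b} {Q : State → Set p} {Q′ : State → Set p′} → (∀ {s′} → Q s′ → Q′ s′) →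
    Outcome c s b Q → Outcome c s b Q′
  outcome-map f (t , s′ , r , b , h) = t , s′ , r , b , f h

  insert-grown : ∀ {s h A} m m′ (cap : Cap m) (cap′ : Cap m′) → Sim s A → HeapOf m cap A h → m ≤ m′ →
    suc (length h) ≤ m′ → (k : Key) → Outcome ⟦ insertᶜ ⟧ (setKeyReg 0 k s) (time insertᶜ) (Inserted h k)
  insert-grown m m′ cap cap′ sim H m≤ le k =
    outcome-map (inserted-result m′ cap′) (insert-do m′ cap′ sim (enlarge m m′ cap cap′ m≤ H) le k)

  -- If the new size passes the capacity, the hypothesis `fits` supplies a larger one.
  insert-good : ∀ {s h} → Good s h → Fits 3600 (suc (length h)) → (k : Key) →
    Outcome ⟦ insertᶜ ⟧ (setKeyReg 0 k s) (time insertᶜ) (Inserted h k)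
  insert-good {s} {h} (m , cap , A , sim , H) fits k =
    [ (λ le → insert-grown m m cap cap sim H ≤-refl le k)
    , (λ ge → insert-grown m (suc (length h)) cap fits sim H ge ≤-refl k) ]′ (≤-total (suc (length h)) m)

  find-good : ∀ {s h} → Good s h → Outcome ⟦ findᶜ ⟧ s (time findᶜ) (λ s′ → Good s′ h × IsMin h (result s′))
  find-good {s} {h} (m , cap , A , sim , H) = outcome-map
    (λ { (_ , sim′ , refl , _) → (m , cap , _ , sim′ , heap-result m cap H) ,
           subst (IsMin h) (sym (Sim.reg-≡ sim′ (s≤s z≤n))) min })
    (Bounded.do-WP K w m cap {findᶜ} {Q = λ B → B ≡ setR argʳ (rg A minʳ) A × Lift q ⊤} (lastW (rg A minʳ) refl _ (refl , _)) sim)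
    where
    open Bounded.Heap H
    min : IsMin h (rg A minʳ)
    min = [ (λ { (e , z) → inj₁ (e , z) })
          , (λ { (lf , le) → let k , ck = Tree.key (Bounded.Core.tree core) (proj₁ lf) (proj₂ lf) in
                 inj₂ (k , leaf-in lf ck , All.tabulate (λ i → let ly , cy = in-leaf i in below ck cy (le ly))) }) ]′ least
      where
      below : ∀ {y k k′} → C A (rg A minʳ) ≡ just k → C A y ≡ just k′ → KLe (C A) (rg A minʳ) y → k ≤ᴷ k′
      below ck cy (k₁ , k₂ , e₁ , e₂ , le) with trans (sym ck) e₁ | trans (sym cy) e₂
      ... | refl | refl = le

  decrease-good : ∀ {s h} → Good s h → ∀ {x k₀} k → (x , k₀) ∈ h → k ≤ᴷ k₀ →
    Outcome ⟦ decreaseᶜ ⟧ (setReg 0 x (setKeyReg 0 k s)) (time decreaseᶜ)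
      (λ s′ → Good s′ (changeKey x k h))
  decrease-good {s} {h} (m , cap , A , sim , H) {x} k i k≤ =
    outcome-map (λ { (B , sim′ , HB , _) → m , cap , B , sim′ , HB })
      (Bounded.do-WP K w m cap {decreaseᶜ} {Q = λ B → HeapOf m cap B (changeKey x k h) × Lift q ⊤}
        (Bounded.decrease-wp K w m cap (heap-args m cap H) i refl k≤ (λ HB → HB , _))
        (sim-setR (Bounded.big K w m cap) (sim-key sim) (s≤s z≤n)
          (Bounded.small-id K w m cap {x} (Bounded.id-ok K w m cap core (proj₁ (proj₁ (in-leaf i)))))))
    where open Bounded.Heap H

  delete-good : ∀ {s h} → Good s h → h ≢ [] → ∃[ x ] (regs s 1 ≡ x ×
    Outcome ⟦ deleteᶜ ⟧ s (deleteTime * suc ⌊log₂ length h ⌋) (λ s′ → Good s′ (remove x h)))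
  delete-good {s} {h} (m , cap , A , sim , H) ne =
    rg A minʳ , Sim.reg-≡ sim (s≤s (s≤s z≤n)) ,
    outcome-map (λ { (B , sim′ , HB) → m , cap , B , sim′ , HB }) (Bounded.delete-do K w m cap H ne sim)

  find-result : ∀ {s t s′} → Run ⟦ findᶜ ⟧ s t s′ → result s′ ≡ regs s 1
  find-result set-reg = refl

  -- Both programs start from `minʳ`, which is register 1, so the element deleted is the one that is
  -- found.
  delete-same : ∀ {s h t t′ s₁ s′ b} →
    ∃[ x ] (regs s 1 ≡ x × Outcome ⟦ deleteᶜ ⟧ s b (λ s′ → Good s′ (remove x h))) →
    Run ⟦ findᶜ ⟧ s t s₁ → Run ⟦ deleteᶜ ⟧ s t′ s′ → Good s′ (remove (result s₁) h)
  delete-same {h = h} {s′ = s′} (x , e , out) run run′ =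
    subst (λ y → Good s′ (remove y h)) (trans (sym e) (sym (find-result run)))
      (same-outcome {Q = λ s′ → Good s′ (remove x h)} out run′)

  reachable-good : ∀ {s h} → Reachable 3600 s h → Good s h
  reachable-good (made fits skip) = made-good fits
  reachable-good (inserted k r fits run) =
    proj₁ (same-outcome {Q = Inserted _ k} (insert-good (reachable-good r) fits k) run)
  reachable-good (found {h = h} r run) =
    proj₁ (same-outcome {Q = λ s′ → Good s′ h × IsMin h (result s′)} (find-good (reachable-good r)) run)
  reachable-good (decreased x k₀ k r i k≤ run) =
    same-outcome {Q = λ s′ → Good s′ (changeKey x k _)} (decrease-good (reachable-good r) k i k≤) run
  reachable-good (deleted {h = h} r ne run run′) = delete-same {h = h} (delete-good (reachable-good r) ne) run run′

  implements : Implements 3600 (makeHeap: constant insert: (λ n → constant) findMin: (λ n → constant)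
                 decreaseKey: (λ n → constant) deleteMin: (λ n → constant * (1 + ⌊log₂ n ⌋)))
  implements = record
    { makeHeap-halts = λ _ → 0 , blank , skip , z≤n
    ; insert-correct = λ r fits k → let t , s′ , run , le , _ , p = insert-good (reachable-good r) fits k in
        t , s′ , run , ≤-trans le (m≤m+n (time insertᶜ) _) , p
    ; findMin-correct = λ r → let t , s′ , run , le , good , min = find-good (reachable-good r)
                                  t₂ , s″ , run′ , _ = find-good good in
        t , s′ , run , ≤-trans le (≤-trans (m≤m+n (time findᶜ) _) (m≤n+m _ (time insertᶜ))) , min ,
        t₂ , s″ , run′ , trans (find-result run′) (again run)
    ; decreaseKey-halts = λ r k i k≤ → let t , s′ , run , le , _ = decrease-good (reachable-good r) k i k≤ in
        t , s′ , run , ≤-trans le (≤-trans (m≤m+n (time decreaseᶜ) deleteTime)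
          (≤-trans (m≤n+m _ (time findᶜ)) (m≤n+m _ (time insertᶜ))))
    ; deleteMin-halts = λ {_} {h} r ne → let _ , _ , t , s′ , run , le , _ = delete-good (reachable-good r) ne in
        t , s′ , run , ≤-trans le (*-monoˡ-≤ (suc ⌊log₂ length h ⌋)
          (≤-trans (m≤n+m deleteTime (time decreaseᶜ)) (≤-trans (m≤n+m _ (time findᶜ)) (m≤n+m _ (time insertᶜ))))) }
    where
    again : ∀ {s t s′} → Run ⟦ findᶜ ⟧ s t s′ → regs s′ 1 ≡ result s′
    again set-reg = refl

mainTheorem1 : ∀ {a ℓ₁ ℓ₂} →
    Σ[ P ∈ HeapProgram ] ∃[ c ] ∃[ d ]
    ((K : DecTotalOrder a ℓ₁ ℓ₂) (w : ℕ) →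
    HeapSpec.Implements K w P d
    (makeHeap: c
    insert: (λ n → c)
    findMin: (λ n → c)
    decreaseKey: (λ n → c)
    deleteMin: (λ n → c * (1 + ⌊log₂ n ⌋))))
mainTheorem1 = program , constant , 3600 , λ K w → Correct.implements K w
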